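{- Let $q$ be an odd prime power, $n\ge 3$ an odd integer, $\varepsilon\in\{1,-1\}$, and let $\mathcal Q=\mathcal Q^\varepsilon(n,q)$ be the non-degenerate hyperbolic ($\varepsilon=1$) or elliptic ($\varepsilon=-1$) quadric in $\mathrm{PG}(n,q)$. Let $\mathcal P$ be the set of anisotropic points of $\mathcal Q$, and let $R_0,\dots,R_5$ be the relations on $\mathcal P$ defined in the context. Then $R_0,\dots,R_5$ constitute an association scheme on $\mathcal P$. With $m=\frac{n-1}{2}$, for a suitable ordering $V_0,\dots,V_5$ of its eigenspaces, its matrix of eigenvalues $\mathbf P$ (rows indexed by $V_0,\dots,V_5$, columns by $R_0,\dots,R_5$) is $$\mathbf P=\begin{pmatrix} 1 & q^{n-1}-1 & \frac14 q^{m}(q^{m}+\varepsilon)(q-3) & \frac14 q^{m}(q^{m}-\varepsilon)(q-1) & \frac14 q^{m}(q^{m}+\varepsilon)(q-1) & \frac14 q^{m}(q^{m}-\varepsilon)(q+1)\\ 1 & q^{n-1}-1 & \frac14 q^{m}(q^{m}+\varepsilon)(q-3) & \frac14 q^{m}(q^{m}-\varepsilon)(q-1) & -\frac14 q^{m}(q^{m}+\varepsilon)(q-1) & -\frac14 q^{m}(q^{m}-\varepsilon)(q+1)\\ 1 & \varepsilon q^{m-1}-1 & \frac14\varepsilon q^{m-1}(q+1)(q-3) & -\frac14\varepsilon q^{m-1}(q-1)^2 & \frac14\varepsilon q^{m-1}(q-1)(q+1) & -\frac14\varepsilon q^{m-1}(q-1)(q+1)\\ 1 & \varepsilon q^{m-1}-1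 & \frac14\varepsilon q^{m-1}(q+1)(q-3) & -\frac14\varepsilon q^{m-1}(q-1)^2 & -\frac14\varepsilon q^{m-1}(q-1)(q+1) & \frac14\varepsilon q^{m-1}(q-1)(q+1)\\ 1 & \varepsilon q^{m}-1 & -\varepsilon q^{m} & 0 & 0 & 0\\ 1 & -\varepsilon q^{m}-1 & 0 & \varepsilon q^{m} & 0 & 0 \end{pmatrix}$$ and its matrix of dual eigenvalues $\mathbf Q$ (rows indexed by $R_0,\dots,R_5$, columns by $V_0,\dots,V_5$) is $$\mathbf Q=\begin{pmatrix} 1 & 1 & q^2\frac{q^{n-1}-1}{q^2-1} & q^2\frac{q^{n-1}-1}{q^2-1} & \frac{q-3}{2(q-1)}(q^{m}+\varepsilon)(q^{m+1}-\varepsilon) & \frac{q-1}{2(q+1)}(q^{m}-\varepsilon)(q^{m+1}-\varepsilon)\\ 1 & 1 & q^2\frac{\varepsilon q^{m-1}-1}{q^2-1} & q^2\frac{\varepsilon q^{m-1}-1}{q^2-1} & \varepsilon\frac{q-3}{2(q-1)}(q^{m+1}-\varepsilon) & -\varepsilon\frac{q-1}{2(q+1)}(q^{m+1}-\varepsilon)\\ 1 & 1 & \varepsilon\frac{q}{q-1}(q^{m}-\varepsilon) & \varepsilon\frac{q}{q-1}(q^{m}-\varepsilon) & -\varepsilon\frac{2}{q-1}(q^{m+1}-\varepsilon) & 0\\ 1 & 1 & -\varepsilon\frac{q}{q+1}(q^{m}+\varepsilon) & -\varepsilon\frac{q}{q+1}(q^{m}+\varepsilon) & 0 & \varepsilon\frac{2}{q+1}(q^{m+1}-\varepsilon)\\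 1 & -1 & \varepsilon\frac{q}{q-1}(q^{m}-\varepsilon) & -\varepsilon\frac{q}{q-1}(q^{m}-\varepsilon) & 0 & 0\\ 1 & -1 & -\varepsilon\frac{q}{q+1}(q^{m}+\varepsilon) & \varepsilon\frac{q}{q+1}(q^{m}+\varepsilon) & 0 & 0 \end{pmatrix}.$$ Here, for $q=3$, the relation $R_2$ is empty and is omitted: $R_0,R_1,R_3,R_4,R_5$ then form a $4$-class association scheme, whose matrices are obtained from $\mathbf P$ and $\mathbf Q$ by deleting the row and column corresponding to $R_2$ and $V_4$.
   Context: Quadric: $\mathcal Q^\varepsilon(n,q)$ ($n$ odd) is the set of points of $\mathrm{PG}(n,q)$ whose coordinate vectors are zeros of $\kappa(x)=x_0x_1+\dots+x_{n-3}x_{n-2}+f(x_{n-1},x_n)$, with $f$ a non-degenerate binary quadratic form that is reducible over $\mathbb F_q$ if $\varepsilon=1$ and irreducible if $\varepsilon=-1$. Points not on $\mathcal Q$ are anisotropic. $S_q$ is the set of non-zero squares of $\mathbb F_q$, $\overline S_q$ the set of non-squares. For an anisotropic point $X$ with coordinate vector $x$, its quadratic type is $\kappa(X)=S_q$ if $\kappa(x)\in S_q$ and $\kappa(X)=\overline S_q$ if $\kappa(x)\in\overline S_q$; products are $S_q\cdot S_q=\overline S_q\cdot\overline S_q=S_q$, $S_q\cdot\overline S_q=\overline S_q\cdot S_q=\overline S_q$. Relations: $R_0$ is the identity relation on $\mathcal P$. For distinct $X,Y\in\mathcal P$, with $\langle X,Y\rangle$ the line joining them: $(X,Y)\in R_1$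 iff $|\langle X,Y\rangle\cap\mathcal Q|=1$ (then automatically $\kappa(X)\cdot\kappa(Y)=S_q$); $(X,Y)\in R_2$ iff $|\langle X,Y\rangle\cap\mathcal Q|=2$ and $\kappa(X)\cdot\kappa(Y)=S_q$; $(X,Y)\in R_3$ iff $|\langle X,Y\rangle\cap\mathcal Q|=0$ and $\kappa(X)\cdot\kappa(Y)=S_q$; $(X,Y)\in R_4$ iff $|\langle X,Y\rangle\cap\mathcal Q|=2$ and $\kappa(X)\cdot\kappa(Y)=\overline S_q$; $(X,Y)\in R_5$ iff $|\langle X,Y\rangle\cap\mathcal Q|=0$ and $\kappa(X)\cdot\kappa(Y)=\overline S_q$. Association scheme: a partition of $\mathcal P\times\mathcal P$ into non-empty symmetric relations $R_0,\dots,R_d$, with $R_0$ the identity, such that for all $i,j,k$ the number $|\{Z:(X,Z)\in R_i,(Y,Z)\in R_j\}|$ is the same for all $(X,Y)\in R_k$. If $A_i$ is the 0/1 adjacency matrix of $R_i$, the real span of the $A_i$ (the Bose–Mesner algebra) has a basis of pairwise orthogonal idempotents $E_0=\frac1{|\mathcal P|}J,E_1,\dots,E_d$ with $A_iE_j=p_i(j)E_j$; $V_j$ is the column space of $E_j$. The matrix of eigenvalues is $\mathbf P$ with entry $p_i(j)$ in row $j$, column $i$; the matrix of dual eigenvalues is $\mathbf Q=|\mathcal P|\,\mathbf P^{ -1}$. -}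

module Defs where

open import Level using (Level; _⊔_)
open import Algebra.Bundles using (CommutativeRing)
import Algebra.Definitions.RawMonoid as RawMonoidDefs
import Algebra.Definitions.RawSemiring as RawSemiringDefs
open import Data.Integer.Base using (+_)
open import Data.Bool.Base using (if_then_else_)
open import Data.Fin.Base using (Fin; zero; suc)
open import Data.Fin.Patterns using (0F; 1F; 2F; 3F; 4F; 5F)
open import Data.Fin.Properties using () renaming (_≟_ to _≟ᶠ_)
open import Data.Nat.Base as ℕ using (ℕ; zero; suc)
open import Data.Nat.Divisibility using (_∣_)
open import Data.Nat.Primality using (Prime)
open import Data.Product using (∃₂; ∃!; ∃-syntax; _×_; _,_; proj₁; proj₂)
import Data.Rational.Base as Rat
open Rat using (ℚ; 0ℚ; 1ℚ)
open import Data.Rational.Properties using () renaming (_≟_ to _≟ℚ_)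
open import Data.Sign.Base as Sign using (Sign)
open import Data.Vec.Base using (Vec; []; _∷_; lookup)
open import Data.Vec.Functional using (Vector; tail)
open import Function.Base using (_∘_)
open import Function.Bundles using (Inverse; _⇔_)
open import Relation.Binary.Bundles using (Setoid)
open import Relation.Binary.Core using (Rel)
open import Relation.Binary.Definitions using (Decidable; Symmetric; _Respects₂_)
import Relation.Binary.Construct.On as On
open import Relation.Binary.PropositionalEquality using (_≡_; _≢_; refl; setoid)
open import Relation.Nullary using (¬_; does; yes; no)
open import Relation.Unary using (Pred)

private
  variable
    a ℓ r p k ℓₖ : Level

-- Cardinalities are counted up to the setoid's equality.

HasSize : Setoid a ℓ → ℕ → Set (a ⊔ ℓ)
HasSize S v = Inverse S (setoid (Fin v))

Restrict : (S : Setoid a ℓ) → Pred (Setoid.Carrier S) p → Setoid (a ⊔ p) ℓ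
Restrict S P = On.setoid S (proj₁ {B = P})

------------------------------------------------------------------------
-- Association schemes

record IsAssociationScheme (S : Setoid a ℓ) {d : ℕ}
       (R : Fin (suc d) → Rel (Setoid.Carrier S) r) : Set (a ⊔ ℓ ⊔ r) where
  open Setoid S using (Carrier; _≈_)
  field
    size        : ℕ
    enumeration : HasSize S size
    respects    : ∀ i → R i Respects₂ _≈_
    partitions  : ∀ x y → ∃! _≡_ (λ i → R i x y)
    nonEmpty    : ∀ i → ∃₂ λ x y → R i x y
    symmetric   : ∀ i → Symmetric (R i)
    identity    : ∀ {x y} → R 0F x y ⇔ x ≈ y
    intersectionNumber : ∀ i j l → ∃[ c ] (∀ {x y} → R l x y →
                         HasSize (Restrict S (λ z → R i x z × R j y z)) c)

  relation? : ∀ i → Decidable (R i)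
  relation? i x y with partitions x y
  ... | j , Rj , unique with j ≟ᶠ i
  ...   | yes refl = yes Rj
  ...   | no  j≢i  = no (j≢i ∘ unique)

-- Square matrices with entries in K, indexed by a finite setoid, and the
-- Bose–Mesner algebra over K.  The classical notion is the case K = ℝ.

module _ (K : CommutativeRing k ℓₖ) {S : Setoid a ℓ} {d : ℕ}
         {R : Fin (suc d) → Rel (Setoid.Carrier S) r}
         (scheme : IsAssociationScheme S R) where

  open Setoid S using () renaming (Carrier to Point)
  open IsAssociationScheme scheme
  open CommutativeRing K
  open RawMonoidDefs +-rawMonoid using (sum) renaming (_×_ to _×ₖ_)

  Matrix : Set (a ⊔ k)
  Matrix = Point → Point → Carrier

  infix 4 _≋_
  _≋_ : Matrix → Matrix → Set (a ⊔ ℓₖ)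
  M ≋ N = ∀ x y → M x y ≈ N x y

  𝟎 𝐉 : Matrix
  𝟎 _ _ = 0#
  𝐉 _ _ = 1#

  infixl 7 _·_ _•_
  _·_ : Matrix → Matrix → Matrix
  (M · N) x y = sum λ t → M x (Inverse.from enumeration t) * N (Inverse.from enumeration t) y

  _•_ : Carrier → Matrix → Matrix
  (c • M) x y = c * M x y

  combination : ∀ {n} → Vector Carrier n → Vector Matrix n → Matrix
  combination c B x y = sum λ i → c i * B i x y

  InSpan : ∀ {n} → Vector Matrix n → Matrix → Set (a ⊔ k ⊔ ℓₖ)
  InSpan B M = ∃[ c ] M ≋ combination c B

  LinearlyIndependent : ∀ {n} → Vector Matrix n → Set (a ⊔ k ⊔ ℓₖ)
  LinearlyIndependent B = ∀ c → combination c B ≋ 𝟎 → ∀ i → c i ≈ 0#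

  A : Fin (suc d) → Matrix
  A i x y = if does (relation? i x y) then 1# else 0#

  BoseMesner : Matrix → Set (a ⊔ k ⊔ ℓₖ)
  BoseMesner = InSpan A

  identityEntry : Fin (suc d) → Fin (suc d) → Carrier
  identityEntry i j = if does (i ≟ᶠ j) then 1# else 0#

  -- The eigenspace V j is the column space of E j, so an ordering of the
  -- eigenspaces is an ordering of the idempotents.  The entry P j i is the
  -- eigenvalue of A i on V j; the last two fields say Q = size · P⁻¹.

  record HasEigenmatrices (P Q : Fin (suc d) → Fin (suc d) → Carrier)
         : Set (a ⊔ k ⊔ ℓₖ) where
    field
      E           : Fin (suc d) → Matrix
      E-element   : ∀ j → BoseMesner (E j)
      E-spans     : ∀ M → BoseMesner M → InSpan E M
      E-independent : LinearlyIndependent E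
      idempotent  : ∀ j → E j · E j ≋ E j
      orthogonal  : ∀ i j → i ≢ j → E i · E j ≋ 𝟎
      E₀          : (size ×ₖ 1#) • E 0F ≋ 𝐉
      eigenvalue  : ∀ i j → A i · E j ≋ P j i • E j
      P-Q         : ∀ i j → sum (λ t → P i t * Q t j) ≈ (size ×ₖ 1#) * identityEntry i j
      Q-P         : ∀ i j → sum (λ t → Q i t * P t j) ≈ (size ×ₖ 1#) * identityEntry i j

------------------------------------------------------------------------
-- Fields

IsOddPrimePower : ℕ → Set
IsOddPrimePower q = (∃₂ λ p h → Prime p × 1 ℕ.≤ h × q ≡ p ℕ.^ h) × ¬ (2 ∣ q)

record IsField (F : CommutativeRing a ℓ) : Set (a ⊔ ℓ) where
  open CommutativeRing F
  field
    0≉1     : ¬ (0# ≈ 1#)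
    inverse : ∀ x → ¬ (x ≈ 0#) → ∃[ y ] x * y ≈ 1#

------------------------------------------------------------------------
-- Quadrics

data QuadraticType : Set where
  S S̄ : QuadraticType

infixl 7 _·ᵗ_
_·ᵗ_ : QuadraticType → QuadraticType → QuadraticType
S ·ᵗ S = S
S̄ ·ᵗ S̄ = S
S ·ᵗ S̄ = S̄
S̄ ·ᵗ S = S̄

module _ (F : CommutativeRing a ℓ) where

  open CommutativeRing F

  -- α x² + β x y + γ y²
  record BinaryForm : Set a where
    constructor binaryForm
    field α β γ : Carrier

    value : Carrier → Carrier → Carrier
    value x y = α * (x * x) + β * (x * y) + γ * (y * y)

    polar : (x y x′ y′ : Carrier) → Carrier
    polar x y x′ y′ = value (x + x′) (y + y′) - value x y - value x′ y′

    NonDegenerate : Set (a ⊔ ℓ)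
    NonDegenerate = ∀ x y → value x y ≈ 0# → (∀ x′ y′ → polar x y x′ y′ ≈ 0#) →
                    x ≈ 0# × y ≈ 0#

    -- (s x + t y)(s′ x + t′ y)
    Reducible : Set (a ⊔ ℓ)
    Reducible = ∃₂ λ s t → ∃₂ λ s′ t′ →
                α ≈ s * s′ × β ≈ s * t′ + t * s′ × γ ≈ t * t′

  HasSign : Sign → BinaryForm → Set (a ⊔ ℓ)
  HasSign Sign.+ f = BinaryForm.Reducible f
  HasSign Sign.- f = ¬ BinaryForm.Reducible f

  HasType : Carrier → QuadraticType → Set (a ⊔ ℓ)
  HasType x S = ¬ (x ≈ 0#) × ∃[ y ] x ≈ y * y
  HasType x S̄ = ¬ (∃[ y ] x ≈ y * y)

  module _ (f : BinaryForm) where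

    -- In n + 1 = 2 + m * 2 coordinates:
    -- x₀x₁ + … + xₙ₋₃xₙ₋₂ + f(xₙ₋₁, xₙ)
    κ : ∀ m → Vector Carrier (2 ℕ.+ m ℕ.* 2) → Carrier
    κ zero    x = BinaryForm.value f (x 0F) (x 1F)
    κ (suc m) x = x 0F * x 1F + κ m (tail (tail x))

------------------------------------------------------------------------
-- Projective geometry

module _ (F : CommutativeRing a ℓ) (F-field : IsField F) where

  open CommutativeRing F renaming (refl to ≈-refl; sym to ≈-sym; trans to ≈-trans)
  open IsField F-field

  private
    unit≉0 : ∀ {c e} → c * e ≈ 1# → ¬ (e ≈ 0#)
    unit≉0 {c} ce≈1 e≈0 = 0≉1 (≈-trans (≈-sym (zeroʳ c)) (≈-trans (*-congˡ (≈-sym e≈0)) ce≈1))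

    cancel : ∀ {c e} x → c * e ≈ 1# → e * (c * x) ≈ x
    cancel {c} {e} x ce≈1 =
      ≈-trans (≈-sym (*-assoc e c x))
        (≈-trans (*-congʳ (≈-trans (*-comm e c) ce≈1)) (*-identityˡ x))

    product≉0 : ∀ {c e} → ¬ (c ≈ 0#) → ¬ (e ≈ 0#) → ¬ (c * e ≈ 0#)
    product≉0 {c} {e} c≉0 e≉0 ce≈0 with inverse c c≉0
    ... | c′ , cc′≈1 = e≉0 (≈-trans (≈-sym (cancel e cc′≈1)) (≈-trans (*-congˡ ce≈0) (zeroʳ c′)))

  PG : ℕ → Setoid (a ⊔ ℓ) (a ⊔ ℓ)
  PG n = record
    { Carrier = ∃[ x ] ¬ (∀ i → x i ≈ 0#)
    ; _≈_     = λ X Y → Proportional (proj₁ X) (proj₁ Y)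
    ; isEquivalence = record
      { refl  = 1# , (0≉1 ∘ ≈-sym) , λ i → ≈-sym (*-identityˡ _)
      ; sym   = λ (c , c≉0 , y≈cx) → let c′ , cc′≈1 = inverse c c≉0 in
                c′ , unit≉0 cc′≈1 , λ i → ≈-sym (≈-trans (*-congˡ (y≈cx i)) (cancel _ cc′≈1))
      ; trans = λ (c , c≉0 , y≈cx) (e , e≉0 , z≈ey) →
                e * c , product≉0 e≉0 c≉0 ,
                λ i → ≈-trans (z≈ey i) (≈-trans (*-congˡ (y≈cx i)) (≈-sym (*-assoc e c _)))
      }
    }
    where
      Proportional : Rel (Vector Carrier (suc n)) (a ⊔ ℓ)
      Proportional x y = ∃[ c ] ¬ (c ≈ 0#) × (∀ i → y i ≈ c * x i)

  module _ {n : ℕ} where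

    open Setoid (PG n) using () renaming (Carrier to Point)

    Line : Point → Point → Pred Point (a ⊔ ℓ)
    Line (x , _) (y , _) (z , _) = ∃₂ λ s t → ∀ i → z i ≈ s * x i + t * y i

  ----------------------------------------------------------------------
  -- The relations on the anisotropic points of a quadric in PG(2m + 1, q)

  module _ (f : BinaryForm F) (m : ℕ) where

    private
      n = 1 ℕ.+ m ℕ.* 2

    Quadric : Pred (Setoid.Carrier (PG n)) ℓ
    Quadric (x , _) = κ F f m x ≈ 0#

    AnisotropicPoints : Setoid (a ⊔ ℓ) (a ⊔ ℓ)
    AnisotropicPoints = Restrict (PG n) (λ X → ¬ Quadric X)

    open Setoid AnisotropicPoints using () renaming (Carrier to Point; _≈_ to _≈ₚ_)

    LineMeetsQuadricIn : ℕ → Rel Point (a ⊔ ℓ)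
    LineMeetsQuadricIn c (X , _) (Y , _) =
      HasSize (Restrict (PG n) (λ Z → Line X Y Z × Quadric Z)) c

    κ·κ≡ : QuadraticType → Rel Point (a ⊔ ℓ)
    κ·κ≡ t ((x , _) , _) ((y , _) , _) =
      ∃₂ λ u v → HasType F (κ F f m x) u × HasType F (κ F f m y) v × u ·ᵗ v ≡ t

    R : Fin 6 → Rel Point (a ⊔ ℓ)
    R 0F X Y = X ≈ₚ Y
    R 1F X Y = ¬ (X ≈ₚ Y) × LineMeetsQuadricIn 1 X Y
    R 2F X Y = ¬ (X ≈ₚ Y) × LineMeetsQuadricIn 2 X Y × κ·κ≡ S X Y
    R 3F X Y = ¬ (X ≈ₚ Y) × LineMeetsQuadricIn 0 X Y × κ·κ≡ S X Y
    R 4F X Y = ¬ (X ≈ₚ Y) × LineMeetsQuadricIn 2 X Y × κ·κ≡ S̄ X Y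
    R 5F X Y = ¬ (X ≈ₚ Y) × LineMeetsQuadricIn 0 X Y × κ·κ≡ S̄ X Y

------------------------------------------------------------------------
-- The eigenmatrices

-- Every denominator below is positive as soon as q > 1.
infixl 7 _/_
_/_ : ℚ → ℚ → ℚ
x / y with y ≟ℚ 0ℚ
... | yes _   = 0ℚ
... | no  y≢0 = Rat._÷_ x y {{Rat.≢-nonZero y≢0}}

fromℕ : ℕ → ℚ
fromℕ k = + k Rat./ 1

fromSign : Sign → ℚ
fromSign Sign.+ = 1ℚ
fromSign Sign.- = Rat.- 1ℚ

module _ (order m : ℕ) (sign : Sign) where

  open Rat using (_+_; _*_; _-_; -_; ½)
  open RawSemiringDefs Rat.+-*-rawSemiring using (_^_)

  private
    n = 1 ℕ.+ m ℕ.* 2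
    q = fromℕ order
    ε = fromSign sign
    0# = 0ℚ
    1# = 1ℚ
    2# = fromℕ 2
    3# = fromℕ 3
    ¼ = ½ * ½

    -1# : ℚ
    -1# = - 1ℚ

    q^m q^[m-1] q^[m+1] q^[n-1] : ℚ
    q^m     = q ^ m
    q^[m-1] = q ^ (m ℕ.∸ 1)
    q^[m+1] = q ^ (m ℕ.+ 1)
    q^[n-1] = q ^ (n ℕ.∸ 1)

  𝐏 : Fin 6 → Fin 6 → ℚ
  𝐏 j i = lookup (lookup rows j) i
    where
    rows : Vec (Vec ℚ 6) 6
    rows =
        ( 1# ∷ q^[n-1] - 1#
            ∷ ¼ * q^m * (q^m + ε) * (q - 3#)
            ∷ ¼ * q^m * (q^m - ε) * (q - 1#)
            ∷ ¼ * q^m * (q^m + ε) * (q - 1#)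
            ∷ ¼ * q^m * (q^m - ε) * (q + 1#) ∷ [] )
      ∷ ( 1# ∷ q^[n-1] - 1#
            ∷ ¼ * q^m * (q^m + ε) * (q - 3#)
            ∷ ¼ * q^m * (q^m - ε) * (q - 1#)
            ∷ - (¼ * q^m * (q^m + ε) * (q - 1#))
            ∷ - (¼ * q^m * (q^m - ε) * (q + 1#)) ∷ [] )
      ∷ ( 1# ∷ ε * q^[m-1] - 1#
            ∷ ¼ * ε * q^[m-1] * (q + 1#) * (q - 3#)
            ∷ - (¼ * ε * q^[m-1] * (q - 1#) ^ 2)
            ∷ ¼ * ε * q^[m-1] * (q - 1#) * (q + 1#)
            ∷ - (¼ * ε * q^[m-1] * (q - 1#) * (q + 1#)) ∷ [] )
      ∷ ( 1# ∷ ε * q^[m-1] - 1#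
            ∷ ¼ * ε * q^[m-1] * (q + 1#) * (q - 3#)
            ∷ - (¼ * ε * q^[m-1] * (q - 1#) ^ 2)
            ∷ - (¼ * ε * q^[m-1] * (q - 1#) * (q + 1#))
            ∷ ¼ * ε * q^[m-1] * (q - 1#) * (q + 1#) ∷ [] )
      ∷ ( 1# ∷ ε * q^m - 1#     ∷ - (ε * q^m) ∷ 0#       ∷ 0# ∷ 0# ∷ [] )
      ∷ ( 1# ∷ - (ε * q^m) - 1# ∷ 0#           ∷ ε * q^m ∷ 0# ∷ 0# ∷ [] )
      ∷ []

  𝐐 : Fin 6 → Fin 6 → ℚ
  𝐐 i j = lookup (lookup rows i) j
    where
    rows : Vec (Vec ℚ 6) 6
    rows =
        ( 1# ∷ 1#
            ∷ q ^ 2 * ((q^[n-1] - 1#) / (q ^ 2 - 1#))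
            ∷ q ^ 2 * ((q^[n-1] - 1#) / (q ^ 2 - 1#))
            ∷ (q - 3#) / (2# * (q - 1#)) * (q^m + ε) * (q^[m+1] - ε)
            ∷ (q - 1#) / (2# * (q + 1#)) * (q^m - ε) * (q^[m+1] - ε) ∷ [] )
      ∷ ( 1# ∷ 1#
            ∷ q ^ 2 * ((ε * q^[m-1] - 1#) / (q ^ 2 - 1#))
            ∷ q ^ 2 * ((ε * q^[m-1] - 1#) / (q ^ 2 - 1#))
            ∷ ε * ((q - 3#) / (2# * (q - 1#))) * (q^[m+1] - ε)
            ∷ - (ε * ((q - 1#) / (2# * (q + 1#))) * (q^[m+1] - ε)) ∷ [] )
      ∷ ( 1# ∷ 1#
            ∷ ε * (q / (q - 1#)) * (q^m - ε)
            ∷ ε * (q / (q - 1#)) * (q^m - ε)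
            ∷ - (ε * (2# / (q - 1#)) * (q^[m+1] - ε))
            ∷ 0# ∷ [] )
      ∷ ( 1# ∷ 1#
            ∷ - (ε * (q / (q + 1#)) * (q^m + ε))
            ∷ - (ε * (q / (q + 1#)) * (q^m + ε))
            ∷ 0#
            ∷ ε * (2# / (q + 1#)) * (q^[m+1] - ε) ∷ [] )
      ∷ ( 1# ∷ -1#
            ∷ ε * (q / (q - 1#)) * (q^m - ε)
            ∷ - (ε * (q / (q - 1#)) * (q^m - ε))
            ∷ 0# ∷ 0# ∷ [] )
      ∷ ( 1# ∷ -1#
            ∷ - (ε * (q / (q + 1#)) * (q^m + ε))
            ∷ ε * (q / (q + 1#)) * (q^m + ε)
            ∷ 0# ∷ 0# ∷ [] )
      ∷ []

{-# OPTIONS --safe #-}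
module Submission where

-- Let D(x, y) be the discriminant of κ on the line ⟨x, y⟩ and χ the quadratic character of F.
-- The relation of two points is determined by χ(κ x) χ(κ y) and χ(D x y), so the adjacency matrices
-- are combinations of J, J′ = (χ(κ x) χ(κ y)), I, Z = [D = 0], G = χ(D) and G′ = J′ ∘ G.
-- An entry of a product of these is a sum over z of a function of b(x, z), b(y, z) and κ z.
-- Splitting z along x and y, and cancelling a hyperbolic plane, turns it into a sum over the values
-- taken by a smaller form, whose distribution is that of κ and is known.  Then 𝐏 and 𝐐 only
-- have to satisfy multiplication and orthogonality relations, which are polynomial identities
-- in q, q^(m-1) and ε.

-- The counting uses the characters 1 and χ instead of indicator functions, because sums of χ over
-- quadratic polynomials have closed values; each indicator of a relation is a combination of the
-- basis matrices with quarter-integral coefficients. The obstacle is the orthogonal complement of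
-- x, which is never constructed. Sums over it are replaced by sums over the whole space, in which
-- every vector of the complement occurs equally often, and its norm distribution is found by
-- adjoining -κ(x) u², so that x and the new variable form a hyperbolic plane. For a tangent line
-- the second such step fails, because the component of y orthogonal to x is isotropic; there the
-- sum is averaged along that component. Eigenspaces are not computed either. It suffices that the
-- rows of 𝐏 are multiplicative on the intersection numbers and that 𝐐 inverts 𝐏 up to the number of
-- points; the idempotents are then the combinations of adjacency matrices given by the columns of
-- 𝐐, divided by that number. The exception q = 3 comes from the factor q - 3 in the valency of
-- `R 2F`.

import Defs
open import Algebra.Bundles using (CommutativeRing)

-- Ring identities with integer coefficients

module IntegerSolver {c ℓ} (R : CommutativeRing c ℓ) where

  open import Algebra.Solver.Ring.AlmostCommutativeRing
    using (fromCommutativeRing; _-Raw-AlmostCommutative⟶_)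
  import Algebra.Solver.Ring as Solver
  open import Data.Integer.Base as ℤ using (ℤ; -[1+_]; _⊖_) renaming (+_ to pos)
  import Data.Integer.Properties as ℤₚ
  import Data.Nat.Properties as ℕₚ
  open import Data.Maybe.Base using (Maybe; just; nothing)
  open import Data.Nat.Base as ℕ using (ℕ; zero; suc)
  open import Relation.Binary.PropositionalEquality as ≡ using (_≡_)
  open import Relation.Nullary using (yes; no)

  open CommutativeRing R
  open import Algebra.Properties.Ring ring
  open import Algebra.Properties.AbelianGroup +-abelianGroup using (⁻¹-∙-comm)
  open import Algebra.Properties.Semiring.Mult.TCOptimised semiring
    using (×1-homo-*; ×-homo-+; 1+×) renaming (_×_ to infixl 8 _×′_)
  open import Relation.Binary.Reasoning.Setoid setoid

  -- The optimised multiple sends 1 to `1#` itself and 2 to `1# + 1#` by computation, so that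
  -- numerals in solver terms agree with the sums of ones in hypotheses such as `2≢0`.
  fromℤ : ℤ → Carrier
  fromℤ (pos n)  = n ×′ 1#
  fromℤ -[1+ n ] = - (suc n ×′ 1#)

  private
    -‿homo : ∀ x → fromℤ (ℤ.- x) ≈ - fromℤ x
    -‿homo (pos zero)    = sym -0#≈0#
    -‿homo (pos (suc n)) = refl
    -‿homo -[1+ n ]      = sym (-‿involutive _)

    ⊖-homo : ∀ m n → fromℤ (m ⊖ n) ≈ m ×′ 1# - n ×′ 1#
    ⊖-homo m       zero    = sym (trans (+-congˡ -0#≈0#) (+-identityʳ _))
    ⊖-homo zero    (suc n) = sym (+-identityˡ _)
    ⊖-homo (suc m) (suc n) = begin
      fromℤ (suc m ⊖ suc n)              ≈⟨ reflexive (≡.cong fromℤ (ℤₚ.[1+m]⊖[1+n]≡m⊖n m n)) ⟩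
      fromℤ (m ⊖ n)                      ≈⟨ ⊖-homo m n ⟩
      a - b                              ≈⟨ +-congˡ (+-identityˡ _) ⟨
      a + (0# - b)                       ≈⟨ +-congˡ (+-congʳ (-‿inverseʳ 1#)) ⟨
      a + ((1# - 1#) - b)                ≈⟨ +-congˡ (+-assoc _ _ _) ⟩
      a + (1# + (- 1# - b))              ≈⟨ +-assoc _ _ _ ⟨
      (a + 1#) + (- 1# - b)              ≈⟨ +-cong (+-comm a 1#) (⁻¹-∙-comm 1# b) ⟩
      (1# + a) - (1# + b)                ≈⟨ +-cong (1+× m 1#) (-‿cong (1+× n 1#)) ⟨
      suc m ×′ 1# - suc n ×′ 1#          ∎
      where
      a = m ×′ 1#
      b = n ×′ 1#

    +-homo : ∀ x y → fromℤ (x ℤ.+ y) ≈ fromℤ x + fromℤ y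
    +-homo (pos m)  (pos n)  = ×-homo-+ 1# m n
    +-homo (pos m)  -[1+ n ] = ⊖-homo m (suc n)
    +-homo -[1+ m ] (pos n)  = trans (⊖-homo n (suc m)) (+-comm _ _)
    +-homo -[1+ m ] -[1+ n ] = begin
      - (suc (suc (m ℕ.+ n)) ×′ 1#)        ≈⟨ reflexive (≡.cong (λ k → - (k ×′ 1#)) (≡.sym (≡.cong suc (ℕₚ.+-suc m n)))) ⟩
      - ((suc m ℕ.+ suc n) ×′ 1#)          ≈⟨ -‿cong (×-homo-+ 1# (suc m) (suc n)) ⟩
      - (suc m ×′ 1# + suc n ×′ 1#)        ≈⟨ ⁻¹-∙-comm _ _ ⟨
      - (suc m ×′ 1#) - (suc n ×′ 1#)      ∎

    *-homo⁺ : ∀ m y → fromℤ (pos m ℤ.* y) ≈ fromℤ (pos m) * fromℤ y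
    *-homo⁺ m (pos n)  = trans (reflexive (≡.cong fromℤ (≡.sym (ℤₚ.pos-* m n)))) (×1-homo-* m n)
    *-homo⁺ m -[1+ n ] = begin
      fromℤ (pos m ℤ.* (ℤ.- pos (suc n)))  ≈⟨ reflexive (≡.cong fromℤ (≡.sym (ℤₚ.neg-distribʳ-* (pos m) (pos (suc n))))) ⟩
      fromℤ (ℤ.- (pos m ℤ.* pos (suc n)))  ≈⟨ -‿homo (pos m ℤ.* pos (suc n)) ⟩
      - fromℤ (pos m ℤ.* pos (suc n))      ≈⟨ -‿cong (*-homo⁺ m (pos (suc n))) ⟩
      - (m ×′ 1# * suc n ×′ 1#)            ≈⟨ -‿distribʳ-* _ _ ⟩
      m ×′ 1# * - (suc n ×′ 1#)            ∎

    *-homo : ∀ x y → fromℤ (x ℤ.* y) ≈ fromℤ x * fromℤ y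
    *-homo (pos m)  y = *-homo⁺ m y
    *-homo -[1+ m ] y = begin
      fromℤ ((ℤ.- pos (suc m)) ℤ.* y)      ≈⟨ reflexive (≡.cong fromℤ (≡.sym (ℤₚ.neg-distribˡ-* (pos (suc m)) y))) ⟩
      fromℤ (ℤ.- (pos (suc m) ℤ.* y))      ≈⟨ -‿homo (pos (suc m) ℤ.* y) ⟩
      - fromℤ (pos (suc m) ℤ.* y)          ≈⟨ -‿cong (*-homo⁺ (suc m) y) ⟩
      - (suc m ×′ 1# * fromℤ y)            ≈⟨ -‿distribˡ-* _ _ ⟩
      - (suc m ×′ 1#) * fromℤ y            ∎

    ℤ⟶R : ℤ.+-*-rawRing -Raw-AlmostCommutative⟶ fromCommutativeRing R
    ℤ⟶R = record
      { ⟦_⟧ = fromℤ ; +-homo = +-homo ; *-homo = *-homo ; -‿homo = -‿homo ; 0-homo = refl ; 1-homo = refl }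

    coefficients≟ : ∀ x y → Maybe (fromℤ x ≈ fromℤ y)
    coefficients≟ x y with x ℤₚ.≟ y
    ... | yes x≡y = just (reflexive (≡.cong fromℤ x≡y))
    ... | no  _   = nothing

  private
    module S = Solver ℤ.+-*-rawRing (fromCommutativeRing R) ℤ⟶R coefficients≟

  open S public
    using (Polynomial; con; var; _:+_; _:*_; _:-_; :-_; _:=_; solve; prove)
    renaming (⟦_⟧ to eval)

  infix 4 _≋?_
  -- Equal normal forms give equality in all environments at once. A finite family of table
  -- identities can thus be settled by evaluating this test, without a solver call for each entry.
  _≋?_ : ∀ {n} (p r : Polynomial n) → Maybe (∀ ρ → eval p ρ ≈ eval r ρ)
  p ≋? r with S.normalise p S.≟N S.normalise r
  ... | just e  = just λ ρ → prove ρ p r (S.⟦ e ⟧N-cong ρ)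
  ... | nothing = nothing

-- Commutative rings with propositional equality

module DiscreteRings where

  open import Algebra.Bundles using (CommutativeRing)
  open import Algebra.Structures using (IsCommutativeRing)
  open import Level using (0ℓ)
  open import Relation.Binary.PropositionalEquality using (_≡_)

  -- Propositional equality lets summands be rewritten with `cong` and zero tests be matched with
  -- `refl`. Both the rationals and the copy of the finite field are rings of this kind.
  record DiscreteRing : Set₁ where
    infixl 7 _*_
    infixl 6 _+_
    infix  8 -_
    field
      Carrier           : Set
      _+_ _*_           : Carrier → Carrier → Carrier
      -_                : Carrier → Carrier
      0# 1#             : Carrier
      isCommutativeRing : IsCommutativeRing _≡_ _+_ _*_ -_ 0# 1#

    commutativeRing : CommutativeRing 0ℓ 0ℓ
    commutativeRing = record { isCommutativeRing = isCommutativeRing }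

    open CommutativeRing commutativeRing public
      using ( _-_; +-assoc; +-comm; +-identityˡ; +-identityʳ; -‿inverseˡ; -‿inverseʳ
            ; *-assoc; *-comm; *-identityˡ; *-identityʳ; zeroˡ; zeroʳ; distribˡ; distribʳ; semiring; ring )

-- Finite types and their decidable subsets

module FiniteTypes where

  open import Data.Fin.Base using (Fin; zero; suc; combine; quotient; remainder)
  open import Data.Fin.Properties using () renaming (_≟_ to _≟ᶠ_)
  open import Data.Fin.Properties using (suc-injective; combine-remQuot; remQuot-combine)
  open import Data.Nat.Base as ℕ using (ℕ; zero; suc)
  open import Data.Vec.Base using (Vec; []; _∷_)
  open import Data.Vec.Properties using (≡-dec)
  open import Data.Product.Base using (∃; _,_; map; proj₁; proj₂)
  open import Function.Base using (_∘_)
  open import Level using (Level)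
  open import Relation.Nullary using (Dec; yes; no; contradiction)
  open import Relation.Binary.Definitions using (DecidableEquality)
  open import Relation.Binary.PropositionalEquality

  record Finite (A : Set) : Set where
    field
      size       : ℕ
      enum       : Fin size → A
      index      : A → Fin size
      enum-index : ∀ x → enum (index x) ≡ x
      index-enum : ∀ i → index (enum i) ≡ i
      _≟_        : DecidableEquality A

    infix 4 _≟_

    index-injective : ∀ {x y} → index x ≡ index y → x ≡ y
    index-injective {x} {y} e = trans (sym (enum-index x)) (trans (cong enum e) (enum-index y))

  open Finite {{...}} public using (_≟_)

  instance
    Fin-finite : ∀ {n} → Finite (Fin n)
    Fin-finite {n} = record
      { size = n ; enum = λ i → i ; index = λ i → i ; enum-index = λ _ → refl ; index-enum = λ _ → refl ; _≟_ = _≟ᶠ_ }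

  module _ {p : Level} where

    count : ∀ {n} {P : Fin n → Set p} → (∀ i → Dec (P i)) → ℕ
    count {zero}  P? = 0
    count {suc n} P? with P? zero
    ... | yes _ = suc (count (P? ∘ suc))
    ... | no  _ = count (P? ∘ suc)

    -- Together with the two properties below, this enumerates a decidable subset without
    -- repetition; subsets of finite setoids obtain their size in this way.
    select : ∀ {n} {P : Fin n → Set p} (P? : ∀ i → Dec (P i)) → Fin (count P?) → ∃ P
    select {suc n} P? j with P? zero
    select {suc n} P? zero    | yes p = zero , p
    select {suc n} P? (suc j) | yes _ = map suc (λ p → p) (select (P? ∘ suc) j)
    select {suc n} P? j       | no  _ = map suc (λ p → p) (select (P? ∘ suc) j)

    select-injective : ∀ {n} {P : Fin n → Set p} (P? : ∀ i → Dec (P i)) j k →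
                       proj₁ (select P? j) ≡ proj₁ (select P? k) → j ≡ k
    select-injective {suc n} P? j k e with P? zero
    select-injective {suc n} P? zero    zero    e | yes _ = refl
    select-injective {suc n} P? (suc j) (suc k) e | yes _ =
      cong suc (select-injective (P? ∘ suc) j k (suc-injective e))
    select-injective {suc n} P? j       k       e | no  _ =
      select-injective (P? ∘ suc) j k (suc-injective e)

    select-surjective : ∀ {n} {P : Fin n → Set p} (P? : ∀ i → Dec (P i)) i → P i →
                        ∃ λ j → proj₁ (select P? j) ≡ i
    select-surjective {suc n} P? i p with P? zero
    select-surjective {suc n} P? zero    p | yes _ = zero , refl
    select-surjective {suc n} P? (suc i) p | yes _ = map suc (cong suc) (select-surjective (P? ∘ suc) i p)
    select-surjective {suc n} P? zero    p | no ¬p = contradiction p ¬p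
    select-surjective {suc n} P? (suc i) p | no _  = map (λ j → j) (cong suc) (select-surjective (P? ∘ suc) i p)

  instance
    Vec-finite : ∀ {A : Set} {{_ : Finite A}} {n} → Finite (Vec A n)
    Vec-finite {A} {{fin}} = go _
      where
      open Finite fin
      go : ∀ n → Finite (Vec A n)
      go zero = record
        { size = 1 ; enum = λ _ → [] ; index = λ _ → zero
        ; enum-index = λ { [] → refl } ; index-enum = λ { zero → refl } ; _≟_ = ≡-dec (Finite._≟_ fin) }
      go (suc n) = record
        { size  = size ℕ.* Finite.size rest
        ; enum  = λ i → enum (quotient (Finite.size rest) i) ∷ Finite.enum rest (remainder {size} (Finite.size rest) i)
        ; index = λ { (x ∷ v) → combine (index x) (Finite.index rest v) }
        ; enum-index = λ { (x ∷ v) →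
            trans (cong (λ p → enum (proj₁ p) ∷ Finite.enum rest (proj₂ p)) (remQuot-combine (index x) (Finite.index rest v)))
                  (cong₂ _∷_ (enum-index x) (Finite.enum-index rest v)) }
        ; index-enum = λ i → trans (cong₂ combine (index-enum _) (Finite.index-enum rest _)) (combine-remQuot {size} (Finite.size rest) i)
        ; _≟_ = ≡-dec (Finite._≟_ fin) }
        where rest = go n

open DiscreteRings using (DiscreteRing)

-- Finite sums and indicators

module Sums (N : DiscreteRing) where

  open import Data.Bool.Base using (if_then_else_)
  open import Data.Fin.Base using (Fin)
  open import Data.Fin.Permutation using (Permutation; permutation)
  open import Data.Fin.Properties using () renaming (_≟_ to _≟ᶠ_)
  open import Data.Nat.Base as ℕ using (ℕ; zero; suc)
  open import Function.Base using (_∘_)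
  open import Level using (Level)
  open import Relation.Binary.PropositionalEquality
  open import Relation.Nullary using (¬_; Dec; does; yes; no; contradiction)
  open FiniteTypes
  open DiscreteRing N renaming (Carrier to Num)
  open IntegerSolver commutativeRing
  open import Algebra.Properties.Semiring.Sum semiring
    using (sum; sum-cong-≗; ∑-distrib-+; ∑-comm; ∑-permute; *-distribˡ-sum)

  open import Algebra.Properties.Ring ring using (-1*x≈-x)
  open import Algebra.Properties.Semiring.Mult.TCOptimised semiring using (1+×) renaming (_×_ to infixl 8 _×′_)

  open ≡-Reasoning

  ∣_∣ : (A : Set) {{_ : Finite A}} → Num
  ∣ A ∣ {{fin}} = Finite.size fin ×′ 1#

  ⟦_⟧ : ∀ {p} {P : Set p} → Dec P → Num
  ⟦ P? ⟧ = if does P? then 1# else 0#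

  ⟦⟧-yes : ∀ {p} {P : Set p} (P? : Dec P) → P → ⟦ P? ⟧ ≡ 1#
  ⟦⟧-yes (yes _) _ = refl
  ⟦⟧-yes (no ¬p) p = contradiction p ¬p

  ⟦⟧-no : ∀ {p} {P : Set p} (P? : Dec P) → ¬ P → ⟦ P? ⟧ ≡ 0#
  ⟦⟧-no (yes p) ¬p = contradiction p ¬p
  ⟦⟧-no (no _) _ = refl

  ⟦⟧-⇔ : ∀ {p r} {P : Set p} {R : Set r} (P? : Dec P) (R? : Dec R) →
         (P → R) → (R → P) → ⟦ P? ⟧ ≡ ⟦ R? ⟧
  ⟦⟧-⇔ (yes p) R? f g = sym (⟦⟧-yes R? (f p))
  ⟦⟧-⇔ (no ¬p) R? f g = sym (⟦⟧-no R? (¬p ∘ g))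

  -- The trailing factor u allows two nested indicators to be merged in place inside a longer
  -- product.
  ⟦⟧-× : ∀ {p r t} {P : Set p} {R : Set r} {T : Set t} (P? : Dec P) (R? : Dec R) (T? : Dec T) →
         (P → R → T) → (T → P) → (T → R) → ∀ u → ⟦ P? ⟧ * (⟦ R? ⟧ * u) ≡ ⟦ T? ⟧ * u
  ⟦⟧-× (no ¬p) R? T? f g h u = trans (zeroˡ _) (sym (trans (cong (_* u) (⟦⟧-no T? (¬p ∘ g))) (zeroˡ u)))
  ⟦⟧-× (yes p) R? T? f g h u = trans (*-identityˡ _) (cong (_* u) (⟦⟧-⇔ R? T? (f p) h))

  module _ {A : Set} {{fin : Finite A}} where
    open Finite fin using (size; enum; index; enum-index; index-enum)

    δ : A → A → Num
    δ x y = ⟦ x ≟ y ⟧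

    opaque
      ∑ : (A → Num) → Num
      ∑ φ = sum (φ ∘ enum)

      ∑-cong : ∀ {φ ψ : A → Num} → (∀ x → φ x ≡ ψ x) → ∑ φ ≡ ∑ ψ
      ∑-cong e = sum-cong-≗ (e ∘ enum)

      ∑-+ : ∀ (φ ψ : A → Num) → ∑ (λ x → φ x + ψ x) ≡ ∑ φ + ∑ ψ
      ∑-+ φ ψ = ∑-distrib-+ (φ ∘ enum) (ψ ∘ enum)

      ∑-* : ∀ c (φ : A → Num) → ∑ (λ x → c * φ x) ≡ c * ∑ φ
      ∑-* c φ = sym (*-distribˡ-sum c (φ ∘ enum))

      ∑-const : ∀ c → ∑ (λ _ → c) ≡ ∣ A ∣ * c
      ∑-const c = go size
        where
        go : ∀ n → sum {n} (λ _ → c) ≡ (n ×′ 1#) * c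
        go zero    = sym (zeroˡ c)
        go (suc n) = trans (cong (c +_) (go n)) (sym (trans (cong (_* c) (1+× n 1#)) (trans (distribʳ c 1# _) (cong (_+ (n ×′ 1#) * c) (*-identityˡ c)))))

      sum-δ : ∀ {n} (φ : Fin n → Num) a → sum (λ x → ⟦ x ≟ᶠ a ⟧ * φ x) ≡ φ a
      sum-δ {suc n} φ Fin.zero =
        trans (cong₂ _+_ (*-identityˡ _)
                (trans (sum-cong-≗ {n} λ x → zeroˡ (φ (Fin.suc x))) (zeros n)))
              (+-identityʳ _)
        where
        zeros : ∀ n → sum {n} (λ _ → 0#) ≡ 0#
        zeros zero    = refl
        zeros (suc n) = trans (+-identityˡ _) (zeros n)
      sum-δ {suc n} φ (Fin.suc a) =
        trans (cong₂ _+_ (zeroˡ (φ Fin.zero)) (trans (sum-cong-≗ {n} λ x → refl) (sum-δ (φ ∘ Fin.suc) a)))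
              (+-identityˡ _)

      ∑-δ : ∀ (φ : A → Num) a → ∑ (λ x → δ x a * φ x) ≡ φ a
      ∑-δ φ a = begin
        sum (λ i → δ (enum i) a * φ (enum i))            ≡⟨ sum-cong-≗ {size} (λ i → cong (_* φ (enum i)) (δ≡ i)) ⟩
        sum (λ i → ⟦ i ≟ᶠ index a ⟧ * φ (enum i))        ≡⟨ sum-δ (φ ∘ enum) (index a) ⟩
        φ (enum (index a))                               ≡⟨ cong φ (enum-index a) ⟩
        φ a                                              ∎
        where
        δ≡ : ∀ i → δ (enum i) a ≡ ⟦ i ≟ᶠ index a ⟧
        δ≡ i = ⟦⟧-⇔ (enum i ≟ a) (i ≟ᶠ index a)
                 (λ e → trans (sym (index-enum i)) (cong index e))
                 (λ e → trans (cong enum e) (enum-index a))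

      ∑-bij : ∀ (φ : A → Num) (f g : A → A) → (∀ x → f (g x) ≡ x) → (∀ x → g (f x) ≡ x) →
              ∑ (λ x → φ (f x)) ≡ ∑ φ
      ∑-bij φ f g fg gf = begin
        ∑ (λ x → φ (f x))                               ≡⟨ sum-cong-≗ {size} (λ i → cong φ (sym (enum-index (f (enum i))))) ⟩
        sum (λ i → φ (enum (index (f (enum i)))))       ≡⟨ sym (∑-permute (φ ∘ enum) π) ⟩
        ∑ φ                                             ∎
        where
        π : Permutation size size
        π = permutation (index ∘ f ∘ enum) (index ∘ g ∘ enum)
              (λ i → trans (cong (index ∘ f) (enum-index _)) (trans (cong index (fg _)) (index-enum i)))
              (λ i → trans (cong (index ∘ g) (enum-index _)) (trans (cong index (gf _)) (index-enum i)))

    ∑-*ʳ : ∀ (φ : A → Num) c → ∑ (λ x → φ x * c) ≡ ∑ φ * c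
    ∑-*ʳ φ c = trans (∑-cong λ x → *-comm (φ x) c) (trans (∑-* c φ) (*-comm c _))

    ∑-zero : ∑ (λ _ → 0#) ≡ 0#
    ∑-zero = trans (∑-cong λ _ → sym (zeroˡ 0#)) (trans (∑-* 0# (λ _ → 0#)) (zeroˡ _))

    ∑-neg : ∀ (φ : A → Num) → ∑ (λ x → - φ x) ≡ - ∑ φ
    ∑-neg φ = trans (∑-cong λ x → sym (-1*x≈-x (φ x))) (trans (∑-* _ φ) (-1*x≈-x _))

    ∑-- : ∀ (φ ψ : A → Num) → ∑ (λ x → φ x - ψ x) ≡ ∑ φ - ∑ ψ
    ∑-- φ ψ = trans (∑-+ φ (λ x → - ψ x)) (cong (∑ φ +_) (∑-neg ψ))

    ∑-lin : ∀ a (φ : A → Num) b (ψ : A → Num) → ∑ (λ x → a * φ x + b * ψ x) ≡ a * ∑ φ + b * ∑ ψ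
    ∑-lin a φ b ψ = trans (∑-+ (λ x → a * φ x) (λ x → b * ψ x)) (cong₂ _+_ (∑-* a φ) (∑-* b ψ))

    δ-sym : ∀ x y → δ x y ≡ δ y x
    δ-sym x y = ⟦⟧-⇔ (x ≟ y) (y ≟ x) sym sym

    ∑-δ′ : ∀ (φ : A → Num) a → ∑ (λ x → δ a x * φ x) ≡ φ a
    ∑-δ′ φ a = trans (∑-cong λ x → cong (_* φ x) (δ-sym a x)) (∑-δ φ a)

    ∑δ≡1 : ∀ a → ∑ (λ x → δ x a) ≡ 1#
    ∑δ≡1 a = trans (∑-cong λ x → sym (*-identityʳ (δ x a))) (∑-δ (λ _ → 1#) a)

  opaque
    unfolding ∑

    ∑-swap : ∀ {A B : Set} {{_ : Finite A}} {{_ : Finite B}} (φ : A → B → Num) →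
             ∑ (λ x → ∑ (λ y → φ x y)) ≡ ∑ (λ y → ∑ (λ x → φ x y))
    ∑-swap {{fA}} {{fB}} φ = ∑-comm (λ i j → φ (Finite.enum fA i) (Finite.enum fB j))

  ∑-prod : ∀ {A B : Set} {{_ : Finite A}} {{_ : Finite B}} (φ : A → Num) (ψ : B → Num) →
           ∑ (λ x → ∑ (λ y → φ x * ψ y)) ≡ ∑ φ * ∑ ψ
  ∑-prod φ ψ = trans (∑-cong λ x → ∑-* (φ x) ψ) (∑-*ʳ φ (∑ ψ))

  -- φ s is written as a double sum of delta functions at `f s` and `g s`. After the sum over s has
  -- been moved inside, the two deltas are a single delta at `h a b`. No enumeration of a product
  -- type is involved.
  ∑-pairs : ∀ {S A B : Set} {{_ : Finite S}} {{_ : Finite A}} {{_ : Finite B}}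
            (φ : S → Num) (h : A → B → S) (f : S → A) (g : S → B) →
            (∀ s → h (f s) (g s) ≡ s) → (∀ a b → f (h a b) ≡ a) → (∀ a b → g (h a b) ≡ b) →
            ∑ φ ≡ ∑ (λ a → ∑ (λ b → φ (h a b)))
  ∑-pairs φ h f g hfg fh gh = begin
    ∑ φ
      ≡⟨ ∑-cong (λ s → sym (trans (∑-δ _ (f s)) (trans (∑-δ _ (g s)) (cong φ (hfg s))))) ⟩
    ∑ (λ s → ∑ (λ a → δ a (f s) * ∑ (λ b → δ b (g s) * φ (h a b))))
      ≡⟨ ∑-cong (λ s → ∑-cong λ a → sym (∑-* (δ a (f s)) _)) ⟩
    ∑ (λ s → ∑ (λ a → ∑ (λ b → δ a (f s) * (δ b (g s) * φ (h a b)))))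
      ≡⟨ trans (∑-swap _) (∑-cong λ a → ∑-swap _) ⟩
    ∑ (λ a → ∑ (λ b → ∑ (λ s → δ a (f s) * (δ b (g s) * φ (h a b)))))
      ≡⟨ ∑-cong (λ a → ∑-cong λ b → trans (∑-cong λ s → point a b s) (∑-δ (λ _ → φ (h a b)) (h a b))) ⟩
    ∑ (λ a → ∑ (λ b → φ (h a b))) ∎
    where
    point : ∀ a b s → δ a (f s) * (δ b (g s) * φ (h a b)) ≡ δ s (h a b) * φ (h a b)
    point a b s = ⟦⟧-× (a ≟ f s) (b ≟ g s) (s ≟ h a b)
      (λ { refl refl → sym (hfg s) })
      (λ e → sym (trans (cong f e) (fh a b))) (λ e → sym (trans (cong g e) (gh a b))) _

  module _ {p : Level} where

    sum-⟦⟧ : ∀ {n} {P : Fin n → Set p} (P? : ∀ i → Dec (P i)) →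
             sum (λ i → ⟦ P? i ⟧) ≡ count P? ×′ 1#
    sum-⟦⟧ {zero}  P? = refl
    sum-⟦⟧ {suc n} P? with P? Fin.zero
    ... | yes _ = trans (cong (1# +_) (sum-⟦⟧ (P? ∘ Fin.suc))) (sym (1+× (count (P? ∘ Fin.suc)) 1#))
    ... | no  _ = trans (+-identityˡ _) (sum-⟦⟧ (P? ∘ Fin.suc))

  opaque
    unfolding ∑

    -- The passage from sums of indicators back to cardinalities; with injectivity of the natural
    -- numbers in the number ring it turns an evaluated sum into a size.
    ∑-⟦⟧ : ∀ {p} {A : Set} {{fin : Finite A}} {P : A → Set p} (P? : ∀ x → Dec (P x)) →
           ∑ (λ x → ⟦ P? x ⟧) ≡ count (P? ∘ Finite.enum fin) ×′ 1#
    ∑-⟦⟧ {{fin}} P? = sum-⟦⟧ (P? ∘ Finite.enum fin)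

    ∑≡sum : ∀ {n} (φ : Fin n → Num) → ∑ φ ≡ sum φ
    ∑≡sum φ = refl

-- Fields of odd order and the quadratic character

module FiniteFields where

  open FiniteTypes

  open import Data.Product.Base using (∃-syntax; _,_; proj₁; proj₂; _×_)
  open import Data.Integer.Base using () renaming (+_ to pos)
  open import Relation.Binary.PropositionalEquality
  open import Relation.Nullary using (¬_; Dec; yes; no; contradiction; _×-dec_)
  open import Data.Fin.Base using (Fin)
  open import Data.Fin.Properties using (any?; ¬Fin0)
  open import Relation.Nullary.Decidable using (map′)

  record OddField : Set₁ where
    field
      discreteRing : DiscreteRing
    open DiscreteRing discreteRing using (commutativeRing)
    open DiscreteRing discreteRing public using (Carrier)
      renaming ( _+_ to infixl 6 _⊕_; _*_ to infixl 7 _⊗_; -_ to infix 8 ⊖_; _-_ to infixl 6 _⊝_; 0# to 0ᴬ; 1# to 1ᴬ)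
    open IntegerSolver commutativeRing public
      using () renaming (solve to solveᴬ; con to conᴬ; _:+_ to infixl 7 _:⊕_; _:*_ to infixl 8 _:⊗_; _:-_ to infixl 7 _:⊝_; :-_ to infix 9 :⊖_; _:=_ to infix 4 _:≣_; fromℤ to fromℤᴬ)
    field
      {{finite}} : Finite Carrier
      1≢0        : 1ᴬ ≢ 0ᴬ
      2≢0        : 1ᴬ ⊕ 1ᴬ ≢ 0ᴬ
      inverse    : ∀ x → x ≢ 0ᴬ → ∃[ y ] x ⊗ y ≡ 1ᴬ

    open DiscreteRing discreteRing using (*-assoc; *-identityˡ; +-identityʳ; zeroˡ; zeroʳ)

    2ᴬ 4ᴬ : Carrier
    2ᴬ = fromℤᴬ (pos 2)
    4ᴬ = fromℤᴬ (pos 4)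

    cancel-⊗ : ∀ {x y} → x ≢ 0ᴬ → x ⊗ y ≡ 0ᴬ → y ≡ 0ᴬ
    cancel-⊗ {x} {y} x≢0 xy≡0 = let x⁻¹ , xx⁻¹≡1 = inverse x x≢0 in begin
      y                ≡⟨ sym (*-identityˡ y) ⟩
      1ᴬ ⊗ y           ≡⟨ cong (_⊗ y) (sym xx⁻¹≡1) ⟩
      x ⊗ x⁻¹ ⊗ y      ≡⟨ (solveᴬ 3 (λ x i y → x :⊗ i :⊗ y :≣ i :⊗ (x :⊗ y)) refl x (x⁻¹) y) ⟩
      x⁻¹ ⊗ (x ⊗ y)    ≡⟨ cong (x⁻¹ ⊗_) xy≡0 ⟩
      x⁻¹ ⊗ 0ᴬ         ≡⟨ zeroʳ x⁻¹ ⟩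
      0ᴬ               ∎
      where open ≡-Reasoning

    ⊗-≢0 : ∀ {x y} → x ≢ 0ᴬ → y ≢ 0ᴬ → x ⊗ y ≢ 0ᴬ
    ⊗-≢0 x≢0 y≢0 e = y≢0 (cancel-⊗ x≢0 e)

    factorˡ-≢0 : ∀ {x y} → x ⊗ y ≢ 0ᴬ → x ≢ 0ᴬ
    factorˡ-≢0 {y = y} xy≢0 refl = xy≢0 (zeroˡ y)

    ⊝-≡0 : ∀ {x y} → x ⊝ y ≡ 0ᴬ → x ≡ y
    ⊝-≡0 {x} {y} e = trans ((solveᴬ 2 (λ x y → x :≣ y :⊕ (x :⊝ y)) refl x y)) (trans (cong (y ⊕_) e) (+-identityʳ y))

    inverse-≢0 : ∀ {x y} → x ⊗ y ≡ 1ᴬ → y ≢ 0ᴬ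
    inverse-≢0 {x} e refl = 1≢0 (trans (sym e) (zeroʳ x))

    inverse-cancel : ∀ {x x⁻¹} → x ⊗ x⁻¹ ≡ 1ᴬ → ∀ y → x ⊗ (x⁻¹ ⊗ y) ≡ y
    inverse-cancel {x} {x⁻¹} e y = trans (sym (*-assoc x x⁻¹ y)) (trans (cong (_⊗ y) e) (*-identityˡ y))

    4≢0 : 4ᴬ ≢ 0ᴬ
    4≢0 e = ⊗-≢0 2≢0 2≢0 (trans (solveᴬ 0 (conᴬ (pos 2) :⊗ conᴬ (pos 2) :≣ conᴬ (pos 4)) refl) e)

    square? : ∀ k → Dec (∃[ s ] s ⊗ s ≡ k)
    square? k = map′ (λ (i , e) → enum i , e) (λ (s , e) → index s , trans (cong (λ z → z ⊗ z) (enum-index s)) e)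
                  (any? λ i → enum i ⊗ enum i ≟ k)
      where open Finite finite using (enum; index; enum-index)

  data SquareClass : Set where
    zero square nonsquare : SquareClass

  -- An integral domain of characteristic zero. The first law cancels factors such as q, q - 1 and
  -- 4, the second recovers a cardinality from its image.
  record NumberRing : Set₁ where
    field
      discreteRing : DiscreteRing
    open DiscreteRing discreteRing public
    open IntegerSolver commutativeRing public
    field
      integral         : ∀ {x y} → x * y ≡ 0# → x ≢ 0# → y ≡ 0#
      fromℕ-injective  : ∀ m n → fromℤ (pos m) ≡ fromℤ (pos n) → m ≡ n

    cancel : ∀ {x y z} → x ≢ 0# → x * y ≡ x * z → y ≡ z
    cancel {x} {y} {z} x≢0 e = begin
      y            ≡⟨ (solve 2 (λ y z → y := (y :- z) :+ z) refl y z) ⟩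
      (y - z) + z  ≡⟨ cong (_+ z) (integral difference x≢0) ⟩
      0# + z       ≡⟨ +-identityˡ z ⟩
      z            ∎
      where
      open ≡-Reasoning
      difference : x * (y - z) ≡ 0#
      difference = trans (solve 3 (λ x y z → x :* (y :- z) := x :* y :- x :* z) refl x y z)
        (trans (cong (_- x * z) e) (-‿inverseʳ (x * z)))

  module Character (N : NumberRing) (𝔽 : OddField) where

    open NumberRing N renaming (Carrier to Num)
    open OddField 𝔽 renaming (Carrier to A)
    open Sums (NumberRing.discreteRing N)
    open ≡-Reasoning

    signOf : SquareClass → Num
    signOf zero      = 0#
    signOf square    = 1#
    signOf nonsquare = - 1#

    data HasClass (k : A) : SquareClass → Set where
      zero      : k ≡ 0ᴬ → HasClass k zero
      square    : k ≢ 0ᴬ → ∀ s → s ⊗ s ≡ k → HasClass k square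
      nonsquare : (∀ s → s ⊗ s ≢ k) → HasClass k nonsquare

    private
      classify : ∀ k → ∃[ c ] HasClass k c
      classify k with k ≟ 0ᴬ | square? k
      ... | yes k≡0 | _            = zero , zero k≡0
      ... | no k≢0  | yes (s , e)  = square , square k≢0 s e
      ... | no k≢0  | no ¬s        = nonsquare , nonsquare λ s e → ¬s (s , e)

    opaque
      class : A → SquareClass
      class k = proj₁ (classify k)

      hasClass : ∀ k → HasClass k (class k)
      hasClass k = proj₂ (classify k)

    χ : A → Num
    χ k = signOf (class k)

    class-unique : ∀ {k c} → HasClass k c → class k ≡ c
    class-unique {k} h = unique (hasClass k) h
      where
      unique : ∀ {k c d} → HasClass k c → HasClass k d → c ≡ d
      unique (zero e)        (zero _)        = refl
      unique (zero e)        (square k≢0 _ _) = contradiction e k≢0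
      unique (zero refl)     (nonsquare ¬s)  = contradiction (solveᴬ 0 (conᴬ (pos 0) :⊗ conᴬ (pos 0) :≣ conᴬ (pos 0)) refl) (¬s 0ᴬ)
      unique (square k≢0 _ _) (zero e)        = contradiction e k≢0
      unique (square _ _ _)  (square _ _ _)  = refl
      unique (square _ s e)  (nonsquare ¬s)  = contradiction e (¬s s)
      unique (nonsquare ¬s)  (zero refl)     = contradiction (solveᴬ 0 (conᴬ (pos 0) :⊗ conᴬ (pos 0) :≣ conᴬ (pos 0)) refl) (¬s 0ᴬ)
      unique (nonsquare ¬s)  (square _ s e)  = contradiction e (¬s s)
      unique (nonsquare _)   (nonsquare _)   = refl

    χ-class : ∀ {k c} → HasClass k c → χ k ≡ signOf c
    χ-class h = cong signOf (class-unique h)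

    χ0 : χ 0ᴬ ≡ 0#
    χ0 = χ-class (zero refl)

    χ-square : ∀ {s} → s ≢ 0ᴬ → χ (s ⊗ s) ≡ 1#
    χ-square {s} s≢0 = χ-class (square (⊗-≢0 s≢0 s≢0) s refl)

    χ²≡1 : ∀ {k} → k ≢ 0ᴬ → χ k * χ k ≡ 1#
    χ²≡1 {k} k≢0 with class k | hasClass k
    ... | zero      | zero e   = contradiction e k≢0
    ... | square    | _        = (solve 0 (con (pos 1) :* con (pos 1) := con (pos 1)) refl)
    ... | nonsquare | _        = (solve 0 (:- con (pos 1) :* :- con (pos 1) := con (pos 1)) refl)

    ∑-translate : ∀ (φ : A → Num) a → ∑ (λ t → φ (a ⊕ t)) ≡ ∑ φ
    ∑-translate φ a = ∑-bij φ (a ⊕_) (⊖ a ⊕_) (λ t → (solveᴬ 2 (λ a t → a :⊕ (:⊖ a :⊕ t) :≣ t) refl a t)) (λ t → (solveᴬ 2 (λ a t → :⊖ a :⊕ (a :⊕ t) :≣ t) refl a t))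

    ∑-translateʳ : ∀ (φ : A → Num) a → ∑ (λ t → φ (t ⊕ a)) ≡ ∑ φ
    ∑-translateʳ φ a = trans (∑-cong λ t → cong φ (solveᴬ 2 (λ t a → t :⊕ a :≣ a :⊕ t) refl t a)) (∑-translate φ a)

    ∑-scale : ∀ (φ : A → Num) {a} → a ≢ 0ᴬ → ∑ (λ t → φ (a ⊗ t)) ≡ ∑ φ
    ∑-scale φ {a} a≢0 = let a⁻¹ , e = inverse a a≢0 in
      ∑-bij φ (a ⊗_) (a⁻¹ ⊗_) (inverse-cancel e) (inverse-cancel (trans (solveᴬ 2 (λ a i → i :⊗ a :≣ a :⊗ i) refl a (a⁻¹)) e))

    ∑-affine : ∀ (φ : A → Num) {a} b → a ≢ 0ᴬ → ∑ (λ t → φ (b ⊕ a ⊗ t)) ≡ ∑ φ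
    ∑-affine φ b a≢0 = trans (∑-scale (λ t → φ (b ⊕ t)) a≢0) (∑-translate φ b)

    q : Num
    q = ∣ A ∣

    ∑-≢0 : ∀ (φ : A → Num) v → (∀ t → t ≢ 0ᴬ → φ t ≡ v) → ∑ φ ≡ φ 0ᴬ + (q - 1#) * v
    ∑-≢0 φ v h = begin
      ∑ φ                                             ≡⟨ ∑-cong split ⟩
      ∑ (λ t → v + δ t 0ᴬ * (φ t - v))                ≡⟨ ∑-+ _ _ ⟩
      ∑ (λ t → v) + ∑ (λ t → δ t 0ᴬ * (φ t - v))      ≡⟨ cong₂ _+_ (∑-const v) (∑-δ (λ t → φ t - v) 0ᴬ) ⟩
      q * v + (φ 0ᴬ - v)                              ≡⟨ (solve 3 (λ q v u → q :* v :+ (u :- v) := u :+ (q :- con (pos 1)) :* v) refl q v (φ 0ᴬ)) ⟩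
      φ 0ᴬ + (q - 1#) * v                             ∎
      where
      split : ∀ t → φ t ≡ v + δ t 0ᴬ * (φ t - v)
      split t with t ≟ 0ᴬ
      ... | yes refl = (solve 2 (λ u v → u := v :+ con (pos 1) :* (u :- v)) refl (φ 0ᴬ) v)
      ... | no t≢0   = trans (h t t≢0) (solve 2 (λ u v → v := v :+ con (pos 0) :* (u :- v)) refl (φ t) v)

    -- For d ≠ 0 the second argument runs through the field once, for d = 0 it stays at v. The
    -- factor `δ d 0ᴬ` joins both cases in one formula, which can be summed over d.
    ∑-line : ∀ (θ : A → A → Num) d v →
      ∑ (λ s → θ d (v ⊕ d ⊗ s)) ≡ (∑ (θ d) - δ d 0ᴬ * ∑ (θ 0ᴬ)) + q * (δ d 0ᴬ * θ 0ᴬ v)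
    ∑-line θ d v with d ≟ 0ᴬ
    ... | yes refl = trans (∑-cong λ s → cong (θ 0ᴬ) (solveᴬ 2 (λ v s → v :⊕ conᴬ (pos 0) :⊗ s :≣ v) refl v s)) (trans (∑-const (θ 0ᴬ v))
            (solve 3 (λ q o T → q :* o := (T :- con (pos 1) :* T) :+ q :* (con (pos 1) :* o)) refl q (θ 0ᴬ v) (∑ (θ 0ᴬ))))
    ... | no d≢0   = trans (∑-affine (θ d) v d≢0)
            (solve 4 (λ q o T U → U := (U :- con (pos 0) :* T) :+ q :* (con (pos 0) :* o)) refl q (θ 0ᴬ v) (∑ (θ 0ᴬ)) (∑ (θ d)))

    -- The value distribution of a hyperbolic plane: s t runs through the field for each s ≠ 0 and
    -- is constantly 0 for s = 0.
    ∑∑-product : ∀ (ψ : A → Num) → ∑ (λ s → ∑ λ t → ψ (s ⊗ t)) ≡ q * ψ 0ᴬ + (q - 1#) * ∑ ψ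
    ∑∑-product ψ = trans (∑-≢0 _ (∑ ψ) λ s s≢0 → ∑-scale ψ s≢0)
      (cong (_+ (q - 1#) * ∑ ψ) (trans (∑-cong λ t → cong ψ (solveᴬ 1 (λ t → conᴬ (pos 0) :⊗ t :≣ conᴬ (pos 0)) refl t)) (∑-const (ψ 0ᴬ))))

    -- Again a hyperbolic plane: u = t + s makes the difference of squares s (s + 2t), and s + 2t
    -- runs through the field with t because 2 is invertible.
    ∑∑-difference : ∀ (ψ : A → Num) → ∑ (λ t → ∑ λ u → ψ (u ⊗ u ⊝ t ⊗ t)) ≡ q * ψ 0ᴬ + (q - 1#) * ∑ ψ
    ∑∑-difference ψ = begin
      ∑ (λ t → ∑ λ u → ψ (u ⊗ u ⊝ t ⊗ t))
        ≡⟨ ∑-cong (λ t → sym (∑-translate (λ u → ψ (u ⊗ u ⊝ t ⊗ t)) t)) ⟩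
      ∑ (λ t → ∑ λ s → ψ ((t ⊕ s) ⊗ (t ⊕ s) ⊝ t ⊗ t))
        ≡⟨ ∑-cong (λ t → ∑-cong λ s → cong ψ (solveᴬ 2 (λ s t → (t :⊕ s) :⊗ (t :⊕ s) :⊝ t :⊗ t :≣ s :⊗ (s :⊕ conᴬ (pos 2) :⊗ t)) refl s t)) ⟩
      ∑ (λ t → ∑ λ s → ψ (s ⊗ (s ⊕ 2ᴬ ⊗ t)))
        ≡⟨ ∑-swap _ ⟩
      ∑ (λ s → ∑ λ t → ψ (s ⊗ (s ⊕ 2ᴬ ⊗ t)))
        ≡⟨ ∑-cong (λ s → ∑-affine (λ t → ψ (s ⊗ t)) s 2≢0) ⟩
      ∑ (λ s → ∑ λ t → ψ (s ⊗ t))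
        ≡⟨ ∑∑-product ψ ⟩
      q * ψ 0ᴬ + (q - 1#) * ∑ ψ ∎

    square-roots : ∀ k → ∑ (λ s → δ (s ⊗ s) k) ≡ 1# + χ k
    square-roots k with class k | hasClass k
    ... | zero | zero refl = begin
      ∑ (λ s → δ (s ⊗ s) 0ᴬ)  ≡⟨ ∑-cong (λ s → ⟦⟧-⇔ (s ⊗ s ≟ 0ᴬ) (s ≟ 0ᴬ) (root s) λ { refl → (solveᴬ 0 (conᴬ (pos 0) :⊗ conᴬ (pos 0) :≣ conᴬ (pos 0)) refl) }) ⟩
      ∑ (λ s → δ s 0ᴬ)        ≡⟨ ∑δ≡1 0ᴬ ⟩
      1#                      ≡⟨ (solve 0 (con (pos 1) := con (pos 1) :+ con (pos 0)) refl) ⟩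
      1# + 0#                 ∎
      where
      root : ∀ s → s ⊗ s ≡ 0ᴬ → s ≡ 0ᴬ
      root s e with s ≟ 0ᴬ
      ... | yes s≡0 = s≡0
      ... | no s≢0  = cancel-⊗ s≢0 e
    ... | square | square k≢0 r refl = begin
      ∑ (λ s → δ (s ⊗ s) (r ⊗ r))         ≡⟨ ∑-cong roots ⟩
      ∑ (λ s → δ s r + δ s (⊖ r))         ≡⟨ ∑-+ _ _ ⟩
      ∑ (λ s → δ s r) + ∑ (λ s → δ s (⊖ r))  ≡⟨ cong₂ _+_ (∑δ≡1 r) (∑δ≡1 (⊖ r)) ⟩
      1# + 1#                             ∎
      where
      r≢0 : r ≢ 0ᴬ
      r≢0 = factorˡ-≢0 k≢0
      r≢-r : r ≢ ⊖ r
      r≢-r e = ⊗-≢0 2≢0 r≢0 (trans (solveᴬ 1 (λ r → conᴬ (pos 2) :⊗ r :≣ r :⊕ r) refl r) (trans (cong (r ⊕_) e) (solveᴬ 1 (λ r → r :⊕ :⊖ r :≣ conᴬ (pos 0)) refl r)))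
      roots : ∀ s → δ (s ⊗ s) (r ⊗ r) ≡ δ s r + δ s (⊖ r)
      roots s with s ≟ r | s ≟ ⊖ r
      ... | yes refl | yes e    = contradiction e r≢-r
      ... | yes refl | no _     = trans (⟦⟧-yes (s ⊗ s ≟ r ⊗ r) refl) (solve 0 (con (pos 1) := con (pos 1) :+ con (pos 0)) refl)
      ... | no _     | yes refl = trans (⟦⟧-yes (s ⊗ s ≟ r ⊗ r) (solveᴬ 1 (λ r → :⊖ r :⊗ :⊖ r :≣ r :⊗ r) refl r)) (solve 0 (con (pos 1) := con (pos 0) :+ con (pos 1)) refl)
      ... | no s≢r   | no s≢-r  = trans (⟦⟧-no (s ⊗ s ≟ r ⊗ r) λ e → s≢-r (⊝-≡0 (cancel-⊗ (λ e′ → s≢r (⊝-≡0 e′))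
          (trans (solveᴬ 2 (λ r s → (s :⊝ r) :⊗ (s :⊝ :⊖ r) :≣ s :⊗ s :⊝ r :⊗ r) refl r s) (trans (cong (_⊝ r ⊗ r) e) (solveᴬ 1 (λ r → r :⊗ r :⊝ r :⊗ r :≣ conᴬ (pos 0)) refl r))))))
          (solve 0 (con (pos 0) := con (pos 0) :+ con (pos 0)) refl)
    ... | nonsquare | nonsquare ¬s = begin
      ∑ (λ s → δ (s ⊗ s) k)   ≡⟨ ∑-cong (λ s → ⟦⟧-no (s ⊗ s ≟ k) (¬s s)) ⟩
      ∑ (λ s → 0#)            ≡⟨ ∑-zero ⟩
      0#                      ≡⟨ (solve 0 (con (pos 0) := con (pos 1) :+ :- con (pos 1)) refl) ⟩
      1# + - 1#               ∎

    ∑-squares : ∀ (ψ : A → Num) → ∑ (λ s → ψ (s ⊗ s)) ≡ ∑ ψ + ∑ (λ k → χ k * ψ k)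
    ∑-squares ψ = begin
      ∑ (λ s → ψ (s ⊗ s))                        ≡⟨ ∑-cong (λ s → sym (∑-δ′ ψ (s ⊗ s))) ⟩
      ∑ (λ s → ∑ λ k → δ (s ⊗ s) k * ψ k)        ≡⟨ ∑-swap _ ⟩
      ∑ (λ k → ∑ λ s → δ (s ⊗ s) k * ψ k)        ≡⟨ ∑-cong (λ k → trans (∑-*ʳ _ (ψ k)) (cong (_* ψ k) (square-roots k))) ⟩
      ∑ (λ k → (1# + χ k) * ψ k)                 ≡⟨ ∑-cong (λ k → (solve 2 (λ c p → (con (pos 1) :+ c) :* p := p :+ c :* p) refl (χ k) (ψ k))) ⟩
      ∑ (λ k → ψ k + χ k * ψ k)                  ≡⟨ ∑-+ _ _ ⟩
      ∑ ψ + ∑ (λ k → χ k * ψ k)                  ∎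

    -- For the constant function 1, `∑-squares` says that q equals q plus the sum of χ.
    ∑χ≡0 : ∑ χ ≡ 0#
    ∑χ≡0 = begin
      ∑ χ                                  ≡⟨ ∑-cong (λ k → (solve 1 (λ c → c := c :* con (pos 1)) refl (χ k))) ⟩
      ∑ (λ k → χ k * 1#)                   ≡⟨ (solve 2 (λ a b → b := (a :+ b) :- a) refl (∑ (λ _ → 1#)) (∑ (λ k → χ k * 1#))) ⟩
      (∑ (λ _ → 1#) + ∑ (λ k → χ k * 1#)) - ∑ (λ _ → 1#)
                                           ≡⟨ cong (_- ∑ (λ _ → 1#)) (sym (∑-squares (λ _ → 1#))) ⟩
      ∑ (λ _ → 1#) - ∑ (λ _ → 1#)          ≡⟨ (solve 1 (λ a → a :- a := con (pos 0)) refl (∑ (λ _ → 1#))) ⟩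
      0#                                   ∎

    -- In characteristic zero a sum of indicators is a cardinality, so it vanishes only for the
    -- empty set.
    ∑-⟦⟧≡0 : ∀ {p} {B : Set} {{_ : Finite B}} {P : B → Set p} (P? : ∀ x → Dec (P x)) →
              ∑ (λ x → ⟦ P? x ⟧) ≡ 0# → ∀ x → ¬ P x
    ∑-⟦⟧≡0 {{fin}} {P} P? e x p = ¬Fin0 (subst Fin none (proj₁ chosen))
      where
      open Finite fin using (enum; index; enum-index)
      none   = fromℕ-injective (count λ i → P? (enum i)) 0 (trans (sym (∑-⟦⟧ P?)) e)
      chosen = select-surjective (λ i → P? (enum i)) (index x) (subst P (sym (enum-index x)) p)

    nonsquare? : ∀ k → Dec (class k ≡ nonsquare)
    nonsquare? k with class k
    ... | zero      = no λ ()
    ... | square    = no λ ()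
    ... | nonsquare = yes refl

    private
      2*≡0 : ∀ {x} → - (1# + 1#) * x ≡ 0# → x ≡ 0#
      2*≡0 {x} e = integral (trans (solve 1 (λ x → con (pos 2) :* x := :- (:- (con (pos 1) :+ con (pos 1)) :* x)) refl x) (trans (cong -_ e) (solve 0 (:- con (pos 0) := con (pos 0)) refl)))
                     λ 2≡0 → contradiction (fromℕ-injective 2 0 2≡0) λ ()

      class-s²* : ∀ {s} → s ≢ 0ᴬ → ∀ k → class (s ⊗ s ⊗ k) ≡ class k
      class-s²* {s} s≢0 k with class k | hasClass k
      ... | zero      | zero refl          = class-unique (zero (solveᴬ 1 (λ s → s :⊗ s :⊗ conᴬ (pos 0) :≣ conᴬ (pos 0)) refl s))
      ... | square    | square k≢0 r refl  = class-unique
        (square (⊗-≢0 (⊗-≢0 s≢0 s≢0) k≢0) (s ⊗ r) (solveᴬ 2 (λ s r → s :⊗ r :⊗ (s :⊗ r) :≣ s :⊗ s :⊗ (r :⊗ r)) refl s r))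
      ... | nonsquare | nonsquare ¬r       = class-unique (nonsquare λ r e →
        let s⁻¹ , ss⁻¹≡1 = inverse s s≢0 in
        ¬r (s⁻¹ ⊗ r) (begin
          s⁻¹ ⊗ r ⊗ (s⁻¹ ⊗ r)                ≡⟨ (solveᴬ 2 (λ i r → i :⊗ r :⊗ (i :⊗ r) :≣ i :⊗ (i :⊗ (r :⊗ r))) refl (s⁻¹) r) ⟩
          s⁻¹ ⊗ (s⁻¹ ⊗ (r ⊗ r))              ≡⟨ cong (λ z → s⁻¹ ⊗ (s⁻¹ ⊗ z)) e ⟩
          s⁻¹ ⊗ (s⁻¹ ⊗ (s ⊗ s ⊗ k))          ≡⟨ (solveᴬ 3 (λ i s k → i :⊗ (i :⊗ (s :⊗ s :⊗ k)) :≣ s :⊗ i :⊗ (s :⊗ (i :⊗ k))) refl (s⁻¹) s k) ⟩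
          s ⊗ s⁻¹ ⊗ (s ⊗ (s⁻¹ ⊗ k))          ≡⟨ cong₂ _⊗_ ss⁻¹≡1 (inverse-cancel ss⁻¹≡1 k) ⟩
          1ᴬ ⊗ k                             ≡⟨ (solveᴬ 1 (λ k → conᴬ (pos 1) :⊗ k :≣ k) refl k) ⟩
          k                                  ∎))

      χ-s²* : ∀ {s} → s ≢ 0ᴬ → ∀ k → χ (s ⊗ s ⊗ k) ≡ χ k
      χ-s²* s≢0 k = cong signOf (class-s²* s≢0 k)

      -- As χ sums to zero, so does y ↦ χ (c y) + χ y; its terms are 0 or −2, hence vanish.
      nonsquare-* : ∀ {c} → class c ≡ nonsquare → ∀ y → class y ≡ nonsquare → class (c ⊗ y) ≢ nonsquare
      nonsquare-* {c} c-non y y-non cy-non = none y (y-non , cy-non)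
        where
        bad? : ∀ y → Dec (class y ≡ nonsquare × class (c ⊗ y) ≡ nonsquare)
        bad? y = nonsquare? y ×-dec nonsquare? (c ⊗ y)

        c≢0 : c ≢ 0ᴬ
        c≢0 refl with trans (sym c-non) (class-unique (zero refl))
        ... | ()

        term : ∀ y → χ (c ⊗ y) + χ y ≡ - (1# + 1#) * ⟦ bad? y ⟧
        term y with class y in y-class | hasClass y
        ... | zero      | zero refl         = trans (cong (_+ 0#) (χ-class (zero (solveᴬ 1 (λ c → c :⊗ conᴬ (pos 0) :≣ conᴬ (pos 0)) refl c)))) (solve 0 (con (pos 0) :+ con (pos 0) := :- (con (pos 1) :+ con (pos 1)) :* con (pos 0)) refl)
        ... | square    | square s²≢0 s refl = trans (cong (_+ 1#) (trans (cong χ (solveᴬ 2 (λ c s → c :⊗ (s :⊗ s) :≣ s :⊗ s :⊗ c) refl c s))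
                  (trans (χ-s²* (factorˡ-≢0 s²≢0) c) (cong signOf c-non)))) (solve 0 (:- con (pos 1) :+ con (pos 1) := :- (con (pos 1) :+ con (pos 1)) :* con (pos 0)) refl)
        ... | nonsquare | nonsquare ¬s with class (c ⊗ y) | hasClass (c ⊗ y)
        ...   | square    | _      = (solve 0 (con (pos 1) :+ :- con (pos 1) := :- (con (pos 1) :+ con (pos 1)) :* con (pos 0)) refl)
        ...   | nonsquare | _      = (solve 0 (:- con (pos 1) :+ :- con (pos 1) := :- (con (pos 1) :+ con (pos 1)) :* con (pos 1)) refl)
        ...   | zero      | zero e = contradiction (trans (solveᴬ 0 (conᴬ (pos 0) :⊗ conᴬ (pos 0) :≣ conᴬ (pos 0)) refl) (sym (cancel-⊗ c≢0 e))) (¬s 0ᴬ)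

        none : ∀ y → ¬ (class y ≡ nonsquare × class (c ⊗ y) ≡ nonsquare)
        none = ∑-⟦⟧≡0 bad? (2*≡0 (begin
          - (1# + 1#) * ∑ (λ y → ⟦ bad? y ⟧)    ≡⟨ sym (∑-* _ _) ⟩
          ∑ (λ y → - (1# + 1#) * ⟦ bad? y ⟧)    ≡⟨ ∑-cong (λ y → sym (term y)) ⟩
          ∑ (λ y → χ (c ⊗ y) + χ y)             ≡⟨ ∑-+ _ _ ⟩
          ∑ (λ y → χ (c ⊗ y)) + ∑ χ             ≡⟨ cong₂ _+_ (trans (∑-scale χ c≢0) ∑χ≡0) ∑χ≡0 ⟩
          0# + 0#                               ≡⟨ +-identityˡ 0# ⟩
          0#                                    ∎))

    -- Zero and square factors are handled by witnesses. For two nonsquares `nonsquare-*` excludes a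
    -- nonsquare product, and a zero product would force a zero factor; no generator of the
    -- multiplicative group is used.
    χ-* : ∀ x y → χ (x ⊗ y) ≡ χ x * χ y
    χ-* x y with class x in x-class | hasClass x
    ... | zero      | zero refl         = trans (χ-class (zero (solveᴬ 1 (λ y → conᴬ (pos 0) :⊗ y :≣ conᴬ (pos 0)) refl y))) (sym (zeroˡ _))
    ... | square    | square s²≢0 s refl = trans (χ-s²* (factorˡ-≢0 s²≢0) y) (sym (*-identityˡ _))
    ... | nonsquare | nonsquare ¬r with class y in y-class | hasClass y
    ...   | zero      | zero refl         = trans (χ-class (zero (solveᴬ 1 (λ x → x :⊗ conᴬ (pos 0) :≣ conᴬ (pos 0)) refl x))) (sym (zeroʳ _))
    ...   | square    | square s²≢0 s refl = trans (cong χ (solveᴬ 2 (λ x s → x :⊗ (s :⊗ s) :≣ s :⊗ s :⊗ x) refl x s))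
              (trans (χ-s²* (factorˡ-≢0 s²≢0) x) (trans (cong signOf x-class) (sym (*-identityʳ _))))
    ...   | nonsquare | nonsquare ¬s with class (x ⊗ y) in xy-class | hasClass (x ⊗ y)
    ...     | square    | _ = (solve 0 (con (pos 1) := :- con (pos 1) :* :- con (pos 1)) refl)
    ...     | nonsquare | _ = contradiction xy-class (nonsquare-* x-class y y-class)
    ...     | zero      | zero e with x ≟ 0ᴬ
    ...       | yes refl = contradiction (solveᴬ 0 (conᴬ (pos 0) :⊗ conᴬ (pos 0) :≣ conᴬ (pos 0)) refl) (¬r 0ᴬ)
    ...       | no x≢0   = contradiction (trans (solveᴬ 0 (conᴬ (pos 0) :⊗ conᴬ (pos 0) :≣ conᴬ (pos 0)) refl) (sym (cancel-⊗ x≢0 e))) (¬s 0ᴬ)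

    χ-square-* : ∀ {s} → s ≢ 0ᴬ → ∀ k → χ (s ⊗ s ⊗ k) ≡ χ k
    χ-square-* = χ-s²*

    -- The values of s² are counted with weight 1 + χ. Since a² is a square, χ of (k - b) / a equals
    -- χ of a (k - b), so the formula contains no inverse.
    ∑-quadratic : ∀ (ψ : A → Num) {a} b → a ≢ 0ᴬ →
                  ∑ (λ s → ψ (a ⊗ (s ⊗ s) ⊕ b)) ≡ ∑ ψ + ∑ (λ k → χ (a ⊗ (k ⊝ b)) * ψ k)
    ∑-quadratic ψ {a} b a≢0 = begin
      ∑ (λ s → ψ (a ⊗ (s ⊗ s) ⊕ b))
        ≡⟨ ∑-squares (λ k → ψ (a ⊗ k ⊕ b)) ⟩
      ∑ (λ k → ψ (a ⊗ k ⊕ b)) + ∑ (λ k → χ k * ψ (a ⊗ k ⊕ b))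
        ≡⟨ cong₂ _+_ (∑-cong λ k → cong ψ (ℓ k)) (∑-cong λ k → cong₂ _*_ (χ-shift k) (cong ψ (ℓ k))) ⟩
      ∑ (λ k → ψ (b ⊕ a ⊗ k)) + ∑ (λ k → χ (a ⊗ ((b ⊕ a ⊗ k) ⊝ b)) * ψ (b ⊕ a ⊗ k))
        ≡⟨ cong₂ _+_ (∑-affine ψ b a≢0) (∑-affine (λ k → χ (a ⊗ (k ⊝ b)) * ψ k) b a≢0) ⟩
      ∑ ψ + ∑ (λ k → χ (a ⊗ (k ⊝ b)) * ψ k) ∎
      where
      ℓ : ∀ k → a ⊗ k ⊕ b ≡ b ⊕ a ⊗ k
      ℓ k = (solveᴬ 3 (λ a b k → a :⊗ k :⊕ b :≣ b :⊕ a :⊗ k) refl a b k)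
      χ-shift : ∀ k → χ k ≡ χ (a ⊗ ((b ⊕ a ⊗ k) ⊝ b))
      χ-shift k = trans (sym (χ-s²* a≢0 k)) (cong χ (solveᴬ 3 (λ a b k → a :⊗ a :⊗ k :≣ a :⊗ ((b :⊕ a :⊗ k) :⊝ b)) refl a b k))

    private
      -- 1 + χ(t² + b) counts the roots u of u² = t² + b, so the sum is the number of points of the
      -- hyperbola u² - t² = b, less q.
      ∑χ-monic : ∀ b → ∑ (λ t → χ (t ⊗ t ⊕ b)) ≡ q * δ b 0ᴬ - 1#
      ∑χ-monic b = begin
        X                                               ≡⟨ (solve 2 (λ q X → X := (q :* con (pos 1) :+ X) :- q) refl q X) ⟩
        (q * 1# + X) - q                                ≡⟨ cong (λ z → (z + X) - q) (sym (∑-const 1#)) ⟩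
        (∑ (λ _ → 1#) + X) - q                          ≡⟨ cong (_- q) (sym (∑-+ (λ _ → 1#) _)) ⟩
        ∑ (λ t → 1# + χ (t ⊗ t ⊕ b)) - q                ≡⟨ cong (_- q) (∑-cong λ t → sym (square-roots (t ⊗ t ⊕ b))) ⟩
        ∑ (λ t → ∑ λ u → δ (u ⊗ u) (t ⊗ t ⊕ b)) - q     ≡⟨ cong (_- q) (∑-cong λ t → ∑-cong λ u → move t u) ⟩
        ∑ (λ t → ∑ λ u → δ b (u ⊗ u ⊝ t ⊗ t)) - q       ≡⟨ cong (_- q) (∑∑-difference (δ b)) ⟩
        (q * δ b 0ᴬ + (q - 1#) * ∑ (δ b)) - q           ≡⟨ cong (λ z → (q * δ b 0ᴬ + (q - 1#) * z) - q)
                                                             (trans (∑-cong (δ-sym b)) (∑δ≡1 b)) ⟩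
        (q * δ b 0ᴬ + (q - 1#) * 1#) - q                ≡⟨ (solve 2 (λ q d → (q :* d :+ (q :- con (pos 1)) :* con (pos 1)) :- q := q :* d :- con (pos 1)) refl q (δ b 0ᴬ)) ⟩
        q * δ b 0ᴬ - 1#                                 ∎
        where
        X = ∑ (λ t → χ (t ⊗ t ⊕ b))
        move : ∀ t u → δ (u ⊗ u) (t ⊗ t ⊕ b) ≡ δ b (u ⊗ u ⊝ t ⊗ t)
        move t u = ⟦⟧-⇔ (u ⊗ u ≟ t ⊗ t ⊕ b) (b ≟ u ⊗ u ⊝ t ⊗ t)
          (λ e → trans (solveᴬ 2 (λ b t → b :≣ (t :⊗ t :⊕ b) :⊝ t :⊗ t) refl b t) (cong (_⊝ t ⊗ t) (sym e)))
          (λ { refl → (solveᴬ 2 (λ u t → u :⊗ u :≣ t :⊗ t :⊕ (u :⊗ u :⊝ t :⊗ t)) refl u t) })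

    ∑χ-quadratic : ∀ {a} b → a ≢ 0ᴬ → ∑ (λ t → χ (a ⊗ (t ⊗ t) ⊕ b)) ≡ χ a * (q * δ b 0ᴬ - 1#)
    ∑χ-quadratic {a} b a≢0 = let a⁻¹ , aa⁻¹≡1 = inverse a a≢0 in begin
      ∑ (λ t → χ (a ⊗ (t ⊗ t) ⊕ b))
        ≡⟨ ∑-cong (λ t → cong χ (trans (cong (a ⊗ (t ⊗ t) ⊕_) (sym (inverse-cancel aa⁻¹≡1 b)))
             (solveᴬ 3 (λ a t c → a :⊗ (t :⊗ t) :⊕ a :⊗ c :≣ a :⊗ (t :⊗ t :⊕ c)) refl a t (a⁻¹ ⊗ b)))) ⟩
      ∑ (λ t → χ (a ⊗ (t ⊗ t ⊕ a⁻¹ ⊗ b)))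
        ≡⟨ ∑-cong (λ t → χ-* a _) ⟩
      ∑ (λ t → χ a * χ (t ⊗ t ⊕ a⁻¹ ⊗ b))
        ≡⟨ ∑-* (χ a) _ ⟩
      χ a * ∑ (λ t → χ (t ⊗ t ⊕ a⁻¹ ⊗ b))
        ≡⟨ cong (χ a *_) (∑χ-monic (a⁻¹ ⊗ b)) ⟩
      χ a * (q * δ (a⁻¹ ⊗ b) 0ᴬ - 1#)
        ≡⟨ cong (λ z → χ a * (q * z - 1#)) (⟦⟧-⇔ (a⁻¹ ⊗ b ≟ 0ᴬ) (b ≟ 0ᴬ) (cancel-⊗ (inverse-≢0 aa⁻¹≡1)) λ { refl → (solveᴬ 1 (λ i → i :⊗ conᴬ (pos 0) :≣ conᴬ (pos 0)) refl (a⁻¹)) }) ⟩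
      χ a * (q * δ b 0ᴬ - 1#) ∎

    δ-scale : ∀ {a} → a ≢ 0ᴬ → ∀ k → δ (a ⊗ k) 0ᴬ ≡ δ k 0ᴬ
    δ-scale {a} a≢0 k = ⟦⟧-⇔ (a ⊗ k ≟ 0ᴬ) (k ≟ 0ᴬ) (cancel-⊗ a≢0) λ { refl → (solveᴬ 1 (λ a → a :⊗ conᴬ (pos 0) :≣ conᴬ (pos 0)) refl a) }

    -- Summing over x first leaves χ of a quadratic polynomial in y, which `∑χ-quadratic` evaluates.
    -- The sign χ(-a e) is 1 for a hyperbolic plane and -1 for an anisotropic one.
    ∑∑-diagonal : ∀ (ψ : A → Num) {a e} → a ≢ 0ᴬ → e ≢ 0ᴬ →
      ∑ (λ y → ∑ λ x → ψ (a ⊗ (x ⊗ x) ⊕ e ⊗ (y ⊗ y))) ≡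
      (q - χ (⊖ (a ⊗ e))) * ∑ ψ + χ (⊖ (a ⊗ e)) * (q * ψ 0ᴬ)
    ∑∑-diagonal ψ {a} {e} a≢0 e≢0 = begin
      ∑ (λ y → ∑ λ x → ψ (a ⊗ (x ⊗ x) ⊕ e ⊗ (y ⊗ y)))
        ≡⟨ ∑-cong (λ y → ∑-quadratic ψ (e ⊗ (y ⊗ y)) a≢0) ⟩
      ∑ (λ y → ∑ ψ + ∑ (λ k → χ (a ⊗ (k ⊝ e ⊗ (y ⊗ y))) * ψ k))
        ≡⟨ trans (∑-+ _ _) (cong₂ _+_ (∑-const (∑ ψ)) (∑-swap _)) ⟩
      q * ∑ ψ + ∑ (λ k → ∑ λ y → χ (a ⊗ (k ⊝ e ⊗ (y ⊗ y))) * ψ k)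
        ≡⟨ cong (q * ∑ ψ +_) (∑-cong λ k → trans (∑-*ʳ _ (ψ k)) (cong (_* ψ k) (inner k))) ⟩
      q * ∑ ψ + ∑ (λ k → η * (q * δ k 0ᴬ - 1#) * ψ k)
        ≡⟨ cong (q * ∑ ψ +_) (∑-cong λ k → (solve 4 (λ q h d p → h :* (q :* d :- con (pos 1)) :* p := h :* q :* (d :* p) :+ :- h :* p) refl q (η) (δ k 0ᴬ) (ψ k))) ⟩
      q * ∑ ψ + ∑ (λ k → η * q * (δ k 0ᴬ * ψ k) + - η * ψ k)
        ≡⟨ cong (q * ∑ ψ +_) (trans (∑-lin (η * q) (λ k → δ k 0ᴬ * ψ k) (- η) ψ) (cong (λ z → η * q * z + - η * ∑ ψ) (∑-δ ψ 0ᴬ))) ⟩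
      q * ∑ ψ + (η * q * ψ 0ᴬ + - η * ∑ ψ)
        ≡⟨ (solve 4 (λ q h S o → q :* S :+ (h :* q :* o :+ :- h :* S) := (q :- h) :* S :+ h :* (q :* o)) refl q (η) (∑ ψ) (ψ 0ᴬ)) ⟩
      (q - η) * ∑ ψ + η * (q * ψ 0ᴬ) ∎
      where
      η = χ (⊖ (a ⊗ e))
      -ae≢0 : ⊖ (a ⊗ e) ≢ 0ᴬ
      -ae≢0 z = ⊗-≢0 a≢0 e≢0 (trans (solveᴬ 2 (λ a e → a :⊗ e :≣ :⊖ :⊖ (a :⊗ e)) refl a e) (trans (cong ⊖_ z) (solveᴬ 0 (:⊖ conᴬ (pos 0) :≣ conᴬ (pos 0)) refl)))
      inner : ∀ k → ∑ (λ y → χ (a ⊗ (k ⊝ e ⊗ (y ⊗ y)))) ≡ η * (q * δ k 0ᴬ - 1#)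
      inner k = trans (∑-cong λ y → cong χ (solveᴬ 4 (λ a k e y → a :⊗ (k :⊝ e :⊗ (y :⊗ y)) :≣ :⊖ (a :⊗ e) :⊗ (y :⊗ y) :⊕ a :⊗ k) refl a k e y))
        (trans (∑χ-quadratic (a ⊗ k) -ae≢0) (cong (λ z → η * (q * z - 1#)) (δ-scale a≢0 k)))

    -- Completing the square gives the diagonal form α x² + e y² with D = -4 α e, so the sign of the
    -- plane is χ(D).
    ∑∑-binary : ∀ (ψ : A → Num) {α β γ} → α ≢ 0ᴬ → β ⊗ β ⊝ 4ᴬ ⊗ (α ⊗ γ) ≢ 0ᴬ →
      ∑ (λ y → ∑ λ x → ψ (α ⊗ (x ⊗ x) ⊕ β ⊗ (x ⊗ y) ⊕ γ ⊗ (y ⊗ y))) ≡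
      (q - χ (β ⊗ β ⊝ 4ᴬ ⊗ (α ⊗ γ))) * ∑ ψ + χ (β ⊗ β ⊝ 4ᴬ ⊗ (α ⊗ γ)) * (q * ψ 0ᴬ)
    ∑∑-binary ψ {α} {β} {γ} α≢0 D≢0 = begin
      ∑ (λ y → ∑ λ x → ψ (α ⊗ (x ⊗ x) ⊕ β ⊗ (x ⊗ y) ⊕ γ ⊗ (y ⊗ y)))
        ≡⟨ ∑-cong (λ y → sym (∑-translate _ (⊖ (β ⊗ h ⊗ y)))) ⟩
      ∑ (λ y → ∑ λ x → ψ (let u = ⊖ (β ⊗ h ⊗ y) ⊕ x in α ⊗ (u ⊗ u) ⊕ β ⊗ (u ⊗ y) ⊕ γ ⊗ (y ⊗ y)))
        ≡⟨ ∑-cong (λ y → ∑-cong λ x → cong ψ (complete x y)) ⟩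
      ∑ (λ y → ∑ λ x → ψ (α ⊗ (x ⊗ x) ⊕ e ⊗ (y ⊗ y)))
        ≡⟨ ∑∑-diagonal ψ α≢0 e≢0 ⟩
      (q - χ (⊖ (α ⊗ e))) * ∑ ψ + χ (⊖ (α ⊗ e)) * (q * ψ 0ᴬ)
        ≡⟨ cong (λ z → (q - z) * ∑ ψ + z * (q * ψ 0ᴬ)) (sym χD) ⟩
      (q - χ D) * ∑ ψ + χ D * (q * ψ 0ᴬ) ∎
      where
      D = β ⊗ β ⊝ 4ᴬ ⊗ (α ⊗ γ)
      2α≢0 = ⊗-≢0 2≢0 α≢0
      h = proj₁ (inverse (2ᴬ ⊗ α) 2α≢0)
      2αh≡1 : 2ᴬ ⊗ α ⊗ h ≡ 1ᴬ
      2αh≡1 = proj₂ (inverse (2ᴬ ⊗ α) 2α≢0)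
      e = γ ⊝ α ⊗ (β ⊗ h ⊗ (β ⊗ h))
      D≡ : D ≡ 2ᴬ ⊗ 2ᴬ ⊗ ⊖ (α ⊗ e)
      D≡ = begin
        β ⊗ β ⊝ 4ᴬ ⊗ (α ⊗ γ)
          ≡⟨ (solveᴬ 3 (λ α β γ → β :⊗ β :⊝ conᴬ (pos 4) :⊗ (α :⊗ γ) :≣ conᴬ (pos 1) :⊗ conᴬ (pos 1) :⊗ (β :⊗ β) :⊝ conᴬ (pos 4) :⊗ (α :⊗ γ)) refl α β γ) ⟩
        1ᴬ ⊗ 1ᴬ ⊗ (β ⊗ β) ⊝ 4ᴬ ⊗ (α ⊗ γ)
          ≡⟨ cong (λ z → z ⊗ z ⊗ (β ⊗ β) ⊝ 4ᴬ ⊗ (α ⊗ γ)) (sym 2αh≡1) ⟩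
        2ᴬ ⊗ α ⊗ h ⊗ (2ᴬ ⊗ α ⊗ h) ⊗ (β ⊗ β) ⊝ 4ᴬ ⊗ (α ⊗ γ)
          ≡⟨ (solveᴬ 4 (λ α β γ h → conᴬ (pos 2) :⊗ α :⊗ h :⊗ (conᴬ (pos 2) :⊗ α :⊗ h) :⊗ (β :⊗ β) :⊝ conᴬ (pos 4) :⊗ (α :⊗ γ) :≣ conᴬ (pos 2) :⊗ conᴬ (pos 2) :⊗ :⊖ (α :⊗ (γ :⊝ α :⊗ (β :⊗ h :⊗ (β :⊗ h))))) refl α β γ h) ⟩
        2ᴬ ⊗ 2ᴬ ⊗ ⊖ (α ⊗ e) ∎
      χD : χ D ≡ χ (⊖ (α ⊗ e))
      χD = trans (cong χ D≡) (χ-s²* 2≢0 _)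
      e≢0 : e ≢ 0ᴬ
      e≢0 z = D≢0 (trans D≡ (trans (cong (λ w → 2ᴬ ⊗ 2ᴬ ⊗ ⊖ (α ⊗ w)) z) (solveᴬ 1 (λ α → conᴬ (pos 2) :⊗ conᴬ (pos 2) :⊗ :⊖ (α :⊗ conᴬ (pos 0)) :≣ conᴬ (pos 0)) refl α)))
      -- The solver cannot use 2αh = 1. The identity is therefore stated with an extra multiple of 1
      -- - 2αh, and the equation is then substituted into that term. Several proofs below proceed in
      -- the same way.
      complete : ∀ x y → (let u = ⊖ (β ⊗ h ⊗ y) ⊕ x in α ⊗ (u ⊗ u) ⊕ β ⊗ (u ⊗ y) ⊕ γ ⊗ (y ⊗ y)) ≡
                         α ⊗ (x ⊗ x) ⊕ e ⊗ (y ⊗ y)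
      complete x y = begin
        (let u = ⊖ (β ⊗ h ⊗ y) ⊕ x in α ⊗ (u ⊗ u) ⊕ β ⊗ (u ⊗ y) ⊕ γ ⊗ (y ⊗ y))
          ≡⟨ (solveᴬ 6 (λ x y α β γ h → α :⊗ ((:⊖ (β :⊗ h :⊗ y) :⊕ x) :⊗ (:⊖ (β :⊗ h :⊗ y) :⊕ x)) :⊕ β :⊗ ((:⊖ (β :⊗ h :⊗ y) :⊕ x) :⊗ y) :⊕ γ :⊗ (y :⊗ y) :≣ α :⊗ (x :⊗ x) :⊕ (γ :⊝ α :⊗ (β :⊗ h :⊗ (β :⊗ h))) :⊗ (y :⊗ y) :⊕ (conᴬ (pos 1) :⊝ conᴬ (pos 2) :⊗ α :⊗ h) :⊗ (β :⊗ x :⊗ y :⊝ β :⊗ h :⊗ (β :⊗ y :⊗ y))) refl x y α β γ h) ⟩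
        α ⊗ (x ⊗ x) ⊕ e ⊗ (y ⊗ y) ⊕ (1ᴬ ⊝ 2ᴬ ⊗ α ⊗ h) ⊗ (β ⊗ x ⊗ y ⊝ β ⊗ h ⊗ (β ⊗ y ⊗ y))
          ≡⟨ cong (λ z → α ⊗ (x ⊗ x) ⊕ e ⊗ (y ⊗ y) ⊕ (1ᴬ ⊝ z) ⊗ (β ⊗ x ⊗ y ⊝ β ⊗ h ⊗ (β ⊗ y ⊗ y))) 2αh≡1 ⟩
        α ⊗ (x ⊗ x) ⊕ e ⊗ (y ⊗ y) ⊕ (1ᴬ ⊝ 1ᴬ) ⊗ (β ⊗ x ⊗ y ⊝ β ⊗ h ⊗ (β ⊗ y ⊗ y))
          ≡⟨ (solveᴬ 2 (λ u w → u :⊕ (conᴬ (pos 1) :⊝ conᴬ (pos 1)) :⊗ w :≣ u) refl (α ⊗ (x ⊗ x) ⊕ e ⊗ (y ⊗ y)) (β ⊗ x ⊗ y ⊝ β ⊗ h ⊗ (β ⊗ y ⊗ y))) ⟩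
        α ⊗ (x ⊗ x) ⊕ e ⊗ (y ⊗ y) ∎

-- Joint distribution of norms and products with one or two fixed vectors

module QuadraticSpaces where

  open import Data.Integer.Base using () renaming (+_ to pos)
  open import Data.Unit.Base using (tt)
  open import Data.Product.Base using (proj₁; proj₂)
  open import Relation.Binary.PropositionalEquality
  open FiniteTypes
  open FiniteFields

  -- Of the vector space only the translations z + s x are kept: all sums over V below are evaluated
  -- by averaging along lines in the direction of a fixed vector.
  record QuadraticSpace (𝔽 : OddField) : Set₁ where
    open OddField 𝔽 renaming (Carrier to A)
    infixl 6 _+[_]_
    field
      V           : Set
      {{finiteV}} : Finite V
      κ           : V → A
      b           : V → V → A
      _+[_]_      : V → A → V → V
      κ-+[]       : ∀ z s x → κ (z +[ s ] x) ≡ κ z ⊕ s ⊗ b x z ⊕ s ⊗ s ⊗ κ x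
      b-+[]       : ∀ y z s x → b y (z +[ s ] x) ≡ b y z ⊕ s ⊗ b y x
      b-sym       : ∀ x y → b x y ≡ b y x
      b-self      : ∀ x → b x x ≡ 2ᴬ ⊗ κ x
      +[]-+[]     : ∀ z s t x → (z +[ s ] x) +[ t ] x ≡ z +[ s ⊕ t ] x
      +[0]        : ∀ z x → z +[ 0ᴬ ] x ≡ z

    D : V → V → A
    D x y = b x y ⊗ b x y ⊝ 4ᴬ ⊗ (κ x ⊗ κ y)

  -- In dimension 2m + 2 with M = q^(m-1): each non-zero value is taken q^(2m+1) - ε q^m times, and
  -- zero is taken ε q^(m+1) times more. Using q^(m-1) keeps all later formulas free of division.
  record NormDistribution (N : NumberRing) (𝔽 : OddField) (space : QuadraticSpace 𝔽) : Set where
    open NumberRing N renaming (Carrier to Num)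
    open OddField 𝔽 renaming (Carrier to A)
    open QuadraticSpace space
    open Sums (NumberRing.discreteRing N)
    open Character N 𝔽 using (q)
    field
      q≢0   : q ≢ 0#
      ε M   : Num
      ∣V∣≡  : ∣ V ∣ ≡ q * q * q * q * M * M
      ∑-κ   : ∀ (ψ : A → Num) → ∑ (λ z → ψ (κ z)) ≡
              (q * q * q * M * M - ε * q * M) * ∑ ψ + ε * q * q * M * ψ 0ᴬ

  module Counting (N : NumberRing) (𝔽 : OddField) (space : QuadraticSpace 𝔽)
                  (distribution : NormDistribution N 𝔽 space) where

    open NumberRing N renaming (Carrier to Num)
    open OddField 𝔽 renaming (Carrier to A)
    open QuadraticSpace space
    open NormDistribution distribution
    open Sums (NumberRing.discreteRing N)
    open Character N 𝔽
    open ≡-Reasoning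

    ∑-+[] : ∀ (Φ : V → Num) s x → ∑ (λ z → Φ (z +[ s ] x)) ≡ ∑ Φ
    ∑-+[] Φ s x = ∑-bij Φ (_+[ s ] x) (_+[ ⊖ s ] x)
      (λ z → trans (+[]-+[] z (⊖ s) s x) (trans (cong (z +[_] x) (solveᴬ 1 (λ s → :⊖ s :⊕ s :≣ conᴬ (pos 0)) refl s)) (+[0] z x)))
      (λ z → trans (+[]-+[] z s (⊖ s) x) (trans (cong (z +[_] x) (solveᴬ 1 (λ s → s :⊕ :⊖ s :≣ conᴬ (pos 0)) refl s)) (+[0] z x)))

    -- The starting point of each line may depend on z, because the sum over s is invariant under
    -- translation. Below, o z moves z to its component orthogonal to x.
    ∑-average : ∀ (Φ : V → Num) (o : V → A) x →
                q * ∑ Φ ≡ ∑ (λ z → ∑ λ s → Φ (z +[ o z ⊕ s ] x))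
    ∑-average Φ o x = sym (begin
      ∑ (λ z → ∑ λ s → Φ (z +[ o z ⊕ s ] x))   ≡⟨ ∑-cong (λ z → ∑-translate (λ s → Φ (z +[ s ] x)) (o z)) ⟩
      ∑ (λ z → ∑ λ s → Φ (z +[ s ] x))         ≡⟨ ∑-swap _ ⟩
      ∑ (λ s → ∑ λ z → Φ (z +[ s ] x))         ≡⟨ ∑-cong (λ s → ∑-+[] Φ s x) ⟩
      ∑ (λ (s : A) → ∑ Φ)                      ≡⟨ ∑-const (∑ Φ) ⟩
      q * ∑ Φ                                  ∎)

    -- Q transforms along x in the same way as κ.
    Quadratic : (V → A) → V → Set
    Quadratic Q x = ∀ z s → Q (z +[ s ] x) ≡ Q z ⊕ s ⊗ b x z ⊕ s ⊗ s ⊗ κ x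

    module _ (x : V) (κx≢0 : κ x ≢ 0ᴬ) where
      private
        c = κ x

      1/2κ : A
      1/2κ = proj₁ (inverse (2ᴬ ⊗ c) (⊗-≢0 2≢0 κx≢0))

      2κ/2κ : 2ᴬ ⊗ c ⊗ 1/2κ ≡ 1ᴬ
      2κ/2κ = proj₂ (inverse (2ᴬ ⊗ c) (⊗-≢0 2≢0 κx≢0))

      private
        h = 1/2κ
        -c≢0 : ⊖ c ≢ 0ᴬ
        -c≢0 e = κx≢0 (trans (solveᴬ 1 (λ c → c :≣ :⊖ :⊖ c) refl c) (trans (cong ⊖_ e) (solveᴬ 0 (:⊖ conᴬ (pos 0) :≣ conᴬ (pos 0)) refl)))
        κ-+[]′ : Quadratic κ x
        κ-+[]′ z s = κ-+[] z s x

      -- The value of Q at the component of z orthogonal to x.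
      orthogonal : (V → A) → V → A
      orthogonal Q z = Q z ⊝ c ⊗ (h ⊗ b x z ⊗ (h ⊗ b x z))

      module _ (Q : V → A) (quad : Quadratic Q x) where

        private
          Q-split : ∀ z s → Q (z +[ ⊖ (h ⊗ b x z) ⊕ s ] x) ≡ orthogonal Q z ⊕ c ⊗ (s ⊗ s)
          Q-split z s = begin
            Q (z +[ ⊖ (h ⊗ b x z) ⊕ s ] x)
              ≡⟨ quad z _ ⟩
            Q z ⊕ (⊖ (h ⊗ b x z) ⊕ s) ⊗ b x z ⊕ (⊖ (h ⊗ b x z) ⊕ s) ⊗ (⊖ (h ⊗ b x z) ⊕ s) ⊗ c
              ≡⟨ (solveᴬ 5 (λ Q h t s c → Q :⊕ (:⊖ (h :⊗ t) :⊕ s) :⊗ t :⊕ (:⊖ (h :⊗ t) :⊕ s) :⊗ (:⊖ (h :⊗ t) :⊕ s) :⊗ c :≣ Q :⊝ c :⊗ (h :⊗ t :⊗ (h :⊗ t)) :⊕ c :⊗ (s :⊗ s) :⊕ (conᴬ (pos 1) :⊝ conᴬ (pos 2) :⊗ c :⊗ h) :⊗ (s :⊗ t :⊝ h :⊗ t :⊗ t)) refl (Q z) h (b x z) s c) ⟩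
            orthogonal Q z ⊕ c ⊗ (s ⊗ s) ⊕ (1ᴬ ⊝ 2ᴬ ⊗ c ⊗ h) ⊗ (s ⊗ b x z ⊝ h ⊗ b x z ⊗ b x z)
              ≡⟨ cong (λ w → orthogonal Q z ⊕ c ⊗ (s ⊗ s) ⊕ (1ᴬ ⊝ w) ⊗ (s ⊗ b x z ⊝ h ⊗ b x z ⊗ b x z)) 2κ/2κ ⟩
            orthogonal Q z ⊕ c ⊗ (s ⊗ s) ⊕ (1ᴬ ⊝ 1ᴬ) ⊗ (s ⊗ b x z ⊝ h ⊗ b x z ⊗ b x z)
              ≡⟨ (solveᴬ 2 (λ u w → u :⊕ (conᴬ (pos 1) :⊝ conᴬ (pos 1)) :⊗ w :≣ u) refl (orthogonal Q z ⊕ c ⊗ (s ⊗ s)) (s ⊗ b x z ⊝ h ⊗ b x z ⊗ b x z)) ⟩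
            orthogonal Q z ⊕ c ⊗ (s ⊗ s) ∎

          b-split : ∀ z s → b x (z +[ ⊖ (h ⊗ b x z) ⊕ s ] x) ≡ 2ᴬ ⊗ c ⊗ s
          b-split z s = begin
            b x (z +[ ⊖ (h ⊗ b x z) ⊕ s ] x)
              ≡⟨ trans (b-+[] x z _ x) (cong (λ w → b x z ⊕ (⊖ (h ⊗ b x z) ⊕ s) ⊗ w) (b-self x)) ⟩
            b x z ⊕ (⊖ (h ⊗ b x z) ⊕ s) ⊗ (2ᴬ ⊗ c)
              ≡⟨ (solveᴬ 4 (λ t h s c → t :⊕ (:⊖ (h :⊗ t) :⊕ s) :⊗ (conᴬ (pos 2) :⊗ c) :≣ (conᴬ (pos 1) :⊝ conᴬ (pos 2) :⊗ c :⊗ h) :⊗ t :⊕ conᴬ (pos 2) :⊗ c :⊗ s) refl (b x z) h s c) ⟩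
            (1ᴬ ⊝ 2ᴬ ⊗ c ⊗ h) ⊗ b x z ⊕ 2ᴬ ⊗ c ⊗ s
              ≡⟨ cong (λ w → (1ᴬ ⊝ w) ⊗ b x z ⊕ 2ᴬ ⊗ c ⊗ s) 2κ/2κ ⟩
            (1ᴬ ⊝ 1ᴬ) ⊗ b x z ⊕ 2ᴬ ⊗ c ⊗ s
              ≡⟨ (solveᴬ 2 (λ t u → (conᴬ (pos 1) :⊝ conᴬ (pos 1)) :⊗ t :⊕ u :≣ u) refl (b x z) (2ᴬ ⊗ c ⊗ s)) ⟩
            2ᴬ ⊗ c ⊗ s ∎

        -- Each z is parametrised as s x plus its component orthogonal to x, which makes its product
        -- with x equal to 2cs and adds c s² to the norm. The argument e carries along any quantity
        -- constant in the direction of x, such as the product with a vector orthogonal to x.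
        ∑-split : ∀ {E : Set} (e : V → E) → (∀ z s → e (z +[ s ] x) ≡ e z) → (φ : A → E → A → Num) →
                  q * ∑ (λ z → φ (b x z) (e z) (Q z)) ≡
                  ∑ (λ s → ∑ λ z → φ (2ᴬ ⊗ c ⊗ s) (e z) (orthogonal Q z ⊕ c ⊗ (s ⊗ s)))
        ∑-split e e-inv φ = trans (∑-average _ (λ z → ⊖ (h ⊗ b x z)) x) (trans
          (∑-cong λ z → ∑-cong λ s → trans (cong₂ (λ u v → φ u v (Q (z +[ ⊖ (h ⊗ b x z) ⊕ s ] x))) (b-split z s) (e-inv z _)) (cong (φ _ _) (Q-split z s)))
          (∑-swap _))

        -- This allows the splitting to be repeated: after removal of the component along x, the
        -- remaining form still behaves like κ along a vector orthogonal to x.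
        orthogonal-quadratic : ∀ y → b x y ≡ 0ᴬ → Quadratic Q y → Quadratic (orthogonal Q) y
        orthogonal-quadratic y x⊥y quad-y z s = begin
          Q (z +[ s ] y) ⊝ c ⊗ (h ⊗ b x (z +[ s ] y) ⊗ (h ⊗ b x (z +[ s ] y)))
            ≡⟨ cong₂ (λ u v → u ⊝ c ⊗ (h ⊗ v ⊗ (h ⊗ v))) (quad-y z s)
                 (trans (b-+[] x z s y) (trans (cong (λ w → b x z ⊕ s ⊗ w) x⊥y) (solveᴬ 2 (λ t s → t :⊕ s :⊗ conᴬ (pos 0) :≣ t) refl (b x z) s))) ⟩
          Q z ⊕ s ⊗ b y z ⊕ s ⊗ s ⊗ κ y ⊝ c ⊗ (h ⊗ b x z ⊗ (h ⊗ b x z))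
            ≡⟨ (solveᴬ 4 (λ Q u v w → Q :⊕ u :⊕ v :⊝ w :≣ Q :⊝ w :⊕ u :⊕ v) refl (Q z) (s ⊗ b y z) (s ⊗ s ⊗ κ y) (c ⊗ (h ⊗ b x z ⊗ (h ⊗ b x z)))) ⟩
          orthogonal Q z ⊕ s ⊗ b y z ⊕ s ⊗ s ⊗ κ y ∎

        -- Witt cancellation: c s² − c u² is a hyperbolic plane, which adds a uniform distribution.
        ∑-orthogonal : ∀ (ψ : A → Num) →
          q * ∑ (λ z → ψ (orthogonal Q z)) + (q - 1#) * (∣ V ∣ * ∑ ψ) ≡
          q * ∑ (λ u → ∑ λ z → ψ (Q z ⊕ ⊖ c ⊗ (u ⊗ u)))
        ∑-orthogonal ψ = sym (begin
          q * ∑ (λ u → ∑ λ z → ψ (Q z ⊕ ⊖ c ⊗ (u ⊗ u)))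
            ≡⟨ cong (q *_) (∑-swap _) ⟩
          q * ∑ (λ z → ∑ λ u → ψ (Q z ⊕ ⊖ c ⊗ (u ⊗ u)))
            ≡⟨ ∑-split (λ _ → tt) (λ _ _ → refl) (λ _ _ k → ∑ λ u → ψ (k ⊕ ⊖ c ⊗ (u ⊗ u))) ⟩
          ∑ (λ s → ∑ λ z → ∑ λ u → ψ (orthogonal Q z ⊕ c ⊗ (s ⊗ s) ⊕ ⊖ c ⊗ (u ⊗ u)))
            ≡⟨ ∑-swap _ ⟩
          ∑ (λ z → ∑ λ s → ∑ λ u → ψ (orthogonal Q z ⊕ c ⊗ (s ⊗ s) ⊕ ⊖ c ⊗ (u ⊗ u)))
            ≡⟨ ∑-cong (λ z → ∑-cong λ s → ∑-cong λ u → cong ψ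
                 (solveᴬ 4 (λ Q c s u → Q :⊕ c :⊗ (s :⊗ s) :⊕ :⊖ c :⊗ (u :⊗ u) :≣ Q :⊕ :⊖ c :⊗ (u :⊗ u :⊝ s :⊗ s)) refl (orthogonal Q z) c s u)) ⟩
          ∑ (λ z → ∑ λ s → ∑ λ u → ψ (orthogonal Q z ⊕ ⊖ c ⊗ (u ⊗ u ⊝ s ⊗ s)))
            ≡⟨ ∑-cong (λ z → ∑∑-difference (λ k → ψ (orthogonal Q z ⊕ ⊖ c ⊗ k))) ⟩
          ∑ (λ z → q * ψ (orthogonal Q z ⊕ ⊖ c ⊗ 0ᴬ) + (q - 1#) * ∑ (λ k → ψ (orthogonal Q z ⊕ ⊖ c ⊗ k)))
            ≡⟨ ∑-cong (λ z → cong₂ (λ u v → q * ψ u + (q - 1#) * v)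
                 (solveᴬ 2 (λ Q c → Q :⊕ :⊖ c :⊗ conᴬ (pos 0) :≣ Q) refl (orthogonal Q z) c) (∑-affine ψ (orthogonal Q z) -c≢0)) ⟩
          ∑ (λ z → q * ψ (orthogonal Q z) + (q - 1#) * ∑ ψ)
            ≡⟨ trans (∑-+ _ _) (cong₂ _+_ (∑-* q _) (∑-const _)) ⟩
          q * ∑ (λ z → ψ (orthogonal Q z)) + ∣ V ∣ * ((q - 1#) * ∑ ψ)
            ≡⟨ (solve 4 (λ X v q S → X :+ v :* ((q :- con (pos 1)) :* S) := X :+ (q :- con (pos 1)) :* (v :* S)) refl (q * ∑ (λ z → ψ (orthogonal Q z))) (∣ V ∣) q (∑ ψ)) ⟩
          q * ∑ (λ z → ψ (orthogonal Q z)) + (q - 1#) * (∣ V ∣ * ∑ ψ) ∎)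

      -- The complement of x is a parabolic space of dimension 2m + 1: it has q^(2m) + ε q^m χ(-c k)
      -- vectors of norm k. As the sum runs over V, each of them is counted q times.
      ∑-κ-orthogonal : ∀ (ψ : A → Num) →
        ∑ (λ z → ψ (orthogonal κ z)) ≡ q * q * q * M * M * ∑ ψ + ε * q * q * M * ∑ (λ k → χ (⊖ c ⊗ k) * ψ k)
      ∑-κ-orthogonal ψ = cancel q≢0 (begin
        q * X
          ≡⟨ (solve 3 (λ q X w → q :* X := (q :* X :+ w) :- w) refl q X ((q - 1#) * (∣ V ∣ * S))) ⟩
        (q * X + (q - 1#) * (∣ V ∣ * S)) - (q - 1#) * (∣ V ∣ * S)
          ≡⟨ cong₂ _-_ (∑-orthogonal κ κ-+[]′ ψ) (cong (λ v → (q - 1#) * (v * S)) ∣V∣≡) ⟩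
        q * ∑ (λ u → ∑ λ z → ψ (κ z ⊕ ⊖ c ⊗ (u ⊗ u))) - (q - 1#) * (q * q * q * q * M * M * S)
          ≡⟨ cong (λ w → q * w - (q - 1#) * (q * q * q * q * M * M * S)) inner ⟩
        q * (q * ((q * q * q * M * M - ε * q * M) * S) + ε * q * q * M * (S + Y)) - (q - 1#) * (q * q * q * q * M * M * S)
          ≡⟨ (solve 5 (λ q M ε S Y → q :* (q :* ((q :* q :* q :* M :* M :- ε :* q :* M) :* S) :+ ε :* q :* q :* M :* (S :+ Y)) :- (q :- con (pos 1)) :* (q :* q :* q :* q :* M :* M :* S) := q :* (q :* q :* q :* M :* M :* S :+ ε :* q :* q :* M :* Y)) refl q M ε S Y) ⟩
        q * (q * q * q * M * M * S + ε * q * q * M * Y) ∎)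
        where
        X = ∑ (λ z → ψ (orthogonal κ z))
        S = ∑ ψ
        Y = ∑ (λ k → χ (⊖ c ⊗ k) * ψ k)
        inner : ∑ (λ u → ∑ λ z → ψ (κ z ⊕ ⊖ c ⊗ (u ⊗ u))) ≡ q * ((q * q * q * M * M - ε * q * M) * S) + ε * q * q * M * (S + Y)
        inner = begin
          ∑ (λ u → ∑ λ z → ψ (κ z ⊕ ⊖ c ⊗ (u ⊗ u)))
            ≡⟨ ∑-cong (λ u → trans (∑-κ (λ k → ψ (k ⊕ ⊖ c ⊗ (u ⊗ u)))) (cong₂ (λ v w → (q * q * q * M * M - ε * q * M) * v + ε * q * q * M * ψ w)
                 (∑-translateʳ ψ (⊖ c ⊗ (u ⊗ u))) (solveᴬ 2 (λ c u → conᴬ (pos 0) :⊕ :⊖ c :⊗ (u :⊗ u) :≣ :⊖ c :⊗ (u :⊗ u) :⊕ conᴬ (pos 0)) refl c u))) ⟩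
          ∑ (λ u → (q * q * q * M * M - ε * q * M) * S + ε * q * q * M * ψ (⊖ c ⊗ (u ⊗ u) ⊕ 0ᴬ))
            ≡⟨ trans (∑-+ _ _) (cong₂ _+_ (∑-const _) (∑-* _ _)) ⟩
          q * ((q * q * q * M * M - ε * q * M) * S) + ε * q * q * M * ∑ (λ u → ψ (⊖ c ⊗ (u ⊗ u) ⊕ 0ᴬ))
            ≡⟨ cong (λ w → q * ((q * q * q * M * M - ε * q * M) * S) + ε * q * q * M * w)
                 (trans (∑-quadratic ψ 0ᴬ -c≢0) (cong (S +_) (∑-cong λ k → cong (λ w → χ w * ψ k) (solveᴬ 2 (λ c k → :⊖ c :⊗ (k :⊝ conᴬ (pos 0)) :≣ :⊖ c :⊗ k) refl c k)))) ⟩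
          q * ((q * q * q * M * M - ε * q * M) * S) + ε * q * q * M * (S + Y) ∎

      -- With a = 2cs the product of x and z, the parabolic weight is the character of a² - 4ck,
      -- which is the discriminant of the line through x and z.
      χ-D : ∀ s k → χ (⊖ c ⊗ (k ⊝ c ⊗ (s ⊗ s))) ≡ χ (2ᴬ ⊗ c ⊗ s ⊗ (2ᴬ ⊗ c ⊗ s) ⊝ 4ᴬ ⊗ (c ⊗ k))
      χ-D s k = trans (sym (χ-square-* 2≢0 _))
        (cong χ (solveᴬ 3 (λ c s k → conᴬ (pos 2) :⊗ conᴬ (pos 2) :⊗ (:⊖ c :⊗ (k :⊝ c :⊗ (s :⊗ s))) :≣ conᴬ (pos 2) :⊗ c :⊗ s :⊗ (conᴬ (pos 2) :⊗ c :⊗ s) :⊝ conᴬ (pos 4) :⊗ (c :⊗ k)) refl c s k))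

      -- The change of variables from s and the norm of the orthogonal component to the product a
      -- and the full norm k.
      ∑-twisted : ∀ (φ : A → A → Num) →
        ∑ (λ s → ∑ λ k → χ (⊖ c ⊗ k) * φ (2ᴬ ⊗ c ⊗ s) (k ⊕ c ⊗ (s ⊗ s))) ≡
        ∑ (λ a → ∑ λ k → χ (a ⊗ a ⊝ 4ᴬ ⊗ (c ⊗ k)) * φ a k)
      ∑-twisted φ = begin
        ∑ (λ s → ∑ λ k → χ (⊖ c ⊗ k) * φ (2ᴬ ⊗ c ⊗ s) (k ⊕ c ⊗ (s ⊗ s)))
          ≡⟨ ∑-cong (λ s → sym (∑-translateʳ _ (⊖ (c ⊗ (s ⊗ s))))) ⟩
        ∑ (λ s → ∑ λ k → χ (⊖ c ⊗ (k ⊝ c ⊗ (s ⊗ s))) * φ (2ᴬ ⊗ c ⊗ s) (k ⊝ c ⊗ (s ⊗ s) ⊕ c ⊗ (s ⊗ s)))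
          ≡⟨ ∑-cong (λ s → ∑-cong λ k → cong₂ _*_ (χ-D s k) (cong (φ _) (solveᴬ 2 (λ k w → k :⊝ w :⊕ w :≣ k) refl k (c ⊗ (s ⊗ s))))) ⟩
        ∑ (λ s → ∑ λ k → χ (2ᴬ ⊗ c ⊗ s ⊗ (2ᴬ ⊗ c ⊗ s) ⊝ 4ᴬ ⊗ (c ⊗ k)) * φ (2ᴬ ⊗ c ⊗ s) k)
          ≡⟨ ∑-scale (λ a → ∑ λ k → χ (a ⊗ a ⊝ 4ᴬ ⊗ (c ⊗ k)) * φ a k) (⊗-≢0 2≢0 κx≢0) ⟩
        ∑ (λ a → ∑ λ k → χ (a ⊗ a ⊝ 4ᴬ ⊗ (c ⊗ k)) * φ a k) ∎

      ∑-untwisted : ∀ (φ : A → A → Num) →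
        ∑ (λ s → ∑ λ k → φ (2ᴬ ⊗ c ⊗ s) (k ⊕ c ⊗ (s ⊗ s))) ≡ ∑ (λ a → ∑ λ k → φ a k)
      ∑-untwisted φ = trans (∑-cong λ s → ∑-translateʳ (φ (2ᴬ ⊗ c ⊗ s)) (c ⊗ (s ⊗ s)))
        (∑-scale (λ a → ∑ (φ a)) (⊗-≢0 2≢0 κx≢0))

      -- There are q^(2m) + ε q^m χ(a² - 4ck) vectors z with product a and norm k: a uniform part
      -- and a part weighted with the character of the discriminant.
      ∑-one : ∀ (φ : A → A → Num) →
        ∑ (λ z → φ (b x z) (κ z)) ≡
        q * q * M * M * ∑ (λ a → ∑ λ k → φ a k) +
        ε * q * M * ∑ (λ a → ∑ λ k → χ (a ⊗ a ⊝ 4ᴬ ⊗ (c ⊗ k)) * φ a k)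
      ∑-one φ = cancel q≢0 (begin
        q * ∑ (λ z → φ (b x z) (κ z))
          ≡⟨ ∑-split κ κ-+[]′ (λ _ → tt) (λ _ _ → refl) (λ a _ k → φ a k) ⟩
        ∑ (λ s → ∑ λ z → φ (2ᴬ ⊗ c ⊗ s) (orthogonal κ z ⊕ c ⊗ (s ⊗ s)))
          ≡⟨ ∑-cong (λ s → ∑-κ-orthogonal (λ k → φ (2ᴬ ⊗ c ⊗ s) (k ⊕ c ⊗ (s ⊗ s)))) ⟩
        ∑ (λ s → q * q * q * M * M * ∑ (λ k → φ (2ᴬ ⊗ c ⊗ s) (k ⊕ c ⊗ (s ⊗ s))) +
                 ε * q * q * M * ∑ (λ k → χ (⊖ c ⊗ k) * φ (2ᴬ ⊗ c ⊗ s) (k ⊕ c ⊗ (s ⊗ s))))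
          ≡⟨ ∑-lin (q * q * q * M * M) _ (ε * q * q * M) _ ⟩
        q * q * q * M * M * ∑ (λ s → ∑ λ k → φ (2ᴬ ⊗ c ⊗ s) (k ⊕ c ⊗ (s ⊗ s))) +
        ε * q * q * M * ∑ (λ s → ∑ λ k → χ (⊖ c ⊗ k) * φ (2ᴬ ⊗ c ⊗ s) (k ⊕ c ⊗ (s ⊗ s)))
          ≡⟨ cong₂ (λ u v → q * q * q * M * M * u + ε * q * q * M * v) (∑-untwisted φ) (∑-twisted φ) ⟩
        q * q * q * M * M * U + ε * q * q * M * W
          ≡⟨ (solve 5 (λ q M ε U W → q :* q :* q :* M :* M :* U :+ ε :* q :* q :* M :* W := q :* (q :* q :* M :* M :* U :+ ε :* q :* M :* W)) refl q M ε U W) ⟩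
        q * (q * q * M * M * U + ε * q * M * W) ∎)
        where
        U = ∑ (λ a → ∑ λ k → φ a k)
        W = ∑ (λ a → ∑ λ k → χ (a ⊗ a ⊝ 4ᴬ ⊗ (c ⊗ k)) * φ a k)

      module _ (y : V) where

        slope : A
        slope = h ⊗ b x y

        -- The component of y orthogonal to x.
        y⊥ : V
        y⊥ = y +[ ⊖ slope ] x

        private
          t = b x y

        2κ-slope : 2ᴬ ⊗ c ⊗ slope ≡ t
        2κ-slope = trans (solveᴬ 3 (λ c h t → conᴬ (pos 2) :⊗ c :⊗ (h :⊗ t) :≣ conᴬ (pos 2) :⊗ c :⊗ h :⊗ t) refl c h t)
          (trans (cong (_⊗ t) 2κ/2κ) (solveᴬ 1 (λ t → conᴬ (pos 1) :⊗ t :≣ t) refl t))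

        x⊥y⊥ : b x y⊥ ≡ 0ᴬ
        x⊥y⊥ = begin
          b x y⊥                                ≡⟨ trans (b-+[] x y (⊖ slope) x) (cong (λ w → t ⊕ ⊖ slope ⊗ w) (b-self x)) ⟩
          t ⊕ ⊖ slope ⊗ (2ᴬ ⊗ c)                ≡⟨ (solveᴬ 3 (λ t s c → t :⊕ :⊖ s :⊗ (conᴬ (pos 2) :⊗ c) :≣ t :⊝ conᴬ (pos 2) :⊗ c :⊗ s) refl t (slope) c) ⟩
          t ⊝ 2ᴬ ⊗ c ⊗ slope                    ≡⟨ cong (t ⊝_) 2κ-slope ⟩
          t ⊝ t                                 ≡⟨ (solveᴬ 1 (λ t → t :⊝ t :≣ conᴬ (pos 0)) refl t) ⟩
          0ᴬ                                    ∎

        b-y : ∀ z → b y⊥ z ⊕ slope ⊗ b x z ≡ b y z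
        b-y z = begin
          b y⊥ z ⊕ slope ⊗ b x z                          ≡⟨ cong (_⊕ slope ⊗ b x z) (trans (b-sym y⊥ z) (b-+[] z y (⊖ slope) x)) ⟩
          b z y ⊕ ⊖ slope ⊗ b z x ⊕ slope ⊗ b x z         ≡⟨ cong₂ (λ v w → v ⊕ ⊖ slope ⊗ w ⊕ slope ⊗ b x z) (b-sym z y) (b-sym z x) ⟩
          b y z ⊕ ⊖ slope ⊗ b x z ⊕ slope ⊗ b x z         ≡⟨ (solveᴬ 3 (λ v s w → v :⊕ :⊖ s :⊗ w :⊕ s :⊗ w :≣ v) refl (b y z) (slope) (b x z)) ⟩
          b y z                                           ∎

        -- The base x, y⊥ of the line is orthogonal and arises from x, y by a change of determinant
        -- one, so the discriminant becomes -4 κ(x) κ(y⊥).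
        D≡ : D x y ≡ 2ᴬ ⊗ 2ᴬ ⊗ ⊖ (c ⊗ κ y⊥)
        D≡ = sym (begin
          2ᴬ ⊗ 2ᴬ ⊗ ⊖ (c ⊗ κ y⊥)
            ≡⟨ cong (λ w → 2ᴬ ⊗ 2ᴬ ⊗ ⊖ (c ⊗ w)) (κ-+[] y (⊖ slope) x) ⟩
          2ᴬ ⊗ 2ᴬ ⊗ ⊖ (c ⊗ (κ y ⊕ ⊖ slope ⊗ t ⊕ ⊖ slope ⊗ ⊖ slope ⊗ c))
            ≡⟨ (solveᴬ 4 (λ c s t k → conᴬ (pos 2) :⊗ conᴬ (pos 2) :⊗ :⊖ (c :⊗ (k :⊕ :⊖ s :⊗ t :⊕ :⊖ s :⊗ :⊖ s :⊗ c)) :≣ conᴬ (pos 2) :⊗ (conᴬ (pos 2) :⊗ c :⊗ s) :⊗ t :⊝ conᴬ (pos 2) :⊗ c :⊗ s :⊗ (conᴬ (pos 2) :⊗ c :⊗ s) :⊝ conᴬ (pos 4) :⊗ (c :⊗ k)) refl c (slope) t (κ y)) ⟩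
          2ᴬ ⊗ (2ᴬ ⊗ c ⊗ slope) ⊗ t ⊝ 2ᴬ ⊗ c ⊗ slope ⊗ (2ᴬ ⊗ c ⊗ slope) ⊝ 4ᴬ ⊗ (c ⊗ κ y)
            ≡⟨ cong (λ w → 2ᴬ ⊗ w ⊗ t ⊝ w ⊗ w ⊝ 4ᴬ ⊗ (c ⊗ κ y)) 2κ-slope ⟩
          2ᴬ ⊗ t ⊗ t ⊝ t ⊗ t ⊝ 4ᴬ ⊗ (c ⊗ κ y)
            ≡⟨ (solveᴬ 2 (λ t u → conᴬ (pos 2) :⊗ t :⊗ t :⊝ t :⊗ t :⊝ u :≣ t :⊗ t :⊝ u) refl t (4ᴬ ⊗ (c ⊗ κ y))) ⟩
          D x y ∎)

        χD≡ : χ (D x y) ≡ χ (⊖ (c ⊗ κ y⊥))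
        χD≡ = trans (cong χ D≡) (χ-square-* 2≢0 _)

    module _ (x : V) (κx≢0 : κ x ≢ 0ᴬ) (y : V) where

      private
        c = κ x
        t = b x y
        ℓ = slope x κx≢0 y
        y′ = y⊥ x κx≢0 y
        c′ = κ y′
        Q₁ = orthogonal x κx≢0 κ

        Q₁-quadratic : Quadratic Q₁ y′
        Q₁-quadratic = orthogonal-quadratic x κx≢0 κ (λ z s → κ-+[] z s x) y′ (x⊥y⊥ x κx≢0 y) (λ z s → κ-+[] z s y′)

        ∑-κ-split : ∀ (φ : A → A → A → Num) →
          q * ∑ (λ z → φ (b x z) (b y′ z) (κ z)) ≡
          ∑ (λ s → ∑ λ z → φ (2ᴬ ⊗ c ⊗ s) (b y′ z) (Q₁ z ⊕ c ⊗ (s ⊗ s)))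
        ∑-κ-split = ∑-split x κx≢0 κ (λ z s → κ-+[] z s x) (b y′)
          λ z s → trans (b-+[] y′ z s x) (trans (cong (λ w → b y′ z ⊕ s ⊗ w) (trans (b-sym y′ x) (x⊥y⊥ x κx≢0 y)))
                    (solveᴬ 2 (λ u s → u :⊕ s :⊗ conᴬ (pos 0) :≣ u) refl (b y′ z) s))

        -- Products with y and with y⊥ differ by ℓ times the product with x. This shear leaves the
        -- uniform part of the distribution unchanged.
        shear : ∀ (φ : A → A → A → Num) →
          ∑ (λ a → ∑ λ d → ∑ λ k → φ a (d ⊕ ℓ ⊗ a) k) ≡ ∑ (λ a → ∑ λ d → ∑ λ k → φ a d k)
        shear φ = ∑-cong λ a → ∑-translateʳ (λ d → ∑ λ k → φ a d k) (ℓ ⊗ a)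

      module _ (D≢0 : D x y ≢ 0ᴬ) where

        private
          η = χ (D x y)

          -cc′≢0 : ⊖ (c ⊗ c′) ≢ 0ᴬ
          -cc′≢0 e = D≢0 (trans (D≡ x κx≢0 y) (trans (cong (2ᴬ ⊗ 2ᴬ ⊗_) e) (solveᴬ 0 (conᴬ (pos 2) :⊗ conᴬ (pos 2) :⊗ conᴬ (pos 0) :≣ conᴬ (pos 0)) refl)))

          c′≢0 : c′ ≢ 0ᴬ
          c′≢0 e = -cc′≢0 (trans (cong (λ w → ⊖ (c ⊗ w)) e) (solveᴬ 1 (λ c → :⊖ (c :⊗ conᴬ (pos 0)) :≣ conᴬ (pos 0)) refl c))

          -c≢0 : ⊖ c ≢ 0ᴬ
          -c≢0 e = κx≢0 (trans (solveᴬ 1 (λ c → c :≣ :⊖ :⊖ c) refl c) (trans (cong ⊖_ e) (solveᴬ 0 (:⊖ conᴬ (pos 0) :≣ conᴬ (pos 0)) refl)))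

          Q₂ = orthogonal y′ c′≢0 Q₁

          -- The complement of the plane of x and y has even dimension 2m and sign ε η, since η is 1
          -- for a hyperbolic and -1 for an anisotropic plane. Each of its vectors is counted q²
          -- times.
          ∑-Q₂ : ∀ (ψ : A → Num) →
            ∑ (λ z → ψ (Q₂ z)) ≡ (q * q * q * M * M - ε * η * q * q * M) * ∑ ψ + ε * η * q * q * q * M * ψ 0ᴬ
          ∑-Q₂ ψ = cancel q≢0 (begin
            q * X
              ≡⟨ (solve 3 (λ q X w → q :* X := (q :* X :+ w) :- w) refl q X ((q - 1#) * (∣ V ∣ * S))) ⟩
            (q * X + (q - 1#) * (∣ V ∣ * S)) - (q - 1#) * (∣ V ∣ * S)
              ≡⟨ cong₂ _-_ (∑-orthogonal y′ c′≢0 Q₁ Q₁-quadratic ψ) (cong (λ v → (q - 1#) * (v * S)) ∣V∣≡) ⟩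
            q * ∑ (λ u → ∑ λ z → ψ (Q₁ z ⊕ ⊖ c′ ⊗ (u ⊗ u))) - (q - 1#) * (q * q * q * q * M * M * S)
              ≡⟨ cong (λ w → q * w - (q - 1#) * (q * q * q * q * M * M * S)) inner ⟩
            q * (q * q * q * M * M * (q * S) + ε * q * q * M * (η * q * ψ 0ᴬ + - η * S)) - (q - 1#) * (q * q * q * q * M * M * S)
              ≡⟨ (solve 6 (λ q M ε h S o → q :* (q :* q :* q :* M :* M :* (q :* S) :+ ε :* q :* q :* M :* (h :* q :* o :+ :- h :* S)) :- (q :- con (pos 1)) :* (q :* q :* q :* q :* M :* M :* S) := q :* ((q :* q :* q :* M :* M :- ε :* h :* q :* q :* M) :* S :+ ε :* h :* q :* q :* q :* M :* o)) refl q M ε (η) S (ψ 0ᴬ)) ⟩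
            q * ((q * q * q * M * M - ε * η * q * q * M) * S + ε * η * q * q * q * M * ψ 0ᴬ) ∎)
            where
            X = ∑ (λ z → ψ (Q₂ z))
            S = ∑ ψ
            -- Shifting k makes the argument of χ a quadratic polynomial in u with leading
            -- coefficient -c c′, so the sum over u can be evaluated first.
            twisted : ∑ (λ u → ∑ λ k → χ (⊖ c ⊗ k) * ψ (k ⊕ ⊖ c′ ⊗ (u ⊗ u))) ≡ η * q * ψ 0ᴬ + - η * S
            twisted = begin
              ∑ (λ u → ∑ λ k → χ (⊖ c ⊗ k) * ψ (k ⊕ ⊖ c′ ⊗ (u ⊗ u)))
                ≡⟨ ∑-cong (λ u → sym (∑-translateʳ _ (c′ ⊗ (u ⊗ u)))) ⟩
              ∑ (λ u → ∑ λ k → χ (⊖ c ⊗ (k ⊕ c′ ⊗ (u ⊗ u))) * ψ (k ⊕ c′ ⊗ (u ⊗ u) ⊕ ⊖ c′ ⊗ (u ⊗ u)))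
                ≡⟨ ∑-cong (λ u → ∑-cong λ k → cong₂ (λ v w → χ v * ψ w)
                     (solveᴬ 4 (λ c d k u → :⊖ c :⊗ (k :⊕ d :⊗ (u :⊗ u)) :≣ :⊖ (c :⊗ d) :⊗ (u :⊗ u) :⊕ :⊖ c :⊗ k) refl c (c′) k u)
                     (solveᴬ 3 (λ d k u → k :⊕ d :⊗ (u :⊗ u) :⊕ :⊖ d :⊗ (u :⊗ u) :≣ k) refl (c′) k u)) ⟩
              ∑ (λ u → ∑ λ k → χ (⊖ (c ⊗ c′) ⊗ (u ⊗ u) ⊕ ⊖ c ⊗ k) * ψ k)
                ≡⟨ ∑-swap _ ⟩
              ∑ (λ k → ∑ λ u → χ (⊖ (c ⊗ c′) ⊗ (u ⊗ u) ⊕ ⊖ c ⊗ k) * ψ k)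
                ≡⟨ ∑-cong (λ k → trans (∑-*ʳ _ (ψ k)) (cong (_* ψ k) (trans (∑χ-quadratic (⊖ c ⊗ k) -cc′≢0)
                     (cong₂ (λ v w → v * (q * w - 1#)) (sym (χD≡ x κx≢0 y)) (δ-scale -c≢0 k))))) ⟩
              ∑ (λ k → η * (q * δ k 0ᴬ - 1#) * ψ k)
                ≡⟨ ∑-cong (λ k → (solve 4 (λ q h d p → h :* (q :* d :- con (pos 1)) :* p := h :* q :* (d :* p) :+ :- h :* p) refl q (η) (δ k 0ᴬ) (ψ k))) ⟩
              ∑ (λ k → η * q * (δ k 0ᴬ * ψ k) + - η * ψ k)
                ≡⟨ trans (∑-lin (η * q) (λ k → δ k 0ᴬ * ψ k) (- η) ψ) (cong (λ w → η * q * w + - η * S) (∑-δ ψ 0ᴬ)) ⟩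
              η * q * ψ 0ᴬ + - η * S ∎
            inner : ∑ (λ u → ∑ λ z → ψ (Q₁ z ⊕ ⊖ c′ ⊗ (u ⊗ u))) ≡
                    q * q * q * M * M * (q * S) + ε * q * q * M * (η * q * ψ 0ᴬ + - η * S)
            inner = begin
              ∑ (λ u → ∑ λ z → ψ (Q₁ z ⊕ ⊖ c′ ⊗ (u ⊗ u)))
                ≡⟨ ∑-cong (λ u → trans (∑-κ-orthogonal x κx≢0 (λ k → ψ (k ⊕ ⊖ c′ ⊗ (u ⊗ u))))
                     (cong (λ w → q * q * q * M * M * w + ε * q * q * M * ∑ (λ k → χ (⊖ c ⊗ k) * ψ (k ⊕ ⊖ c′ ⊗ (u ⊗ u))))
                       (∑-translateʳ ψ (⊖ c′ ⊗ (u ⊗ u))))) ⟩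
              ∑ (λ u → q * q * q * M * M * S + ε * q * q * M * ∑ (λ k → χ (⊖ c ⊗ k) * ψ (k ⊕ ⊖ c′ ⊗ (u ⊗ u))))
                ≡⟨ ∑-lin (q * q * q * M * M) (λ _ → S) (ε * q * q * M) _ ⟩
              q * q * q * M * M * ∑ (λ (u : A) → S) + ε * q * q * M * ∑ (λ u → ∑ λ k → χ (⊖ c ⊗ k) * ψ (k ⊕ ⊖ c′ ⊗ (u ⊗ u)))
                ≡⟨ cong₂ (λ v w → q * q * q * M * M * v + ε * q * q * M * w) (∑-const S) twisted ⟩
              q * q * q * M * M * (q * S) + ε * q * q * M * (η * q * ψ 0ᴬ + - η * S) ∎

          -- The excess that the distribution of `Q₂` has at zero produces the second sum: its
          -- arguments are the products and the norm of the vector s x + r y⊥ itself.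
          ∑-two⊥ : ∀ (φ : A → A → A → Num) →
            ∑ (λ z → φ (b x z) (b y′ z) (κ z)) ≡
            (q * M * M - ε * η * M) * ∑ (λ a → ∑ λ d → ∑ λ k → φ a d k) +
            ε * η * q * M * ∑ (λ s → ∑ λ r → φ (2ᴬ ⊗ c ⊗ s) (2ᴬ ⊗ c′ ⊗ r) (c′ ⊗ (r ⊗ r) ⊕ c ⊗ (s ⊗ s)))
          ∑-two⊥ φ = cancel q≢0 (cancel q≢0 (begin
            q * (q * ∑ (λ z → φ (b x z) (b y′ z) (κ z)))
              ≡⟨ cong (q *_) (∑-κ-split φ) ⟩
            q * ∑ (λ s → ∑ λ z → φ (2ᴬ ⊗ c ⊗ s) (b y′ z) (Q₁ z ⊕ c ⊗ (s ⊗ s)))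
              ≡⟨ trans (sym (∑-* q _)) (∑-cong λ s → ∑-split y′ c′≢0 Q₁ Q₁-quadratic (λ _ → tt) (λ _ _ → refl)
                   (λ d _ k → φ (2ᴬ ⊗ c ⊗ s) d (k ⊕ c ⊗ (s ⊗ s)))) ⟩
            ∑ (λ s → ∑ λ r → ∑ λ z → Φ s r (Q₂ z ⊕ c′ ⊗ (r ⊗ r) ⊕ c ⊗ (s ⊗ s)))
              ≡⟨ ∑-cong (λ s → ∑-cong λ r → trans (∑-Q₂ (λ k → Φ s r (k ⊕ c′ ⊗ (r ⊗ r) ⊕ c ⊗ (s ⊗ s))))
                   (cong₂ (λ v w → A₂ * v + B₂ * Φ s r w)
                     (trans (∑-translateʳ (λ k → Φ s r (k ⊕ c ⊗ (s ⊗ s))) (c′ ⊗ (r ⊗ r))) (∑-translateʳ (Φ s r) (c ⊗ (s ⊗ s))))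
                     (solveᴬ 2 (λ u v → conᴬ (pos 0) :⊕ u :⊕ v :≣ u :⊕ v) refl (c′ ⊗ (r ⊗ r)) (c ⊗ (s ⊗ s))))) ⟩
            ∑ (λ s → ∑ λ r → A₂ * ∑ (Φ s r) + B₂ * Φ s r (c′ ⊗ (r ⊗ r) ⊕ c ⊗ (s ⊗ s)))
              ≡⟨ trans (∑-cong λ s → ∑-lin A₂ _ B₂ _) (∑-lin A₂ _ B₂ _) ⟩
            A₂ * ∑ (λ s → ∑ λ r → ∑ (Φ s r)) + B₂ * W
              ≡⟨ cong (λ v → A₂ * v + B₂ * W) (trans
                   (∑-cong λ s → ∑-scale (λ d → ∑ λ k → φ (2ᴬ ⊗ c ⊗ s) d k) (⊗-≢0 2≢0 c′≢0))
                   (∑-scale (λ a → ∑ λ d → ∑ λ k → φ a d k) (⊗-≢0 2≢0 κx≢0))) ⟩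
            A₂ * U + B₂ * W
              ≡⟨ (solve 6 (λ q M ε h U W → (q :* q :* q :* M :* M :- ε :* h :* q :* q :* M) :* U :+ ε :* h :* q :* q :* q :* M :* W := q :* (q :* ((q :* M :* M :- ε :* h :* M) :* U :+ ε :* h :* q :* M :* W))) refl q M ε (η) U W) ⟩
            q * (q * ((q * M * M - ε * η * M) * U + ε * η * q * M * W)) ∎))
            where
            Φ : A → A → A → Num
            Φ s r = φ (2ᴬ ⊗ c ⊗ s) (2ᴬ ⊗ c′ ⊗ r)
            A₂ = q * q * q * M * M - ε * η * q * q * M
            B₂ = ε * η * q * q * q * M
            U = ∑ (λ a → ∑ λ d → ∑ λ k → φ a d k)
            W = ∑ (λ s → ∑ λ r → Φ s r (c′ ⊗ (r ⊗ r) ⊕ c ⊗ (s ⊗ s)))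

        -- The second sum runs over the points s x + r y of the plane spanned by x and y.
        ∑-two : ∀ (φ : A → A → A → Num) →
          ∑ (λ z → φ (b x z) (b y z) (κ z)) ≡
          (q * M * M - ε * η * M) * ∑ (λ a → ∑ λ d → ∑ λ k → φ a d k) +
          ε * η * q * M * ∑ (λ r → ∑ λ s →
            φ (2ᴬ ⊗ c ⊗ s ⊕ t ⊗ r) (t ⊗ s ⊕ 2ᴬ ⊗ κ y ⊗ r) (c ⊗ (s ⊗ s) ⊕ t ⊗ (s ⊗ r) ⊕ κ y ⊗ (r ⊗ r)))
        ∑-two φ = begin
          ∑ (λ z → φ (b x z) (b y z) (κ z))
            ≡⟨ ∑-cong (λ z → cong (λ w → φ (b x z) w (κ z)) (sym (b-y x κx≢0 y z))) ⟩
          ∑ (λ z → φ (b x z) (b y′ z ⊕ ℓ ⊗ b x z) (κ z))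
            ≡⟨ ∑-two⊥ (λ a d k → φ a (d ⊕ ℓ ⊗ a) k) ⟩
          (q * M * M - ε * η * M) * ∑ (λ a → ∑ λ d → ∑ λ k → φ a (d ⊕ ℓ ⊗ a) k) +
          ε * η * q * M * ∑ (λ s → ∑ λ r → φ (2ᴬ ⊗ c ⊗ s) (2ᴬ ⊗ c′ ⊗ r ⊕ ℓ ⊗ (2ᴬ ⊗ c ⊗ s)) (c′ ⊗ (r ⊗ r) ⊕ c ⊗ (s ⊗ s)))
            ≡⟨ cong₂ (λ v w → (q * M * M - ε * η * M) * v + ε * η * q * M * w) (shear φ) plane ⟩
          (q * M * M - ε * η * M) * ∑ (λ a → ∑ λ d → ∑ λ k → φ a d k) +
          ε * η * q * M * ∑ (λ r → ∑ λ s →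
            φ (2ᴬ ⊗ c ⊗ s ⊕ t ⊗ r) (t ⊗ s ⊕ 2ᴬ ⊗ κ y ⊗ r) (c ⊗ (s ⊗ s) ⊕ t ⊗ (s ⊗ r) ⊕ κ y ⊗ (r ⊗ r))) ∎
          where
          2cℓ≡t : 2ᴬ ⊗ c ⊗ ℓ ≡ t
          2cℓ≡t = 2κ-slope x κx≢0 y
          c′≡ : c′ ≡ κ y ⊕ ⊖ ℓ ⊗ (2ᴬ ⊗ c ⊗ ℓ) ⊕ ⊖ ℓ ⊗ ⊖ ℓ ⊗ c
          c′≡ = trans (κ-+[] y (⊖ ℓ) x) (cong (λ w → κ y ⊕ ⊖ ℓ ⊗ w ⊕ ⊖ ℓ ⊗ ⊖ ℓ ⊗ c) (sym 2cℓ≡t))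
          plane : ∑ (λ s → ∑ λ r → φ (2ᴬ ⊗ c ⊗ s) (2ᴬ ⊗ c′ ⊗ r ⊕ ℓ ⊗ (2ᴬ ⊗ c ⊗ s)) (c′ ⊗ (r ⊗ r) ⊕ c ⊗ (s ⊗ s))) ≡
                  ∑ (λ r → ∑ λ s → φ (2ᴬ ⊗ c ⊗ s ⊕ t ⊗ r) (t ⊗ s ⊕ 2ᴬ ⊗ κ y ⊗ r) (c ⊗ (s ⊗ s) ⊕ t ⊗ (s ⊗ r) ⊕ κ y ⊗ (r ⊗ r)))
          plane = trans (∑-swap _) (∑-cong λ r → trans (sym (∑-translateʳ _ (ℓ ⊗ r))) (∑-cong λ s → point r s c′≡ 2cℓ≡t))
            where
            -- c′ and t are generalised to d and u together with the equations that determine them,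
            -- so that matching on `refl` leaves polynomial identities in c, ℓ, κ y, r and s.
            point : ∀ r s {d u} → d ≡ κ y ⊕ ⊖ ℓ ⊗ (2ᴬ ⊗ c ⊗ ℓ) ⊕ ⊖ ℓ ⊗ ⊖ ℓ ⊗ c → 2ᴬ ⊗ c ⊗ ℓ ≡ u →
              φ (2ᴬ ⊗ c ⊗ (s ⊕ ℓ ⊗ r)) (2ᴬ ⊗ d ⊗ r ⊕ ℓ ⊗ (2ᴬ ⊗ c ⊗ (s ⊕ ℓ ⊗ r))) (d ⊗ (r ⊗ r) ⊕ c ⊗ ((s ⊕ ℓ ⊗ r) ⊗ (s ⊕ ℓ ⊗ r))) ≡
              φ (2ᴬ ⊗ c ⊗ s ⊕ u ⊗ r) (u ⊗ s ⊕ 2ᴬ ⊗ κ y ⊗ r) (c ⊗ (s ⊗ s) ⊕ u ⊗ (s ⊗ r) ⊕ κ y ⊗ (r ⊗ r))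
            point r s refl refl = cong₂ (λ f w → f w) (cong₂ φ
              (solveᴬ 4 (λ c s l r → conᴬ (pos 2) :⊗ c :⊗ (s :⊕ l :⊗ r) :≣ conᴬ (pos 2) :⊗ c :⊗ s :⊕ conᴬ (pos 2) :⊗ c :⊗ l :⊗ r) refl c s (ℓ) r)
              (solveᴬ 5 (λ c s l r k → conᴬ (pos 2) :⊗ (k :⊕ :⊖ l :⊗ (conᴬ (pos 2) :⊗ c :⊗ l) :⊕ :⊖ l :⊗ :⊖ l :⊗ c) :⊗ r :⊕ l :⊗ (conᴬ (pos 2) :⊗ c :⊗ (s :⊕ l :⊗ r)) :≣ conᴬ (pos 2) :⊗ c :⊗ l :⊗ s :⊕ conᴬ (pos 2) :⊗ k :⊗ r) refl c s (ℓ) r (κ y)))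
              (solveᴬ 5 (λ c s l r k → (k :⊕ :⊖ l :⊗ (conᴬ (pos 2) :⊗ c :⊗ l) :⊕ :⊖ l :⊗ :⊖ l :⊗ c) :⊗ (r :⊗ r) :⊕ c :⊗ ((s :⊕ l :⊗ r) :⊗ (s :⊕ l :⊗ r)) :≣ c :⊗ (s :⊗ s) :⊕ conᴬ (pos 2) :⊗ c :⊗ l :⊗ (s :⊗ r) :⊕ k :⊗ (r :⊗ r)) refl c s (ℓ) r (κ y))

      -- On a tangent line y′ spans the radical.
      module _ (D≡0 : D x y ≡ 0ᴬ) (w : V) (y′≁w : b y′ w ≢ 0ᴬ) where

        private
          c′≡0 : c′ ≡ 0ᴬ
          c′≡0 = cancel-⊗ (⊗-≢0 4≢0 κx≢0) (trans (solveᴬ 2 (λ c d → conᴬ (pos 4) :⊗ c :⊗ d :≣ :⊖ (conᴬ (pos 2) :⊗ conᴬ (pos 2) :⊗ :⊖ (c :⊗ d))) refl c (c′))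
            (trans (cong ⊖_ (trans (sym (D≡ x κx≢0 y)) D≡0)) (solveᴬ 0 (:⊖ conᴬ (pos 0) :≣ conᴬ (pos 0)) refl)))

          -- As w is not orthogonal to y′, the product with y′ runs through the field on each line
          -- in direction w, hence is uniformly distributed on V.
          ∑-b : ∀ (θ : A → Num) → q * ∑ (λ z → θ (b y′ z)) ≡ ∣ V ∣ * ∑ θ
          ∑-b θ = begin
            q * ∑ (λ z → θ (b y′ z))                        ≡⟨ ∑-average (λ z → θ (b y′ z)) (λ _ → 0ᴬ) w ⟩
            ∑ (λ z → ∑ λ s → θ (b y′ (z +[ 0ᴬ ⊕ s ] w)))    ≡⟨ ∑-cong (λ z → ∑-cong λ s → cong θ (trans (b-+[] y′ z (0ᴬ ⊕ s) w)
                                                                 (solveᴬ 3 (λ u s v → u :⊕ (conᴬ (pos 0) :⊕ s) :⊗ v :≣ u :⊕ v :⊗ s) refl (b y′ z) s (b y′ w)))) ⟩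
            ∑ (λ z → ∑ λ s → θ (b y′ z ⊕ b y′ w ⊗ s))       ≡⟨ ∑-cong (λ z → ∑-affine θ (b y′ z) y′≁w) ⟩
            ∑ (λ (z : V) → ∑ θ)                             ≡⟨ ∑-const (∑ θ) ⟩
            ∣ V ∣ * ∑ θ                                     ∎

          -- Along y′ the form `Q₁` is linear with slope b y′ z. Where this slope is non-zero the
          -- values are uniform; where it is zero they are constant and have to be kept as a
          -- separate sum.
          ∑-radical : ∀ (θ : A → A → Num) →
            q * (q * ∑ (λ z → θ (b y′ z) (Q₁ z))) ≡
            ∣ V ∣ * (∑ (λ d → ∑ (θ d)) - ∑ (θ 0ᴬ)) + q * (q * ∑ (λ z → δ (b y′ z) 0ᴬ * θ 0ᴬ (Q₁ z)))
          ∑-radical θ = begin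
            q * (q * ∑ (λ z → θ (b y′ z) (Q₁ z)))
              ≡⟨ cong (q *_) (∑-average _ (λ _ → 0ᴬ) y′) ⟩
            q * ∑ (λ z → ∑ λ s → θ (b y′ (z +[ 0ᴬ ⊕ s ] y′)) (Q₁ (z +[ 0ᴬ ⊕ s ] y′)))
              ≡⟨ cong (q *_) (∑-cong λ z → trans (∑-cong λ s → cong₂ θ (b-inv z s) (Q-inv z s)) (∑-line θ (b y′ z) (Q₁ z))) ⟩
            q * ∑ (λ z → (Θ (b y′ z) - δ (b y′ z) 0ᴬ * Θ 0ᴬ) + q * (δ (b y′ z) 0ᴬ * θ 0ᴬ (Q₁ z)))
              ≡⟨ cong (q *_) (trans (∑-+ _ _) (cong (∑ (λ z → Θ (b y′ z) - δ (b y′ z) 0ᴬ * Θ 0ᴬ) +_) (∑-* q _))) ⟩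
            q * (∑ (λ z → Θ (b y′ z) - δ (b y′ z) 0ᴬ * Θ 0ᴬ) + q * Y)
              ≡⟨ distribˡ q _ _ ⟩
            q * ∑ (λ z → Θ (b y′ z) - δ (b y′ z) 0ᴬ * Θ 0ᴬ) + q * (q * Y)
              ≡⟨ cong (_+ q * (q * Y)) (trans (∑-b (λ d → Θ d - δ d 0ᴬ * Θ 0ᴬ)) (cong (∣ V ∣ *_)
                   (trans (∑-- Θ _) (cong (λ u → ∑ Θ - u) (∑-δ (λ _ → Θ 0ᴬ) 0ᴬ))))) ⟩
            ∣ V ∣ * (∑ Θ - Θ 0ᴬ) + q * (q * Y) ∎
            where
            Θ : A → Num
            Θ d = ∑ (θ d)
            Y = ∑ (λ z → δ (b y′ z) 0ᴬ * θ 0ᴬ (Q₁ z))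
            b-inv : ∀ z s → b y′ (z +[ 0ᴬ ⊕ s ] y′) ≡ b y′ z
            b-inv z s = trans (b-+[] y′ z (0ᴬ ⊕ s) y′)
              (trans (cong (λ v → b y′ z ⊕ (0ᴬ ⊕ s) ⊗ v) (trans (b-self y′) (cong (2ᴬ ⊗_) c′≡0)))
                (solveᴬ 2 (λ u s → u :⊕ (conᴬ (pos 0) :⊕ s) :⊗ (conᴬ (pos 2) :⊗ conᴬ (pos 0)) :≣ u) refl (b y′ z) s))
            Q-inv : ∀ z s → Q₁ (z +[ 0ᴬ ⊕ s ] y′) ≡ Q₁ z ⊕ b y′ z ⊗ s
            Q-inv z s = trans (Q₁-quadratic z (0ᴬ ⊕ s))
              (trans (cong (λ v → Q₁ z ⊕ (0ᴬ ⊕ s) ⊗ b y′ z ⊕ (0ᴬ ⊕ s) ⊗ (0ᴬ ⊕ s) ⊗ v) c′≡0)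
                (solveᴬ 3 (λ u s Q → Q :⊕ (conᴬ (pos 0) :⊕ s) :⊗ u :⊕ (conᴬ (pos 0) :⊕ s) :⊗ (conᴬ (pos 0) :⊕ s) :⊗ conᴬ (pos 0) :≣ Q :⊕ u :⊗ s) refl (b y′ z) s (Q₁ z)))

          -- Only vectors orthogonal to the radical deviate from uniformity, and they do so with the
          -- parabolic weight of the complement of x.
          ∑-tangent⊥ : ∀ (θ : A → A → Num) →
            ∑ (λ z → θ (b y′ z) (Q₁ z)) ≡
            q * q * M * M * ∑ (λ d → ∑ (θ d)) + ε * q * q * M * ∑ (λ k → χ (⊖ c ⊗ k) * θ 0ᴬ k)
          ∑-tangent⊥ θ = cancel q≢0 (cancel q≢0 (begin
            q * (q * ∑ (λ z → θ (b y′ z) (Q₁ z)))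
              ≡⟨ ∑-radical θ ⟩
            ∣ V ∣ * (∑ (λ d → ∑ (θ d)) - S) + q * (q * Y)
              ≡⟨ cong (λ u → ∣ V ∣ * (∑ (λ d → ∑ (θ d)) - S) + u) q²Y ⟩
            ∣ V ∣ * (∑ (λ d → ∑ (θ d)) - S) + (q * (q * (q * q * q * M * M * S + ε * q * q * M * X)) - ∣ V ∣ * (q * S - S))
              ≡⟨ cong (λ v → v * (∑ (λ d → ∑ (θ d)) - S) + (q * (q * (q * q * q * M * M * S + ε * q * q * M * X)) - v * (q * S - S))) ∣V∣≡ ⟩
            q * q * q * q * M * M * (U - S) + (q * (q * (q * q * q * M * M * S + ε * q * q * M * X)) - q * q * q * q * M * M * (q * S - S))
              ≡⟨ (solve 6 (λ q M ε U S X → q :* q :* q :* q :* M :* M :* (U :- S) :+ (q :* (q :* (q :* q :* q :* M :* M :* S :+ ε :* q :* q :* M :* X)) :- q :* q :* q :* q :* M :* M :* (q :* S :- S)) := q :* (q :* (q :* q :* M :* M :* U :+ ε :* q :* q :* M :* X))) refl q M ε U S X) ⟩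
            q * (q * (q * q * M * M * U + ε * q * q * M * X)) ∎))
            where
            U = ∑ (λ d → ∑ (θ d))
            S = ∑ (θ 0ᴬ)
            X = ∑ (λ k → χ (⊖ c ⊗ k) * θ 0ᴬ k)
            Y = ∑ (λ z → δ (b y′ z) 0ᴬ * θ 0ᴬ (Q₁ z))
            -- The restricted sum Y is obtained by reading `∑-radical` backwards for the function
            -- that ignores d, whose full sum is known from `∑-κ-orthogonal`.
            q²Y : q * (q * Y) ≡ q * (q * (q * q * q * M * M * S + ε * q * q * M * X)) - ∣ V ∣ * (q * S - S)
            q²Y = begin
              q * (q * Y)
                ≡⟨ (solve 2 (λ Z v → Z := (v :+ Z) :- v) refl (q * (q * Y)) (∣ V ∣ * (q * S - S))) ⟩
              (∣ V ∣ * (q * S - S) + q * (q * Y)) - ∣ V ∣ * (q * S - S)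
                ≡⟨ cong (λ u → (∣ V ∣ * (u - S) + q * (q * Y)) - ∣ V ∣ * (q * S - S)) (sym (∑-const S)) ⟩
              (∣ V ∣ * (∑ (λ (d : A) → S) - S) + q * (q * Y)) - ∣ V ∣ * (q * S - S)
                ≡⟨ cong (_- ∣ V ∣ * (q * S - S)) (sym (∑-radical (λ _ → θ 0ᴬ))) ⟩
              q * (q * ∑ (λ z → θ 0ᴬ (Q₁ z))) - ∣ V ∣ * (q * S - S)
                ≡⟨ cong (λ u → q * (q * u) - ∣ V ∣ * (q * S - S)) (∑-κ-orthogonal x κx≢0 (θ 0ᴬ)) ⟩
              q * (q * (q * q * q * M * M * S + ε * q * q * M * X)) - ∣ V ∣ * (q * S - S) ∎

        -- The vectors orthogonal to the radical are those whose product with y is ℓ times the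
        -- product with x; this is the constraint in the second sum.
        ∑-tangent : ∀ (φ : A → A → A → Num) →
          ∑ (λ z → φ (b x z) (b y z) (κ z)) ≡
          q * M * M * ∑ (λ a → ∑ λ d → ∑ λ k → φ a d k) +
          ε * q * M * ∑ (λ a → ∑ λ k → χ (a ⊗ a ⊝ 4ᴬ ⊗ (c ⊗ k)) * φ a (ℓ ⊗ a) k)
        ∑-tangent φ = cancel q≢0 (begin
          q * ∑ (λ z → φ (b x z) (b y z) (κ z))
            ≡⟨ cong (q *_) (∑-cong λ z → cong (λ u → φ (b x z) u (κ z)) (sym (b-y x κx≢0 y z))) ⟩
          q * ∑ (λ z → φ (b x z) (b y′ z ⊕ ℓ ⊗ b x z) (κ z))
            ≡⟨ ∑-κ-split (λ a d k → φ a (d ⊕ ℓ ⊗ a) k) ⟩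
          ∑ (λ s → ∑ λ z → φ (2ᴬ ⊗ c ⊗ s) (b y′ z ⊕ ℓ ⊗ (2ᴬ ⊗ c ⊗ s)) (Q₁ z ⊕ c ⊗ (s ⊗ s)))
            ≡⟨ ∑-cong (λ s → ∑-tangent⊥ (λ d k → φ (2ᴬ ⊗ c ⊗ s) (d ⊕ ℓ ⊗ (2ᴬ ⊗ c ⊗ s)) (k ⊕ c ⊗ (s ⊗ s)))) ⟩
          ∑ (λ s → q * q * M * M * ∑ (λ d → ∑ λ k → φ (2ᴬ ⊗ c ⊗ s) (d ⊕ ℓ ⊗ (2ᴬ ⊗ c ⊗ s)) (k ⊕ c ⊗ (s ⊗ s))) +
                   ε * q * q * M * ∑ (λ k → χ (⊖ c ⊗ k) * φ (2ᴬ ⊗ c ⊗ s) (0ᴬ ⊕ ℓ ⊗ (2ᴬ ⊗ c ⊗ s)) (k ⊕ c ⊗ (s ⊗ s))))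
            ≡⟨ ∑-lin (q * q * M * M) _ (ε * q * q * M) _ ⟩
          q * q * M * M * ∑ (λ s → ∑ λ d → ∑ λ k → φ (2ᴬ ⊗ c ⊗ s) (d ⊕ ℓ ⊗ (2ᴬ ⊗ c ⊗ s)) (k ⊕ c ⊗ (s ⊗ s))) +
          ε * q * q * M * ∑ (λ s → ∑ λ k → χ (⊖ c ⊗ k) * φ (2ᴬ ⊗ c ⊗ s) (0ᴬ ⊕ ℓ ⊗ (2ᴬ ⊗ c ⊗ s)) (k ⊕ c ⊗ (s ⊗ s)))
            ≡⟨ cong₂ (λ u v → q * q * M * M * u + ε * q * q * M * v)
                 (trans (∑-cong λ s → trans (∑-translateʳ (λ d → ∑ λ k → φ (2ᴬ ⊗ c ⊗ s) d (k ⊕ c ⊗ (s ⊗ s))) _)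
                   (∑-cong λ d → ∑-translateʳ (φ (2ᴬ ⊗ c ⊗ s) d) _)) (∑-scale (λ a → ∑ λ d → ∑ λ k → φ a d k) (⊗-≢0 2≢0 κx≢0)))
                 (trans (∑-twisted x κx≢0 (λ a k → φ a (0ᴬ ⊕ ℓ ⊗ a) k)) (∑-cong λ a → ∑-cong λ k →
                   cong (λ u → χ (a ⊗ a ⊝ 4ᴬ ⊗ (c ⊗ k)) * φ a u k) (solveᴬ 1 (λ u → conᴬ (pos 0) :⊕ u :≣ u) refl (ℓ ⊗ a)))) ⟩
          q * q * M * M * U + ε * q * q * M * W
            ≡⟨ (solve 5 (λ q M ε U W → q :* q :* M :* M :* U :+ ε :* q :* q :* M :* W := q :* (q :* M :* M :* U :+ ε :* q :* M :* W)) refl q M ε U W) ⟩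
          q * (q * M * M * U + ε * q * M * W) ∎)
          where
          U = ∑ (λ a → ∑ λ d → ∑ λ k → φ a d k)
          W = ∑ (λ a → ∑ λ k → χ (a ⊗ a ⊝ 4ᴬ ⊗ (c ⊗ k)) * φ a (ℓ ⊗ a) k)

-- Character sums in the entries of the products

module Products where

  open import Data.Integer.Base using () renaming (+_ to pos)
  open import Relation.Binary.PropositionalEquality
  open import Relation.Nullary using (yes; no; contradiction)
  open FiniteTypes
  open FiniteFields
  open QuadraticSpaces

  module CharacterSums (N : NumberRing) (𝔽 : OddField) where

    open NumberRing N renaming (Carrier to Num)
    open OddField 𝔽 renaming (Carrier to A)
    open Sums (NumberRing.discreteRing N)
    open Character N 𝔽
    open ≡-Reasoning

    δ₀ χ² : A → Num
    δ₀ k = δ k 0ᴬ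
    χ² k = χ k * χ k

    χ²≡1-δ₀ : ∀ k → χ² k ≡ 1# - δ₀ k
    χ²≡1-δ₀ k with k ≟ 0ᴬ
    ... | yes refl = trans (cong₂ _*_ χ0 χ0) (solve 0 (con (pos 0) :* con (pos 0) := con (pos 1) :- con (pos 1)) refl)
    ... | no k≢0   = trans (χ²≡1 k≢0) (solve 0 (con (pos 1) := con (pos 1) :- con (pos 0)) refl)

    χ²-0 : χ² 0ᴬ ≡ 0#
    χ²-0 = trans (cong₂ _*_ χ0 χ0) (zeroˡ 0#)

    χ-δ₀ : ∀ k → χ k * δ₀ k ≡ 0#
    χ-δ₀ k with k ≟ 0ᴬ
    ... | yes refl = trans (cong (_* 1#) χ0) (zeroˡ 1#)
    ... | no _     = zeroʳ (χ k)

    χ³≡χ : ∀ k → χ k * χ² k ≡ χ k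
    χ³≡χ k = begin
      χ k * χ² k            ≡⟨ cong (χ k *_) (χ²≡1-δ₀ k) ⟩
      χ k * (1# - δ₀ k)     ≡⟨ (solve 2 (λ c d → c :* (con (pos 1) :- d) := c :- c :* d) refl (χ k) (δ₀ k)) ⟩
      χ k - χ k * δ₀ k      ≡⟨ cong (λ z → χ k - z) (χ-δ₀ k) ⟩
      χ k - 0#              ≡⟨ (solve 1 (λ c → c :- con (pos 0) := c) refl (χ k)) ⟩
      χ k                   ∎

    ∑χ² : ∑ χ² ≡ q - 1#
    ∑χ² = begin
      ∑ χ²                       ≡⟨ ∑-cong χ²≡1-δ₀ ⟩
      ∑ (λ k → 1# - δ₀ k)        ≡⟨ ∑-- (λ _ → 1#) δ₀ ⟩
      ∑ (λ (k : A) → 1#) - ∑ δ₀  ≡⟨ cong₂ _-_ (trans (∑-const 1#) (*-identityʳ q)) (∑δ≡1 0ᴬ) ⟩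
      q - 1#                     ∎

    -- Numbers of discriminants with a given property depend on a non-zero norm k only through χ k.
    -- Zero is left out because the weights χ² and χ vanish there; summing with them reads off u and
    -- v respectively, times q - 1.
    Affine : (A → Num) → Num → Num → Set
    Affine f u v = ∀ k → k ≢ 0ᴬ → f k ≡ u + v * χ k

    private
      weighted : ∀ {f u v} → Affine f u v → ∀ (W : A → Num) → W 0ᴬ ≡ 0# → ∀ k →
                 W k * f k ≡ W k * (u + v * χ k)
      weighted h W W0 k with k ≟ 0ᴬ
      ... | yes refl = trans (cong (_* _) W0) (trans (zeroˡ _) (sym (trans (cong (_* _) W0) (zeroˡ _))))
      ... | no k≢0   = cong (W k *_) (h k k≢0)

    ∑-χ²-affine : ∀ {f u v} → Affine f u v → ∑ (λ k → χ² k * f k) ≡ (q - 1#) * u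
    ∑-χ²-affine {f} {u} {v} h = begin
      ∑ (λ k → χ² k * f k)                     ≡⟨ ∑-cong (weighted h χ² χ²-0) ⟩
      ∑ (λ k → χ² k * (u + v * χ k))           ≡⟨ ∑-cong (λ k → (solve 4 (λ s u v k → s :* (u :+ v :* k) := u :* s :+ v :* (k :* s)) refl (χ² k) u v (χ k))) ⟩
      ∑ (λ k → u * χ² k + v * (χ k * χ² k))    ≡⟨ ∑-lin u χ² v _ ⟩
      u * ∑ χ² + v * ∑ (λ k → χ k * χ² k)      ≡⟨ cong₂ (λ x y → u * x + v * y) ∑χ² (trans (∑-cong χ³≡χ) ∑χ≡0) ⟩
      u * (q - 1#) + v * 0#                    ≡⟨ (solve 3 (λ u q v → u :* (q :- con (pos 1)) :+ v :* con (pos 0) := (q :- con (pos 1)) :* u) refl u q v) ⟩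
      (q - 1#) * u                             ∎

    ∑-χ-affine : ∀ {f u v} → Affine f u v → ∑ (λ k → χ k * f k) ≡ (q - 1#) * v
    ∑-χ-affine {f} {u} {v} h = begin
      ∑ (λ k → χ k * f k)                      ≡⟨ ∑-cong (weighted h χ χ0) ⟩
      ∑ (λ k → χ k * (u + v * χ k))            ≡⟨ ∑-cong (λ k → (solve 3 (λ u v k → k :* (u :+ v :* k) := u :* k :+ v :* (k :* k)) refl u v (χ k))) ⟩
      ∑ (λ k → u * χ k + v * χ² k)             ≡⟨ ∑-lin u χ v χ² ⟩
      u * ∑ χ + v * ∑ χ²                       ≡⟨ cong₂ (λ x y → u * x + v * y) ∑χ≡0 ∑χ² ⟩
      u * 0# + v * (q - 1#)                    ≡⟨ (solve 3 (λ u q v → u :* con (pos 0) :+ v :* (q :- con (pos 1)) := (q :- con (pos 1)) :* v) refl u q v) ⟩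
      (q - 1#) * v                             ∎

    -- Multiplication in the group algebra of a group of order two, as χ² = 1 away from zero.
    affine-* : ∀ {f g u v u′ v′} → Affine f u v → Affine g u′ v′ →
               Affine (λ k → f k * g k) (u * u′ + v * v′) (u * v′ + v * u′)
    affine-* {f} {g} {u} {v} {u′} {v′} h h′ k k≢0 = begin
      f k * g k                                      ≡⟨ cong₂ _*_ (h k k≢0) (h′ k k≢0) ⟩
      (u + v * χ k) * (u′ + v′ * χ k)                ≡⟨ (solve 5 (λ u v p r c → (u :+ v :* c) :* (p :+ r :* c) := u :* p :+ v :* r :* (c :* c) :+ (u :* r :+ v :* p) :* c) refl u v (u′) (v′) (χ k)) ⟩
      u * u′ + v * v′ * χ² k + (u * v′ + v * u′) * χ k
                                                     ≡⟨ cong (λ z → u * u′ + z + (u * v′ + v * u′) * χ k)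
                                                          (trans (cong (v * v′ *_) (χ²≡1 k≢0)) (*-identityʳ _)) ⟩
      u * u′ + v * v′ + (u * v′ + v * u′) * χ k      ∎

    -- The sum of F over the discriminants of the binary forms with fixed norms c and k.
    discriminants : (A → Num) → A → A → Num
    discriminants F c k = ∑ λ a → F (a ⊗ a ⊝ 4ᴬ ⊗ (c ⊗ k))

    module _ {c : A} (c≢0 : c ≢ 0ᴬ) where

      private
        -4ck≢0 : ∀ {k} → k ≢ 0ᴬ → ⊖ (4ᴬ ⊗ (c ⊗ k)) ≢ 0ᴬ
        -4ck≢0 {k} k≢0 e = ⊗-≢0 4≢0 (⊗-≢0 c≢0 k≢0) (trans (solveᴬ 1 (λ u → u :≣ :⊖ :⊖ u) refl (4ᴬ ⊗ (c ⊗ k))) (trans (cong ⊖_ e) (solveᴬ 0 (:⊖ conᴬ (pos 0) :≣ conᴬ (pos 0)) refl)))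

      -- The discriminant vanishes for the square roots a of 4ck, of which there are 1 + χ(c) χ(k).
      discriminants-δ₀ : Affine (discriminants δ₀ c) 1# (χ c)
      discriminants-δ₀ k k≢0 = begin
        ∑ (λ a → δ (a ⊗ a ⊝ 4ᴬ ⊗ (c ⊗ k)) 0ᴬ)   ≡⟨ ∑-cong (λ a → ⟦⟧-⇔ (_ ≟ 0ᴬ) (_ ≟ 4ᴬ ⊗ (c ⊗ k)) ⊝-≡0
                                                      λ e → trans (cong (_⊝ 4ᴬ ⊗ (c ⊗ k)) e) (solveᴬ 1 (λ u → u :⊝ u :≣ conᴬ (pos 0)) refl (4ᴬ ⊗ (c ⊗ k)))) ⟩
        ∑ (λ a → δ (a ⊗ a) (4ᴬ ⊗ (c ⊗ k)))      ≡⟨ square-roots (4ᴬ ⊗ (c ⊗ k)) ⟩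
        1# + χ (4ᴬ ⊗ (c ⊗ k))                   ≡⟨ cong (1# +_) (trans (cong χ (solveᴬ 2 (λ c k → conᴬ (pos 4) :⊗ (c :⊗ k) :≣ conᴬ (pos 2) :⊗ conᴬ (pos 2) :⊗ (c :⊗ k)) refl c k)) (trans (χ-square-* 2≢0 _) (χ-* c k))) ⟩
        1# + χ c * χ k                          ∎

      -- For ck ≠ 0 this is the sum of χ over a quadratic polynomial that is not a square, which is
      -- -1.
      discriminants-χ : Affine (discriminants χ c) (- 1#) 0#
      discriminants-χ k k≢0 = begin
        ∑ (λ a → χ (a ⊗ a ⊝ 4ᴬ ⊗ (c ⊗ k)))                 ≡⟨ ∑-cong (λ a → cong χ (solveᴬ 2 (λ a u → a :⊗ a :⊝ u :≣ conᴬ (pos 1) :⊗ (a :⊗ a) :⊕ :⊖ u) refl a (4ᴬ ⊗ (c ⊗ k)))) ⟩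
        ∑ (λ a → χ (1ᴬ ⊗ (a ⊗ a) ⊕ ⊖ (4ᴬ ⊗ (c ⊗ k))))      ≡⟨ ∑χ-quadratic _ 1≢0 ⟩
        χ 1ᴬ * (q * δ₀ (⊖ (4ᴬ ⊗ (c ⊗ k))) - 1#)            ≡⟨ cong₂ (λ u v → u * (q * v - 1#)) χ1 (⟦⟧-no (_ ≟ 0ᴬ) (-4ck≢0 k≢0)) ⟩
        1# * (q * 0# - 1#)                                 ≡⟨ (solve 2 (λ q x → con (pos 1) :* (q :* con (pos 0) :- con (pos 1)) := :- con (pos 1) :+ con (pos 0) :* x) refl q (χ k)) ⟩
        - 1# + 0# * χ k                                    ∎
        where
        χ1 : χ 1ᴬ ≡ 1#
        χ1 = trans (cong χ (solveᴬ 0 (conᴬ (pos 1) :≣ conᴬ (pos 1) :⊗ conᴬ (pos 1)) refl)) (χ-square 1≢0)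

      discriminants-χ² : Affine (discriminants χ² c) (q - 1#) (- χ c)
      discriminants-χ² k k≢0 = begin
        ∑ (λ a → χ² (d a))                     ≡⟨ ∑-cong (λ a → χ²≡1-δ₀ (d a)) ⟩
        ∑ (λ a → 1# - δ₀ (d a))                ≡⟨ ∑-- (λ _ → 1#) (λ a → δ₀ (d a)) ⟩
        ∑ (λ (a : A) → 1#) - ∑ (λ a → δ₀ (d a))  ≡⟨ cong₂ _-_ (trans (∑-const 1#) (*-identityʳ q)) (discriminants-δ₀ k k≢0) ⟩
        q - (1# + χ c * χ k)                   ≡⟨ (solve 3 (λ q c k → q :- (con (pos 1) :+ c :* k) := (q :- con (pos 1)) :+ :- c :* k) refl q (χ c) (χ k)) ⟩
        (q - 1#) + - χ c * χ k                 ∎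
        where
        d : A → A
        d a = a ⊗ a ⊝ 4ᴬ ⊗ (c ⊗ k)

    discriminants-0 : ∀ {F c} → (∀ d → F d ≡ 0#) → Affine (discriminants F c) 0# 0#
    discriminants-0 h k k≢0 = trans (∑-cong λ a → h _) (trans ∑-zero (solve 1 (λ k → con (pos 0) := con (pos 0) :+ con (pos 0) :* k) refl (χ k)))

    affine-≗ : ∀ {F G c u v} → (∀ d → F d ≡ G d) → Affine (discriminants G c) u v → Affine (discriminants F c) u v
    affine-≗ h a k k≢0 = trans (∑-cong λ _ → h _) (a k k≢0)

    -- Once the norm k is fixed, the discriminants with x and with y depend on separate variables,
    -- so the uniform part of the distribution contributes a product of two one-variable sums.
    ∑-separate : ∀ (W : A → Num) (f g : A → A → Num) →
      ∑ (λ a → ∑ λ d → ∑ λ k → W k * (f a k * g d k)) ≡ ∑ (λ k → W k * (∑ (λ a → f a k) * ∑ (λ d → g d k)))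
    ∑-separate W f g = begin
      ∑ (λ a → ∑ λ d → ∑ λ k → W k * (f a k * g d k))   ≡⟨ ∑-cong (λ a → ∑-swap _) ⟩
      ∑ (λ a → ∑ λ k → ∑ λ d → W k * (f a k * g d k))   ≡⟨ ∑-swap _ ⟩
      ∑ (λ k → ∑ λ a → ∑ λ d → W k * (f a k * g d k))   ≡⟨ ∑-cong (λ k → trans (∑-cong λ a → ∑-* (W k) _) (trans (∑-* (W k) _)
                                                             (cong (W k *_) (∑-prod (λ a → f a k) (λ d → g d k))))) ⟩
      ∑ (λ k → W k * (∑ (λ a → f a k) * ∑ (λ d → g d k)))  ∎

    ∑-weight : ∀ (W : A → Num) (f : A → A → Num) →
      ∑ (λ a → ∑ λ k → W k * f a k) ≡ ∑ (λ k → W k * ∑ (λ a → f a k))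
    ∑-weight W f = trans (∑-swap _) (∑-cong λ k → ∑-* (W k) _)

  module Products (N : NumberRing) (𝔽 : OddField) (space : QuadraticSpace 𝔽)
                  (distribution : NormDistribution N 𝔽 space) where

    open NumberRing N renaming (Carrier to Num)
    open OddField 𝔽 renaming (Carrier to A)
    open QuadraticSpace space
    open NormDistribution distribution
    open Counting N 𝔽 space distribution
    open Sums (NumberRing.discreteRing N)
    open Character N 𝔽
    open CharacterSums N 𝔽
    open ≡-Reasoning

    -- χ² is the indicator of the non-zero norms, so after division by q - 1 this is the number of
    -- anisotropic points.
    ∑-χ²κ : ∑ (λ z → χ² (κ z)) ≡ (q - 1#) * (q * q * q * M * M - ε * q * M)
    ∑-χ²κ = trans (∑-κ χ²) (trans (cong₂ (λ u v → (q * q * q * M * M - ε * q * M) * u + ε * q * q * M * v) ∑χ² χ²-0)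
      (solve 3 (λ q M ε → (q :* q :* q :* M :* M :- ε :* q :* M) :* (q :- con (pos 1)) :+ ε :* q :* q :* M :* con (pos 0) := (q :- con (pos 1)) :* (q :* q :* q :* M :* M :- ε :* q :* M)) refl q M ε))

    ∑-χκ : ∑ (λ z → χ (κ z)) ≡ 0#
    ∑-χκ = trans (∑-κ χ) (trans (cong₂ (λ u v → (q * q * q * M * M - ε * q * M) * u + ε * q * q * M * v) ∑χ≡0 χ0)
      (solve 3 (λ q M ε → (q :* q :* q :* M :* M :- ε :* q :* M) :* con (pos 0) :+ ε :* q :* q :* M :* con (pos 0) := con (pos 0)) refl q M ε))

    module _ (x : V) (κx≢0 : κ x ≢ 0ᴬ) where

      private
        c = κ x

      -- The discriminant D x z is a function of the product b x z and the norm κ z, whose joint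
      -- distribution `∑-one` provides; its second part multiplies F by χ.
      ∑-row : ∀ (W F : A → Num) →
        ∑ (λ z → W (κ z) * F (D x z)) ≡
        q * q * M * M * ∑ (λ k → W k * discriminants F c k) +
        ε * q * M * ∑ (λ k → W k * discriminants (λ d → χ d * F d) c k)
      ∑-row W F = trans (∑-one x κx≢0 (λ a k → W k * F (a ⊗ a ⊝ 4ᴬ ⊗ (c ⊗ k))))
        (cong₂ (λ u v → q * q * M * M * u + ε * q * M * v) (∑-weight W _)
          (trans (∑-cong λ a → ∑-cong λ k → let d = a ⊗ a ⊝ 4ᴬ ⊗ (c ⊗ k) in
            (solve 3 (λ d w f → d :* (w :* f) := w :* (d :* f)) refl (χ d) (W k) (F d))) (∑-weight W _)))

      module _ {F : A → Num} {u v u′ v′ : Num} (α : Affine (discriminants F c) u v)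
               (β : Affine (discriminants (λ d → χ d * F d) c) u′ v′) where

        ∑-row-χ² : ∑ (λ z → χ² (κ z) * F (D x z)) ≡ (q - 1#) * (q * q * M * M * u + ε * q * M * u′)
        ∑-row-χ² = trans (∑-row χ² F) (trans (cong₂ (λ s t → q * q * M * M * s + ε * q * M * t) (∑-χ²-affine α) (∑-χ²-affine β))
          (solve 5 (λ q M ε u r → q :* q :* M :* M :* ((q :- con (pos 1)) :* u) :+ ε :* q :* M :* ((q :- con (pos 1)) :* r) := (q :- con (pos 1)) :* (q :* q :* M :* M :* u :+ ε :* q :* M :* r)) refl q M ε u (u′)))

        ∑-row-χ : ∑ (λ z → χ (κ z) * F (D x z)) ≡ (q - 1#) * (q * q * M * M * v + ε * q * M * v′)
        ∑-row-χ = trans (∑-row χ F) (trans (cong₂ (λ s t → q * q * M * M * s + ε * q * M * t) (∑-χ-affine α) (∑-χ-affine β))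
          (solve 5 (λ q M ε v r → q :* q :* M :* M :* ((q :- con (pos 1)) :* v) :+ ε :* q :* M :* ((q :- con (pos 1)) :* r) := (q :- con (pos 1)) :* (q :* q :* M :* M :* v :+ ε :* q :* M :* r)) refl q M ε v (v′)))

      row-Z : ∑ (λ z → χ² (κ z) * δ₀ (D x z)) ≡ (q - 1#) * (q * q * M * M)
      row-Z = trans (∑-row-χ² {F = δ₀} (discriminants-δ₀ κx≢0) (discriminants-0 χ-δ₀))
        (solve 3 (λ q M ε → (q :- con (pos 1)) :* (q :* q :* M :* M :* con (pos 1) :+ ε :* q :* M :* con (pos 0)) := (q :- con (pos 1)) :* (q :* q :* M :* M)) refl q M ε)

      row-G : ∑ (λ z → χ² (κ z) * χ (D x z)) ≡ (q - 1#) * (ε * q * M * (q - 1#) - q * q * M * M)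
      row-G = trans (∑-row-χ² {F = χ} (discriminants-χ κx≢0) (discriminants-χ² κx≢0))
        (solve 3 (λ q M ε → (q :- con (pos 1)) :* (q :* q :* M :* M :* :- con (pos 1) :+ ε :* q :* M :* (q :- con (pos 1))) := (q :- con (pos 1)) :* (ε :* q :* M :* (q :- con (pos 1)) :- q :* q :* M :* M)) refl q M ε)

      row-TG : ∑ (λ z → χ (κ z) * χ (D x z)) ≡ (q - 1#) * - (ε * q * M * χ c)
      row-TG = trans (∑-row-χ {F = χ} (discriminants-χ κx≢0) (discriminants-χ² κx≢0))
        (solve 4 (λ q M ε t → (q :- con (pos 1)) :* (q :* q :* M :* M :* con (pos 0) :+ ε :* q :* M :* :- t) := (q :- con (pos 1)) :* :- (ε :* q :* M :* t)) refl q M ε (χ c))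

      diagonal-GG : ∑ (λ z → χ² (κ z) * (χ (D x z) * χ (D x z))) ≡ (q - 1#) * (q * q * M * M * (q - 1#) - ε * q * M)
      diagonal-GG = trans (∑-row-χ² {F = χ²} (discriminants-χ² κx≢0) (affine-≗ χ³≡χ (discriminants-χ κx≢0)))
        (solve 3 (λ q M ε → (q :- con (pos 1)) :* (q :* q :* M :* M :* (q :- con (pos 1)) :+ ε :* q :* M :* :- con (pos 1)) := (q :- con (pos 1)) :* (q :* q :* M :* M :* (q :- con (pos 1)) :- ε :* q :* M)) refl q M ε)

      diagonal-GTG : ∑ (λ z → χ (κ z) * (χ (D x z) * χ (D x z))) ≡ (q - 1#) * - (q * q * M * M * χ c)
      diagonal-GTG = trans (∑-row-χ {F = χ²} (discriminants-χ² κx≢0) (affine-≗ χ³≡χ (discriminants-χ κx≢0)))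
        (solve 4 (λ q M ε t → (q :- con (pos 1)) :* (q :* q :* M :* M :* :- t :+ ε :* q :* M :* con (pos 0)) := (q :- con (pos 1)) :* :- (q :* q :* M :* M :* t)) refl q M ε (χ c))

      module _ (y : V) (κy≢0 : κ y ≢ 0ᴬ) where

        private
          t = b x y

        module _ (D≢0 : D x y ≢ 0ᴬ) where

          private
            η = χ (D x y)
            norm : A → A → A
            norm s r = c ⊗ (s ⊗ s) ⊕ t ⊗ (s ⊗ r) ⊕ κ y ⊗ (r ⊗ r)

            plane : (W F G : A → Num) → Num
            plane W F G = ∑ λ r → ∑ λ s → W (norm s r) * (F (r ⊗ r ⊗ D x y) * G (s ⊗ s ⊗ D x y))

          -- For z = s x + r y in the plane one has D x z = r² D x y and D y z = s² D x y. Thus the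
          -- plane term involves the discriminant of x and y only up to squares.
          ∑-secant : ∀ (W F G : A → Num) →
            ∑ (λ z → W (κ z) * (F (D x z) * G (D y z))) ≡
            (q * M * M - ε * η * M) * ∑ (λ k → W k * (discriminants F c k * discriminants G (κ y) k)) +
            ε * η * q * M * plane W F G
          ∑-secant W F G = trans (∑-two x κx≢0 y D≢0 (λ a d k → W k * (F (a ⊗ a ⊝ 4ᴬ ⊗ (c ⊗ k)) * G (d ⊗ d ⊝ 4ᴬ ⊗ (κ y ⊗ k)))))
            (cong₂ (λ u v → (q * M * M - ε * η * M) * u + ε * η * q * M * v)
              (∑-separate W (λ a k → F (a ⊗ a ⊝ 4ᴬ ⊗ (c ⊗ k))) (λ d k → G (d ⊗ d ⊝ 4ᴬ ⊗ (κ y ⊗ k))))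
              (∑-cong λ r → ∑-cong λ s → cong₂ (λ u v → W (norm s r) * (F u * G v))
                (solveᴬ 5 (λ c s t r k → (conᴬ (pos 2) :⊗ c :⊗ s :⊕ t :⊗ r) :⊗ (conᴬ (pos 2) :⊗ c :⊗ s :⊕ t :⊗ r) :⊝ conᴬ (pos 4) :⊗ (c :⊗ (c :⊗ (s :⊗ s) :⊕ t :⊗ (s :⊗ r) :⊕ k :⊗ (r :⊗ r))) :≣ r :⊗ r :⊗ (t :⊗ t :⊝ conᴬ (pos 4) :⊗ (c :⊗ k))) refl c s t r (κ y))
                (solveᴬ 5 (λ c s t r k → (t :⊗ s :⊕ conᴬ (pos 2) :⊗ k :⊗ r) :⊗ (t :⊗ s :⊕ conᴬ (pos 2) :⊗ k :⊗ r) :⊝ conᴬ (pos 4) :⊗ (k :⊗ (c :⊗ (s :⊗ s) :⊕ t :⊗ (s :⊗ r) :⊕ k :⊗ (r :⊗ r))) :≣ s :⊗ s :⊗ (t :⊗ t :⊝ conᴬ (pos 4) :⊗ (c :⊗ k))) refl c s t r (κ y))))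

          private
            δ₀-D : ∀ r → δ₀ (r ⊗ r ⊗ D x y) ≡ δ r 0ᴬ
            δ₀-D r = ⟦⟧-⇔ (r ⊗ r ⊗ D x y ≟ 0ᴬ) (r ≟ 0ᴬ) zero-r λ { refl → (solveᴬ 1 (λ d → conᴬ (pos 0) :⊗ conᴬ (pos 0) :⊗ d :≣ conᴬ (pos 0)) refl (D x y)) }
              where
              zero-r : r ⊗ r ⊗ D x y ≡ 0ᴬ → r ≡ 0ᴬ
              zero-r e with r ≟ 0ᴬ
              ... | yes r≡0 = r≡0
              ... | no r≢0  = contradiction (cancel-⊗ (⊗-≢0 r≢0 r≢0) e) D≢0

            χ-D′ : ∀ r → χ (r ⊗ r ⊗ D x y) ≡ (1# - δ r 0ᴬ) * η
            χ-D′ r = trans (χ-* (r ⊗ r) _) (cong (_* η) (trans (χ-* r r) (χ²≡1-δ₀ r)))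

            norm-s0 : ∀ s → norm s 0ᴬ ≡ c ⊗ (s ⊗ s)
            norm-s0 s = (solveᴬ 4 (λ c s t k → c :⊗ (s :⊗ s) :⊕ t :⊗ (s :⊗ conᴬ (pos 0)) :⊕ k :⊗ (conᴬ (pos 0) :⊗ conᴬ (pos 0)) :≣ c :⊗ (s :⊗ s)) refl c s t (κ y))

            norm-0r : ∀ r → norm 0ᴬ r ≡ κ y ⊗ (r ⊗ r)
            norm-0r r = (solveᴬ 4 (λ c r t k → c :⊗ (conᴬ (pos 0) :⊗ conᴬ (pos 0)) :⊕ t :⊗ (conᴬ (pos 0) :⊗ r) :⊕ k :⊗ (r :⊗ r) :≣ k :⊗ (r :⊗ r)) refl c r t (κ y))

            plane-Z : ∀ (W G : A → Num) → plane W δ₀ G ≡ ∑ (λ s → W (c ⊗ (s ⊗ s)) * G (s ⊗ s ⊗ D x y))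
            plane-Z W G = begin
              plane W δ₀ G
                ≡⟨ ∑-cong (λ r → trans (∑-cong λ s → trans (cong (λ u → W (norm s r) * (u * G (s ⊗ s ⊗ D x y))) (δ₀-D r))
                     (solve 3 (λ w d g → w :* (d :* g) := d :* (w :* g)) refl (W (norm s r)) (δ r 0ᴬ) (G (s ⊗ s ⊗ D x y)))) (∑-* (δ r 0ᴬ) _)) ⟩
              ∑ (λ r → δ r 0ᴬ * ∑ λ s → W (norm s r) * G (s ⊗ s ⊗ D x y))
                ≡⟨ ∑-δ (λ r → ∑ λ s → W (norm s r) * G (s ⊗ s ⊗ D x y)) 0ᴬ ⟩
              ∑ (λ s → W (norm s 0ᴬ) * G (s ⊗ s ⊗ D x y))
                ≡⟨ ∑-cong (λ s → cong (λ u → W u * G (s ⊗ s ⊗ D x y)) (norm-s0 s)) ⟩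
              ∑ (λ s → W (c ⊗ (s ⊗ s)) * G (s ⊗ s ⊗ D x y)) ∎

            plane-ZZ : plane χ² δ₀ δ₀ ≡ 0#
            plane-ZZ = trans (plane-Z χ² δ₀) (trans (∑-cong λ s → trans (cong (χ² (c ⊗ (s ⊗ s)) *_) (δ₀-D s)) (*-comm _ _))
              (trans (∑-δ (λ s → χ² (c ⊗ (s ⊗ s))) 0ᴬ) (trans (cong χ² (solveᴬ 1 (λ c → c :⊗ (conᴬ (pos 0) :⊗ conᴬ (pos 0)) :≣ conᴬ (pos 0)) refl c)) χ²-0)))

            multiples : ∀ (W : A → Num) → W 0ᴬ ≡ 0# → ∀ {a w} → (∀ s → s ≢ 0ᴬ → W (a ⊗ (s ⊗ s)) ≡ w) →
                        ∑ (λ s → W (a ⊗ (s ⊗ s))) ≡ (q - 1#) * w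
            multiples W W0 {a} {w} h = trans (∑-≢0 _ w h)
              (trans (cong (_+ (q - 1#) * w) (trans (cong W (solveᴬ 1 (λ a → a :⊗ (conᴬ (pos 0) :⊗ conᴬ (pos 0)) :≣ conᴬ (pos 0)) refl a)) W0)) (+-identityˡ _))

            χ-multiple : ∀ a s → s ≢ 0ᴬ → χ (a ⊗ (s ⊗ s)) ≡ χ a
            χ-multiple a s s≢0 = trans (cong χ (solveᴬ 2 (λ a s → a :⊗ (s :⊗ s) :≣ s :⊗ s :⊗ a) refl a s)) (χ-square-* s≢0 a)

            χ²-multiple : ∀ {a} → a ≢ 0ᴬ → ∀ s → s ≢ 0ᴬ → χ² (a ⊗ (s ⊗ s)) ≡ 1#
            χ²-multiple a≢0 s s≢0 = χ²≡1 (⊗-≢0 a≢0 (⊗-≢0 s≢0 s≢0))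

            plane-ZG : plane χ² δ₀ χ ≡ (q - 1#) * η
            plane-ZG = begin
              plane χ² δ₀ χ                                         ≡⟨ plane-Z χ² χ ⟩
              ∑ (λ s → χ² (c ⊗ (s ⊗ s)) * χ (s ⊗ s ⊗ D x y))        ≡⟨ ∑-≢0 _ η (λ s s≢0 → trans (cong₂ _*_ (χ²-multiple κx≢0 s s≢0) (χ-square-* s≢0 _)) (*-identityˡ η)) ⟩
              χ² (c ⊗ (0ᴬ ⊗ 0ᴬ)) * χ (0ᴬ ⊗ 0ᴬ ⊗ D x y) + (q - 1#) * η
                                                                    ≡⟨ cong (λ u → u * χ (0ᴬ ⊗ 0ᴬ ⊗ D x y) + (q - 1#) * η) (trans (cong χ² (solveᴬ 1 (λ c → c :⊗ (conᴬ (pos 0) :⊗ conᴬ (pos 0)) :≣ conᴬ (pos 0)) refl c)) χ²-0) ⟩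
              0# * χ (0ᴬ ⊗ 0ᴬ ⊗ D x y) + (q - 1#) * η               ≡⟨ (solve 2 (λ u v → con (pos 0) :* u :+ v := v) refl (χ (0ᴬ ⊗ 0ᴬ ⊗ D x y)) ((q - 1#) * η)) ⟩
              (q - 1#) * η                                          ∎

            -- Inclusion–exclusion over the points of the line other than x and y.
            plane-GG : ∀ {W : A → Num} → W 0ᴬ ≡ 0# → ∀ {v w} →
                       (∀ s → s ≢ 0ᴬ → W (c ⊗ (s ⊗ s)) ≡ v) → (∀ s → s ≢ 0ᴬ → W (κ y ⊗ (s ⊗ s)) ≡ w) →
                       plane W χ χ ≡ (q - η) * ∑ W - (q - 1#) * (v + w)
            plane-GG {W} W0 {v} {w} hv hw = begin
              plane W χ χ
                ≡⟨ ∑-cong (λ r → ∑-cong λ s → expand r s) ⟩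
              ∑ (λ r → ∑ λ s → (W (norm s r) - δ s 0ᴬ * W (norm s r)) - δ r 0ᴬ * (W (norm s r) - δ s 0ᴬ * W (norm s r)))
                ≡⟨ ∑-cong (λ r → trans (∑-- (λ s → W (norm s r) - δ s 0ᴬ * W (norm s r)) _) (cong (λ u → inner r - u) (∑-* (δ r 0ᴬ) _))) ⟩
              ∑ (λ r → inner r - δ r 0ᴬ * inner r)
                ≡⟨ trans (∑-- inner _) (cong (λ u → ∑ inner - u) (∑-δ inner 0ᴬ)) ⟩
              ∑ inner - inner 0ᴬ
                ≡⟨ cong₂ _-_ (trans (∑-cong inner≡) (trans (∑-- _ _) (cong₂ _-_ full (multiples W W0 hw))))
                     (trans (inner≡ 0ᴬ) (cong₂ _-_ (trans (∑-cong λ s → cong W (norm-s0 s)) (multiples W W0 hv)) (trans (cong W (solveᴬ 1 (λ k → k :⊗ (conᴬ (pos 0) :⊗ conᴬ (pos 0)) :≣ conᴬ (pos 0)) refl (κ y))) W0))) ⟩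
              ((q - η) * ∑ W - (q - 1#) * w) - ((q - 1#) * v - 0#)
                ≡⟨ (solve 4 (λ a q v w → (a :- (q :- con (pos 1)) :* w) :- ((q :- con (pos 1)) :* v :- con (pos 0)) := a :- (q :- con (pos 1)) :* (v :+ w)) refl ((q - η) * ∑ W) q v w) ⟩
              (q - η) * ∑ W - (q - 1#) * (v + w) ∎
              where
              inner : A → Num
              inner r = ∑ λ s → W (norm s r) - δ s 0ᴬ * W (norm s r)
              inner≡ : ∀ r → inner r ≡ ∑ (λ s → W (norm s r)) - W (κ y ⊗ (r ⊗ r))
              inner≡ r = trans (∑-- _ _) (cong (λ u → ∑ (λ s → W (norm s r)) - u)
                (trans (∑-δ (λ s → W (norm s r)) 0ᴬ) (cong W (norm-0r r))))
              full : ∑ (λ r → ∑ λ s → W (norm s r)) ≡ (q - η) * ∑ W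
              full = trans (∑∑-binary W κx≢0 D≢0) (trans (cong (λ u → (q - η) * ∑ W + η * (q * u)) W0)
                (solve 3 (λ a h q → a :+ h :* (q :* con (pos 0)) := a) refl ((q - η) * ∑ W) (η) q))
              expand : ∀ r s → W (norm s r) * (χ (r ⊗ r ⊗ D x y) * χ (s ⊗ s ⊗ D x y)) ≡
                       (W (norm s r) - δ s 0ᴬ * W (norm s r)) - δ r 0ᴬ * (W (norm s r) - δ s 0ᴬ * W (norm s r))
              expand r s = begin
                u * (χ (r ⊗ r ⊗ D x y) * χ (s ⊗ s ⊗ D x y))
                  ≡⟨ cong₂ (λ v w → u * (v * w)) (χ-D′ r) (χ-D′ s) ⟩
                u * ((1# - δ r 0ᴬ) * η * ((1# - δ s 0ᴬ) * η))
                  ≡⟨ (solve 4 (λ u d e h → u :* ((con (pos 1) :- d) :* h :* ((con (pos 1) :- e) :* h)) := h :* h :* ((u :- e :* u) :- d :* (u :- e :* u))) refl u (δ r 0ᴬ) (δ s 0ᴬ) (η)) ⟩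
                η * η * ((u - δ s 0ᴬ * u) - δ r 0ᴬ * (u - δ s 0ᴬ * u))
                  ≡⟨ trans (cong (_* ((u - δ s 0ᴬ * u) - δ r 0ᴬ * (u - δ s 0ᴬ * u))) (χ²≡1 D≢0)) (*-identityˡ _) ⟩
                (u - δ s 0ᴬ * u) - δ r 0ᴬ * (u - δ s 0ᴬ * u) ∎
                where u = W (norm s r)

          secant-ZZ : ∑ (λ z → χ² (κ z) * (δ₀ (D x z) * δ₀ (D y z))) ≡
                      (q - 1#) * ((1# + χ c * χ (κ y)) * (q * M * M - ε * η * M))
          secant-ZZ = trans (∑-secant χ² δ₀ δ₀) (trans
            (cong₂ (λ u v → (q * M * M - ε * η * M) * u + ε * η * q * M * v)
              (∑-χ²-affine (affine-* (discriminants-δ₀ κx≢0) (discriminants-δ₀ κy≢0))) plane-ZZ)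
            (solve 6 (λ q M ε h s t → (q :* M :* M :- ε :* h :* M) :* ((q :- con (pos 1)) :* (con (pos 1) :* con (pos 1) :+ s :* t)) :+ ε :* h :* q :* M :* con (pos 0) := (q :- con (pos 1)) :* ((con (pos 1) :+ s :* t) :* (q :* M :* M :- ε :* h :* M))) refl q M ε (η) (χ c) (χ (κ y))))

          -- η enters twice, once as the sign of the plane term and once as the character of D y z
          -- on the multiples of x. As D x y ≠ 0, the square of η is 1.
          secant-ZG : ∑ (λ z → χ² (κ z) * (δ₀ (D x z) * χ (D y z))) ≡
                      (q - 1#) * (ε * q * M + ε * η * M - q * M * M)
          secant-ZG = trans (∑-secant χ² δ₀ χ) (trans
            (cong₂ (λ u v → (q * M * M - ε * η * M) * u + ε * η * q * M * v)
              (∑-χ²-affine (affine-* (discriminants-δ₀ κx≢0) (discriminants-χ κy≢0))) plane-ZG)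
            (trans (solve 5 (λ q M ε h s → (q :* M :* M :- ε :* h :* M) :* ((q :- con (pos 1)) :* (con (pos 1) :* :- con (pos 1) :+ s :* con (pos 0))) :+ ε :* h :* q :* M :* ((q :- con (pos 1)) :* h) := (q :- con (pos 1)) :* (ε :* q :* M :* (h :* h) :+ ε :* h :* M :- q :* M :* M)) refl q M ε (η) (χ c))
              (trans (cong (λ u → (q - 1#) * (ε * q * M * u + ε * η * M - q * M * M)) (χ²≡1 D≢0))
                (cong (λ u → (q - 1#) * (u + ε * η * M - q * M * M)) (*-identityʳ _)))))

          secant-GG : ∑ (λ z → χ² (κ z) * (χ (D x z) * χ (D y z))) ≡
                      (q - 1#) * (q * M * M - ε * η * M + ε * η * q * M * (q - (1# + 1#)) - ε * q * M)
          secant-GG = trans (∑-secant χ² χ χ) (trans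
            (cong₂ (λ u v → (q * M * M - ε * η * M) * u + ε * η * q * M * v)
              (∑-χ²-affine (affine-* (discriminants-χ κx≢0) (discriminants-χ κy≢0)))
              (trans (plane-GG χ²-0 (χ²-multiple κx≢0) (χ²-multiple κy≢0)) (cong (λ u → (q - η) * u - (q - 1#) * (1# + 1#)) ∑χ²)))
            (trans (solve 4 (λ q M ε h → (q :* M :* M :- ε :* h :* M) :* ((q :- con (pos 1)) :* (:- con (pos 1) :* :- con (pos 1) :+ con (pos 0) :* con (pos 0))) :+ ε :* h :* q :* M :* ((q :- h) :* (q :- con (pos 1)) :- (q :- con (pos 1)) :* (con (pos 1) :+ con (pos 1))) := (q :- con (pos 1)) :* (q :* M :* M :- ε :* h :* M :+ ε :* h :* q :* M :* (q :- con (pos 2)) :- ε :* q :* M :* (h :* h))) refl q M ε (η))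
              (trans (cong (λ u → (q - 1#) * (q * M * M - ε * η * M + ε * η * q * M * (q - (1# + 1#)) - ε * q * M * u)) (χ²≡1 D≢0))
                (cong (λ u → (q - 1#) * (q * M * M - ε * η * M + ε * η * q * M * (q - (1# + 1#)) - u)) (*-identityʳ _)))))

          secant-GTG : ∑ (λ z → χ (κ z) * (χ (D x z) * χ (D y z))) ≡
                       (q - 1#) * - (ε * η * q * M * (χ c + χ (κ y)))
          secant-GTG = trans (∑-secant χ χ χ) (trans
            (cong₂ (λ u v → (q * M * M - ε * η * M) * u + ε * η * q * M * v)
              (∑-χ-affine (affine-* (discriminants-χ κx≢0) (discriminants-χ κy≢0)))
              (trans (plane-GG χ0 (χ-multiple c) (χ-multiple (κ y))) (cong (λ u → (q - η) * u - (q - 1#) * (χ c + χ (κ y))) ∑χ≡0)))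
            (solve 6 (λ q M ε h s t → (q :* M :* M :- ε :* h :* M) :* ((q :- con (pos 1)) :* (:- con (pos 1) :* con (pos 0) :+ con (pos 0) :* :- con (pos 1))) :+ ε :* h :* q :* M :* ((q :- h) :* con (pos 0) :- (q :- con (pos 1)) :* (s :+ t)) := (q :- con (pos 1)) :* :- (ε :* h :* q :* M :* (s :+ t))) refl q M ε (η) (χ c) (χ (κ y))))

        module _ (D≡0 : D x y ≡ 0ᴬ) (w : V) (y⊥≁w : b (y⊥ x κx≢0 y) w ≢ 0ᴬ) where

          private
            ℓ = slope x κx≢0 y
            -- On a tangent line y is ℓ x plus a radical vector of norm zero, so its norm is ℓ²
            -- times that of x.
            κy≡ : κ y ≡ c ⊗ (ℓ ⊗ ℓ)
            κy≡ = sym (⊝-≡0 (cancel-⊗ (⊗-≢0 4≢0 κx≢0) (begin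
              4ᴬ ⊗ c ⊗ (c ⊗ (ℓ ⊗ ℓ) ⊝ κ y)
                ≡⟨ (solveᴬ 3 (λ c l k → conᴬ (pos 4) :⊗ c :⊗ (c :⊗ (l :⊗ l) :⊝ k) :≣ conᴬ (pos 2) :⊗ c :⊗ l :⊗ (conᴬ (pos 2) :⊗ c :⊗ l) :⊝ conᴬ (pos 4) :⊗ (c :⊗ k)) refl c (ℓ) (κ y)) ⟩
              2ᴬ ⊗ c ⊗ ℓ ⊗ (2ᴬ ⊗ c ⊗ ℓ) ⊝ 4ᴬ ⊗ (c ⊗ κ y)
                ≡⟨ cong (λ u → u ⊗ u ⊝ 4ᴬ ⊗ (c ⊗ κ y)) (2κ-slope x κx≢0 y) ⟩
              D x y
                ≡⟨ D≡0 ⟩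
              0ᴬ ∎)))

            ℓ≢0 : ℓ ≢ 0ᴬ
            ℓ≢0 e = κy≢0 (trans κy≡ (trans (cong (λ u → c ⊗ (u ⊗ u)) e) (solveᴬ 1 (λ c → c :⊗ (conᴬ (pos 0) :⊗ conᴬ (pos 0)) :≣ conᴬ (pos 0)) refl c)))

          -- The norms of x and y differ by the square ℓ². This is why points on a tangent line
          -- always have the same quadratic type.
          tangent-types : χ c * χ (κ y) ≡ 1#
          tangent-types = trans (cong (λ u → χ c * χ u) κy≡) (trans (sym (χ-* c _))
            (trans (cong χ (solveᴬ 2 (λ c l → c :⊗ (c :⊗ (l :⊗ l)) :≣ c :⊗ l :⊗ (c :⊗ l)) refl c (ℓ))) (χ-square (⊗-≢0 κx≢0 ℓ≢0))))

          -- On the non-uniform part the product with y is ℓ a, and the norm of y is c ℓ², so D y z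
          -- = ℓ² D x z. Both factors then depend on the single discriminant with x.
          ∑-tangent-line : ∀ (W F G : A → Num) →
            ∑ (λ z → W (κ z) * (F (D x z) * G (D y z))) ≡
            q * M * M * ∑ (λ k → W k * (discriminants F c k * discriminants G (κ y) k)) +
            ε * q * M * ∑ (λ k → W k * discriminants (λ d → χ d * (F d * G (ℓ ⊗ ℓ ⊗ d))) c k)
          ∑-tangent-line W F G = trans (∑-tangent x κx≢0 y D≡0 w y⊥≁w (λ a d k → W k * (F (a ⊗ a ⊝ 4ᴬ ⊗ (c ⊗ k)) * G (d ⊗ d ⊝ 4ᴬ ⊗ (κ y ⊗ k)))))
            (cong₂ (λ u v → q * M * M * u + ε * q * M * v)
              (∑-separate W (λ a k → F (a ⊗ a ⊝ 4ᴬ ⊗ (c ⊗ k))) (λ d k → G (d ⊗ d ⊝ 4ᴬ ⊗ (κ y ⊗ k))))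
              (trans (∑-cong λ a → ∑-cong λ k → point a k) (∑-weight W _)))
            where
            point : ∀ a k → let d = a ⊗ a ⊝ 4ᴬ ⊗ (c ⊗ k) in
              χ d * (W k * (F d * G (ℓ ⊗ a ⊗ (ℓ ⊗ a) ⊝ 4ᴬ ⊗ (κ y ⊗ k)))) ≡ W k * (χ d * (F d * G (ℓ ⊗ ℓ ⊗ d)))
            point a k = trans (cong (λ u → χ d * (W k * (F d * G u)))
                (trans (cong (λ u → ℓ ⊗ a ⊗ (ℓ ⊗ a) ⊝ 4ᴬ ⊗ (u ⊗ k)) κy≡)
                  (solveᴬ 4 (λ l a c k → l :⊗ a :⊗ (l :⊗ a) :⊝ conᴬ (pos 4) :⊗ (c :⊗ (l :⊗ l) :⊗ k) :≣ l :⊗ l :⊗ (a :⊗ a :⊝ conᴬ (pos 4) :⊗ (c :⊗ k))) refl (ℓ) a c k)))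
              (solve 4 (λ d w f g → d :* (w :* (f :* g)) := w :* (d :* (f :* g))) refl (χ d) (W k) (F d) (G (ℓ ⊗ ℓ ⊗ d)))
              where d = a ⊗ a ⊝ 4ᴬ ⊗ (c ⊗ k)

          private
            -- F ∈ {δ₀, χ} against χ; the first factor kills or reproduces χ.
            δ₀-any : ∀ {G : A → Num} d → χ d * (δ₀ d * G d) ≡ 0#
            δ₀-any {G} d = trans (sym (*-assoc (χ d) (δ₀ d) (G d))) (trans (cong (_* G d) (χ-δ₀ d)) (zeroˡ _))

            χ-χ : ∀ d → χ d * (χ d * χ (ℓ ⊗ ℓ ⊗ d)) ≡ χ d
            χ-χ d = trans (cong (λ u → χ d * (χ d * u)) (χ-square-* ℓ≢0 d)) (χ³≡χ d)

          tangent-ZZ : ∑ (λ z → χ² (κ z) * (δ₀ (D x z) * δ₀ (D y z))) ≡ (q - 1#) * ((1# + 1#) * q * M * M)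
          tangent-ZZ = trans (∑-tangent-line χ² δ₀ δ₀) (trans
            (cong₂ (λ u v → q * M * M * u + ε * q * M * v)
              (trans (∑-χ²-affine (affine-* (discriminants-δ₀ κx≢0) (discriminants-δ₀ κy≢0))) (cong (λ u → (q - 1#) * (1# * 1# + u)) tangent-types))
              (∑-χ²-affine (discriminants-0 (δ₀-any {λ d → δ₀ (ℓ ⊗ ℓ ⊗ d)}))))
            (solve 3 (λ q M ε → q :* M :* M :* ((q :- con (pos 1)) :* (con (pos 1) :* con (pos 1) :+ con (pos 1))) :+ ε :* q :* M :* ((q :- con (pos 1)) :* con (pos 0)) := (q :- con (pos 1)) :* (con (pos 2) :* q :* M :* M)) refl q M ε))

          tangent-ZG : ∑ (λ z → χ² (κ z) * (δ₀ (D x z) * χ (D y z))) ≡ (q - 1#) * - (q * M * M)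
          tangent-ZG = trans (∑-tangent-line χ² δ₀ χ) (trans
            (cong₂ (λ u v → q * M * M * u + ε * q * M * v)
              (∑-χ²-affine (affine-* (discriminants-δ₀ κx≢0) (discriminants-χ κy≢0)))
              (∑-χ²-affine (discriminants-0 (δ₀-any {λ d → χ (ℓ ⊗ ℓ ⊗ d)}))))
            (solve 4 (λ q M ε s → q :* M :* M :* ((q :- con (pos 1)) :* (con (pos 1) :* :- con (pos 1) :+ s :* con (pos 0))) :+ ε :* q :* M :* ((q :- con (pos 1)) :* con (pos 0)) := (q :- con (pos 1)) :* :- (q :* M :* M)) refl q M ε (χ c)))

          tangent-GG : ∑ (λ z → χ² (κ z) * (χ (D x z) * χ (D y z))) ≡ (q - 1#) * (q * M * M - ε * q * M)
          tangent-GG = trans (∑-tangent-line χ² χ χ) (trans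
            (cong₂ (λ u v → q * M * M * u + ε * q * M * v)
              (∑-χ²-affine (affine-* (discriminants-χ κx≢0) (discriminants-χ κy≢0)))
              (∑-χ²-affine (affine-≗ χ-χ (discriminants-χ κx≢0))))
            (solve 3 (λ q M ε → q :* M :* M :* ((q :- con (pos 1)) :* (:- con (pos 1) :* :- con (pos 1) :+ con (pos 0) :* con (pos 0))) :+ ε :* q :* M :* ((q :- con (pos 1)) :* :- con (pos 1)) := (q :- con (pos 1)) :* (q :* M :* M :- ε :* q :* M)) refl q M ε))

          tangent-GTG : ∑ (λ z → χ (κ z) * (χ (D x z) * χ (D y z))) ≡ 0#
          tangent-GTG = trans (∑-tangent-line χ χ χ) (trans
            (cong₂ (λ u v → q * M * M * u + ε * q * M * v)
              (∑-χ-affine (affine-* (discriminants-χ κx≢0) (discriminants-χ κy≢0)))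
              (∑-χ-affine (affine-≗ χ-χ (discriminants-χ κx≢0))))
            (solve 3 (λ q M ε → q :* M :* M :* ((q :- con (pos 1)) :* (:- con (pos 1) :* con (pos 0) :+ con (pos 0) :* :- con (pos 1))) :+ ε :* q :* M :* ((q :- con (pos 1)) :* con (pos 0)) := con (pos 0)) refl q M ε))

-- The polar form of κ in coordinates

module PolarForms {a ℓ} (R : CommutativeRing a ℓ) (f : Defs.BinaryForm R) where

  open import Defs using (BinaryForm; module BinaryForm; κ)

  open import Data.Fin.Base using (Fin; zero; suc)
  open import Data.Fin.Patterns using (0F; 1F)
  open import Data.Integer.Base using () renaming (+_ to pos)
  open import Data.Nat.Base as ℕ using (ℕ; zero; suc)
  open import Data.Product.Base using (proj₁; proj₂)
  open import Data.Vec.Functional using (Vector; tail)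
  open CommutativeRing R hiding (zero)
  open IntegerSolver R
  open BinaryForm f
  open import Relation.Binary.Reasoning.Setoid setoid

  2# 4# : Carrier
  2# = fromℤ (pos 2)
  4# = fromℤ (pos 4)

  -- The bilinear form κ(x + y) - κ(x) - κ(y), written out by the same recursion as κ, so that each
  -- of its properties is one ring identity per pair of coordinates.
  polarForm : ∀ m → (x y : Vector Carrier (2 ℕ.+ m ℕ.* 2)) → Carrier
  polarForm zero    x y = 2# * (α * (x 0F * y 0F)) + β * (x 0F * y 1F + x 1F * y 0F) + 2# * (γ * (x 1F * y 1F))
  polarForm (suc m) x y = x 0F * y 1F + x 1F * y 0F + polarForm m (tail (tail x)) (tail (tail y))

  discriminant : ∀ m → (x y : Vector Carrier (2 ℕ.+ m ℕ.* 2)) → Carrier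
  discriminant m x y = polarForm m x y * polarForm m x y - 4# * (κ R f m x * κ R f m y)

  value-cong : ∀ {x x′ y y′} → x ≈ x′ → y ≈ y′ → value x y ≈ value x′ y′
  value-cong e e′ = +-cong (+-cong (*-congˡ (*-cong e e)) (*-congˡ (*-cong e e′))) (*-congˡ (*-cong e′ e′))

  κ-cong : ∀ m {x y} → (∀ i → x i ≈ y i) → κ R f m x ≈ κ R f m y
  κ-cong zero    e = value-cong (e 0F) (e 1F)
  κ-cong (suc m) e = +-cong (*-cong (e 0F) (e 1F)) (κ-cong m (λ i → e (suc (suc i))))

  polarForm-cong : ∀ m {x x′ y y′} → (∀ i → x i ≈ x′ i) → (∀ i → y i ≈ y′ i) → polarForm m x y ≈ polarForm m x′ y′
  polarForm-cong zero    e e′ =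
    +-cong (+-cong (*-congˡ (*-congˡ (*-cong (e 0F) (e′ 0F))))
                   (*-congˡ (+-cong (*-cong (e 0F) (e′ 1F)) (*-cong (e 1F) (e′ 0F)))))
           (*-congˡ (*-congˡ (*-cong (e 1F) (e′ 1F))))
  polarForm-cong (suc m) e e′ =
    +-cong (+-cong (*-cong (e 0F) (e′ 1F)) (*-cong (e 1F) (e′ 0F)))
           (polarForm-cong m (λ i → e (suc (suc i))) (λ i → e′ (suc (suc i))))

  -- The hypothesis on z is pointwise because vectors are functions compared entrywise. Special
  -- choices of s and t give homogeneity and the vanishing at zero.
  κ-linear : ∀ m s t x y {z} → (∀ i → z i ≈ s * x i + t * y i) →
             κ R f m z ≈ s * s * κ R f m x + s * t * polarForm m x y + t * t * κ R f m y
  κ-linear zero s t x y e = trans (value-cong (e 0F) (e 1F))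
    (solve 9 (λ α β γ s t a b c d → α :* ((s :* a :+ t :* c) :* (s :* a :+ t :* c)) :+ β :* ((s :* a :+ t :* c) :* (s :* b :+ t :* d)) :+ γ :* ((s :* b :+ t :* d) :* (s :* b :+ t :* d)) := s :* s :* (α :* (a :* a) :+ β :* (a :* b) :+ γ :* (b :* b)) :+ s :* t :* (con (pos 2) :* (α :* (a :* c)) :+ β :* (a :* d :+ b :* c) :+ con (pos 2) :* (γ :* (b :* d))) :+ t :* t :* (α :* (c :* c) :+ β :* (c :* d) :+ γ :* (d :* d))) refl α β γ s t (x 0F) (x 1F) (y 0F) (y 1F))
  κ-linear (suc m) s t x y e = trans
    (+-cong (*-cong (e 0F) (e 1F)) (κ-linear m s t (tail (tail x)) (tail (tail y)) (λ i → e (suc (suc i)))))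
    (solve 9 (λ s t a b c d k p l → (s :* a :+ t :* c) :* (s :* b :+ t :* d) :+ (s :* s :* k :+ s :* t :* p :+ t :* t :* l) := s :* s :* (a :* b :+ k) :+ s :* t :* (a :* d :+ b :* c :+ p) :+ t :* t :* (c :* d :+ l)) refl s t (x 0F) (x 1F) (y 0F) (y 1F) (κ R f m (tail (tail x))) (polarForm m (tail (tail x)) (tail (tail y))) (κ R f m (tail (tail y))))

  polarForm-linear : ∀ m s t w x y {z} → (∀ i → z i ≈ s * x i + t * y i) →
                     polarForm m w z ≈ s * polarForm m w x + t * polarForm m w y
  polarForm-linear zero s t w x y e = trans (polarForm-cong zero {w} {w} (λ _ → refl) e)
    (solve 11 (λ α β γ s t a b c d u v → con (pos 2) :* (α :* (u :* (s :* a :+ t :* c))) :+ β :* (u :* (s :* b :+ t :* d) :+ v :* (s :* a :+ t :* c)) :+ con (pos 2) :* (γ :* (v :* (s :* b :+ t :* d))) := s :* (con (pos 2) :* (α :* (u :* a)) :+ β :* (u :* b :+ v :* a) :+ con (pos 2) :* (γ :* (v :* b))) :+ t :* (con (pos 2) :* (α :* (u :* c)) :+ β :* (u :* d :+ v :* c) :+ con (pos 2) :* (γ :* (v :* d)))) refl α β γ s t (x 0F) (x 1F) (y 0F) (y 1F) (w 0F) (w 1F))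
  polarForm-linear (suc m) s t w x y e = trans
    (+-cong (+-cong (*-congˡ (e 1F)) (*-congˡ (e 0F)))
      (polarForm-linear m s t (tail (tail w)) (tail (tail x)) (tail (tail y)) (λ i → e (suc (suc i)))))
    (solve 10 (λ s t a b c d u v p r → u :* (s :* b :+ t :* d) :+ v :* (s :* a :+ t :* c) :+ (s :* p :+ t :* r) := s :* (u :* b :+ v :* a :+ p) :+ t :* (u :* d :+ v :* c :+ r)) refl s t (x 0F) (x 1F) (y 0F) (y 1F) (w 0F) (w 1F) (polarForm m (tail (tail w)) (tail (tail x))) (polarForm m (tail (tail w)) (tail (tail y))))

  polarForm-sym : ∀ m x y → polarForm m x y ≈ polarForm m y x
  polarForm-sym zero x y = (solve 7 (λ α β γ a b c d → con (pos 2) :* (α :* (a :* c)) :+ β :* (a :* d :+ b :* c) :+ con (pos 2) :* (γ :* (b :* d)) := con (pos 2) :* (α :* (c :* a)) :+ β :* (c :* b :+ d :* a) :+ con (pos 2) :* (γ :* (d :* b))) refl α β γ (x 0F) (x 1F) (y 0F) (y 1F))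
  polarForm-sym (suc m) x y = trans (+-congˡ (polarForm-sym m (tail (tail x)) (tail (tail y))))
    (solve 5 (λ a b c d p → a :* d :+ b :* c :+ p := c :* b :+ d :* a :+ p) refl (x 0F) (x 1F) (y 0F) (y 1F) (polarForm m (tail (tail y)) (tail (tail x))))

  polarForm-self : ∀ m x → polarForm m x x ≈ 2# * κ R f m x
  polarForm-self zero x = (solve 5 (λ α β γ a b → con (pos 2) :* (α :* (a :* a)) :+ β :* (a :* b :+ b :* a) :+ con (pos 2) :* (γ :* (b :* b)) := con (pos 2) :* (α :* (a :* a) :+ β :* (a :* b) :+ γ :* (b :* b))) refl α β γ (x 0F) (x 1F))
  polarForm-self (suc m) x = trans (+-congˡ (polarForm-self m (tail (tail x))))
    (solve 3 (λ a b k → a :* b :+ b :* a :+ con (pos 2) :* k := con (pos 2) :* (a :* b :+ k)) refl (x 0F) (x 1F) (κ R f m (tail (tail x))))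

  discriminant-sym : ∀ m x y → discriminant m x y ≈ discriminant m y x
  discriminant-sym m x y = +-cong (*-cong (polarForm-sym m x y) (polarForm-sym m x y)) (-‿cong (*-congˡ (*-comm _ _)))

  -- Passing from x, y to x, s x + t y is a change of base with determinant t, and a discriminant is
  -- multiplied by the square of the determinant.
  discriminant-linear : ∀ m s t x y {z} → (∀ i → z i ≈ s * x i + t * y i) →
                        discriminant m x z ≈ t * t * discriminant m x y
  discriminant-linear m s t x y {z} e = begin
    discriminant m x z
      ≈⟨ +-cong (*-cong b≈ b≈) (-‿cong (*-congˡ (*-congˡ (κ-linear m s t x y e)))) ⟩
    (s * (2# * k) + t * p) * (s * (2# * k) + t * p) - 4# * (k * (s * s * k + s * t * p + t * t * l))
      ≈⟨ (solve 5 (λ s t k p l → (s :* (con (pos 2) :* k) :+ t :* p) :* (s :* (con (pos 2) :* k) :+ t :* p) :- con (pos 4) :* (k :* (s :* s :* k :+ s :* t :* p :+ t :* t :* l)) := t :* t :* (p :* p :- con (pos 4) :* (k :* l))) refl s t k p l) ⟩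
    t * t * discriminant m x y ∎
    where
    k = κ R f m x
    l = κ R f m y
    p = polarForm m x y
    b≈ : polarForm m x z ≈ s * (2# * k) + t * p
    b≈ = trans (polarForm-linear m s t x x y e) (+-congʳ (*-congˡ (polarForm-self m x)))

  unit₀ unit₁ : ∀ m → Vector Carrier (2 ℕ.+ m ℕ.* 2)
  unit₀ m 0F            = 1#
  unit₀ m (suc _)       = 0#
  unit₁ m 0F            = 0#
  unit₁ m 1F            = 1#
  unit₁ m (suc (suc _)) = 0#

  polarForm-0 : ∀ m x {y} → (∀ i → y i ≈ 0#) → polarForm m x y ≈ 0#
  polarForm-0 m x {y} e = trans (polarForm-linear m 0# 0# x y y (λ i → trans (e i) (solve 1 (λ u → con (pos 0) := con (pos 0) :* u :+ con (pos 0) :* u) refl (y i))))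
    (solve 1 (λ p → con (pos 0) :* p :+ con (pos 0) :* p := con (pos 0)) refl (polarForm m x y))

  module _ (2-cancel : ∀ x → 2# * x ≈ 0# → x ≈ 0#) (nonDegenerate : NonDegenerate) where

    -- In each hyperbolic pair, pairing with one unit vector reads off the opposite coordinate. For
    -- the remaining two coordinates, x is orthogonal to itself, so 2 times its value under f is
    -- zero and the hypothesis on f applies.
    polarForm-nondegenerate : ∀ m x → (∀ y → polarForm m x y ≈ 0#) → ∀ i → x i ≈ 0#
    polarForm-nondegenerate zero x h = λ { 0F → proj₁ zeros ; 1F → proj₂ zeros }
      where
      zeros = nonDegenerate (x 0F) (x 1F)
        (2-cancel _ (trans (sym (polarForm-self zero x)) (h x)))
        λ u v → trans (solve 7 (λ α β γ a b u v → α :* ((a :+ u) :* (a :+ u)) :+ β :* ((a :+ u) :* (b :+ v)) :+ γ :* ((b :+ v) :* (b :+ v)) :- (α :* (a :* a) :+ β :* (a :* b) :+ γ :* (b :* b)) :- (α :* (u :* u) :+ β :* (u :* v) :+ γ :* (v :* v)) := con (pos 2) :* (α :* (a :* u)) :+ β :* (a :* v :+ b :* u) :+ con (pos 2) :* (γ :* (b :* v))) refl α β γ (x 0F) (x 1F) u v) (h (λ { 0F → u ; 1F → v }))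
    polarForm-nondegenerate (suc m) x h = λ
      { 0F            → trans (trans (solve 2 (λ a b → a := a :* con (pos 1) :+ b :* con (pos 0) :+ con (pos 0)) refl (x 0F) (x 1F))
                          (+-congˡ (sym (polarForm-0 m (tail (tail x)) (λ _ → refl))))) (h (unit₁ (suc m)))
      ; 1F            → trans (trans (solve 2 (λ a b → b := a :* con (pos 0) :+ b :* con (pos 1) :+ con (pos 0)) refl (x 0F) (x 1F))
                          (+-congˡ (sym (polarForm-0 m (tail (tail x)) (λ _ → refl))))) (h (unit₀ (suc m)))
      ; (suc (suc i)) → polarForm-nondegenerate m (tail (tail x)) rest i
      }
      where
      rest : ∀ y → polarForm m (tail (tail x)) y ≈ 0#
      rest y = trans (solve 3 (λ a b p → p := a :* con (pos 0) :+ b :* con (pos 0) :+ p) refl (x 0F) (x 1F) (polarForm m (tail (tail x)) y))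
        (h λ { 0F → 0# ; 1F → 0# ; (suc (suc i)) → y i })

-- Coordinate vectors and the value distribution of κ

module VectorModel where

  open import Data.Fin.Base using (Fin; zero; suc)
  open import Data.Integer.Base using () renaming (+_ to pos)
  open import Data.Nat.Base as ℕ using (ℕ; zero; suc)
  open import Data.Product.Base using (∃-syntax; _,_; proj₁; proj₂)
  open import Data.Vec.Base using (Vec; []; _∷_; lookup; zipWith; tabulate; head; tail)
  open import Data.Vec.Properties using (lookup-zipWith; lookup∘tabulate)
  open import Relation.Binary.PropositionalEquality
  open import Relation.Nullary using (¬_; Dec)
  open import Relation.Nullary.Decidable using (map′; decidable-stable; ¬?)
  open import Data.Fin.Properties using (any?)
  open DiscreteRings
  open FiniteTypes
  open FiniteFields
  open QuadraticSpaces
  open import Defs using (BinaryForm; module BinaryForm; κ)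

  module VectorSpace (𝔽 : OddField) (f : BinaryForm (DiscreteRing.commutativeRing (OddField.discreteRing 𝔽))) where

    open OddField 𝔽 renaming (Carrier to A)
    open PolarForms (DiscreteRing.commutativeRing (OddField.discreteRing 𝔽)) f

    private
      R = DiscreteRing.commutativeRing (OddField.discreteRing 𝔽)

    infixl 6 _+[_]_
    _+[_]_ : ∀ {n} → Vec A n → A → Vec A n → Vec A n
    z +[ s ] x = zipWith (λ a c → a ⊕ s ⊗ c) z x

    private
      lookup-+[] : ∀ {n} (z : Vec A n) s x i → lookup (z +[ s ] x) i ≡ 1ᴬ ⊗ lookup z i ⊕ s ⊗ lookup x i
      lookup-+[] z s x i = trans (lookup-zipWith _ i z x) (solveᴬ 3 (λ a s c → a :⊕ s :⊗ c :≣ conᴬ (pos 1) :⊗ a :⊕ s :⊗ c) refl (lookup z i) s (lookup x i))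

      +[]-+[]′ : ∀ {n} (z : Vec A n) s t x → (z +[ s ] x) +[ t ] x ≡ z +[ s ⊕ t ] x
      +[]-+[]′ []      s t []      = refl
      +[]-+[]′ (a ∷ z) s t (c ∷ x) = cong₂ _∷_ (solveᴬ 4 (λ a s t c → a :⊕ s :⊗ c :⊕ t :⊗ c :≣ a :⊕ (s :⊕ t) :⊗ c) refl a s t c) (+[]-+[]′ z s t x)

      +[0]′ : ∀ {n} (z x : Vec A n) → z +[ 0ᴬ ] x ≡ z
      +[0]′ []      []      = refl
      +[0]′ (a ∷ z) (c ∷ x) = cong₂ _∷_ (solveᴬ 2 (λ a c → a :⊕ conᴬ (pos 0) :⊗ c :≣ a) refl a c) (+[0]′ z x)

    space : ℕ → QuadraticSpace 𝔽
    space m = record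
      { V       = Vec A (2 ℕ.+ m ℕ.* 2)
      ; κ       = λ x → κ R f m (lookup x)
      ; b       = λ x y → polarForm m (lookup x) (lookup y)
      ; _+[_]_  = _+[_]_
      ; κ-+[]   = λ z s x → trans (κ-linear m 1ᴬ s (lookup z) (lookup x) (lookup-+[] z s x))
          (trans (cong (λ p → 1ᴬ ⊗ 1ᴬ ⊗ κ R f m (lookup z) ⊕ 1ᴬ ⊗ s ⊗ p ⊕ s ⊗ s ⊗ κ R f m (lookup x)) (polarForm-sym m (lookup z) (lookup x)))
            (solveᴬ 4 (λ k s p l → conᴬ (pos 1) :⊗ conᴬ (pos 1) :⊗ k :⊕ conᴬ (pos 1) :⊗ s :⊗ p :⊕ s :⊗ s :⊗ l :≣ k :⊕ s :⊗ p :⊕ s :⊗ s :⊗ l) refl (κ R f m (lookup z)) s (polarForm m (lookup x) (lookup z)) (κ R f m (lookup x))))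
      ; b-+[]   = λ y z s x → trans (polarForm-linear m 1ᴬ s (lookup y) (lookup z) (lookup x) (lookup-+[] z s x))
          (solveᴬ 3 (λ u s v → conᴬ (pos 1) :⊗ u :⊕ s :⊗ v :≣ u :⊕ s :⊗ v) refl (polarForm m (lookup y) (lookup z)) s (polarForm m (lookup y) (lookup x)))
      ; b-sym   = λ x y → polarForm-sym m (lookup x) (lookup y)
      ; b-self  = λ x → polarForm-self m (lookup x)
      ; +[]-+[] = +[]-+[]′
      ; +[0]    = +[0]′
      }

    module _ (nonDegenerate : BinaryForm.NonDegenerate f) (m : ℕ) where
      open QuadraticSpace (space m) using (V; b)

      -- The contrapositive of non-degeneracy; the vector w itself comes from a search through the
      -- finite space. For tangent lines it is applied to the radical vector.
      non-orthogonal : ∀ r → ¬ (∀ i → lookup r i ≡ 0ᴬ) → ∃[ w ] b r w ≢ 0ᴬ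
      non-orthogonal r r≢0 = decidable-stable some? λ none →
        r≢0 (polarForm-nondegenerate (λ x → cancel-⊗ 2≢0) nonDegenerate m (lookup r) λ y →
          trans (sym (polarForm-cong m {lookup r} {lookup r} (λ _ → refl) (lookup∘tabulate y)))
            (decidable-stable (b r (tabulate y) ≟ 0ᴬ) λ b≢0 → none (tabulate y , b≢0)))
        where
        open Finite (Vec-finite {A} {n = 2 ℕ.+ m ℕ.* 2}) using (enum; index; enum-index)
        some? : Dec (∃[ w ] b r w ≢ 0ᴬ)
        some? = map′ (λ (i , h) → enum i , h) (λ (w , h) → index w , subst (λ v → b r v ≢ 0ᴬ) (sym (enum-index w)) h)
                  (any? λ i → ¬? (b r (enum i) ≟ 0ᴬ))

  module NormCount (N : NumberRing) (𝔽 : OddField)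
                   (f : BinaryForm (DiscreteRing.commutativeRing (OddField.discreteRing 𝔽))) where

    open NumberRing N renaming (Carrier to Num)
    open OddField 𝔽 renaming (Carrier to A)
    open Sums (NumberRing.discreteRing N)
    open Character N 𝔽
    open VectorSpace 𝔽 f
    open BinaryForm f
    open ≡-Reasoning

    private
      R = DiscreteRing.commutativeRing (OddField.discreteRing 𝔽)

    ∑-cons : ∀ {n} (φ : Vec A (suc n) → Num) → ∑ φ ≡ ∑ (λ a → ∑ λ v → φ (a ∷ v))
    ∑-cons φ = ∑-pairs φ _∷_ head tail (λ { (a ∷ v) → refl }) (λ _ _ → refl) (λ _ _ → refl)

    ∑-nil : (φ : Vec A 0 → Num) → ∑ φ ≡ φ []
    ∑-nil φ = begin
      ∑ φ                        ≡⟨ ∑-cong (λ { [] → sym (*-identityˡ (φ [])) }) ⟩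
      ∑ (λ v → 1# * φ [])        ≡⟨ ∑-cong (λ v → cong (_* φ []) (sym (⟦⟧-yes (v ≟ []) (unique v)))) ⟩
      ∑ (λ v → δ v [] * φ [])    ≡⟨ ∑-δ (λ _ → φ []) [] ⟩
      φ []                       ∎
      where
      unique : (v : Vec A 0) → v ≡ []
      unique [] = refl

    power : ℕ → Num
    power zero    = 1#
    power (suc m) = q * power m

    module _ (ε : Num) (∑-value : ∀ (ψ : A → Num) →
               ∑ (λ x → ∑ λ y → ψ (value x y)) ≡ (q - ε) * ∑ ψ + ε * q * ψ 0ᴬ) where

      private
        V : ℕ → Set
        V m = Vec A (2 ℕ.+ m ℕ.* 2)

      ∣V∣ : ∀ m → ∣ V m ∣ ≡ q * q * power m * power m
      ∣V∣ m = trans (trans (sym (*-identityʳ _)) (sym (∑-const 1#))) (go m)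
        where
        go : ∀ m → ∑ (λ (v : V m) → 1#) ≡ q * q * power m * power m
        step : ∀ n u → ∑ (λ (v : Vec A n) → 1#) ≡ u → ∑ (λ (v : Vec A (2 ℕ.+ n)) → 1#) ≡ q * (q * u)
        step n u e = trans (∑-cons _) (trans (∑-const _) (cong (q *_) (trans (∑-cons {n} (λ _ → 1#)) (trans (∑-const _) (cong (q *_) e)))))
        go zero    = trans (step 0 1# (∑-nil (λ _ → 1#))) (solve 1 (λ q → q :* (q :* con (pos 1)) := q :* q :* con (pos 1) :* con (pos 1)) refl q)
        go (suc m) = trans (step (2 ℕ.+ m ℕ.* 2) _ (go m))
          (solve 2 (λ q p → q :* (q :* (q :* q :* p :* p)) := q :* q :* (q :* p) :* (q :* p)) refl q (power m))

      -- Each further hyperbolic pair spreads the distribution uniformly except for its excess at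
      -- zero, so the sign ε of the binary form survives unchanged.
      ∑-κ-power : ∀ m (ψ : A → Num) → ∑ (λ (z : V m) → ψ (κ R f m (lookup z))) ≡
                  (q * power m * power m - ε * power m) * ∑ ψ + ε * q * power m * ψ 0ᴬ
      ∑-κ-power zero ψ = begin
        ∑ (λ (z : V 0) → ψ (κ R f 0 (lookup z)))        ≡⟨ trans (∑-cons _) (∑-cong λ x → trans (∑-cons _) (∑-cong λ y → ∑-nil _)) ⟩
        ∑ (λ x → ∑ λ y → ψ (value x y))                 ≡⟨ ∑-value ψ ⟩
        (q - ε) * ∑ ψ + ε * q * ψ 0ᴬ                    ≡⟨ (solve 4 (λ q ε S o → (q :- ε) :* S :+ ε :* q :* o := (q :* con (pos 1) :* con (pos 1) :- ε :* con (pos 1)) :* S :+ ε :* q :* con (pos 1) :* o) refl q ε (∑ ψ) (ψ 0ᴬ)) ⟩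
        (q * 1# * 1# - ε * 1#) * ∑ ψ + ε * q * 1# * ψ 0ᴬ  ∎
      ∑-κ-power (suc m) ψ = begin
        ∑ (λ (z : V (suc m)) → ψ (κ R f (suc m) (lookup z)))
          ≡⟨ trans (∑-cons _) (∑-cong λ x → ∑-cons _) ⟩
        ∑ (λ x → ∑ λ y → ∑ λ (z : V m) → ψ (x ⊗ y ⊕ κ R f m (lookup z)))
          ≡⟨ trans (∑-cong λ x → ∑-swap _) (∑-swap _) ⟩
        ∑ (λ (z : V m) → ∑ λ x → ∑ λ y → ψ (x ⊗ y ⊕ κ R f m (lookup z)))
          ≡⟨ ∑-cong (λ z → trans (∑∑-product (λ k → ψ (k ⊕ κ R f m (lookup z))))
               (cong₂ (λ u v → q * ψ u + (q - 1#) * v) (solveᴬ 1 (λ k → conᴬ (pos 0) :⊕ k :≣ k) refl (κ R f m (lookup z))) (∑-translateʳ ψ _))) ⟩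
        ∑ (λ (z : V m) → q * ψ (κ R f m (lookup z)) + (q - 1#) * ∑ ψ)
          ≡⟨ trans (∑-+ _ _) (cong₂ _+_ (trans (∑-* q _) (cong (q *_) (∑-κ-power m ψ))) (trans (∑-const _) (cong (_* ((q - 1#) * ∑ ψ)) (∣V∣ m)))) ⟩
        q * ((q * P * P - ε * P) * ∑ ψ + ε * q * P * ψ 0ᴬ) + q * q * P * P * ((q - 1#) * ∑ ψ)
          ≡⟨ (solve 5 (λ q ε P S o → q :* ((q :* P :* P :- ε :* P) :* S :+ ε :* q :* P :* o) :+ q :* q :* P :* P :* ((q :- con (pos 1)) :* S) := (q :* (q :* P) :* (q :* P) :- ε :* (q :* P)) :* S :+ ε :* q :* (q :* P) :* o) refl q ε P (∑ ψ) (ψ 0ᴬ)) ⟩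
        (q * (q * P) * (q * P) - ε * (q * P)) * ∑ ψ + ε * q * (q * P) * ψ 0ᴬ ∎
        where P = power m

      q≢0 : q ≢ 0#
      q≢0 e = nonempty (fromℕ-injective (Finite.size finite) 0 e)
        where
        nonempty : Finite.size finite ≢ 0
        nonempty size≡0 with subst Fin size≡0 (Finite.index finite 0ᴬ)
        ... | ()

      -- The space has at least one hyperbolic pair, hence q^(m-1) is the power one below and needs
      -- no division.
      distribution : ∀ m → NormDistribution N 𝔽 (space (suc m))
      distribution m = record
        { q≢0  = q≢0
        ; ε    = ε
        ; M    = power m
        ; ∣V∣≡ = trans (∣V∣ (suc m)) (solve 2 (λ q p → q :* q :* (q :* p) :* (q :* p) := q :* q :* q :* q :* p :* p) refl q (power m))
        ; ∑-κ  = λ ψ → trans (∑-κ-power (suc m) ψ)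
            (solve 5 (λ q ε P S o → (q :* (q :* P) :* (q :* P) :- ε :* (q :* P)) :* S :+ ε :* q :* (q :* P) :* o := (q :* q :* q :* P :* P :- ε :* q :* P) :* S :+ ε :* q :* q :* P :* o) refl q ε (power m) (∑ ψ) (ψ 0ᴬ))
        }

    -- The substitution is a bijection of pairs with inverse given by the adjugate matrix divided by
    -- the determinant; pairs are encoded as vectors of length two.
    ∑-linear : ∀ {s t s′ t′} → s ⊗ t′ ⊝ t ⊗ s′ ≢ 0ᴬ → ∀ (φ : A → A → Num) →
      ∑ (λ u → ∑ λ v → φ u v) ≡ ∑ (λ x → ∑ λ y → φ (s ⊗ x ⊕ t ⊗ y) (s′ ⊗ x ⊕ t′ ⊗ y))
    ∑-linear {s} {t} {s′} {t′} det≢0 φ = begin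
      ∑ (λ u → ∑ λ v → φ u v)                   ≡⟨ sym (pairs Φ) ⟩
      ∑ Φ                                       ≡⟨ sym (∑-bij Φ (matrix s t s′ t′) (matrix (d ⊗ t′) (⊖ (d ⊗ t)) (⊖ (d ⊗ s′)) (d ⊗ s)) there back) ⟩
      ∑ (λ v → Φ (matrix s t s′ t′ v))          ≡⟨ pairs _ ⟩
      ∑ (λ x → ∑ λ y → φ (s ⊗ x ⊕ t ⊗ y) (s′ ⊗ x ⊕ t′ ⊗ y))  ∎
      where
      Φ : Vec A 2 → Num
      Φ (u ∷ v ∷ []) = φ u v
      pairs : ∀ (Ψ : Vec A 2 → Num) → ∑ Ψ ≡ ∑ (λ u → ∑ λ v → Ψ (u ∷ v ∷ []))
      pairs Ψ = trans (∑-cons Ψ) (∑-cong λ u → trans (∑-cons _) (∑-cong λ v → ∑-nil _))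
      matrix : (a b c e : A) → Vec A 2 → Vec A 2
      matrix a b c e (x ∷ y ∷ []) = (a ⊗ x ⊕ b ⊗ y) ∷ (c ⊗ x ⊕ e ⊗ y) ∷ []
      d = proj₁ (inverse _ det≢0)
      unit : ∀ x → (s ⊗ t′ ⊝ t ⊗ s′) ⊗ d ⊗ x ≡ x
      unit x = trans (cong (_⊗ x) (proj₂ (inverse _ det≢0))) (solveᴬ 1 (λ x → conᴬ (pos 1) :⊗ x :≣ x) refl x)
      there : ∀ v → matrix s t s′ t′ (matrix (d ⊗ t′) (⊖ (d ⊗ t)) (⊖ (d ⊗ s′)) (d ⊗ s) v) ≡ v
      there (x ∷ y ∷ []) = cong₂ (λ u v → u ∷ v ∷ [])
        (trans (solveᴬ 7 (λ s t p r d x y → s :⊗ (d :⊗ r :⊗ x :⊕ :⊖ (d :⊗ t) :⊗ y) :⊕ t :⊗ (:⊖ (d :⊗ p) :⊗ x :⊕ d :⊗ s :⊗ y) :≣ (s :⊗ r :⊝ t :⊗ p) :⊗ d :⊗ x) refl s t (s′) (t′) d x y) (unit x))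
        (trans (solveᴬ 7 (λ s t p r d x y → p :⊗ (d :⊗ r :⊗ x :⊕ :⊖ (d :⊗ t) :⊗ y) :⊕ r :⊗ (:⊖ (d :⊗ p) :⊗ x :⊕ d :⊗ s :⊗ y) :≣ (s :⊗ r :⊝ t :⊗ p) :⊗ d :⊗ y) refl s t (s′) (t′) d x y) (unit y))
      back : ∀ v → matrix (d ⊗ t′) (⊖ (d ⊗ t)) (⊖ (d ⊗ s′)) (d ⊗ s) (matrix s t s′ t′ v) ≡ v
      back (x ∷ y ∷ []) = cong₂ (λ u v → u ∷ v ∷ [])
        (trans (solveᴬ 7 (λ s t p r d x y → d :⊗ r :⊗ (s :⊗ x :⊕ t :⊗ y) :⊕ :⊖ (d :⊗ t) :⊗ (p :⊗ x :⊕ r :⊗ y) :≣ (s :⊗ r :⊝ t :⊗ p) :⊗ d :⊗ x) refl s t (s′) (t′) d x y) (unit x))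
        (trans (solveᴬ 7 (λ s t p r d x y → :⊖ (d :⊗ p) :⊗ (s :⊗ x :⊕ t :⊗ y) :⊕ d :⊗ s :⊗ (p :⊗ x :⊕ r :⊗ y) :≣ (s :⊗ r :⊝ t :⊗ p) :⊗ d :⊗ y) refl s t (s′) (t′) d x y) (unit y))

    -- Two independent linear factors can be taken as new coordinates, which makes the form a
    -- product of variables.
    ∑-reducible : ∀ {s t s′ t′} → α ≡ s ⊗ s′ → β ≡ s ⊗ t′ ⊕ t ⊗ s′ → γ ≡ t ⊗ t′ → s ⊗ t′ ⊝ t ⊗ s′ ≢ 0ᴬ →
      ∀ (ψ : A → Num) → ∑ (λ x → ∑ λ y → ψ (value x y)) ≡ (q - 1#) * ∑ ψ + 1# * q * ψ 0ᴬ
    ∑-reducible {s} {t} {s′} {t′} α≡ β≡ γ≡ det≢0 ψ = begin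
      ∑ (λ x → ∑ λ y → ψ (value x y))
        ≡⟨ ∑-cong (λ x → ∑-cong λ y → cong ψ (trans
             (cong₂ (λ a c → a ⊗ (x ⊗ x) ⊕ c ⊗ (x ⊗ y) ⊕ γ ⊗ (y ⊗ y)) α≡ β≡)
             (trans (cong (λ c → s ⊗ s′ ⊗ (x ⊗ x) ⊕ (s ⊗ t′ ⊕ t ⊗ s′) ⊗ (x ⊗ y) ⊕ c ⊗ (y ⊗ y)) γ≡)
               (solveᴬ 6 (λ s t p r x y → s :⊗ p :⊗ (x :⊗ x) :⊕ (s :⊗ r :⊕ t :⊗ p) :⊗ (x :⊗ y) :⊕ t :⊗ r :⊗ (y :⊗ y) :≣ (s :⊗ x :⊕ t :⊗ y) :⊗ (p :⊗ x :⊕ r :⊗ y)) refl s t (s′) (t′) x y)))) ⟩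
      ∑ (λ x → ∑ λ y → ψ ((s ⊗ x ⊕ t ⊗ y) ⊗ (s′ ⊗ x ⊕ t′ ⊗ y)))
        ≡⟨ sym (∑-linear det≢0 (λ u v → ψ (u ⊗ v))) ⟩
      ∑ (λ u → ∑ λ v → ψ (u ⊗ v))
        ≡⟨ ∑∑-product ψ ⟩
      q * ψ 0ᴬ + (q - 1#) * ∑ ψ
        ≡⟨ (solve 3 (λ q S o → q :* o :+ (q :- con (pos 1)) :* S := (q :- con (pos 1)) :* S :+ con (pos 1) :* q :* o) refl q (∑ ψ) (ψ 0ᴬ)) ⟩
      (q - 1#) * ∑ ψ + 1# * q * ψ 0ᴬ ∎

    ∑-irreducible : ¬ Reducible → ∀ (ψ : A → Num) →
      ∑ (λ x → ∑ λ y → ψ (value x y)) ≡ (q - - 1#) * ∑ ψ + - 1# * q * ψ 0ᴬ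
    ∑-irreducible irreducible ψ = begin
      ∑ (λ x → ∑ λ y → ψ (value x y))            ≡⟨ ∑-swap _ ⟩
      ∑ (λ y → ∑ λ x → ψ (value x y))            ≡⟨ ∑∑-binary ψ α≢0 D≢0 ⟩
      (q - χ D) * ∑ ψ + χ D * (q * ψ 0ᴬ)         ≡⟨ cong (λ u → (q - u) * ∑ ψ + u * (q * ψ 0ᴬ)) (χ-class (nonsquare D-nonsquare)) ⟩
      (q - - 1#) * ∑ ψ + - 1# * (q * ψ 0ᴬ)       ≡⟨ cong ((q - - 1#) * ∑ ψ +_) (sym (*-assoc _ _ _)) ⟩
      (q - - 1#) * ∑ ψ + - 1# * q * ψ 0ᴬ         ∎
      where
      D = β ⊗ β ⊝ 4ᴬ ⊗ (α ⊗ γ)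
      α≢0 : α ≢ 0ᴬ
      -- For α = 0 the form is y (β x + γ y).
      α≢0 α≡0 = irreducible (0ᴬ , 1ᴬ , β , γ , trans α≡0 (solveᴬ 1 (λ β → conᴬ (pos 0) :≣ conᴬ (pos 0) :⊗ β) refl β) , (solveᴬ 2 (λ β γ → β :≣ conᴬ (pos 0) :⊗ γ :⊕ conᴬ (pos 1) :⊗ β) refl β γ) , (solveᴬ 1 (λ γ → γ :≣ conᴬ (pos 1) :⊗ γ) refl γ))
      -- If the discriminant is e², then 4α times the form is the difference of the squares of 2αx +
      -- βy and e y. This gives the two factors, one of them divided by 4α.
      D-nonsquare : ∀ e → e ⊗ e ≢ D
      D-nonsquare e e²≡D = irreducible
        ( 2ᴬ ⊗ α ⊗ u , (β ⊝ e) ⊗ u , 2ᴬ ⊗ α , β ⊕ e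
        , trans (sym (unit α)) (solveᴬ 2 (λ α u → conᴬ (pos 4) :⊗ α :⊗ u :⊗ α :≣ conᴬ (pos 2) :⊗ α :⊗ u :⊗ (conᴬ (pos 2) :⊗ α)) refl α u)
        , trans (sym (unit β)) (solveᴬ 4 (λ α β u e → conᴬ (pos 4) :⊗ α :⊗ u :⊗ β :≣ conᴬ (pos 2) :⊗ α :⊗ u :⊗ (β :⊕ e) :⊕ (β :⊝ e) :⊗ u :⊗ (conᴬ (pos 2) :⊗ α)) refl α β u e)
        , trans (sym (unit γ)) (trans (solveᴬ 4 (λ α β γ u → conᴬ (pos 4) :⊗ α :⊗ u :⊗ γ :≣ (β :⊗ β :⊝ (β :⊗ β :⊝ conᴬ (pos 4) :⊗ (α :⊗ γ))) :⊗ u) refl α β γ u)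
            (trans (cong (λ w → (β ⊗ β ⊝ w) ⊗ u) (sym e²≡D)) (solveᴬ 3 (λ β e u → (β :⊗ β :⊝ e :⊗ e) :⊗ u :≣ (β :⊝ e) :⊗ u :⊗ (β :⊕ e)) refl β e u))))
        where
        u = proj₁ (inverse (4ᴬ ⊗ α) (⊗-≢0 4≢0 α≢0))
        unit : ∀ x → 4ᴬ ⊗ α ⊗ u ⊗ x ≡ x
        unit x = trans (cong (_⊗ x) (proj₂ (inverse (4ᴬ ⊗ α) (⊗-≢0 4≢0 α≢0)))) (solveᴬ 1 (λ x → conᴬ (pos 1) :⊗ x :≣ x) refl x)
      D≢0 : D ≢ 0ᴬ
      D≢0 D≡0 = D-nonsquare 0ᴬ (trans (solveᴬ 0 (conᴬ (pos 0) :⊗ conᴬ (pos 0) :≣ conᴬ (pos 0)) refl) (sym D≡0))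

-- A copy of the field on a type with propositional equality

module FieldModel where

  open import Algebra.Bundles using (CommutativeRing; RawRing)
  open import Algebra.Morphism.Structures using (IsRingMonomorphism)
  import Algebra.Morphism.RingMonomorphism as RingMonomorphism
  open import Data.Fin.Base as Fin using (Fin)
  import Data.Fin.Properties as Fin
  open import Data.Integer.Base using () renaming (+_ to pos)
  open import Data.Nat.Base as ℕ using (ℕ; zero; suc)
  import Data.Nat.Properties as ℕ
  open import Data.Nat.Divisibility using (_∣_; divides)
  open import Data.Product.Base using (_×_; _,_; proj₁; proj₂)
  open import Function.Base using (_∘_)
  open import Function.Bundles using (Inverse)
  open import Level using (Level; 0ℓ; _⊔_)
  import Level
  open import Relation.Binary.Definitions using (tri<; tri≈; tri>)
  open import Relation.Binary.PropositionalEquality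
  open import Relation.Nullary using (¬_; Dec; contradiction)
  open import Relation.Nullary.Decidable using (map′)
  open DiscreteRings
  open FiniteTypes
  open FiniteFields
  open import Defs using (BinaryForm; module BinaryForm; κ; IsField; HasSize)

  module Parity (N : NumberRing) where

    open NumberRing N renaming (Carrier to Num)
    open Sums (NumberRing.discreteRing N)
    open import Algebra.Properties.Semiring.Mult.TCOptimised semiring using (×-homo-+)
    open ≡-Reasoning

    -- Such an involution exchanges the elements with x < f x and those with f x < x. It serves to
    -- exclude characteristic two, where x ↦ x + 1 would be of this kind on a field of odd order.
    involution-even : ∀ {n} (f : Fin n → Fin n) → (∀ x → f (f x) ≡ x) → (∀ x → f x ≢ x) → 2 ∣ n
    involution-even {n} f ff f≢ = divides below (trans n≡ (trans (cong (below ℕ.+_) (sym (ℕ.+-identityʳ below))) (ℕ.*-comm 2 below)))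
      where
      below = count (λ x → x Fin.<? f x)
      S = ∑ (λ x → ⟦ x Fin.<? f x ⟧)
      split : ∀ x → 1# ≡ ⟦ x Fin.<? f x ⟧ + ⟦ f x Fin.<? x ⟧
      split x with Fin.<-cmp x (f x)
      ... | tri< x<fx _ fx≮x = trans (solve 0 (con (pos 1) := con (pos 1) :+ con (pos 0)) refl) (sym (cong₂ _+_ (⟦⟧-yes (x Fin.<? f x) x<fx) (⟦⟧-no (f x Fin.<? x) fx≮x)))
      ... | tri≈ _ e _       = contradiction (sym e) (f≢ x)
      ... | tri> x≮fx _ fx<x = trans (solve 0 (con (pos 1) := con (pos 0) :+ con (pos 1)) refl) (sym (cong₂ _+_ (⟦⟧-no (x Fin.<? f x) x≮fx) (⟦⟧-yes (f x Fin.<? x) fx<x)))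
      S≡ : S ≡ fromℤ (pos below)
      S≡ = ∑-⟦⟧ (λ x → x Fin.<? f x)
      n≡ : n ≡ below ℕ.+ below
      n≡ = fromℕ-injective _ _ (begin
        fromℤ (pos n)                                            ≡⟨ sym (trans (∑-const {Fin n} 1#) (*-identityʳ _)) ⟩
        ∑ (λ (x : Fin n) → 1#)                                   ≡⟨ ∑-cong split ⟩
        ∑ (λ x → ⟦ x Fin.<? f x ⟧ + ⟦ f x Fin.<? x ⟧)            ≡⟨ ∑-+ _ _ ⟩
        S + ∑ (λ x → ⟦ f x Fin.<? x ⟧)                           ≡⟨ cong (S +_) (sym (∑-bij (λ x → ⟦ f x Fin.<? x ⟧) f f ff ff)) ⟩
        S + ∑ (λ x → ⟦ f (f x) Fin.<? f x ⟧)                     ≡⟨ cong (S +_) (∑-cong λ x → cong (λ y → ⟦ y Fin.<? f x ⟧) (ff x)) ⟩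
        S + S                                                    ≡⟨ cong₂ _+_ S≡ S≡ ⟩
        fromℤ (pos below) + fromℤ (pos below)                    ≡⟨ sym (×-homo-+ 1# below below) ⟩
        fromℤ (pos (below ℕ.+ below))                            ∎)

  -- An isomorphism of F with an `OddField`. The geometry refers to F and its setoid equality, the
  -- counting to the copy; norms, polar forms and discriminants are carried across by `to`.
  record Model {a ℓ} (F : CommutativeRing a ℓ) : Set (a ⊔ ℓ ⊔ Level.suc 0ℓ) where
    private
      module F = CommutativeRing F
    field
      oddField : OddField
    open OddField oddField using (_⊕_; _⊗_; ⊖_; 0ᴬ; 1ᴬ) renaming (Carrier to A)
    field
      to      : F.Carrier → A
      from    : A → F.Carrier
      to-cong : ∀ {x y} → x F.≈ y → to x ≡ to y
      to-from : ∀ x → to (from x) ≡ x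
      from-to : ∀ x → from (to x) F.≈ x
      to-+    : ∀ x y → to (x F.+ y) ≡ to x ⊕ to y
      to-*    : ∀ x y → to (x F.* y) ≡ to x ⊗ to y
      to-neg  : ∀ x → to (F.- x) ≡ ⊖ to x
      to-0    : to F.0# ≡ 0ᴬ
      to-1    : to F.1# ≡ 1ᴬ

  module FieldModel (N : NumberRing) {a ℓ} (F : CommutativeRing a ℓ) (F-field : IsField F)
                    {order : ℕ} (hasSize : HasSize (CommutativeRing.setoid F) order) (odd : ¬ (2 ∣ order)) where

    private
      module F = CommutativeRing F
    open Inverse hasSize using (to; from; to-cong; from-cong) renaming (strictlyInverseˡ to to-from; strictlyInverseʳ to from-to)

    private
      rawRing : RawRing 0ℓ 0ℓ
      rawRing = record
        { Carrier = Fin order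
        ; _≈_     = _≡_
        ; _+_     = λ x y → to (from x F.+ from y)
        ; _*_     = λ x y → to (from x F.* from y)
        ; -_      = λ x → to (F.- from x)
        ; 0#      = to F.0#
        ; 1#      = to F.1#
        }

      from-monomorphism : IsRingMonomorphism rawRing F.rawRing from
      from-monomorphism = record
        { isRingHomomorphism = record
          { isSemiringHomomorphism = record
            { isNearSemiringHomomorphism = record
              { +-isMonoidHomomorphism = record
                { isMagmaHomomorphism = record
                  { isRelHomomorphism = record { cong = from-cong }
                  ; homo = λ x y → from-to _ }
                ; ε-homo = from-to _ }
              ; *-homo = λ x y → from-to _ }
            ; 1#-homo = from-to _ }
          ; -‿homo = λ x → from-to _ }
        ; injective = λ {x} {y} e → trans (sym (to-from x)) (trans (to-cong e) (to-from y))
        }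

      discreteRing : DiscreteRing
      discreteRing = record { isCommutativeRing = RingMonomorphism.isCommutativeRing from-monomorphism F.isCommutativeRing }

    open DiscreteRing discreteRing hiding (Carrier)

    to-+ : ∀ x y → to (x F.+ y) ≡ to x + to y
    to-+ x y = to-cong (F.sym (F.+-cong (from-to x) (from-to y)))

    to-* : ∀ x y → to (x F.* y) ≡ to x * to y
    to-* x y = to-cong (F.sym (F.*-cong (from-to x) (from-to y)))

    to-neg : ∀ x → to (F.- x) ≡ - to x
    to-neg x = to-cong (F.sym (F.-‿cong (from-to x)))

    to-≡0 : ∀ {x} → to x ≡ 0# → x F.≈ F.0#
    to-≡0 {x} e = F.trans (F.sym (from-to x)) (F.trans (from-cong e) (from-to F.0#))

    private
      1≢0′ : 1# ≢ 0#
      1≢0′ e = IsField.0≉1 F-field (F.sym (to-≡0 e))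

      open IntegerSolver commutativeRing using (solve; con; _:+_; _:*_; _:=_)

    oddField : OddField
    oddField = record
      { discreteRing = discreteRing
      ; 1≢0          = 1≢0′
      -- If 1 + 1 = 0, adding 1 is an involution without fixed points, so the order would be even.
      ; 2≢0          = λ 2≡0 → odd (Parity.involution-even N (_+ 1#)
          (λ x → trans (+-assoc x 1# 1#) (trans (cong (λ z → x + z) 2≡0) (+-identityʳ x)))
          (λ x e → 1≢0′ (trans (trans (sym (+-identityˡ 1#)) (trans (cong (_+ 1#) (sym (-‿inverseˡ x))) (+-assoc _ _ _)))
                     (trans (cong (λ z → - x + z) e) (-‿inverseˡ x)))))
      ; inverse      = λ x x≢0 →
          let y , xy≈1 = IsField.inverse F-field (from x) (λ e → x≢0 (trans (sym (to-from x)) (to-cong e))) in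
          to y , trans (to-cong (F.*-congˡ (from-to y))) (to-cong xy≈1)
      }

    model : Model F
    model = record
      { oddField = oddField
      ; to      = to
      ; from    = from
      ; to-cong = to-cong
      ; to-from = to-from
      ; from-to = from-to
      ; to-+    = to-+
      ; to-*    = to-*
      ; to-neg  = to-neg
      ; to-0    = refl
      ; to-1    = refl
      }

  module Transfer {a ℓ} (F : CommutativeRing a ℓ) (F-field : IsField F) (model : Model F) where

    private
      module F = CommutativeRing F
    open Model model public
    open DiscreteRing (OddField.discreteRing oddField) hiding (Carrier)

    from-cong : ∀ {x y} → x ≡ y → from x F.≈ from y
    from-cong refl = F.refl

    to-≡0 : ∀ {x} → to x ≡ 0# → x F.≈ F.0#
    to-≡0 {x} e = F.trans (F.sym (from-to x)) (F.trans (from-cong (trans e (sym to-0))) (from-to F.0#))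

    from-+ : ∀ x y → from (x + y) F.≈ from x F.+ from y
    from-+ x y = F.trans (from-cong (sym (trans (to-+ _ _) (cong₂ _+_ (to-from x) (to-from y))))) (from-to _)

    from-* : ∀ x y → from (x * y) F.≈ from x F.* from y
    from-* x y = F.trans (from-cong (sym (trans (to-* _ _) (cong₂ _*_ (to-from x) (to-from y))))) (from-to _)

    infix 4 _≈?_
    _≈?_ : ∀ x y → Dec (x F.≈ y)
    x ≈? y = map′ (λ e → F.trans (F.sym (from-to x)) (F.trans (from-cong e) (from-to y))) to-cong (to x ≟ to y)

    module _ (f : BinaryForm F) where

      open BinaryForm f

      form : BinaryForm commutativeRing
      form = record { α = to α ; β = to β ; γ = to γ }

      private
        module form = BinaryForm form

      to-value : ∀ x y → to (value x y) ≡ form.value (to x) (to y)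
      to-value x y = trans (to-+ _ _) (cong₂ _+_ (trans (to-+ _ _) (cong₂ _+_ (to-** α x x) (to-** β x y))) (to-** γ y y))
        where
        to-** : ∀ u v w → to (u F.* (v F.* w)) ≡ to u * (to v * to w)
        to-** u v w = trans (to-* u _) (cong (to u *_) (to-* v w))

      to-κ : ∀ m x → to (κ F f m x) ≡ κ commutativeRing form m (to ∘ x)
      to-κ zero    x = to-value _ _
      to-κ (suc m) x = trans (to-+ _ _) (cong₂ _+_ (to-* _ _) (to-κ m _))

      to-polarForm : ∀ m x y → to (PolarForms.polarForm F f m x y) ≡ PolarForms.polarForm commutativeRing form m (to ∘ x) (to ∘ y)
      to-polarForm zero x y = trans (to-+ _ _) (cong₂ _+_ (trans (to-+ _ _) (cong₂ _+_
          (to-2 _ _ (trans (to-* _ _) (cong (to α *_) (to-* _ _))))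
          (trans (to-* _ _) (cong (to β *_) (trans (to-+ _ _) (cong₂ _+_ (to-* _ _) (to-* _ _)))))))
          (to-2 _ _ (trans (to-* _ _) (cong (to γ *_) (to-* _ _)))))
        where
        to-2 : ∀ u v → to u ≡ v → to (PolarForms.2# F f F.* u) ≡ PolarForms.2# commutativeRing form * v
        to-2 u v e = trans (to-* _ _) (cong₂ _*_ (trans (to-+ _ _) (cong₂ _+_ to-1 to-1)) e)
      to-polarForm (suc m) x y = trans (to-+ _ _) (cong₂ _+_ (trans (to-+ _ _) (cong₂ _+_ (to-* _ _) (to-* _ _))) (to-polarForm m _ _))

      to-discriminant : ∀ m x y → to (PolarForms.discriminant F f m x y) ≡ PolarForms.discriminant commutativeRing form m (to ∘ x) (to ∘ y)
      to-discriminant m x y = trans (to-+ _ _) (cong₂ _+_ (trans (to-* _ _) (cong₂ _*_ (to-polarForm m x y) (to-polarForm m x y)))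
        (trans (to-neg _) (cong -_ (trans (to-* _ _) (cong₂ _*_ to-4 (trans (to-* _ _) (cong₂ _*_ (to-κ m x) (to-κ m y))))))))
        where
        to-4 : to (PolarForms.4# F f) ≡ PolarForms.4# commutativeRing form
        to-4 = trans (to-+ _ _) (cong₂ _+_ (trans (to-+ _ _) (cong₂ _+_ (trans (to-+ _ _) (cong₂ _+_ to-1 to-1)) to-1)) to-1)

      form-nonDegenerate : NonDegenerate → form.NonDegenerate
      form-nonDegenerate nonDegenerate x y value≡0 polar≡0 =
        let e , e′ = nonDegenerate (from x) (from y) (to-≡0 (trans (to-value _ _) (trans (cong₂ form.value (to-from x) (to-from y)) value≡0)))
                       (λ x′ y′ → to-≡0 (trans (to-polar _ _ x′ y′) (trans (cong₂ (λ u v → form.polar u v (to x′) (to y′)) (to-from x) (to-from y)) (polar≡0 _ _))))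
        in trans (sym (to-from x)) (trans (to-cong e) to-0) , trans (sym (to-from y)) (trans (to-cong e′) to-0)
        where
        to-polar : ∀ x y x′ y′ → to (polar x y x′ y′) ≡ form.polar (to x) (to y) (to x′) (to y′)
        to-polar x y x′ y′ = trans (to-+ _ _) (cong₂ _+_
          (trans (to-+ _ _) (cong₂ _+_ (trans (to-value _ _) (cong₂ form.value (to-+ _ _) (to-+ _ _))) (trans (to-neg _) (cong -_ (to-value _ _)))))
          (trans (to-neg _) (cong -_ (to-value _ _))))

      form-irreducible : ¬ Reducible → ¬ form.Reducible
      form-irreducible irreducible (s , t , s′ , t′ , α≡ , β≡ , γ≡) =
        irreducible (from s , from t , from s′ , from t′ , lift α≡ (from-* _ _)
          , lift β≡ (F.trans (from-+ _ _) (F.+-cong (from-* _ _) (from-* _ _))) , lift γ≡ (from-* _ _))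
        where
        lift : ∀ {u v w} → to u ≡ v → from v F.≈ w → u F.≈ w
        lift e e′ = F.trans (F.sym (from-to _)) (F.trans (from-cong e) e′)

      -- Were the two linear factors proportional, the zero of one of them would be radical.
      determinant≢0 : NonDegenerate → ∀ {s t s′ t′} → α F.≈ s F.* s′ → β F.≈ s F.* t′ F.+ t F.* s′ → γ F.≈ t F.* t′ →
                      to s * to t′ - to t * to s′ ≢ 0#
      determinant≢0 nonDegenerate {s} {t} {s′} {t′} α≈ β≈ γ≈ det≡0 =
        -- Once s = t = 0, the form vanishes identically, so the vector (1, 0) is radical and would
        -- have to be zero.
        IsField.0≉1 F-field (F.sym (proj₁ (nonDegenerate F.1# F.0# (F.trans (value≈ _ _) (isZero _ _ s≈0 t≈0)) λ x y →
          F.trans (polar≈ _ _ _ _) (F.trans (F.+-cong (isZero _ _ s≈0 t≈0) (isZero _ _ s≈0 t≈0)) (F.+-identityˡ _)))))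
        where
        open IntegerSolver F using () renaming (solve to solveᶠ; con to conᶠ; _:+_ to infixl 7 _:+ᶠ_; _:*_ to infixl 8 _:*ᶠ_; _:-_ to infixl 7 _:-ᶠ_; :-_ to infix 9 :-ᶠ_; _:=_ to infix 4 _:=ᶠ_)
        L L′ : F.Carrier → F.Carrier → F.Carrier
        L  x y = s F.* x F.+ t F.* y
        L′ x y = s′ F.* x F.+ t′ F.* y
        det≈0 : s F.* t′ F.- t F.* s′ F.≈ F.0#
        det≈0 = to-≡0 (trans (to-+ _ _) (trans (cong₂ _+_ (to-* _ _) (trans (to-neg _) (cong -_ (to-* _ _)))) det≡0))
        value≈ : ∀ x y → value x y F.≈ L x y F.* L′ x y
        value≈ x y = F.trans (F.+-cong (F.+-cong (F.*-congʳ α≈) (F.*-congʳ β≈)) (F.*-congʳ γ≈))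
          (solveᶠ 6 (λ s t p r x y → s :*ᶠ p :*ᶠ (x :*ᶠ x) :+ᶠ (s :*ᶠ r :+ᶠ t :*ᶠ p) :*ᶠ (x :*ᶠ y) :+ᶠ t :*ᶠ r :*ᶠ (y :*ᶠ y) :=ᶠ (s :*ᶠ x :+ᶠ t :*ᶠ y) :*ᶠ (p :*ᶠ x :+ᶠ r :*ᶠ y)) F.refl s t (s′) (t′) x y)
        polar≈ : ∀ x y x′ y′ → polar x y x′ y′ F.≈ L x y F.* L′ x′ y′ F.+ L x′ y′ F.* L′ x y
        polar≈ x y x′ y′ = F.trans (F.+-cong (F.+-cong (value≈ _ _) (F.-‿cong (value≈ _ _))) (F.-‿cong (value≈ _ _)))
          (solveᶠ 8 (λ s t p r x y z w → (s :*ᶠ (x :+ᶠ z) :+ᶠ t :*ᶠ (y :+ᶠ w)) :*ᶠ (p :*ᶠ (x :+ᶠ z) :+ᶠ r :*ᶠ (y :+ᶠ w)) :-ᶠ (s :*ᶠ x :+ᶠ t :*ᶠ y) :*ᶠ (p :*ᶠ x :+ᶠ r :*ᶠ y) :-ᶠ (s :*ᶠ z :+ᶠ t :*ᶠ w) :*ᶠ (p :*ᶠ z :+ᶠ r :*ᶠ w) :=ᶠ (s :*ᶠ x :+ᶠ t :*ᶠ y) :*ᶠ (p :*ᶠ z :+ᶠ r :*ᶠ w) :+ᶠ (s :*ᶠ z :+ᶠ t :*ᶠ w) :*ᶠ (p :*ᶠ x :+ᶠ r :*ᶠ y)) F.refl s t (s′) (t′) x y (x′) (y′))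
        radical : ∀ x y → L x y F.≈ F.0# → L′ x y F.≈ F.0# → x F.≈ F.0# × y F.≈ F.0#
        radical x y e e′ = nonDegenerate x y (F.trans (value≈ x y) (F.trans (F.*-congʳ e) (F.zeroˡ _)))
          λ x′ y′ → F.trans (polar≈ x y x′ y′) (F.trans (F.+-cong (F.trans (F.*-congʳ e) (F.zeroˡ _)) (F.trans (F.*-congˡ e′) (F.zeroʳ _))) (F.+-identityˡ _))
        zeros : t F.≈ F.0# × F.- s F.≈ F.0#
        zeros = radical t (F.- s) (solveᶠ 2 (λ s t → s :*ᶠ t :+ᶠ t :*ᶠ :-ᶠ s :=ᶠ conᶠ (pos 0)) F.refl s t)
          (F.trans (solveᶠ 4 (λ s t p r → p :*ᶠ t :+ᶠ r :*ᶠ :-ᶠ s :=ᶠ :-ᶠ (s :*ᶠ r :-ᶠ t :*ᶠ p)) F.refl s t (s′) (t′)) (F.trans (F.-‿cong det≈0) (solveᶠ 0 (:-ᶠ conᶠ (pos 0) :=ᶠ conᶠ (pos 0)) F.refl )))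
        s≈0 : s F.≈ F.0#
        s≈0 = F.trans (solveᶠ 1 (λ s → s :=ᶠ :-ᶠ :-ᶠ s) F.refl s) (F.trans (F.-‿cong (proj₂ zeros)) (solveᶠ 0 (:-ᶠ conᶠ (pos 0) :=ᶠ conᶠ (pos 0)) F.refl ))
        t≈0 : t F.≈ F.0#
        t≈0 = proj₁ zeros
        isZero : ∀ x y {u} → s F.≈ F.0# → t F.≈ F.0# → (s F.* x F.+ t F.* y) F.* u F.≈ F.0#
        isZero x y {u} e e′ = F.trans (F.*-congʳ (F.trans (F.+-cong (F.*-congʳ e) (F.*-congʳ e′)) (solveᶠ 2 (λ x y → conᶠ (pos 0) :*ᶠ x :+ᶠ conᶠ (pos 0) :*ᶠ y :=ᶠ conᶠ (pos 0)) F.refl x y))) (F.zeroˡ u)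

-- Sizes of finite setoids

module FiniteSetoids where

  open import Data.Fin.Base using (Fin; zero; suc)
  open import Data.Fin.Permutation using (↔⇒≡)
  open import Data.Fin.Properties using (any?)
  open import Data.Nat.Base using (zero; suc)
  open import Data.Product.Base using (∃; ∃-syntax; _×_; _,_; proj₁; proj₂)
  open import Function.Base using (_∘_)
  open import Function.Bundles using (Inverse)
  import Function.Construct.Composition as Composition
  import Function.Construct.Symmetry as Symmetry
  open import Relation.Binary.Bundles using (Setoid)
  open import Relation.Binary.Definitions using (Decidable)
  open import Relation.Binary.PropositionalEquality as ≡ using (_≡_; cong)
  open import Relation.Nullary using (Dec; yes; no; contradiction)
  open import Defs using (HasSize; Restrict)
  open FiniteTypes

  module _ {a ℓ} (S : Setoid a ℓ) where

    open Setoid S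

    HasSize-unique : ∀ {c d} → HasSize S c → HasSize S d → c ≡ d
    HasSize-unique h k = ↔⇒≡ (Composition.inverse (Symmetry.inverse h) k)

    HasSize-enumerate : ∀ {c} (v : Fin c → Carrier) → (∀ i j → v i ≈ v j → i ≡ j) →
                        (∀ z → ∃[ i ] z ≈ v i) → HasSize S c
    HasSize-enumerate v injective surjective = record
      { to        = proj₁ ∘ surjective
      ; from      = v
      ; to-cong   = λ {x} {y} x≈y → injective _ _ (trans (sym (proj₂ (surjective x))) (trans x≈y (proj₂ (surjective y))))
      ; from-cong = λ i≡j → reflexive (cong v i≡j)
      ; inverse   = (λ {i} {x} x≈vi → injective _ _ (trans (sym (proj₂ (surjective x))) x≈vi))
                  , (λ {x} {i} i≡ → trans (reflexive (cong v i≡)) (sym (proj₂ (surjective x))))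
      }

    module _ (_≈?_ : Decidable _≈_) where

      -- Elements equivalent to a later one are dropped from the covering family. This is how points
      -- are enumerated from vectors, of which several represent the same point.
      HasSize-cover : ∀ {n} (g : Fin n → Carrier) → (∀ z → ∃[ i ] z ≈ g i) → ∃ (HasSize S)
      HasSize-cover {n} g cover = let c , v , injective , covers = representatives g in
        c , HasSize-enumerate v injective λ z →
          let i , z≈gi = cover z
              j , gi≈vj = covers i in j , trans z≈gi gi≈vj
        where
        representatives : ∀ {n} (g : Fin n → Carrier) → ∃[ c ] ∃ λ (v : Fin c → Carrier) →
          (∀ i j → v i ≈ v j → i ≡ j) × (∀ i → ∃[ j ] g i ≈ v j)
        representatives {zero} g = 0 , (λ ()) , (λ ()) , λ ()
        representatives {suc n} g with representatives (g ∘ suc)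
        ... | c , v , injective , covers with any? (λ j → g zero ≈? v j)
        ...   | yes old = c , v , injective , λ { zero → old ; (suc i) → covers i }
        ...   | no new  = suc c , v′ , injective′ , λ { zero → zero , refl ; (suc i) → let j , e = covers i in suc j , e }
          where
          v′ : Fin (suc c) → Carrier
          v′ zero    = g zero
          v′ (suc j) = v j
          injective′ : ∀ i j → v′ i ≈ v′ j → i ≡ j
          injective′ zero    zero    e = ≡.refl
          injective′ zero    (suc j) e = contradiction (j , e) new
          injective′ (suc i) zero    e = contradiction (i , sym e) new
          injective′ (suc i) (suc j) e = cong suc (injective i j e)

    -- The size is stated as a `count` over the given enumeration, which is the form that sums of
    -- indicators evaluate.
    HasSize-restrict : ∀ {n p} (h : HasSize S n) {P : Carrier → Set p} (P? : ∀ x → Dec (P x)) →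
      (∀ {x y} → x ≈ y → P x → P y) → HasSize (Restrict S P) (count (λ i → P? (Inverse.from h i)))
    HasSize-restrict h {P} P? respects = HasSize-enumerate′
      where
      open Inverse h
      Q? = λ i → P? (from i)
      HasSize-enumerate′ : HasSize (Restrict S P) (count Q?)
      HasSize-enumerate′ = record
        { to        = proj₁ ∘ chosen
        ; from      = element
        ; to-cong   = λ {x} {y} x≈y → injective _ _ (trans (sym (proj₂ (chosen x))) (trans x≈y (proj₂ (chosen y))))
        ; from-cong = λ { ≡.refl → refl }
        ; inverse   = (λ {i} {x} x≈ → injective _ _ (trans (sym (proj₂ (chosen x))) x≈))
                    , (λ {x} {i} → λ { ≡.refl → sym (proj₂ (chosen x)) })
        }
        where
        element : Fin (count Q?) → ∃ P
        element j = from (proj₁ (select Q? j)) , proj₂ (select Q? j)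
        injective : ∀ i j → from (proj₁ (select Q? i)) ≈ from (proj₁ (select Q? j)) → i ≡ j
        injective i j e = select-injective Q? i j
          (≡.trans (≡.sym (strictlyInverseˡ _)) (≡.trans (to-cong e) (strictlyInverseˡ _)))
        chosen : (z : ∃ P) → ∃[ j ] proj₁ z ≈ from (proj₁ (select Q? j))
        chosen (x , p) =
          let j , e = select-surjective Q? (to x) (respects (sym (strictlyInverseʳ x)) p) in
          j , trans (sym (strictlyInverseʳ x)) (from-cong (≡.sym e))

-- Lines, the quadric and the relation of two points

module Geometry where

  open import Algebra.Bundles using (CommutativeRing)
  open import Data.Bool.Base using (Bool; if_then_else_)
  open import Data.Fin.Base using (Fin; zero; suc)
  open import Data.Fin.Patterns using (0F; 1F; 2F; 3F; 4F; 5F)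
  import Data.Fin.Properties as Fin
  open import Data.Integer.Base using () renaming (+_ to pos)
  open import Data.Nat.Base as ℕ using (ℕ; zero; suc)
  open import Data.Product.Base using (∃; ∃-syntax; _×_; _,_; proj₁; proj₂)
  open import Level using (_⊔_)
  open import Relation.Binary.Bundles using (Setoid)
  open import Relation.Binary.PropositionalEquality
  open import Relation.Nullary using (¬_; Dec; yes; no; does; contradiction; _×-dec_; ¬?)
  open import Relation.Nullary.Decidable using (map′; decidable-stable)
  open DiscreteRings
  open FiniteTypes
  open FiniteFields
  open FieldModel
  open FiniteSetoids
  open import Defs using (BinaryForm; module BinaryForm; κ; IsField; Restrict; PG; Line; Quadric; AnisotropicPoints; LineMeetsQuadricIn; κ·κ≡; QuadraticType; S; S̄; _·ᵗ_; HasType)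
    renaming (R to Relation)

  module Classification (N : NumberRing) {a ℓ} (F : CommutativeRing a ℓ) (F-field : IsField F)
                  (model : Model F) (f : BinaryForm F) (m : ℕ) where

    private
      module F = CommutativeRing F
    open CommutativeRing F using (_+_; _*_; _-_; -_; 0#; 1#; _≈_)
    open IntegerSolver F using () renaming (solve to solveᶠ; con to conᶠ; _:+_ to infixl 7 _:+ᶠ_; _:*_ to infixl 8 _:*ᶠ_; _:-_ to infixl 7 _:-ᶠ_; :-_ to infix 9 :-ᶠ_; _:=_ to infix 4 _:=ᶠ_)
    open PolarForms F f
    open IsField F-field
    open Transfer F F-field model
    open Character N oddField using (class; hasClass; HasClass; class-unique; zero; square; nonsquare)
    open import Relation.Binary.Reasoning.Setoid F.setoid

    private
      n = 1 ℕ.+ m ℕ.* 2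
      P = AnisotropicPoints F F-field f m
      module P = Setoid P
      module PG = Setoid (PG F F-field n)

    Point : Set _
    Point = P.Carrier

    coordinates : Point → Fin (2 ℕ.+ m ℕ.* 2) → F.Carrier
    coordinates ((x , _) , _) = x

    norm : Point → F.Carrier
    norm X = κ F f m (coordinates X)

    polar disc : Point → Point → F.Carrier
    polar X Y = polarForm m (coordinates X) (coordinates Y)
    disc X Y = discriminant m (coordinates X) (coordinates Y)

    cancel : ∀ {x y} → ¬ x ≈ 0# → x * y ≈ 0# → y ≈ 0#
    cancel {x} {y} x≉0 xy≈0 = let x⁻¹ , xx⁻¹≈1 = inverse x x≉0 in begin
      y                ≈⟨ (solveᶠ 1 (λ y → y :=ᶠ conᶠ (pos 1) :*ᶠ y) F.refl y) ⟩
      1# * y           ≈⟨ F.*-congʳ xx⁻¹≈1 ⟨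
      x * x⁻¹ * y      ≈⟨ (solveᶠ 3 (λ x i y → x :*ᶠ i :*ᶠ y :=ᶠ i :*ᶠ (x :*ᶠ y)) F.refl x (x⁻¹) y) ⟩
      x⁻¹ * (x * y)    ≈⟨ F.*-congˡ xy≈0 ⟩
      x⁻¹ * 0#         ≈⟨ F.zeroʳ x⁻¹ ⟩
      0#               ∎

    *-≉0 : ∀ {x y} → ¬ x ≈ 0# → ¬ y ≈ 0# → ¬ x * y ≈ 0#
    *-≉0 x≉0 y≉0 e = y≉0 (cancel x≉0 e)

    *-injective : ∀ {x y z} → ¬ x ≈ 0# → x * y ≈ x * z → y ≈ z
    *-injective {x} {y} {z} x≉0 e = begin
      y              ≈⟨ (solveᶠ 2 (λ y z → y :=ᶠ (y :-ᶠ z) :+ᶠ z) F.refl y z) ⟩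
      (y - z) + z    ≈⟨ F.+-congʳ (cancel x≉0 (F.trans (solveᶠ 3 (λ x y z → x :*ᶠ (y :-ᶠ z) :=ᶠ x :*ᶠ y :-ᶠ x :*ᶠ z) F.refl x y z)
                          (F.trans (F.+-congʳ e) (F.-‿inverseʳ _)))) ⟩
      0# + z         ≈⟨ F.+-identityˡ z ⟩
      z              ∎

    2≉0 : ¬ 2# ≈ 0#
    2≉0 e = OddField.2≢0 oddField (trans (sym (trans (to-+ 1# 1#) (cong₂ (OddField._⊕_ oddField) to-1 to-1))) (trans (to-cong e) to-0))

    squareClass : F.Carrier → SquareClass
    squareClass u = class (to u)

    data HasSquareClass (u : F.Carrier) : SquareClass → Set (a ⊔ ℓ) where
      isZero      : u ≈ 0# → HasSquareClass u zero
      isSquare    : ¬ u ≈ 0# → ∀ s → s * s ≈ u → HasSquareClass u square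
      isNonsquare : (∀ s → ¬ s * s ≈ u) → HasSquareClass u nonsquare

    hasSquareClass : ∀ u → HasSquareClass u (squareClass u)
    hasSquareClass u with class (to u) | hasClass (to u)
    ... | zero      | zero e         = isZero (to-≡0 e)
    ... | square    | square u≢0 s e = isSquare (λ u≈0 → u≢0 (trans (to-cong u≈0) to-0)) (from s)
            (F.trans (F.sym (from-* s s)) (F.trans (from-cong e) (from-to u)))
    ... | nonsquare | nonsquare ¬s   = isNonsquare λ s e → ¬s (to s) (trans (sym (to-* s s)) (to-cong e))

    squareClass-unique : ∀ {u c} → HasSquareClass u c → squareClass u ≡ c
    squareClass-unique (isZero u≈0)        = class-unique (zero (trans (to-cong u≈0) to-0))
    squareClass-unique (isSquare u≉0 s e)  =
      class-unique (square (λ u≡0 → u≉0 (to-≡0 u≡0)) (to s) (trans (sym (to-* s s)) (to-cong e)))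
    squareClass-unique (isNonsquare ¬s)    = class-unique (nonsquare λ s e → ¬s (from s)
      (F.trans (F.sym (from-* s s)) (F.trans (from-cong e) (from-to _))))

    -- A change of coordinate vector multiplies norms and discriminants by non-zero squares, so
    -- their classes are properties of points.
    squareClass-scale : ∀ {c u v} → ¬ c ≈ 0# → v ≈ c * c * u → squareClass v ≡ squareClass u
    squareClass-scale {c} {u} {v} c≉0 e = squareClass-unique (scaled (hasSquareClass u))
      where
      scaled : ∀ {d} → HasSquareClass u d → HasSquareClass v d
      scaled (isZero u≈0) = isZero (F.trans e (F.trans (F.*-congˡ u≈0) (F.zeroʳ _)))
      scaled (isSquare u≉0 s s²≈u) = isSquare (λ v≈0 → u≉0 (cancel (*-≉0 c≉0 c≉0) (F.trans (F.sym e) v≈0))) (c * s)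
        (F.trans (solveᶠ 2 (λ c s → c :*ᶠ s :*ᶠ (c :*ᶠ s) :=ᶠ c :*ᶠ c :*ᶠ (s :*ᶠ s)) F.refl c s) (F.trans (F.*-congˡ s²≈u) (F.sym e)))
      scaled (isNonsquare ¬s) = isNonsquare λ s s²≈v → let i , ci≈1 = inverse c c≉0 in ¬s (i * s) (begin
        i * s * (i * s)          ≈⟨ (solveᶠ 2 (λ i s → i :*ᶠ s :*ᶠ (i :*ᶠ s) :=ᶠ i :*ᶠ i :*ᶠ (s :*ᶠ s)) F.refl i s) ⟩
        i * i * (s * s)          ≈⟨ F.*-congˡ (F.trans s²≈v e) ⟩
        i * i * (c * c * u)      ≈⟨ (solveᶠ 3 (λ i c u → i :*ᶠ i :*ᶠ (c :*ᶠ c :*ᶠ u) :=ᶠ c :*ᶠ i :*ᶠ (c :*ᶠ i) :*ᶠ u) F.refl i c u) ⟩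
        c * i * (c * i) * u      ≈⟨ F.*-congʳ (F.*-cong ci≈1 ci≈1) ⟩
        1# * 1# * u              ≈⟨ (solveᶠ 1 (λ u → conᶠ (pos 1) :*ᶠ conᶠ (pos 1) :*ᶠ u :=ᶠ u) F.refl u) ⟩
        u                        ∎)

    norm-cong : ∀ X Y → X P.≈ Y → squareClass (norm X) ≡ squareClass (norm Y)
    norm-cong X Y (c , c≉0 , y≈cx) = sym (squareClass-scale c≉0 (F.trans
      (κ-linear m c 0# (coordinates X) (coordinates X) λ i → F.trans (y≈cx i) (solveᶠ 2 (λ c u → c :*ᶠ u :=ᶠ c :*ᶠ u :+ᶠ conᶠ (pos 0) :*ᶠ u) F.refl c (coordinates X i)))
      (solveᶠ 3 (λ c k p → c :*ᶠ c :*ᶠ k :+ᶠ c :*ᶠ conᶠ (pos 0) :*ᶠ p :+ᶠ conᶠ (pos 0) :*ᶠ conᶠ (pos 0) :*ᶠ k :=ᶠ c :*ᶠ c :*ᶠ k) F.refl c (norm X) (polar X X))))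

    disc-congʳ : ∀ X {Y Z} → Y P.≈ Z → squareClass (disc X Y) ≡ squareClass (disc X Z)
    disc-congʳ X {Y} {Z} (c , c≉0 , z≈cy) = sym (squareClass-scale c≉0
      (discriminant-linear m 0# c (coordinates X) (coordinates Y) λ i →
        F.trans (z≈cy i) (solveᶠ 3 (λ c u v → c :*ᶠ v :=ᶠ conᶠ (pos 0) :*ᶠ u :+ᶠ c :*ᶠ v) F.refl c (coordinates X i) (coordinates Y i))))

    disc-sym : ∀ X Y → squareClass (disc X Y) ≡ squareClass (disc Y X)
    disc-sym X Y = cong class (to-cong (discriminant-sym m (coordinates X) (coordinates Y)))

    disc-self : ∀ X Y → X P.≈ Y → disc X Y ≈ 0#
    disc-self X Y (c , c≉0 , y≈cx) = F.trans
      (discriminant-linear m c 0# (coordinates X) (coordinates X) λ i → F.trans (y≈cx i) (solveᶠ 2 (λ c u → c :*ᶠ u :=ᶠ c :*ᶠ u :+ᶠ conᶠ (pos 0) :*ᶠ u) F.refl c (coordinates X i)))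
      (solveᶠ 1 (λ d → conᶠ (pos 0) :*ᶠ conᶠ (pos 0) :*ᶠ d :=ᶠ conᶠ (pos 0)) F.refl (disc X X))

    open Finite (OddField.finite oddField) using (enum; index; enum-index)

    infix 4 _≈ₚ?_
    opaque
      _≈ₚ?_ : ∀ X Y → Dec (X P.≈ Y)
      X ≈ₚ? Y = map′
        (λ (j , c≉0 , e) → from (enum j) , c≉0 , e)
        (λ (c , c≉0 , e) → let c≈ = F.trans (from-cong (enum-index (to c))) (from-to c) in
          index (to c) , (λ z → c≉0 (F.trans (F.sym c≈) z)) , λ i → F.trans (e i) (F.*-congʳ (F.sym c≈)))
        (Fin.any? λ j → ¬? (from (enum j) ≈? 0#) ×-dec Fin.all? λ i → coordinates Y i ≈? from (enum j) * coordinates X i)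

    -- If t were non-zero, a relation s x + t y = 0 would make y the multiple of x by -s / t, and
    -- the points would coincide.
    independent : ∀ X Y → ¬ X P.≈ Y → ∀ {s t} → (∀ i → s * coordinates X i + t * coordinates Y i ≈ 0#) → s ≈ 0# × t ≈ 0#
    independent X@((x , x≉0) , _) Y@((y , y≉0) , _) X≉Y {s} {t} e with t ≈? 0#
    ... | yes t≈0 = decidable-stable (s ≈? 0#) (λ s≉0 → x≉0 λ i → cancel s≉0
            (F.trans (solveᶠ 3 (λ s u v → s :*ᶠ u :=ᶠ s :*ᶠ u :+ᶠ conᶠ (pos 0) :*ᶠ v) F.refl s (x i) (y i)) (F.trans (F.+-congˡ (F.*-congʳ (F.sym t≈0))) (e i)))) , t≈0
    ... | no t≉0  = contradiction (c , c≉0 , y≈cx) X≉Y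
      where
      t⁻¹ = proj₁ (inverse t t≉0)
      tt⁻¹≈1 = proj₂ (inverse t t≉0)
      c = - (t⁻¹ * s)
      y≈cx : ∀ i → y i ≈ c * x i
      y≈cx i = begin
        y i                                    ≈⟨ (solveᶠ 1 (λ y → y :=ᶠ conᶠ (pos 1) :*ᶠ y) F.refl (y i)) ⟩
        1# * y i                               ≈⟨ F.*-congʳ tt⁻¹≈1 ⟨
        t * t⁻¹ * y i                          ≈⟨ (solveᶠ 5 (λ t i s x y → t :*ᶠ i :*ᶠ y :=ᶠ i :*ᶠ (s :*ᶠ x :+ᶠ t :*ᶠ y) :+ᶠ :-ᶠ (i :*ᶠ s) :*ᶠ x) F.refl t (t⁻¹) s (x i) (y i)) ⟩
        t⁻¹ * (s * x i + t * y i) + c * x i    ≈⟨ F.+-congʳ (F.trans (F.*-congˡ (e i)) (F.zeroʳ _)) ⟩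
        0# + c * x i                           ≈⟨ F.+-identityˡ _ ⟩
        c * x i                                ∎
      c≉0 : ¬ c ≈ 0#
      c≉0 c≈0 = y≉0 λ i → F.trans (y≈cx i) (F.trans (F.*-congʳ c≈0) (F.zeroˡ _))

    module _ (X Y : Point) (X≉Y : ¬ X P.≈ Y) where

      private
        x = coordinates X
        y = coordinates Y
        k = norm X
        b = polar X Y
        k≉0 : ¬ k ≈ 0#
        k≉0 = proj₂ X
        LinePoints = Restrict (PG F F-field n) (λ Z → Line F F-field (proj₁ X) (proj₁ Y) Z × Quadric F F-field f m Z)
        module L = Setoid LinePoints

      -- The points of the line on the quadric correspond to the square roots r of the discriminant.
      root : ∀ r → r * r ≈ disc X Y → L.Carrier
      root r r²≈D = (z , z≉0) , (r - b , 2# * k , λ i → F.refl) , z∈Q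
        where
        z : Fin (2 ℕ.+ m ℕ.* 2) → F.Carrier
        z i = (r - b) * x i + 2# * k * y i
        z≉0 : ¬ (∀ i → z i ≈ 0#)
        z≉0 e = *-≉0 2≉0 k≉0 (proj₂ (independent X Y X≉Y e))
        z∈Q : κ F f m z ≈ 0#
        z∈Q = begin
          κ F f m z
            ≈⟨ κ-linear m (r - b) (2# * k) x y (λ i → F.refl) ⟩
          (r - b) * (r - b) * k + (r - b) * (2# * k) * b + 2# * k * (2# * k) * norm Y
            ≈⟨ (solveᶠ 4 (λ r b k l → (r :-ᶠ b) :*ᶠ (r :-ᶠ b) :*ᶠ k :+ᶠ (r :-ᶠ b) :*ᶠ (conᶠ (pos 2) :*ᶠ k) :*ᶠ b :+ᶠ conᶠ (pos 2) :*ᶠ k :*ᶠ (conᶠ (pos 2) :*ᶠ k) :*ᶠ l :=ᶠ k :*ᶠ (r :*ᶠ r :-ᶠ (b :*ᶠ b :-ᶠ conᶠ (pos 4) :*ᶠ (k :*ᶠ l)))) F.refl r b k (norm Y)) ⟩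
          k * (r * r - disc X Y)
            ≈⟨ F.*-congˡ (F.trans (F.+-congʳ r²≈D) (F.-‿inverseʳ _)) ⟩
          k * 0#
            ≈⟨ F.zeroʳ k ⟩
          0# ∎

      root-injective : ∀ {r r′} (e : r * r ≈ disc X Y) (e′ : r′ * r′ ≈ disc X Y) → root r e L.≈ root r′ e′ → r ≈ r′
      root-injective {r} {r′} e e′ (c , c≉0 , z′≈cz) = begin
        r                       ≈⟨ (solveᶠ 3 (λ r b c → r :=ᶠ conᶠ (pos 1) :*ᶠ (r :-ᶠ b) :+ᶠ b) F.refl r b c) ⟩
        1# * (r - b) + b        ≈⟨ F.+-congʳ (F.*-congʳ c≈1) ⟨
        c * (r - b) + b         ≈⟨ (solveᶠ 4 (λ c r p b → c :*ᶠ (r :-ᶠ b) :+ᶠ b :=ᶠ (p :-ᶠ ((p :-ᶠ b) :-ᶠ c :*ᶠ (r :-ᶠ b)))) F.refl c r (r′) b) ⟩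
        r′ - ((r′ - b) - c * (r - b))  ≈⟨ F.+-congˡ (F.-‿cong (proj₁ coefficients)) ⟩
        r′ - 0#                 ≈⟨ (solveᶠ 1 (λ p → p :-ᶠ conᶠ (pos 0) :=ᶠ p) F.refl (r′)) ⟩
        r′                      ∎
        where
        -- Both vectors have coefficient 2k at y, so comparing these coefficients forces c = 1, and
        -- those at x then give r = r′.
        coefficients : ((r′ - b) - c * (r - b)) ≈ 0# × (2# * k - c * (2# * k)) ≈ 0#
        coefficients = independent X Y X≉Y λ i → begin
          ((r′ - b) - c * (r - b)) * x i + (2# * k - c * (2# * k)) * y i
            ≈⟨ (solveᶠ 7 (λ c r p b x y k → ((p :-ᶠ b) :-ᶠ c :*ᶠ (r :-ᶠ b)) :*ᶠ x :+ᶠ (conᶠ (pos 2) :*ᶠ k :-ᶠ c :*ᶠ (conᶠ (pos 2) :*ᶠ k)) :*ᶠ y :=ᶠ ((p :-ᶠ b) :*ᶠ x :+ᶠ conᶠ (pos 2) :*ᶠ k :*ᶠ y) :-ᶠ c :*ᶠ ((r :-ᶠ b) :*ᶠ x :+ᶠ conᶠ (pos 2) :*ᶠ k :*ᶠ y)) F.refl c r (r′) b (x i) (y i) k) ⟩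
          ((r′ - b) * x i + 2# * k * y i) - c * ((r - b) * x i + 2# * k * y i)
            ≈⟨ F.+-congʳ (z′≈cz i) ⟩
          c * ((r - b) * x i + 2# * k * y i) - c * ((r - b) * x i + 2# * k * y i)
            ≈⟨ F.-‿inverseʳ _ ⟩
          0# ∎
        c≈1 : c ≈ 1#
        c≈1 = *-injective (*-≉0 2≉0 k≉0) (begin
          2# * k * c                                  ≈⟨ (solveᶠ 2 (λ k c → conᶠ (pos 2) :*ᶠ k :*ᶠ c :=ᶠ conᶠ (pos 2) :*ᶠ k :*ᶠ conᶠ (pos 1) :-ᶠ (conᶠ (pos 2) :*ᶠ k :-ᶠ c :*ᶠ (conᶠ (pos 2) :*ᶠ k))) F.refl k c) ⟩
          2# * k * 1# - (2# * k - c * (2# * k))       ≈⟨ F.+-congˡ (F.-‿cong (proj₂ coefficients)) ⟩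
          2# * k * 1# - 0#                            ≈⟨ (solveᶠ 1 (λ u → u :-ᶠ conᶠ (pos 0) :=ᶠ u) F.refl (2# * k * 1#)) ⟩
          2# * k * 1#                                 ∎)

      root-surjective : ∀ (Z : L.Carrier) → ∃[ r ] ∃ λ (e : r * r ≈ disc X Y) → Z L.≈ root r e
      root-surjective ((z , z≉0) , (s , t , z≈) , z∈Q) = r , r²≈D , c , c≉0 , λ i → begin
        (r - b) * x i + 2# * k * y i            ≈⟨ (solveᶠ 6 (λ k s i b x y → (conᶠ (pos 2) :*ᶠ k :*ᶠ s :*ᶠ i :+ᶠ b :-ᶠ b) :*ᶠ x :+ᶠ conᶠ (pos 2) :*ᶠ k :*ᶠ y :=ᶠ conᶠ (pos 2) :*ᶠ k :*ᶠ i :*ᶠ s :*ᶠ x :+ᶠ conᶠ (pos 1) :*ᶠ (conᶠ (pos 2) :*ᶠ k :*ᶠ y)) F.refl k s (t⁻¹) b (x i) (y i)) ⟩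
        2# * k * t⁻¹ * s * x i + 1# * (2# * k * y i)
                                                ≈⟨ F.+-congˡ (F.*-congʳ tt⁻¹≈1) ⟨
        2# * k * t⁻¹ * s * x i + t * t⁻¹ * (2# * k * y i)
                                                ≈⟨ (solveᶠ 6 (λ k s t i x y → conᶠ (pos 2) :*ᶠ k :*ᶠ i :*ᶠ s :*ᶠ x :+ᶠ t :*ᶠ i :*ᶠ (conᶠ (pos 2) :*ᶠ k :*ᶠ y) :=ᶠ conᶠ (pos 2) :*ᶠ k :*ᶠ i :*ᶠ (s :*ᶠ x :+ᶠ t :*ᶠ y)) F.refl k s t (t⁻¹) (x i) (y i)) ⟩
        c * (s * x i + t * y i)                 ≈⟨ F.*-congˡ (z≈ i) ⟨
        c * z i                                 ∎
        where
        -- For t = 0 the vector z would be a multiple of x, which is not on the quadric.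
        t≉0 : ¬ t ≈ 0#
        t≉0 t≈0 = z≉0 λ i → F.trans (z≈ i) (F.trans (F.+-cong (F.*-congʳ s≈0) (F.*-congʳ t≈0)) (solveᶠ 2 (λ u v → conᶠ (pos 0) :*ᶠ u :+ᶠ conᶠ (pos 0) :*ᶠ v :=ᶠ conᶠ (pos 0)) F.refl (x i) (y i)))
          where
          s²k≈0 : k * (s * s) ≈ 0#
          s²k≈0 = begin
            k * (s * s)                                       ≈⟨ (solveᶠ 4 (λ k s b l → k :*ᶠ (s :*ᶠ s) :=ᶠ s :*ᶠ s :*ᶠ k :+ᶠ s :*ᶠ conᶠ (pos 0) :*ᶠ b :+ᶠ conᶠ (pos 0) :*ᶠ conᶠ (pos 0) :*ᶠ l) F.refl k s b (norm Y)) ⟩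
            s * s * k + s * 0# * b + 0# * 0# * norm Y         ≈⟨ F.+-cong (F.+-congˡ (F.*-congʳ (F.*-congˡ t≈0))) (F.*-congʳ (F.*-cong t≈0 t≈0)) ⟨
            s * s * k + s * t * b + t * t * norm Y            ≈⟨ κ-linear m s t x y z≈ ⟨
            κ F f m z                                         ≈⟨ z∈Q ⟩
            0#                                                ∎
          s≈0 : s ≈ 0#
          s≈0 = decidable-stable (s ≈? 0#) λ s≉0 → *-≉0 k≉0 (*-≉0 s≉0 s≉0) s²k≈0
        t⁻¹ = proj₁ (inverse t t≉0)
        tt⁻¹≈1 = proj₂ (inverse t t≉0)
        -- The factor c = 2k / t normalises the coefficient of y to 2k; the coefficient of x is then
        -- r - b, which determines r.
        r = 2# * k * s * t⁻¹ + b
        c = 2# * k * t⁻¹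
        t⁻¹≉0 : ¬ t⁻¹ ≈ 0#
        t⁻¹≉0 e = 0≉1 (F.sym (F.trans (F.sym tt⁻¹≈1) (F.trans (F.*-congˡ e) (F.zeroʳ t))))
        c≉0 : ¬ c ≈ 0#
        c≉0 = *-≉0 (*-≉0 2≉0 k≉0) t⁻¹≉0
        r²≈D : r * r ≈ disc X Y
        r²≈D = begin
          r * r
            ≈⟨ (solveᶠ 4 (λ k s i b → (conᶠ (pos 2) :*ᶠ k :*ᶠ s :*ᶠ i :+ᶠ b) :*ᶠ (conᶠ (pos 2) :*ᶠ k :*ᶠ s :*ᶠ i :+ᶠ b) :=ᶠ (conᶠ (pos 2) :*ᶠ k :*ᶠ s :*ᶠ i :+ᶠ conᶠ (pos 1) :*ᶠ b) :*ᶠ (conᶠ (pos 2) :*ᶠ k :*ᶠ s :*ᶠ i :+ᶠ conᶠ (pos 1) :*ᶠ b)) F.refl k s (t⁻¹) b) ⟩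
          (2# * k * s * t⁻¹ + 1# * b) * (2# * k * s * t⁻¹ + 1# * b)
            ≈⟨ F.*-cong (F.+-congˡ (F.*-congʳ tt⁻¹≈1)) (F.+-congˡ (F.*-congʳ tt⁻¹≈1)) ⟨
          (2# * k * s * t⁻¹ + t * t⁻¹ * b) * (2# * k * s * t⁻¹ + t * t⁻¹ * b)
            ≈⟨ (solveᶠ 6 (λ k s t i b l → (conᶠ (pos 2) :*ᶠ k :*ᶠ s :*ᶠ i :+ᶠ t :*ᶠ i :*ᶠ b) :*ᶠ (conᶠ (pos 2) :*ᶠ k :*ᶠ s :*ᶠ i :+ᶠ t :*ᶠ i :*ᶠ b) :=ᶠ conᶠ (pos 4) :*ᶠ k :*ᶠ i :*ᶠ i :*ᶠ (s :*ᶠ s :*ᶠ k :+ᶠ s :*ᶠ t :*ᶠ b :+ᶠ t :*ᶠ t :*ᶠ l) :+ᶠ t :*ᶠ i :*ᶠ (t :*ᶠ i) :*ᶠ (b :*ᶠ b :-ᶠ conᶠ (pos 4) :*ᶠ (k :*ᶠ l))) F.refl k s t (t⁻¹) b (norm Y)) ⟩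
          4# * k * t⁻¹ * t⁻¹ * (s * s * k + s * t * b + t * t * norm Y) + t * t⁻¹ * (t * t⁻¹) * disc X Y
            ≈⟨ F.+-cong (F.*-congˡ (F.trans (F.sym (κ-linear m s t x y z≈)) z∈Q)) (F.*-congʳ (F.*-cong tt⁻¹≈1 tt⁻¹≈1)) ⟩
          4# * k * t⁻¹ * t⁻¹ * 0# + 1# * 1# * disc X Y
            ≈⟨ (solveᶠ 2 (λ u d → u :*ᶠ conᶠ (pos 0) :+ᶠ conᶠ (pos 1) :*ᶠ conᶠ (pos 1) :*ᶠ d :=ᶠ d) F.refl (4# * k * t⁻¹ * t⁻¹) (disc X Y)) ⟩
          disc X Y ∎

      root-cong : ∀ {r r′} (e : r * r ≈ disc X Y) (e′ : r′ * r′ ≈ disc X Y) → r ≈ r′ → root r e L.≈ root r′ e′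
      root-cong {r} {r′} e e′ r≈r′ = 1# , (λ 1≈0 → 0≉1 (F.sym 1≈0)) , λ i →
        F.trans (F.+-congʳ (F.*-congʳ (F.+-congʳ (F.sym r≈r′)))) (F.sym (F.*-identityˡ _))

      lineMeets : ∀ {c} (ρ : Fin c → F.Carrier) (ρ² : ∀ i → ρ i * ρ i ≈ disc X Y) → (∀ i j → ρ i ≈ ρ j → i ≡ j) →
                  (∀ r → r * r ≈ disc X Y → ∃[ i ] r ≈ ρ i) → LineMeetsQuadricIn F F-field f m c X Y
      lineMeets ρ ρ² injective complete = HasSize-enumerate LinePoints (λ i → root (ρ i) (ρ² i))
        (λ i j e → injective i j (root-injective (ρ² i) (ρ² j) e))
        λ Z → let r , e , Z≈ = root-surjective Z
                  i , r≈ = complete r e in i , L.trans {Z} {root r e} {root (ρ i) (ρ² i)} Z≈ (root-cong e (ρ² i) r≈)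

      intersections : SquareClass → ℕ
      intersections zero      = 1
      intersections square    = 2
      intersections nonsquare = 0

      lineMeets-class : LineMeetsQuadricIn F F-field f m (intersections (squareClass (disc X Y))) X Y
      lineMeets-class = go (hasSquareClass (disc X Y))
        where
        square-zero : ∀ r → r * r ≈ 0# → r ≈ 0#
        square-zero r e = decidable-stable (r ≈? 0#) λ r≉0 → *-≉0 r≉0 r≉0 e
        go : ∀ {c} → HasSquareClass (disc X Y) c → LineMeetsQuadricIn F F-field f m (intersections c) X Y
        go (isZero D≈0) = lineMeets {1} (λ _ → 0#) (λ _ → F.trans (F.zeroˡ 0#) (F.sym D≈0)) (λ { zero zero _ → refl })
          λ r e → zero , square-zero r (F.trans e D≈0)
        go (isSquare D≉0 s s²≈D) = lineMeets {2} roots roots² injective complete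
          where
          roots : Fin 2 → F.Carrier
          roots 0F = s
          roots 1F = - s
          roots² : ∀ i → roots i * roots i ≈ disc X Y
          roots² 0F = s²≈D
          roots² 1F = F.trans (solveᶠ 1 (λ s → :-ᶠ s :*ᶠ :-ᶠ s :=ᶠ s :*ᶠ s) F.refl s) s²≈D
          s≉-s : ¬ s ≈ - s
          s≉-s e = D≉0 (F.trans (F.sym s²≈D) (F.trans (F.*-congʳ s≈0) (F.zeroˡ s)))
            where
            s≈0 : s ≈ 0#
            s≈0 = cancel 2≉0 (F.trans (solveᶠ 1 (λ s → conᶠ (pos 2) :*ᶠ s :=ᶠ s :+ᶠ s) F.refl s) (F.trans (F.+-congˡ e) (F.-‿inverseʳ s)))
          injective : ∀ i j → roots i ≈ roots j → i ≡ j
          injective 0F 0F e = refl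
          injective 0F 1F e = contradiction e s≉-s
          injective 1F 0F e = contradiction (F.sym e) s≉-s
          injective 1F 1F e = refl
          complete : ∀ r → r * r ≈ disc X Y → ∃[ i ] r ≈ roots i
          complete r e with r - s ≈? 0#
          ... | yes r-s≈0 = 0F , F.trans (solveᶠ 2 (λ r s → r :=ᶠ (r :-ᶠ s) :+ᶠ s) F.refl r s) (F.trans (F.+-congʳ r-s≈0) (F.+-identityˡ s))
          ... | no r-s≉0  = 1F , F.trans (solveᶠ 2 (λ r s → r :=ᶠ (r :+ᶠ s) :-ᶠ s) F.refl r s) (F.trans (F.+-congʳ (cancel r-s≉0
                  (F.trans (solveᶠ 2 (λ r s → (r :-ᶠ s) :*ᶠ (r :+ᶠ s) :=ᶠ r :*ᶠ r :-ᶠ s :*ᶠ s) F.refl r s) (F.trans (F.+-cong e (F.-‿cong s²≈D)) (F.-‿inverseʳ _))))) (F.+-identityˡ _))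
        go (isNonsquare ¬s) = lineMeets {0} (λ ()) (λ ()) (λ ()) λ r e → contradiction e (¬s r)

      intersections-injective : ∀ {c d} → intersections c ≡ intersections d → c ≡ d
      intersections-injective {zero}      {zero}      _ = refl
      intersections-injective {square}    {square}    _ = refl
      intersections-injective {nonsquare} {nonsquare} _ = refl

      -- The three classes give the different sizes 1, 2 and 0, and a setoid has only one size, so
      -- the class of the discriminant can be recovered.
      lineMeets-unique : ∀ c → LineMeetsQuadricIn F F-field f m (intersections c) X Y → squareClass (disc X Y) ≡ c
      lineMeets-unique c h = intersections-injective (HasSize-unique LinePoints lineMeets-class h)

    typeClass : QuadraticType → SquareClass
    typeClass S = square
    typeClass S̄ = nonsquare

    typeClass-injective : ∀ {t u} → typeClass t ≡ typeClass u → t ≡ u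
    typeClass-injective {S} {S} _ = refl
    typeClass-injective {S̄} {S̄} _ = refl

    hasType-class : ∀ {u} t → HasType F u t → squareClass u ≡ typeClass t
    hasType-class S (u≉0 , s , e) = squareClass-unique (isSquare u≉0 s (F.sym e))
    hasType-class S̄ ¬s           = squareClass-unique (isNonsquare λ s e → ¬s (s , F.sym e))

    type : ∀ X → ∃[ t ] HasType F (norm X) t × squareClass (norm X) ≡ typeClass t
    type X with squareClass (norm X) | hasSquareClass (norm X)
    ... | zero      | isZero e         = contradiction e (proj₂ X)
    ... | square    | isSquare ≉0 s e  = S , (≉0 , s , F.sym e) , refl
    ... | nonsquare | isNonsquare ¬s   = S̄ , (λ (s , e) → ¬s s (F.sym e)) , refl

    κ·κ≡-unique : ∀ {t X Y} → κ·κ≡ F F-field f m t X Y → proj₁ (type X) ·ᵗ proj₁ (type Y) ≡ t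
    κ·κ≡-unique {t} {X} {Y} (u , v , hu , hv , e) = trans (cong₂ _·ᵗ_ (same X u hu) (same Y v hv)) e
      where
      same : ∀ X u → HasType F (norm X) u → proj₁ (type X) ≡ u
      same X u h = typeClass-injective (trans (sym (proj₂ (proj₂ (type X)))) (hasType-class u h))

    -- Tangent lines are not divided by type, because the product of the types is S there.
    relationCode : SquareClass → QuadraticType → Fin 6
    relationCode zero      _ = 1F
    relationCode square    S = 2F
    relationCode nonsquare S = 3F
    relationCode square    S̄ = 4F
    relationCode nonsquare S̄ = 5F

    relation : Point → Point → Fin 6
    relation X Y = if does (X ≈ₚ? Y) then 0F else relationCode (squareClass (disc X Y)) (proj₁ (type X) ·ᵗ proj₁ (type Y))

    relation-holds : ∀ X Y → Relation F F-field f m (relation X Y) X Y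
    relation-holds X Y with X ≈ₚ? Y
    ... | yes X≈Y = X≈Y
    ... | no X≉Y with squareClass (disc X Y) | lineMeets-class X Y X≉Y | proj₁ (type X) ·ᵗ proj₁ (type Y) in e
    ...   | zero      | h | _ = X≉Y , h
    ...   | square    | h | S = X≉Y , h , _ , _ , proj₁ (proj₂ (type X)) , proj₁ (proj₂ (type Y)) , e
    ...   | square    | h | S̄ = X≉Y , h , _ , _ , proj₁ (proj₂ (type X)) , proj₁ (proj₂ (type Y)) , e
    ...   | nonsquare | h | S = X≉Y , h , _ , _ , proj₁ (proj₂ (type X)) , proj₁ (proj₂ (type Y)) , e
    ...   | nonsquare | h | S̄ = X≉Y , h , _ , _ , proj₁ (proj₂ (type X)) , proj₁ (proj₂ (type Y)) , e

    -- With `relation-holds` this makes the relations a partition: each R-relation is the fibre of a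
    -- computed index.
    relation-unique : ∀ i X Y → Relation F F-field f m i X Y → relation X Y ≡ i
    relation-unique i X Y h with X ≈ₚ? Y
    relation-unique 0F X Y h | yes _ = refl
    relation-unique 1F X Y (X≉Y , _) | yes X≈Y = contradiction X≈Y X≉Y
    relation-unique 2F X Y (X≉Y , _) | yes X≈Y = contradiction X≈Y X≉Y
    relation-unique 3F X Y (X≉Y , _) | yes X≈Y = contradiction X≈Y X≉Y
    relation-unique 4F X Y (X≉Y , _) | yes X≈Y = contradiction X≈Y X≉Y
    relation-unique 5F X Y (X≉Y , _) | yes X≈Y = contradiction X≈Y X≉Y
    relation-unique 0F X Y X≈Y | no X≉Y = contradiction X≈Y X≉Y
    relation-unique 1F X Y (_ , h) | no X≉Y = cong (λ c → relationCode c (proj₁ (type X) ·ᵗ proj₁ (type Y))) (lineMeets-unique X Y X≉Y zero h)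
    relation-unique 2F X Y (_ , h , k) | no X≉Y = cong₂ relationCode (lineMeets-unique X Y X≉Y square h) (κ·κ≡-unique {X = X} {Y} k)
    relation-unique 3F X Y (_ , h , k) | no X≉Y = cong₂ relationCode (lineMeets-unique X Y X≉Y nonsquare h) (κ·κ≡-unique {X = X} {Y} k)
    relation-unique 4F X Y (_ , h , k) | no X≉Y = cong₂ relationCode (lineMeets-unique X Y X≉Y square h) (κ·κ≡-unique {X = X} {Y} k)
    relation-unique 5F X Y (_ , h , k) | no X≉Y = cong₂ relationCode (lineMeets-unique X Y X≉Y nonsquare h) (κ·κ≡-unique {X = X} {Y} k)

-- From sums over vectors to sums over points

module PointSums where

  open import Algebra.Bundles using (CommutativeRing)
  open import Data.Fin.Base using (Fin; zero; suc)
  open import Data.Integer.Base using () renaming (+_ to pos)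
  open import Data.Nat.Base as ℕ using (ℕ; zero; suc)
  open import Data.Product.Base using (∃; ∃-syntax; _×_; _,_; proj₁; proj₂)
  open import Data.Sign.Base as Sign using (Sign)
  open import Data.Vec.Base using (Vec; tabulate; lookup; map)
  open import Data.Vec.Properties using (lookup∘tabulate; lookup-map; tabulate-cong; tabulate∘lookup)
  open import Function.Base using (_∘_)
  open import Function.Bundles using (Inverse)
  open import Relation.Binary.Bundles using (Setoid)
  open import Relation.Binary.PropositionalEquality
  open import Relation.Nullary using (¬_; Dec; yes; no; contradiction; ¬?)
  open DiscreteRings
  open FiniteTypes
  open FiniteFields
  open QuadraticSpaces
  open Products
  open VectorModel
  open FieldModel
  open FiniteSetoids
  open Geometry
  open import Defs using (BinaryForm; module BinaryForm; κ; IsField; HasSize; AnisotropicPoints)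

  module PointSums (N : NumberRing) {a ℓ} (F : CommutativeRing a ℓ) (F-field : IsField F)
                   (model : Model F) (f : BinaryForm F) (m : ℕ) where

    private
      module F = CommutativeRing F
    open NumberRing N renaming (Carrier to Num)
    open Transfer F F-field model
    open OddField oddField renaming (Carrier to A)
    open Sums (NumberRing.discreteRing N)
    open Character N oddField
    open CharacterSums N oddField using (χ²; χ²-0; ∑χ²)
    open Classification N F F-field model f m using (Point; coordinates; norm; disc; _≈ₚ?_)
    open VectorSpace oddField (form f) using (space)
    open QuadraticSpace (space m) renaming (κ to normᵛ)
    open ≡-Reasoning

    private
      P = AnisotropicPoints F F-field f m
      module P = Setoid P
      dimension = 2 ℕ.+ m ℕ.* 2
      R = DiscreteRing.commutativeRing (OddField.discreteRing oddField)
      module 𝔽Forms = PolarForms R (form f)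

    vec : Point → V
    vec X = tabulate (to ∘ coordinates X)

    lookup-vec : ∀ X i → lookup (vec X) i ≡ to (coordinates X i)
    lookup-vec X = lookup∘tabulate (to ∘ coordinates X)

    normᵛ-vec : ∀ X → normᵛ (vec X) ≡ to (norm X)
    normᵛ-vec X = trans (𝔽Forms.κ-cong m (lookup-vec X)) (sym (to-κ f m (coordinates X)))

    D-vec : ∀ X Y → D (vec X) (vec Y) ≡ to (disc X Y)
    D-vec X Y = trans
      (cong₂ _⊝_ (cong (λ b → b ⊗ b) (𝔽Forms.polarForm-cong m (lookup-vec X) (lookup-vec Y)))
        (cong (4ᴬ ⊗_) (cong₂ _⊗_ (𝔽Forms.κ-cong m (lookup-vec X)) (𝔽Forms.κ-cong m (lookup-vec Y)))))
      (sym (to-discriminant f m (coordinates X) (coordinates Y)))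

    norm≢0 : ∀ X → normᵛ (vec X) ≢ 0ᴬ
    norm≢0 X e = proj₂ X (to-≡0 (trans (sym (normᵛ-vec X)) e))

    infixr 7 _•_
    _•_ : A → V → V
    c • v = map (c ⊗_) v

    lookup-• : ∀ c v i → lookup (c • v) i ≡ c ⊗ lookup v i
    lookup-• c v i = lookup-map i (c ⊗_) v

    norm-• : ∀ c v → normᵛ (c • v) ≡ c ⊗ c ⊗ normᵛ v
    norm-• c v = trans (𝔽Forms.κ-linear m c 0ᴬ (lookup v) (lookup v)
        λ i → trans (lookup-• c v i) (solveᴬ 2 (λ c u → c :⊗ u :≣ c :⊗ u :⊕ conᴬ (pos 0) :⊗ u) refl c (lookup v i)))
      (solveᴬ 3 (λ c k p → c :⊗ c :⊗ k :⊕ c :⊗ conᴬ (pos 0) :⊗ p :⊕ conᴬ (pos 0) :⊗ conᴬ (pos 0) :⊗ k :≣ c :⊗ c :⊗ k) refl c (normᵛ v) (b v v))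

    D-• : ∀ w c v → D w (c • v) ≡ c ⊗ c ⊗ D w v
    D-• w c v = 𝔽Forms.discriminant-linear m 0ᴬ c (lookup w) (lookup v)
      λ i → trans (lookup-• c v i) (solveᴬ 3 (λ c u z → c :⊗ u :≣ conᴬ (pos 0) :⊗ z :⊕ c :⊗ u) refl c (lookup v i) (lookup w i))

    D-sym : ∀ v w → D v w ≡ D w v
    D-sym v w = 𝔽Forms.discriminant-sym m (lookup v) (lookup w)

    point : ∀ v → normᵛ v ≢ 0ᴬ → Point
    -- The vector is non-zero because κ vanishes at zero, which is the combination with both
    -- coefficients zero.
    point v κ≢0 = (from ∘ lookup v , λ z → κ≉0 (F.trans (PolarForms.κ-linear F f m F.0# F.0# x x λ i →
        F.trans (z i) (F.sym (F.trans (F.+-cong (F.zeroˡ _) (F.zeroˡ _)) (F.+-identityˡ _))))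
      (F.trans (F.+-cong (F.+-cong (F.trans (F.*-congʳ (F.zeroˡ _)) (F.zeroˡ _)) (F.trans (F.*-congʳ (F.zeroˡ _)) (F.zeroˡ _)))
        (F.trans (F.*-congʳ (F.zeroˡ _)) (F.zeroˡ _))) (F.trans (F.+-congʳ (F.+-identityˡ _)) (F.+-identityˡ _))))) , κ≉0
      where
      x = from ∘ lookup v
      κ≉0 : ¬ κ F f m x F.≈ F.0#
      κ≉0 e = κ≢0 (trans (𝔽Forms.κ-cong m (λ i → sym (to-from (lookup v i)))) (trans (sym (to-κ f m x)) (trans (to-cong e) to-0)))

    vec-point : ∀ v κ≢0 → vec (point v κ≢0) ≡ v
    vec-point v κ≢0 = trans (tabulate-cong (λ i → to-from (lookup v i))) (tabulate∘lookup v)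

    vec-≈ : ∀ {X Y} → X P.≈ Y → ∃[ c ] c ≢ 0ᴬ × vec Y ≡ c • vec X
    vec-≈ {X} {Y} (c , c≉0 , e) = to c , (λ z → c≉0 (to-≡0 z)) , trans
      (tabulate-cong λ i → trans (to-cong (e i)) (trans (to-* c _) (trans (cong (to c ⊗_) (sym (lookup-vec X i))) (sym (lookup-• (to c) (vec X) i)))))
      (tabulate∘lookup _)

    ≈-vec : ∀ {X Y} c → c ≢ 0ᴬ → vec Y ≡ c • vec X → X P.≈ Y
    ≈-vec {X} {Y} c c≢0 e = from c , (λ z → c≢0 (trans (sym (to-from c)) (trans (to-cong z) to-0))) , λ i →
      F.trans (F.sym (from-to _)) (F.trans (from-cong (begin
        to (coordinates Y i)            ≡⟨ sym (lookup-vec Y i) ⟩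
        lookup (vec Y) i                ≡⟨ cong (λ v → lookup v i) e ⟩
        lookup (c • vec X) i            ≡⟨ lookup-• c (vec X) i ⟩
        c ⊗ lookup (vec X) i            ≡⟨ cong (c ⊗_) (lookup-vec X i) ⟩
        c ⊗ to (coordinates X i)        ∎)) (F.trans (from-* _ _) (F.*-congˡ (from-to _))))

    opaque
      -- The anisotropic vectors of the finite space cover all points; repetitions are then removed
      -- by the decidable proportionality.
      enumeration : ∃ (HasSize P)
      enumeration = HasSize-cover P _≈ₚ?_ (λ i → let j , κ≢0 = select anisotropic? i in point (enum j) κ≢0) λ X →
        let i , e = select-surjective anisotropic? (index (vec X)) (subst (λ v → normᵛ v ≢ 0ᴬ) (sym (enum-index (vec X))) (norm≢0 X))
            j , κ≢0 = select anisotropic? i in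
        i , ≈-vec {X} {point (enum j) κ≢0} 1ᴬ 1≢0 (trans (vec-point (enum j) κ≢0) (trans (cong enum e) (trans (enum-index (vec X)) (sym (1• (vec X))))))
        where
        open Finite finiteV using (enum; index; enum-index)
        anisotropic? : ∀ j → Dec (normᵛ (enum j) ≢ 0ᴬ)
        anisotropic? j = ¬? (normᵛ (enum j) ≟ 0ᴬ)
        1• : ∀ v → 1ᴬ • v ≡ v
        1• v = trans (sym (tabulate∘lookup _)) (trans (tabulate-cong λ i → trans (lookup-• 1ᴬ v i) (solveᴬ 1 (λ u → conᴬ (pos 1) :⊗ u :≣ u) refl (lookup v i))) (tabulate∘lookup v))

    open Inverse (proj₂ enumeration) public using () renaming (from to pt; to to index; to-cong to index-cong;
      strictlyInverseˡ to index-pt; strictlyInverseʳ to pt-index)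

    private
      byCases : ∀ {p r} {P : Set p} {R : Set r} → Dec P → (P → R) → (¬ P → R) → R
      byCases (yes p) f g = f p
      byCases (no ¬p) f g = g ¬p

      •-cancel : ∀ X {c d} → c • vec X ≡ d • vec X → c ≡ d
      •-cancel X {c} {d} e = byCases (c ⊝ d ≟ 0ᴬ) ⊝-≡0 λ c-d≢0 → contradiction (λ i → to-≡0 (trans (sym (lookup-vec X i)) (cancel-⊗ c-d≢0 (begin
        (c ⊝ d) ⊗ lookup (vec X) i                        ≡⟨ (solveᴬ 3 (λ c d u → (c :⊝ d) :⊗ u :≣ c :⊗ u :⊝ d :⊗ u) refl c d (lookup (vec X) i)) ⟩
        c ⊗ lookup (vec X) i ⊝ d ⊗ lookup (vec X) i       ≡⟨ cong₂ _⊝_ (sym (lookup-• c (vec X) i)) (sym (lookup-• d (vec X) i)) ⟩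
        lookup (c • vec X) i ⊝ lookup (d • vec X) i       ≡⟨ cong (λ v → lookup v i ⊝ lookup (d • vec X) i) e ⟩
        lookup (d • vec X) i ⊝ lookup (d • vec X) i       ≡⟨ (solveᴬ 1 (λ u → u :⊝ u :≣ conᴬ (pos 0)) refl (lookup (d • vec X) i)) ⟩
        0ᴬ                                                ∎)))) (proj₂ (proj₁ X))

      χ²*δ : ∀ c (d : Num) → (c ≢ 0ᴬ → d ≡ 0#) → χ² c * d ≡ 0#
      χ²*δ c d h = byCases (c ≟ 0ᴬ) (λ { refl → trans (cong (_* d) χ²-0) (zeroˡ d) })
        λ c≢0 → trans (cong (χ² c *_) (h c≢0)) (zeroʳ _)

      module _ (z : V) (κz≢0 : normᵛ z ≢ 0ᴬ) where

        private
          Z = point z κz≢0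
          t₀ = index Z
          scaled = vec-≈ {pt t₀} {Z} (pt-index Z)
          c₀ = proj₁ scaled
          z≡ : z ≡ c₀ • vec (pt t₀)
          z≡ = trans (sym (vec-point z κz≢0)) (proj₂ (proj₂ scaled))

          match : ∀ {p r s} {P : Set p} {R : Set r} {S : Set s} (P? : Dec P) (R? : Dec R) (S? : Dec S) {u : Num} →
                  (S → P × R × u ≡ 1#) → (P → R → S) → u * ⟦ S? ⟧ ≡ ⟦ P? ⟧ * ⟦ R? ⟧
          match P? R? (yes s) f g = let p , r , e = f s in trans (*-identityʳ _) (trans e
            (sym (trans (cong₂ _*_ (⟦⟧-yes P? p) (⟦⟧-yes R? r)) (*-identityˡ 1#))))
          match (no _)  R?      (no _)  f g = trans (zeroʳ _) (sym (zeroˡ _))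
          match (yes p) (no _)  (no _)  f g = trans (zeroʳ _) (sym (zeroʳ _))
          match (yes p) (yes r) (no ¬s) f g = contradiction (g p r) ¬s

          -- z is a multiple of exactly one representative, by exactly one scalar; the factor χ² c
          -- only discards c = 0, for which the multiple is the zero vector.
          unique : ∀ t c → χ² c * δ z (c • vec (pt t)) ≡ δ t t₀ * δ c c₀
          unique t c = match (t ≟ t₀) (c ≟ c₀) (z ≟ c • vec (pt t)) found λ { refl refl → z≡ }
            where
            found : z ≡ c • vec (pt t) → t ≡ t₀ × c ≡ c₀ × χ² c ≡ 1#
            found z≡′ = t≡t₀ , •-cancel (pt t₀) (trans (cong (λ s → c • vec (pt s)) (sym t≡t₀)) (trans (sym z≡′) z≡)) , χ²≡1 c≢0
              where
              c≢0 : c ≢ 0ᴬ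
              c≢0 c≡0 = κz≢0 (trans (cong normᵛ z≡′) (trans (norm-• c (vec (pt t)))
                (trans (cong (λ d → d ⊗ d ⊗ normᵛ (vec (pt t))) c≡0) (solveᴬ 1 (λ k → conᴬ (pos 0) :⊗ conᴬ (pos 0) :⊗ k :≣ conᴬ (pos 0)) refl (normᵛ (vec (pt t)))))))
              t≡t₀ : t ≡ t₀
              t≡t₀ = trans (sym (index-pt t)) (index-cong (≈-vec {pt t} {Z} c c≢0 (trans (vec-point z κz≢0) z≡′)))

        anisotropic-representations : ∑ (λ t → ∑ λ c → χ² c * δ z (c • vec (pt t))) ≡ χ² (normᵛ z)
        anisotropic-representations = begin
          ∑ (λ t → ∑ λ c → χ² c * δ z (c • vec (pt t)))     ≡⟨ ∑-cong (λ t → ∑-cong λ c → unique t c) ⟩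
          ∑ (λ t → ∑ λ c → δ t t₀ * δ c c₀)                 ≡⟨ ∑-prod (λ t → δ t t₀) (λ c → δ c c₀) ⟩
          ∑ (λ t → δ t t₀) * ∑ (λ c → δ c c₀)               ≡⟨ cong₂ _*_ (∑δ≡1 t₀) (∑δ≡1 c₀) ⟩
          1# * 1#                                           ≡⟨ *-identityˡ 1# ⟩
          1#                                                ≡⟨ sym (χ²≡1 κz≢0) ⟩
          χ² (normᵛ z)                                      ∎

      -- Every anisotropic vector is a unique multiple of the representative of a unique point.
      representations : ∀ z → ∑ (λ t → ∑ λ c → χ² c * δ z (c • vec (pt t))) ≡ χ² (normᵛ z)
      representations z = byCases (normᵛ z ≟ 0ᴬ) (λ κz≡0 → trans (∑-cong λ t → trans (∑-cong λ c →
            χ²*δ c (δ z (c • vec (pt t))) λ c≢0 → ⟦⟧-no (z ≟ c • vec (pt t)) λ z≡ →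
              ⊗-≢0 (⊗-≢0 c≢0 c≢0) (norm≢0 (pt t)) (trans (sym (norm-• c (vec (pt t)))) (trans (cong normᵛ (sym z≡)) κz≡0))) ∑-zero)
          (trans ∑-zero (sym (trans (cong χ² κz≡0) χ²-0))))
        (anisotropic-representations z)

    -- Each point has q - 1 coordinate vectors and χ² of the norm selects the anisotropic ones. This
    -- accounts for the factor q - 1 in all sums over vectors.
    ∑-points : ∀ (φ : V → Num) → (∀ c z → c ≢ 0ᴬ → φ (c • z) ≡ φ z) →
               (q - 1#) * ∑ (λ t → φ (vec (pt t))) ≡ ∑ (λ z → χ² (normᵛ z) * φ z)
    ∑-points φ invariant = sym (begin
      ∑ (λ z → χ² (normᵛ z) * φ z)
        ≡⟨ ∑-cong (λ z → cong (_* φ z) (sym (representations z))) ⟩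
      ∑ (λ z → ∑ (λ t → ∑ λ c → χ² c * δ z (c • vec (pt t))) * φ z)
        ≡⟨ ∑-cong (λ z → trans (sym (∑-*ʳ _ (φ z))) (∑-cong λ t → sym (∑-*ʳ _ (φ z)))) ⟩
      ∑ (λ z → ∑ λ t → ∑ λ c → χ² c * δ z (c • vec (pt t)) * φ z)
        ≡⟨ trans (∑-swap _) (∑-cong λ t → ∑-swap _) ⟩
      ∑ (λ t → ∑ λ c → ∑ λ z → χ² c * δ z (c • vec (pt t)) * φ z)
        ≡⟨ ∑-cong (λ t → ∑-cong λ c → trans (∑-cong λ z → *-assoc _ _ _) (trans (∑-* (χ² c) _) (cong (χ² c *_) (∑-δ φ (c • vec (pt t)))))) ⟩
      ∑ (λ t → ∑ λ c → χ² c * φ (c • vec (pt t)))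
        ≡⟨ ∑-cong (λ t → trans (∑-cong λ c → invariance t c) (trans (∑-*ʳ χ² _) (cong (_* φ (vec (pt t))) ∑χ²))) ⟩
      ∑ (λ t → (q - 1#) * φ (vec (pt t)))
        ≡⟨ ∑-* _ _ ⟩
      (q - 1#) * ∑ (λ t → φ (vec (pt t))) ∎)
      where
      invariance : ∀ t c → χ² c * φ (c • vec (pt t)) ≡ χ² c * φ (vec (pt t))
      invariance t c = byCases (c ≟ 0ᴬ) (λ c≡0 → trans (vanish c≡0 _) (sym (vanish c≡0 _)))
        λ c≢0 → cong (χ² c *_) (invariant c _ c≢0)
        where
        vanish : c ≡ 0ᴬ → ∀ u → χ² c * u ≡ 0#
        vanish c≡0 u = trans (cong (_* u) (trans (cong χ² c≡0) χ²-0)) (zeroˡ u)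

-- Eigenvalue tables as polynomials

module Tables {c ℓ} (R : CommutativeRing c ℓ) where

  open import Data.Bool.Base using (if_then_else_)
  open import Data.Fin.Base using (Fin; zero; suc)
  open import Data.Fin.Patterns using (0F; 1F; 2F; 3F; 4F; 5F)
  open import Data.Fin.Properties using () renaming (_≟_ to _≟ᶠ_)
  open import Data.Integer.Base using (ℤ; -[1+_]) renaming (+_ to pos)
  open import Data.Maybe.Base using (Maybe; just; from-just; _>>=_)
  open import Data.Nat.Base using (zero; suc)
  open import Data.Vec.Base using (Vec; []; _∷_; lookup)
  open import Data.Vec.Functional using (Vector; foldr)
  open import Relation.Nullary using (does)
  open IntegerSolver R

  Table : Set
  Table = Fin 6 → Fin 6 → Polynomial 3

  table : Vec (Vec (Polynomial 3) 6) 6 → Table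
  table rows i j = lookup (lookup rows i) j

  ∑ₚ : ∀ {n} → Vector (Polynomial 3) n → Polynomial 3
  ∑ₚ = foldr _:+_ (con (pos 0))

  q M ε ε² qM 1ₚ 2ₚ 3ₚ 4ₚ 0ₚ : Polynomial 3
  q  = var 0F
  M  = var 1F
  ε  = var 2F
  ε² = ε :* ε
  qM = q :* M
  0ₚ = con (pos 0)
  1ₚ = con (pos 1)
  2ₚ = con (pos 2)
  3ₚ = con (pos 3)
  4ₚ = con (pos 4)

  -- 4 P with q^(m-1) = M.  The unit is written ε² where this makes the entries homogeneous in
  -- M and ε; the orthogonality and multiplication relations then hold as polynomial identities.
  4P : Table
  4P = table
    ( (4ₚ :* ε² ∷ 4ₚ :* (qM :* qM :- ε²) ∷ qM :* (qM :+ ε) :* (q :- 3ₚ) ∷ qM :* (qM :- ε) :* (q :- 1ₚ)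
        ∷ qM :* (qM :+ ε) :* (q :- 1ₚ) ∷ qM :* (qM :- ε) :* (q :+ 1ₚ) ∷ [])
    ∷ (4ₚ :* ε² ∷ 4ₚ :* (qM :* qM :- ε²) ∷ qM :* (qM :+ ε) :* (q :- 3ₚ) ∷ qM :* (qM :- ε) :* (q :- 1ₚ)
        ∷ :- (qM :* (qM :+ ε) :* (q :- 1ₚ)) ∷ :- (qM :* (qM :- ε) :* (q :+ 1ₚ)) ∷ [])
    ∷ (4ₚ :* ε² ∷ 4ₚ :* (ε :* M :- ε²) ∷ ε :* M :* (q :+ 1ₚ) :* (q :- 3ₚ) ∷ :- (ε :* M :* ((q :- 1ₚ) :* (q :- 1ₚ)))
        ∷ ε :* M :* (q :- 1ₚ) :* (q :+ 1ₚ) ∷ :- (ε :* M :* (q :- 1ₚ) :* (q :+ 1ₚ)) ∷ [])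
    ∷ (4ₚ :* ε² ∷ 4ₚ :* (ε :* M :- ε²) ∷ ε :* M :* (q :+ 1ₚ) :* (q :- 3ₚ) ∷ :- (ε :* M :* ((q :- 1ₚ) :* (q :- 1ₚ)))
        ∷ :- (ε :* M :* (q :- 1ₚ) :* (q :+ 1ₚ)) ∷ ε :* M :* (q :- 1ₚ) :* (q :+ 1ₚ) ∷ [])
    ∷ (4ₚ :* ε² ∷ 4ₚ :* (ε :* qM :- ε²) ∷ :- (4ₚ :* (ε :* qM)) ∷ 0ₚ ∷ 0ₚ ∷ 0ₚ ∷ [])
    ∷ (4ₚ :* ε² ∷ 4ₚ :* (:- (ε :* qM) :- ε²) ∷ 0ₚ ∷ 4ₚ :* (ε :* qM) ∷ 0ₚ ∷ 0ₚ ∷ [])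
    ∷ [])

  -- Column j of Q is numerator j divided by denominator j.
  Q-numerator : Table
  Q-numerator = table
    ( (ε² ∷ ε² ∷ q :* (q :* (qM :* qM :- ε²)) ∷ q :* (q :* (qM :* qM :- ε²))
        ∷ (q :- 3ₚ) :* (qM :+ ε) :* (q :* qM :- ε) ∷ (q :- 1ₚ) :* (qM :- ε) :* (q :* qM :- ε) ∷ [])
    ∷ (ε² ∷ ε² ∷ q :* (q :* (ε :* M :- ε²)) ∷ q :* (q :* (ε :* M :- ε²))
        ∷ ε :* (q :- 3ₚ) :* (q :* qM :- ε) ∷ :- (ε :* (q :- 1ₚ) :* (q :* qM :- ε)) ∷ [])
    ∷ (ε² ∷ ε² ∷ q :* (ε :* (q :+ 1ₚ) :* (qM :- ε)) ∷ q :* (ε :* (q :+ 1ₚ) :* (qM :- ε))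
        ∷ :- (4ₚ :* ε :* (q :* qM :- ε)) ∷ 0ₚ ∷ [])
    ∷ (ε² ∷ ε² ∷ :- (q :* (ε :* (q :- 1ₚ) :* (qM :+ ε))) ∷ :- (q :* (ε :* (q :- 1ₚ) :* (qM :+ ε)))
        ∷ 0ₚ ∷ 4ₚ :* ε :* (q :* qM :- ε) ∷ [])
    ∷ (ε² ∷ :- ε² ∷ q :* (ε :* (q :+ 1ₚ) :* (qM :- ε)) ∷ :- (q :* (ε :* (q :+ 1ₚ) :* (qM :- ε))) ∷ 0ₚ ∷ 0ₚ ∷ [])
    ∷ (ε² ∷ :- ε² ∷ :- (q :* (ε :* (q :- 1ₚ) :* (qM :+ ε))) ∷ q :* (ε :* (q :- 1ₚ) :* (qM :+ ε)) ∷ 0ₚ ∷ 0ₚ ∷ [])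
    ∷ [])

  -- For every j the product of both entries is 2 (q - 1)(q + 1). In 𝐐 𝐏 the columns of 𝐐 are summed
  -- over and need this common denominator; in 𝐏 𝐐 the denominator of the column factors out.
  denominator cofactor : Fin 6 → Polynomial 3
  denominator = lookup (1ₚ ∷ 1ₚ ∷ (q :- 1ₚ) :* (q :+ 1ₚ) ∷ (q :- 1ₚ) :* (q :+ 1ₚ) ∷ 2ₚ :* (q :- 1ₚ) ∷ 2ₚ :* (q :+ 1ₚ) ∷ [])
  cofactor = lookup (2ₚ :* ((q :- 1ₚ) :* (q :+ 1ₚ)) ∷ 2ₚ :* ((q :- 1ₚ) :* (q :+ 1ₚ)) ∷ 2ₚ ∷ 2ₚ ∷ q :+ 1ₚ ∷ q :- 1ₚ ∷ [])

  -- The number q^m (q^(m+1) - ε) of anisotropic points.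
  points : Polynomial 3
  points = qM :* (q :* qM :- ε)

  δₚ : Fin 6 → Fin 6 → Polynomial 3
  δₚ i j = if does (i ≟ᶠ j) then 1ₚ else 0ₚ

  -- The matrices J, J′ = (χ(κ x) χ(κ y)), I, Z = [D = 0], G = χ(D) and G′ = J′ ∘ G.
  basis : Fin 6 → Fin 6 → ℤ
  basis b l = lookup (lookup
    ( (pos 1 ∷ pos 1 ∷ pos 1    ∷ pos 1    ∷ pos 1    ∷ pos 1    ∷ [])
    ∷ (pos 1 ∷ pos 1 ∷ pos 1    ∷ pos 1    ∷ -[1+ 0 ] ∷ -[1+ 0 ] ∷ [])
    ∷ (pos 1 ∷ pos 0 ∷ pos 0    ∷ pos 0    ∷ pos 0    ∷ pos 0    ∷ [])
    ∷ (pos 1 ∷ pos 1 ∷ pos 0    ∷ pos 0    ∷ pos 0    ∷ pos 0    ∷ [])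
    ∷ (pos 0 ∷ pos 0 ∷ pos 1    ∷ -[1+ 0 ] ∷ pos 1    ∷ -[1+ 0 ] ∷ [])
    ∷ (pos 0 ∷ pos 0 ∷ pos 1    ∷ -[1+ 0 ] ∷ -[1+ 0 ] ∷ pos 1    ∷ [])
    ∷ []) b) l

  -- 4 A in terms of the basis.
  4A : Fin 6 → Fin 6 → ℤ
  4A i b = lookup (lookup
    ( (pos 0 ∷ pos 0    ∷ pos 4    ∷ pos 0    ∷ pos 0    ∷ pos 0    ∷ [])
    ∷ (pos 0 ∷ pos 0    ∷ -[1+ 3 ] ∷ pos 4    ∷ pos 0    ∷ pos 0    ∷ [])
    ∷ (pos 1 ∷ pos 1    ∷ pos 0    ∷ -[1+ 1 ] ∷ pos 1    ∷ pos 1    ∷ [])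
    ∷ (pos 1 ∷ pos 1    ∷ pos 0    ∷ -[1+ 1 ] ∷ -[1+ 0 ] ∷ -[1+ 0 ] ∷ [])
    ∷ (pos 1 ∷ -[1+ 0 ] ∷ pos 0    ∷ pos 0    ∷ pos 1    ∷ -[1+ 0 ] ∷ [])
    ∷ (pos 1 ∷ -[1+ 0 ] ∷ pos 0    ∷ pos 0    ∷ -[1+ 0 ] ∷ pos 1    ∷ [])
    ∷ []) i) b

  -- Entries of the products of basis matrices at a pair of points in relation l.
  σ η : Fin 6 → Polynomial 3
  σ l = con (basis 1F l)
  η l = con (basis 4F l)

  rowZ rowG rowG′ : Polynomial 3
  rowZ  = q :* q :* M :* M
  rowG  = ε :* q :* M :* (q :- 1ₚ) :- q :* q :* M :* M
  rowG′ = :- (ε :* q :* M)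

  ZZ ZG GG GG′ : Fin 6 → Polynomial 3
  ZZ 0F  = rowZ
  ZZ 1F  = 2ₚ :* q :* M :* M
  ZZ l   = (1ₚ :+ σ l) :* (q :* M :* M :- ε :* η l :* M)
  ZG 0F  = 0ₚ
  ZG 1F  = :- (q :* M :* M)
  ZG l   = ε :* q :* M :+ ε :* η l :* M :- q :* M :* M
  GG 0F  = q :* q :* M :* M :* (q :- 1ₚ) :- ε :* q :* M
  GG 1F  = q :* M :* M :- ε :* q :* M
  GG l   = q :* M :* M :- ε :* η l :* M :+ ε :* η l :* q :* M :* (q :- 2ₚ) :- ε :* q :* M
  GG′ 0F = :- (q :* q :* M :* M)
  GG′ 1F = 0ₚ
  GG′ l  = :- (ε :* η l :* q :* M :* (1ₚ :+ σ l))

  -- Index 2 is the identity matrix; its products carry ε² in order to have the same degree in M and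
  -- ε as the others. Products with J are row sums, and the twist σ of the pair is extracted
  -- wherever both factors permit it.
  product : Fin 6 → Fin 6 → Fin 6 → Polynomial 3
  product 2F b  l = con (basis b l) :* ε²
  product b  2F l = con (basis b l) :* ε²
  product 0F 0F l = points
  product 0F 1F l = 0ₚ
  product 0F 3F l = rowZ
  product 0F 4F l = rowG
  product 0F 5F l = rowG′
  product 1F 0F l = 0ₚ
  product 1F 1F l = σ l :* points
  product 1F 3F l = σ l :* rowZ
  product 1F 4F l = σ l :* rowG′
  product 1F 5F l = σ l :* rowG
  product 3F 0F l = rowZ
  product 3F 1F l = σ l :* rowZ
  product 3F 3F l = ZZ l
  product 3F 4F l = ZG l
  product 3F 5F l = σ l :* ZG l
  product 4F 0F l = rowG
  product 4F 1F l = σ l :* rowG′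
  product 4F 3F l = ZG l
  product 4F 4F l = GG l
  product 4F 5F l = GG′ l
  product 5F 0F l = rowG′
  product 5F 1F l = σ l :* rowG
  product 5F 3F l = σ l :* ZG l
  product 5F 4F l = GG′ l
  product 5F 5F l = σ l :* GG l

  -- Four times the eigenvalue of basis matrix b on the eigenspace j, because that matrix is the
  -- combination of adjacency matrices given by row b of `basis`.
  4P-basis : Fin 6 → Fin 6 → Polynomial 3
  4P-basis j b = ∑ₚ λ l → con (basis b l) :* 4P j l

  private
    forAll : ∀ {a n} {P : Fin n → Set a} → (∀ i → Maybe (P i)) → Maybe (∀ i → P i)
    forAll {n = zero}  h = just λ ()
    forAll {n = suc n} h = h zero >>= λ p → forAll (λ i → h (suc i)) >>= λ ps → just λ { zero → p ; (suc i) → ps i }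

  open CommutativeRing R using (_≈_)

  -- The two base changes are inverse to each other up to the factor 4.
  basis-4A : ∀ i l ρ → eval (∑ₚ λ b → con (4A i b) :* con (basis b l)) ρ ≈ eval (4ₚ :* δₚ i l) ρ
  basis-4A = from-just (forAll λ i → forAll λ l → (∑ₚ λ b → con (4A i b) :* con (basis b l)) ≋? 4ₚ :* δₚ i l)

  4A-4P-basis : ∀ i j ρ → eval (∑ₚ λ b → con (4A i b) :* 4P-basis j b) ρ ≈ eval (4ₚ :* 4P j i) ρ
  4A-4P-basis = from-just (forAll λ i → forAll λ j → (∑ₚ λ b → con (4A i b) :* 4P-basis j b) ≋? 4ₚ :* 4P j i)

  -- Row j of the eigenvalue table is a character of the algebra: applied to a product of basis
  -- matrices it gives the product of their eigenvalues. All cases are checked by comparing normal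
  -- forms.
  character : ∀ b b′ j ρ → eval (4ₚ :* ∑ₚ λ l → product b b′ l :* 4P j l) ρ ≈ eval (4P-basis j b :* 4P-basis j b′) ρ
  character = from-just (forAll λ b → forAll λ b′ → forAll λ j →
    4ₚ :* (∑ₚ λ l → product b b′ l :* 4P j l) ≋? 4P-basis j b :* 4P-basis j b′)

  PQ : ∀ i j ρ → eval (∑ₚ λ t → 4P i t :* Q-numerator t j) ρ ≈ eval (4ₚ :* ε² :* points :* denominator j :* δₚ i j) ρ
  PQ = from-just (forAll λ i → forAll λ j →
    (∑ₚ λ t → 4P i t :* Q-numerator t j) ≋? 4ₚ :* ε² :* points :* denominator j :* δₚ i j)

  QP : ∀ i j ρ → eval (∑ₚ λ t → cofactor t :* Q-numerator i t :* 4P t j) ρ ≈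
       eval (4ₚ :* ε² :* (2ₚ :* ((q :- 1ₚ) :* (q :+ 1ₚ))) :* points :* δₚ i j) ρ
  QP = from-just (forAll λ i → forAll λ j →
    (∑ₚ λ t → cofactor t :* Q-numerator i t :* 4P t j) ≋? 4ₚ :* ε² :* (2ₚ :* ((q :- 1ₚ) :* (q :+ 1ₚ))) :* points :* δₚ i j)

  valency : ∀ i ρ → eval (∑ₚ λ b → con (4A i b) :* product b 0F 0F) ρ ≈ eval (4P 0F i) ρ
  valency = from-just (forAll λ i → (∑ₚ λ b → con (4A i b) :* product b 0F 0F) ≋? 4P 0F i)

-- Products of the basis matrices in terms of vectors

module BasisProducts where

  open import Data.Bool.Base using (Bool; true; false; _xor_)
  open import Data.Fin.Base using (Fin; suc) renaming (_≤_ to _≤ᶠ_)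
  import Data.Fin.Properties as Fin
  open import Data.Nat.Base using (s≤s)
  open import Data.Sum.Base using (inj₁; inj₂)
  open import Relation.Nullary using (yes; no; contradiction)
  open import Data.Fin.Patterns using (0F; 1F; 2F; 3F; 4F; 5F)
  open import Data.Integer.Base using () renaming (+_ to pos)
  open import Data.Vec.Base using (Vec; []; _∷_)
  open import Relation.Binary.PropositionalEquality
  open DiscreteRings
  open FiniteTypes
  open FiniteFields
  open QuadraticSpaces
  open Products

  module BasisProducts (N : NumberRing) (𝔽 : OddField) (space : QuadraticSpace 𝔽)
                       (distribution : NormDistribution N 𝔽 space) where

    open NumberRing N renaming (Carrier to Num)
    open OddField 𝔽 renaming (Carrier to A)
    open QuadraticSpace space
    open NormDistribution distribution
    open Counting N 𝔽 space distribution using (y⊥)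
    open Sums (NumberRing.discreteRing N)
    open Character N 𝔽
    open CharacterSums N 𝔽
    open Products.Products N 𝔽 space distribution
    open Tables (DiscreteRing.commutativeRing (NumberRing.discreteRing N)) using (product; ZZ; ZG; GG; GG′; σ; η)
    open ≡-Reasoning

    ρ : Vec Num 3
    ρ = q ∷ M ∷ ε ∷ []

    -- Basis matrices 1, 5 carry the factor χ(κ x) χ(κ z).
    twisted : Fin 6 → Bool
    twisted 1F = true
    twisted 5F = true
    twisted _  = false

    kernel : Fin 6 → A → Num
    kernel 3F = δ₀
    kernel 4F = χ
    kernel 5F = χ
    kernel _  = λ _ → 1#

    type : Bool → A → Num
    type false k = 1#
    type true  k = χ k

    -- Both weights vanish on isotropic vectors, so the sums run over coordinate vectors of
    -- anisotropic points only.
    weight : Bool → A → Num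
    weight false = χ²
    weight true  = χ

    entry : Fin 6 → V → V → Num
    entry b x z = type (twisted b) (κ x) * type (twisted b) (κ z) * kernel b (D x z)

    correlation : Bool → (F G : A → Num) → V → V → Num
    correlation w F G x y = ∑ λ z → weight w (κ z) * (F (D x z) * G (D y z))

    private
      χ⁴≡χ² : ∀ k → χ² k * χ² k ≡ χ² k
      χ⁴≡χ² k = trans (*-assoc (χ k) (χ k) (χ² k)) (cong (χ k *_) (χ³≡χ k))

      weigh : ∀ p r k → χ² k * (type p k * type r k) ≡ weight (p xor r) k
      weigh false false k = (solve 1 (λ s → s :* (con (pos 1) :* con (pos 1)) := s) refl (χ² k))
      weigh false true  k = trans (solve 1 (λ c → c :* c :* (con (pos 1) :* c) := c :* (c :* c)) refl (χ k)) (χ³≡χ k)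
      weigh true  false k = trans (solve 1 (λ c → c :* c :* (c :* con (pos 1)) := c :* (c :* c)) refl (χ k)) (χ³≡χ k)
      weigh true  true  k = χ⁴≡χ² k

    -- Two twists χ(κ z) cancel on anisotropic z, while a single one turns the weight χ² into χ;
    -- hence the exclusive or.
    ∑-entries : ∀ b b′ x y →
      ∑ (λ z → χ² (κ z) * (entry b x z * entry b′ y z)) ≡
      type (twisted b) (κ x) * type (twisted b′) (κ y) *
      correlation (twisted b xor twisted b′) (kernel b) (kernel b′) x y
    ∑-entries b b′ x y = trans (∑-cong λ z → trans
        (solve 7 (λ s a c f d e g → s :* (a :* c :* f :* (d :* e :* g)) := a :* d :* (s :* (c :* e) :* (f :* g))) refl (χ² (κ z)) (type (twisted b) (κ x)) (type (twisted b) (κ z)) (kernel b (D x z)) (type (twisted b′) (κ y)) (type (twisted b′) (κ z)) (kernel b′ (D y z)))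
        (cong (λ w → type (twisted b) (κ x) * type (twisted b′) (κ y) * (w * (kernel b (D x z) * kernel b′ (D y z))))
          (weigh (twisted b) (twisted b′) (κ z))))
      (∑-* _ _)

    private
      -- χ(κ z) = χ(κ y) wherever D y z vanishes and κ z does not.
      absorb : ∀ y → κ y ≢ 0ᴬ → ∀ z → χ (κ z) * δ₀ (D y z) ≡ χ (κ y) * (χ² (κ z) * δ₀ (D y z))
      absorb y κy≢0 z with D y z ≟ 0ᴬ
      ... | no _     = trans (zeroʳ _) (sym (trans (cong (χ (κ y) *_) (zeroʳ _)) (zeroʳ _)))
      ... | yes D≡0 with κ z ≟ 0ᴬ
      ...   | yes κz≡0 = trans (cong (λ k → χ k * 1#) κz≡0) (trans (cong (_* 1#) χ0) (sym (trans (cong (λ k → χ (κ y) * (χ² k * 1#)) κz≡0)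
                (trans (cong (λ s → χ (κ y) * (s * 1#)) χ²-0) (solve 1 (λ c → c :* (con (pos 0) :* con (pos 1)) := con (pos 0) :* con (pos 1)) refl (χ (κ y)))))))
      ...   | no κz≢0  = trans (cong (_* 1#) (sym (trans (cong (_* χ (κ z)) same) (*-identityˡ _))))
                (solve 2 (λ c d → c :* d :* d :* con (pos 1) := c :* (d :* d :* con (pos 1))) refl (χ (κ y)) (χ (κ z)))
        where
        same : χ (κ y) * χ (κ z) ≡ 1#
        same = trans (sym (χ-* (κ y) (κ z))) (trans (sym (χ-square-* 2≢0 _)) (trans (cong χ square≡) (χ-square b≢0)))
          where
          square≡ : 2ᴬ ⊗ 2ᴬ ⊗ (κ y ⊗ κ z) ≡ b y z ⊗ b y z
          square≡ = trans (solveᴬ 3 (λ k l b → conᴬ (pos 2) :⊗ conᴬ (pos 2) :⊗ (k :⊗ l) :≣ b :⊗ b :⊝ (b :⊗ b :⊝ conᴬ (pos 4) :⊗ (k :⊗ l))) refl (κ y) (κ z) (b y z))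
            (trans (cong (b y z ⊗ b y z ⊝_) D≡0) (solveᴬ 1 (λ b → b :⊗ b :⊝ conᴬ (pos 0) :≣ b :⊗ b) refl (b y z)))
          b≢0 : b y z ≢ 0ᴬ
          b≢0 e = ⊗-≢0 (⊗-≢0 2≢0 2≢0) (⊗-≢0 κy≢0 κz≢0) (trans square≡ (trans (cong (λ u → u ⊗ u) e) (solveᴬ 0 (conᴬ (pos 0) :⊗ conᴬ (pos 0) :≣ conᴬ (pos 0)) refl)))

    module _ (x y : V) (κx≢0 : κ x ≢ 0ᴬ) (κy≢0 : κ y ≢ 0ᴬ) where

      private
        cx = χ (κ x)
        cy = χ (κ y)

        drop : ∀ w (G : A → Num) → correlation w (λ _ → 1#) G x y ≡ ∑ (λ z → weight w (κ z) * G (D y z))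
        drop w G = ∑-cong λ z → cong (weight w (κ z) *_) (*-identityˡ _)

      -- Under the factor Z the twist at z equals the twist at y and leaves the sum. For this reason
      -- Z has no twisted companion in the basis.
      correlation-χδ : ∀ (F : A → Num) → correlation true F δ₀ x y ≡ cy * correlation false F δ₀ x y
      correlation-χδ F = trans (∑-cong λ z → begin
          χ (κ z) * (F (D x z) * δ₀ (D y z))          ≡⟨ (solve 3 (λ k f d → k :* (f :* d) := f :* (k :* d)) refl (χ (κ z)) (F (D x z)) (δ₀ (D y z))) ⟩
          F (D x z) * (χ (κ z) * δ₀ (D y z))          ≡⟨ cong (F (D x z) *_) (absorb y κy≢0 z) ⟩
          F (D x z) * (cy * (χ² (κ z) * δ₀ (D y z)))  ≡⟨ (solve 4 (λ c k f d → f :* (c :* (k :* d)) := c :* (k :* (f :* d))) refl (cy) (χ² (κ z)) (F (D x z)) (δ₀ (D y z))) ⟩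
          cy * (χ² (κ z) * (F (D x z) * δ₀ (D y z)))  ∎)
        (∑-* cy _)

      correlation-δχ : ∀ (G : A → Num) → correlation true δ₀ G x y ≡ cx * correlation false δ₀ G x y
      correlation-δχ G = trans (∑-cong λ z → begin
          χ (κ z) * (δ₀ (D x z) * G (D y z))          ≡⟨ sym (*-assoc _ _ _) ⟩
          χ (κ z) * δ₀ (D x z) * G (D y z)            ≡⟨ cong (_* G (D y z)) (absorb x κx≢0 z) ⟩
          cx * (χ² (κ z) * δ₀ (D x z)) * G (D y z)    ≡⟨ (solve 4 (λ c k g d → c :* (k :* d) :* g := c :* (k :* (d :* g))) refl (cx) (χ² (κ z)) (G (D y z)) (δ₀ (D x z))) ⟩
          cx * (χ² (κ z) * (δ₀ (D x z) * G (D y z)))  ∎)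
        (∑-* cx _)

      -- Every product of basis matrices other than the identity is either a row sum or one of these
      -- correlations, up to the factor `cx * cy`. The factor q - 1 stems from counting vectors
      -- instead of points.
      record Correlations (l : Fin 6) : Set where
        field
          types : cx * cy ≡ eval (σ l) ρ
          zz    : correlation false δ₀ δ₀ x y ≡ (q - 1#) * eval (ZZ l) ρ
          zg    : correlation false δ₀ χ x y ≡ (q - 1#) * eval (ZG l) ρ
          gg    : correlation false χ χ x y ≡ (q - 1#) * eval (GG l) ρ
          gg′   : cy * correlation true χ χ x y ≡ (q - 1#) * eval (GG′ l) ρ

      private
        cy²≡1 : cy * cy ≡ 1#
        cy²≡1 = χ²≡1 κy≢0

        s11 : correlation false (λ _ → 1#) (λ _ → 1#) x y ≡ (q - 1#) * (q * M * (q * (q * M) - ε))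
        s11 = trans (∑-cong λ z → (solve 1 (λ s → s :* (con (pos 1) :* con (pos 1)) := s) refl (χ² (κ z)))) (trans ∑-χ²κ
          (solve 3 (λ q M ε → (q :- con (pos 1)) :* (q :* q :* q :* M :* M :- ε :* q :* M) := (q :- con (pos 1)) :* (q :* M :* (q :* (q :* M) :- ε))) refl q M ε))

        s11′ : correlation true (λ _ → 1#) (λ _ → 1#) x y ≡ 0#
        s11′ = trans (∑-cong λ z → (solve 1 (λ s → s :* (con (pos 1) :* con (pos 1)) := s) refl (χ (κ z)))) ∑-χκ

        s1Z : correlation false (λ _ → 1#) δ₀ x y ≡ (q - 1#) * (q * q * M * M)
        s1Z = trans (drop false δ₀) (row-Z y κy≢0)

        s1G : correlation false (λ _ → 1#) χ x y ≡ (q - 1#) * (ε * q * M * (q - 1#) - q * q * M * M)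
        s1G = trans (drop false χ) (row-G y κy≢0)

        s1G′ : correlation true (λ _ → 1#) χ x y ≡ (q - 1#) * - (ε * q * M * cy)
        s1G′ = trans (drop true χ) (row-TG y κy≢0)

        one : ∀ {u v} → u ≡ v → 1# * 1# * u ≡ v
        one {u} e = trans (solve 1 (λ u → con (pos 1) :* con (pos 1) :* u := u) refl u) e

      module _ {l : Fin 6} (correlations : Correlations l) where

        open Correlations correlations

        private
          both : ∀ {u p} → u ≡ (q - 1#) * p → cx * cy * u ≡ (q - 1#) * (eval (σ l) ρ * p)
          both {u} {p} h = trans (cong₂ _*_ types h) (solve 3 (λ s q p → s :* ((q :- con (pos 1)) :* p) := (q :- con (pos 1)) :* (s :* p)) refl (eval (σ l) ρ) q p)

        -- The identity matrix is excluded because equality of points is not determined by norms and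
        -- discriminants; the case b > b′ is reduced to this one by exchanging x and y.
        products : ∀ b b′ → b ≢ 2F → b′ ≢ 2F → b ≤ᶠ b′ →
          ∑ (λ z → χ² (κ z) * (entry b x z * entry b′ y z)) ≡ (q - 1#) * eval (product b b′ l) ρ
        products 2F _  b≢2 _ _ = contradiction refl b≢2
        products _  2F _ b≢2 _ = contradiction refl b≢2
        products 0F 0F _ _ _ = trans (∑-entries 0F 0F x y) (one s11)
        products 0F 1F _ _ _ = trans (∑-entries 0F 1F x y) (trans (cong (1# * cy *_) s11′) (solve 2 (λ c q → con (pos 1) :* c :* con (pos 0) := (q :- con (pos 1)) :* con (pos 0)) refl (cy) q))
        products 0F 3F _ _ _ = trans (∑-entries 0F 3F x y) (one s1Z)
        products 0F 4F _ _ _ = trans (∑-entries 0F 4F x y) (one s1G)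
        products 0F 5F _ _ _ = trans (∑-entries 0F 5F x y) (trans (cong (1# * cy *_) s1G′)
          (trans (solve 4 (λ c q ε M → con (pos 1) :* c :* ((q :- con (pos 1)) :* :- (ε :* q :* M :* c)) := (q :- con (pos 1)) :* :- (ε :* q :* M :* (c :* c))) refl (cy) q ε M)
            (cong (λ u → (q - 1#) * - u) (trans (cong (ε * q * M *_) cy²≡1) (*-identityʳ _)))))
        products 1F 1F _ _ _ = trans (∑-entries 1F 1F x y) (both s11)
        products 1F 3F _ _ _ = trans (∑-entries 1F 3F x y) (trans (cong (cx * 1# *_) (correlation-χδ (λ _ → 1#)))
          (trans (solve 3 (λ c d u → c :* con (pos 1) :* (d :* u) := c :* d :* u) refl (cx) (cy) (correlation false (λ _ → 1#) δ₀ x y)) (both s1Z)))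
        products 1F 4F _ _ _ = trans (∑-entries 1F 4F x y) (trans (cong (cx * 1# *_) s1G′)
          (trans (solve 5 (λ c d q ε M → c :* con (pos 1) :* ((q :- con (pos 1)) :* :- (ε :* q :* M :* d)) := c :* d :* ((q :- con (pos 1)) :* :- (ε :* q :* M))) refl (cx) (cy) q ε M) (both refl)))
        products 1F 5F _ _ _ = trans (∑-entries 1F 5F x y) (both s1G)
        products 3F 3F _ _ _ = trans (∑-entries 3F 3F x y) (one zz)
        products 3F 4F _ _ _ = trans (∑-entries 3F 4F x y) (one zg)
        products 3F 5F _ _ _ = trans (∑-entries 3F 5F x y) (trans (cong (1# * cy *_) (correlation-δχ χ))
          (trans (solve 3 (λ c d u → con (pos 1) :* d :* (c :* u) := c :* d :* u) refl (cx) (cy) (correlation false δ₀ χ x y)) (both zg)))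
        products 4F 4F _ _ _ = trans (∑-entries 4F 4F x y) (one gg)
        products 4F 5F _ _ _ = trans (∑-entries 4F 5F x y) (trans (solve 2 (λ c u → con (pos 1) :* c :* u := c :* u) refl (cy) (correlation true χ χ x y)) gg′)
        products 5F 5F _ _ _ = trans (∑-entries 5F 5F x y) (both gg)
        products 1F 0F _ _ ()
        products 3F 0F _ _ ()
        products 4F 0F _ _ ()
        products 5F 0F _ _ ()
        products 3F 1F _ _ (s≤s ())
        products 4F 1F _ _ (s≤s ())
        products 5F 1F _ _ (s≤s ())
        products 4F 3F _ _ (s≤s (s≤s (s≤s ())))
        products 5F 3F _ _ (s≤s (s≤s (s≤s ())))
        products 5F 4F _ _ (s≤s (s≤s (s≤s (s≤s ()))))

    product-sym : ∀ b b′ l → b ≢ 2F → b′ ≢ 2F → b ≤ᶠ b′ → eval (product b′ b l) ρ ≡ eval (product b b′ l) ρ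
    product-sym 2F _  l b≢2 _ _ = contradiction refl b≢2
    product-sym _  2F l _ b≢2 _ = contradiction refl b≢2
    product-sym 0F 0F l _ _ _ = refl
    product-sym 0F 1F l _ _ _ = refl
    product-sym 0F 3F l _ _ _ = refl
    product-sym 0F 4F l _ _ _ = refl
    product-sym 0F 5F l _ _ _ = refl
    product-sym 1F 1F l _ _ _ = refl
    product-sym 1F 3F l _ _ _ = refl
    product-sym 1F 4F l _ _ _ = refl
    product-sym 1F 5F l _ _ _ = refl
    product-sym 3F 3F l _ _ _ = refl
    product-sym 3F 4F l _ _ _ = refl
    product-sym 3F 5F l _ _ _ = refl
    product-sym 4F 4F l _ _ _ = refl
    product-sym 4F 5F l _ _ _ = refl
    product-sym 5F 5F l _ _ _ = refl
    product-sym 1F 0F l _ _ ()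
    product-sym 3F 0F l _ _ ()
    product-sym 4F 0F l _ _ ()
    product-sym 5F 0F l _ _ ()
    product-sym 3F 1F l _ _ (s≤s ())
    product-sym 4F 1F l _ _ (s≤s ())
    product-sym 5F 1F l _ _ (s≤s ())
    product-sym 4F 3F l _ _ (s≤s (s≤s (s≤s ())))
    product-sym 5F 3F l _ _ (s≤s (s≤s (s≤s ())))
    product-sym 5F 4F l _ _ (s≤s (s≤s (s≤s (s≤s ()))))

    module _ {x y : V} (κx≢0 : κ x ≢ 0ᴬ) (κy≢0 : κ y ≢ 0ᴬ) where

      -- A product with b > b′ at (x, y) is the one with b′ < b at (y, x), so the correlations of
      -- both orders are supplied.
      all-products : ∀ {l} → Correlations x y κx≢0 κy≢0 l → Correlations y x κy≢0 κx≢0 l → ∀ b b′ → b ≢ 2F → b′ ≢ 2F →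
        ∑ (λ z → χ² (κ z) * (entry b x z * entry b′ y z)) ≡ (q - 1#) * eval (product b b′ l) ρ
      all-products {l} here there b b′ b≢2 b′≢2 with Fin.≤-total b b′
      ... | inj₁ b≤b′ = products x y κx≢0 κy≢0 here b b′ b≢2 b′≢2 b≤b′
      ... | inj₂ b′≤b = trans (∑-cong λ z → cong (χ² (κ z) *_) (*-comm _ _))
        (trans (products y x κy≢0 κx≢0 there b′ b b′≢2 b≢2 b′≤b) (cong ((q - 1#) *_) (sym (product-sym b′ b l b′≢2 b≢2 b′≤b))))

      private
        cx = χ (κ x)
        cy = χ (κ y)

      -- For proportional vectors the discriminants with z differ by a square factor, so the
      -- correlations become the sums over squares of the kernels.
      equal-correlations : cy ≡ cx → (∀ z → χ (D y z) ≡ χ (D x z)) → Correlations x y κx≢0 κy≢0 0F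
      equal-correlations cy≡cx same = record
        { types = trans (cong (cx *_) cy≡cx) (χ²≡1 κx≢0)
        ; zz    = trans (∑-cong λ z → cong (χ² (κ z) *_) (trans (cong (δ₀ (D x z) *_) (sameδ z)) (δ₀² (D x z)))) (row-Z x κx≢0)
        ; zg    = trans (trans (∑-cong λ z → trans (cong (χ² (κ z) *_) (trans (cong (δ₀ (D x z) *_) (same z)) (trans (*-comm _ _) (χ-δ₀ (D x z))))) (zeroʳ _)) ∑-zero) (sym (zeroʳ _))
        ; gg    = trans (∑-cong λ z → cong (λ u → χ² (κ z) * (χ (D x z) * u)) (same z)) (diagonal-GG x κx≢0)
        ; gg′   = trans (cong₂ _*_ cy≡cx (trans (∑-cong λ z → cong (λ u → χ (κ z) * (χ (D x z) * u)) (same z)) (diagonal-GTG x κx≢0)))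
            (trans (solve 3 (λ c q M → c :* ((q :- con (pos 1)) :* :- (q :* q :* M :* M :* c)) := (q :- con (pos 1)) :* :- (q :* q :* M :* M :* (c :* c))) refl (cx) q M)
              (cong (λ u → (q - 1#) * - u) (trans (cong (q * q * M * M *_) (χ²≡1 κx≢0)) (*-identityʳ _))))
        }
        where
        sameδ : ∀ z → δ₀ (D y z) ≡ δ₀ (D x z)
        sameδ z = trans (δ₀-χ² (D y z)) (trans (cong (λ u → 1# - u * u) (same z)) (sym (δ₀-χ² (D x z))))
          where
          δ₀-χ² : ∀ k → δ₀ k ≡ 1# - χ² k
          δ₀-χ² k = trans (solve 1 (λ d → d := con (pos 1) :- (con (pos 1) :- d)) refl (δ₀ k)) (cong (λ u → 1# - u) (sym (χ²≡1-δ₀ k)))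
        δ₀² : ∀ k → δ₀ k * δ₀ k ≡ δ₀ k
        δ₀² k with k ≟ 0ᴬ
        ... | yes _ = *-identityˡ 1#
        ... | no _  = zeroˡ 0#

      tangent-correlations : D x y ≡ 0ᴬ → ∀ w → b (y⊥ x κx≢0 y) w ≢ 0ᴬ → Correlations x y κx≢0 κy≢0 1F
      tangent-correlations D≡0 w y⊥≁w = record
        { types = tangent-types x κx≢0 y κy≢0 D≡0 w y⊥≁w
        ; zz    = tangent-ZZ x κx≢0 y κy≢0 D≡0 w y⊥≁w
        ; zg    = tangent-ZG x κx≢0 y κy≢0 D≡0 w y⊥≁w
        ; gg    = tangent-GG x κx≢0 y κy≢0 D≡0 w y⊥≁w
        ; gg′   = trans (cong (cy *_) (tangent-GTG x κx≢0 y κy≢0 D≡0 w y⊥≁w)) (solve 2 (λ c q → c :* con (pos 0) := (q :- con (pos 1)) :* con (pos 0)) refl (cy) q)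
        }

      -- With the index in the form suc (suc l), the default clauses of the product tables reduce
      -- for all four relations at once.
      secant-correlations : D x y ≢ 0ᴬ → ∀ l → cx * cy ≡ eval (σ (suc (suc l))) ρ → χ (D x y) ≡ eval (η (suc (suc l))) ρ →
                            Correlations x y κx≢0 κy≢0 (suc (suc l))
      secant-correlations D≢0 l types≡ η≡ = record
        { types = types≡
        ; zz    = trans (secant-ZZ x κx≢0 y κy≢0 D≢0) (cong₂ (λ s h → (q - 1#) * ((1# + s) * (q * M * M - ε * h * M))) types≡ η≡)
        ; zg    = trans (secant-ZG x κx≢0 y κy≢0 D≢0) (cong (λ h → (q - 1#) * (ε * q * M + ε * h * M - q * M * M)) η≡)
        ; gg    = trans (secant-GG x κx≢0 y κy≢0 D≢0) (cong (λ h → (q - 1#) * (q * M * M - ε * h * M + ε * h * q * M * (q - (1# + 1#)) - ε * q * M)) η≡)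
        -- The twist of y turns the sum of the two types into 1 + σ, because `cy * cy` is 1.
        ; gg′   = trans (cong (cy *_) (secant-GTG x κx≢0 y κy≢0 D≢0))
            (trans (solve 6 (λ c d q M ε h → d :* ((q :- con (pos 1)) :* :- (ε :* h :* q :* M :* (c :+ d))) := (q :- con (pos 1)) :* :- (ε :* h :* q :* M :* (d :* d :+ c :* d))) refl (cx) (cy) q M ε (χ (D x y)))
              (trans (cong₂ (λ u s → (q - 1#) * - (ε * χ (D x y) * q * M * (u + s))) (χ²≡1 κy≢0) types≡)
                (cong (λ h → (q - 1#) * - (ε * h * q * M * (1# + eval (σ (suc (suc l))) ρ))) η≡)))
        }

-- Basis matrices on the points

module PointMatrices where

  open import Algebra.Bundles using (CommutativeRing)
  open import Data.Bool.Base using (Bool; true; false)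
  open import Data.Fin.Base using (Fin; zero; suc)
  open import Data.Fin.Patterns using (0F; 1F; 2F; 3F; 4F; 5F)
  open import Data.Integer.Base using () renaming (+_ to pos)
  open import Data.Nat.Base as ℕ using (ℕ; zero; suc)
  open import Data.Product.Base using (_×_; _,_; proj₁; proj₂)
  open import Data.Sign.Base as Sign using (Sign)
  open import Data.Vec.Base using (Vec; lookup)
  open import Data.Vec.Properties using (lookup-zipWith)
  open import Level using (_⊔_)
  open import Function.Base using (_∘_)
  open import Relation.Binary.Bundles using (Setoid)
  open import Relation.Binary.PropositionalEquality
  open import Relation.Nullary using (¬_; yes; no; contradiction)
  open DiscreteRings
  open FiniteTypes
  open FiniteFields
  open QuadraticSpaces
  open Products
  open VectorModel
  open FieldModel
  open FiniteSetoids
  open Geometry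
  open PointSums
  open BasisProducts
  open import Defs using (BinaryForm; module BinaryForm; κ; IsField; AnisotropicPoints; HasSign; S; S̄; _·ᵗ_)
    renaming (R to Relation)

  module PointMatrices (N : NumberRing) {a ℓ} (F : CommutativeRing a ℓ) (F-field : IsField F)
                   (model : Model F) (f : BinaryForm F) (nonDegenerate : BinaryForm.NonDegenerate f)
                   (sign : Sign) (hasSign : HasSign F sign f) (m₀ : ℕ) where

    private
      module F = CommutativeRing F
      m = suc m₀
    open NumberRing N renaming (Carrier to Num)
    open Transfer F F-field model
    open OddField oddField renaming (Carrier to A)
    open Sums (NumberRing.discreteRing N)
    open Character N oddField
    open CharacterSums N oddField using (χ²; δ₀)
    open Classification N F F-field model f m
      using (Point; coordinates; norm; disc; _≈ₚ?_; relation; relationCode; squareClass; hasSquareClass; HasSquareClass;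
             isZero; isSquare; isNonsquare; type; typeClass; typeClass-injective; norm-cong; disc-congʳ; disc-sym; disc-self; independent)
    open VectorSpace oddField (form f) using (space; non-orthogonal; _+[_]_)
    open QuadraticSpace (space m) renaming (κ to normᵛ) hiding (_+[_]_)
    open PointSums.PointSums N F F-field model f m
    open ≡-Reasoning

    private
      P = AnisotropicPoints F F-field f m
      module P = Setoid P

    signNumber : Sign → Num
    signNumber Sign.+ = 1#
    signNumber Sign.- = - 1#

    signNumber² : ∀ s → signNumber s * signNumber s ≡ 1#
    signNumber² Sign.+ = (solve 0 (con (pos 1) :* con (pos 1) := con (pos 1)) refl)
    signNumber² Sign.- = (solve 0 (:- con (pos 1) :* :- con (pos 1) := con (pos 1)) refl)

    private
      ∑-value : ∀ s → HasSign F s f → ∀ (ψ : A → Num) → ∑ (λ x → ∑ λ y → ψ (BinaryForm.value (form f) x y)) ≡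
                (q - signNumber s) * ∑ ψ + signNumber s * q * ψ 0ᴬ
      ∑-value Sign.+ (s , t , s′ , t′ , α≈ , β≈ , γ≈) = NormCount.∑-reducible N oddField (form f)
        (trans (to-cong α≈) (to-* _ _)) (trans (to-cong β≈) (trans (to-+ _ _) (cong₂ _⊕_ (to-* _ _) (to-* _ _))))
        (trans (to-cong γ≈) (to-* _ _)) (determinant≢0 f nonDegenerate α≈ β≈ γ≈)
      ∑-value Sign.- irreducible = NormCount.∑-irreducible N oddField (form f) (form-irreducible f irreducible)

    opaque
      distribution : NormDistribution N oddField (space m)
      distribution = NormCount.distribution N oddField (form f) (signNumber sign) (∑-value sign hasSign) m₀

      distribution-ε : NormDistribution.ε distribution ≡ signNumber sign
      distribution-ε = refl

      distribution-M : NormDistribution.M distribution ≡ NormCount.power N oddField (form f) m₀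
      distribution-M = refl

    open BasisProducts.BasisProducts N oddField (space m) distribution
      using (ρ; entry; kernel; twisted; Correlations; equal-correlations; tangent-correlations; secant-correlations; all-products)
      renaming (type to typeNumber)
    open Counting N oddField (space m) distribution using (y⊥; slope)
    open Tables (DiscreteRing.commutativeRing (NumberRing.discreteRing N))
      using (product; basis; 4A; basis-4A; 4P; 4P-basis; 4A-4P-basis; character; ∑ₚ; points; δₚ)

    ε²≡1 : NormDistribution.ε distribution * NormDistribution.ε distribution ≡ 1#
    ε²≡1 = trans (cong₂ _*_ distribution-ε distribution-ε) (signNumber² sign)

    private
      τ : Point → Num
      τ X = χ (normᵛ (vec X))

      τ≡ : ∀ X → τ X ≡ signOf (typeClass (proj₁ (type X)))
      τ≡ X = trans (cong χ (normᵛ-vec X)) (cong signOf (proj₂ (proj₂ (type X))))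

      τ*τ : ∀ X Y → τ X * τ Y ≡ signOf (typeClass (proj₁ (type X) ·ᵗ proj₁ (type Y)))
      τ*τ X Y = trans (cong₂ _*_ (τ≡ X) (τ≡ Y)) (multiply (proj₁ (type X)) (proj₁ (type Y)))
        where
        multiply : ∀ s t → signOf (typeClass s) * signOf (typeClass t) ≡ signOf (typeClass (s ·ᵗ t))
        multiply S S = (solve 0 (con (pos 1) :* con (pos 1) := con (pos 1)) refl)
        multiply S S̄ = (solve 0 (con (pos 1) :* :- con (pos 1) := :- con (pos 1)) refl)
        multiply S̄ S = (solve 0 (:- con (pos 1) :* con (pos 1) := :- con (pos 1)) refl)
        multiply S̄ S̄ = (solve 0 (:- con (pos 1) :* :- con (pos 1) := con (pos 1)) refl)

      χD : ∀ X Y → χ (D (vec X) (vec Y)) ≡ signOf (squareClass (disc X Y))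
      χD X Y = cong χ (D-vec X Y)

    type-cong : ∀ X Y → X P.≈ Y → proj₁ (type X) ≡ proj₁ (type Y)
    type-cong X Y X≈Y = typeClass-injective (trans (sym (proj₂ (proj₂ (type X)))) (trans (norm-cong X Y X≈Y) (proj₂ (proj₂ (type Y)))))

    -- What the counting needs to know about a pair in each relation. The constructor `secant`
    -- stands for every line with non-zero discriminant, including those that miss the quadric.
    data View (X Y : Point) : Fin 6 → Set (a ⊔ ℓ) where
      equal   : X P.≈ Y → View X Y 0F
      tangent : ¬ X P.≈ Y → disc X Y F.≈ F.0# → View X Y 1F
      secant  : ∀ l → ¬ disc X Y F.≈ F.0# → signOf (squareClass (disc X Y)) ≡ fromℤ (basis 4F (suc (suc l))) →
                signOf (typeClass (proj₁ (type X) ·ᵗ proj₁ (type Y))) ≡ fromℤ (basis 1F (suc (suc l))) → View X Y (suc (suc l))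

    view : ∀ X Y → View X Y (relation X Y)
    view X Y with X ≈ₚ? Y
    ... | yes X≈Y = equal X≈Y
    ... | no X≉Y = distinct (hasSquareClass (disc X Y)) refl (proj₁ (type X) ·ᵗ proj₁ (type Y)) refl
      where
      distinct : ∀ {c} → HasSquareClass (disc X Y) c → squareClass (disc X Y) ≡ c → ∀ t →
                 proj₁ (type X) ·ᵗ proj₁ (type Y) ≡ t → View X Y (relationCode c t)
      distinct (isZero D≈0)        e t e′ = tangent X≉Y D≈0
      distinct (isSquare D≉0 _ _)  e S e′ = secant 0F D≉0 (cong signOf e) (cong (signOf ∘ typeClass) e′)
      distinct (isSquare D≉0 _ _)  e S̄ e′ = secant 2F D≉0 (cong signOf e) (cong (signOf ∘ typeClass) e′)
      distinct (isNonsquare ¬s)    e S e′ = secant 1F (λ D≈0 → ¬s F.0# (F.trans (F.zeroˡ F.0#) (F.sym D≈0))) (cong signOf e) (cong (signOf ∘ typeClass) e′)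
      distinct (isNonsquare ¬s)    e S̄ e′ = secant 3F (λ D≈0 → ¬s F.0# (F.trans (F.zeroˡ F.0#) (F.sym D≈0))) (cong signOf e) (cong (signOf ∘ typeClass) e′)

    relation-congʳ : ∀ X Y Z → Y P.≈ Z → relation X Y ≡ relation X Z
    relation-congʳ X Y Z Y≈Z with X ≈ₚ? Y | X ≈ₚ? Z
    ... | yes _   | yes _   = refl
    ... | yes X≈Y | no X≉Z  = contradiction (P.trans {X} {Y} {Z} X≈Y Y≈Z) X≉Z
    ... | no X≉Y  | yes X≈Z = contradiction (P.trans {X} {Z} {Y} X≈Z (P.sym {Y} {Z} Y≈Z)) X≉Y
    ... | no _    | no _    = cong₂ relationCode (disc-congʳ X {Y} {Z} Y≈Z) (cong (proj₁ (type X) ·ᵗ_) (type-cong Y Z Y≈Z))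

    relation-sym : ∀ X Y → relation X Y ≡ relation Y X
    relation-sym X Y with X ≈ₚ? Y | Y ≈ₚ? X
    ... | yes _   | yes _   = refl
    ... | yes X≈Y | no Y≉X  = contradiction (P.sym {X} {Y} X≈Y) Y≉X
    ... | no X≉Y  | yes Y≈X = contradiction (P.sym {Y} {X} Y≈X) X≉Y
    ... | no _    | no _    = cong₂ relationCode (disc-sym X Y) (·ᵗ-comm (proj₁ (type X)) (proj₁ (type Y)))
      where
      ·ᵗ-comm : ∀ s t → s ·ᵗ t ≡ t ·ᵗ s
      ·ᵗ-comm S S = refl
      ·ᵗ-comm S S̄ = refl
      ·ᵗ-comm S̄ S = refl
      ·ᵗ-comm S̄ S̄ = refl

    private
      -- A vanishing y⊥ would be a linear dependence with coefficient 1 at y. With non-degeneracy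
      -- this supplies the vector w required on tangent lines.
      y⊥≢0 : ∀ X Y → ¬ X P.≈ Y → ¬ (∀ i → lookup (y⊥ (vec X) (norm≢0 X) (vec Y)) i ≡ 0ᴬ)
      y⊥≢0 X Y X≉Y zeros = IsField.0≉1 F-field (F.sym (proj₂ (independent X Y X≉Y {from (⊖ s)} {F.1#} λ i →
        to-≡0 (begin
          to (from (⊖ s) F.* coordinates X i F.+ F.1# F.* coordinates Y i)
            ≡⟨ trans (to-+ _ _) (cong₂ _⊕_ (to-* _ _) (to-* _ _)) ⟩
          to (from (⊖ s)) ⊗ to (coordinates X i) ⊕ to F.1# ⊗ to (coordinates Y i)
            ≡⟨ cong₂ (λ u v → u ⊗ to (coordinates X i) ⊕ v ⊗ to (coordinates Y i)) (to-from (⊖ s)) to-1 ⟩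
          ⊖ s ⊗ to (coordinates X i) ⊕ 1ᴬ ⊗ to (coordinates Y i)
            ≡⟨ (solveᴬ 3 (λ s x y → :⊖ s :⊗ x :⊕ conᴬ (pos 1) :⊗ y :≣ y :⊕ :⊖ s :⊗ x) refl s (to (coordinates X i)) (to (coordinates Y i))) ⟩
          to (coordinates Y i) ⊕ ⊖ s ⊗ to (coordinates X i)
            ≡⟨ cong₂ (λ u v → u ⊕ ⊖ s ⊗ v) (sym (lookup-vec Y i)) (sym (lookup-vec X i)) ⟩
          lookup (vec Y) i ⊕ ⊖ s ⊗ lookup (vec X) i
            ≡⟨ sym (lookup-zipWith (λ u v → u ⊕ ⊖ s ⊗ v) i (vec Y) (vec X)) ⟩
          lookup (vec Y +[ ⊖ s ] vec X) i
            ≡⟨ zeros i ⟩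
          0ᴬ ∎))))
        where s = slope (vec X) (norm≢0 X) (vec Y)

      χD-≈ : ∀ X Y → X P.≈ Y → ∀ z → χ (D (vec Y) z) ≡ χ (D (vec X) z)
      χD-≈ X Y X≈Y z = let c , c≢0 , e = vec-≈ {X} {Y} X≈Y in begin
        χ (D (vec Y) z)                  ≡⟨ cong χ (D-sym (vec Y) z) ⟩
        χ (D z (vec Y))                  ≡⟨ cong (λ v → χ (D z v)) e ⟩
        χ (D z (c • vec X))              ≡⟨ cong χ (D-• z c (vec X)) ⟩
        χ (c ⊗ c ⊗ D z (vec X))          ≡⟨ χ-square-* c≢0 _ ⟩
        χ (D z (vec X))                  ≡⟨ cong χ (D-sym z (vec X)) ⟩
        χ (D (vec X) z)                  ∎

    correlations : ∀ X Y → Correlations (vec X) (vec Y) (norm≢0 X) (norm≢0 Y) (relation X Y)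
    correlations X Y = go (view X Y)
      where
      go : ∀ {l} → View X Y l → Correlations (vec X) (vec Y) (norm≢0 X) (norm≢0 Y) l
      go (equal X≈Y) = equal-correlations (norm≢0 X) (norm≢0 Y)
        (trans (τ≡ Y) (trans (cong (signOf ∘ typeClass) (sym (type-cong X Y X≈Y))) (sym (τ≡ X)))) (χD-≈ X Y X≈Y)
      go (tangent X≉Y D≈0) =
        let w , y⊥≁w = non-orthogonal (form-nonDegenerate f nonDegenerate) m (y⊥ (vec X) (norm≢0 X) (vec Y)) (y⊥≢0 X Y X≉Y) in
        tangent-correlations (norm≢0 X) (norm≢0 Y) (trans (D-vec X Y) (trans (to-cong D≈0) to-0)) w y⊥≁w
      go (secant l D≉0 η≡ σ≡) = secant-correlations (norm≢0 X) (norm≢0 Y)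
        (λ D≡0 → D≉0 (to-≡0 (trans (sym (D-vec X Y)) D≡0))) l (trans (τ*τ X Y) σ≡) (trans (χD X Y) η≡)

    -- Norms and discriminants cannot separate equal points from tangent ones, so the identity
    -- matrix is given by equality of points directly.
    matrix : Fin 6 → Point → Point → Num
    matrix 2F X Y = ⟦ X ≈ₚ? Y ⟧
    matrix b  X Y = entry b (vec X) (vec Y)

    private
      entry-kernel : ∀ X Y → View X Y (relation X Y) → fromℤ (basis 3F (relation X Y)) ≡ δ₀ (D (vec X) (vec Y)) ×
                     fromℤ (basis 4F (relation X Y)) ≡ χ (D (vec X) (vec Y)) × ⟦ X ≈ₚ? Y ⟧ ≡ fromℤ (basis 2F (relation X Y))
      entry-kernel X Y v = go v
        where
        go : ∀ {l} → View X Y l → fromℤ (basis 3F l) ≡ δ₀ (D (vec X) (vec Y)) × fromℤ (basis 4F l) ≡ χ (D (vec X) (vec Y)) ×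
             ⟦ X ≈ₚ? Y ⟧ ≡ fromℤ (basis 2F l)
        zeroD : disc X Y F.≈ F.0# → D (vec X) (vec Y) ≡ 0ᴬ
        zeroD D≈0 = trans (D-vec X Y) (trans (to-cong D≈0) to-0)
        at0 : disc X Y F.≈ F.0# → 1# ≡ δ₀ (D (vec X) (vec Y)) × 0# ≡ χ (D (vec X) (vec Y))
        at0 D≈0 = sym (⟦⟧-yes (D (vec X) (vec Y) ≟ 0ᴬ) (zeroD D≈0)) , sym (trans (cong χ (zeroD D≈0)) χ0)
        go (equal X≈Y) = proj₁ (at0 (disc-self X Y X≈Y)) , proj₂ (at0 (disc-self X Y X≈Y)) , ⟦⟧-yes (X ≈ₚ? Y) X≈Y
        go (tangent X≉Y D≈0) = proj₁ (at0 D≈0) , proj₂ (at0 D≈0) , ⟦⟧-no (X ≈ₚ? Y) X≉Y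
        go (secant l D≉0 η≡ _) = trans (basis-3 l) (sym (⟦⟧-no (D (vec X) (vec Y) ≟ 0ᴬ) λ D≡0 → D≉0 (to-≡0 (trans (sym (D-vec X Y)) D≡0)))) ,
          sym (trans (χD X Y) η≡) , trans (⟦⟧-no (X ≈ₚ? Y) (λ X≈Y → D≉0 (disc-self X Y X≈Y))) (sym (basis-2 l))
          where
          basis-3 : ∀ l → fromℤ (basis 3F (suc (suc l))) ≡ 0#
          basis-3 0F = refl
          basis-3 1F = refl
          basis-3 2F = refl
          basis-3 3F = refl
          basis-2 : ∀ l → fromℤ (basis 2F (suc (suc l))) ≡ 0#
          basis-2 0F = refl
          basis-2 1F = refl
          basis-2 2F = refl
          basis-2 3F = refl

    matrix-basis : ∀ b X Y → matrix b X Y ≡ fromℤ (basis b (relation X Y))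
    matrix-basis b X Y = go b
      where
      k = entry-kernel X Y (view X Y)
      types = Correlations.types (correlations X Y)
      one : ∀ u → 1# * 1# * u ≡ u
      one u = (solve 1 (λ u → con (pos 1) :* con (pos 1) :* u := u) refl u)
      basis-0 : ∀ l → 1# ≡ fromℤ (basis 0F l)
      basis-0 0F = refl
      basis-0 1F = refl
      basis-0 2F = refl
      basis-0 3F = refl
      basis-0 4F = refl
      basis-0 5F = refl
      basis-5 : ∀ l → fromℤ (basis 1F l) * fromℤ (basis 4F l) ≡ fromℤ (basis 5F l)
      basis-5 0F = (solve 0 (con (pos 1) :* con (pos 0) := con (pos 0)) refl)
      basis-5 1F = (solve 0 (con (pos 1) :* con (pos 0) := con (pos 0)) refl)
      basis-5 2F = (solve 0 (con (pos 1) :* con (pos 1) := con (pos 1)) refl)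
      basis-5 3F = (solve 0 (con (pos 1) :* :- con (pos 1) := :- con (pos 1)) refl)
      basis-5 4F = (solve 0 (:- con (pos 1) :* con (pos 1) := :- con (pos 1)) refl)
      basis-5 5F = (solve 0 (:- con (pos 1) :* :- con (pos 1) := con (pos 1)) refl)
      go : ∀ b → matrix b X Y ≡ fromℤ (basis b (relation X Y))
      go 0F = trans (one 1#) (basis-0 (relation X Y))
      go 1F = trans (*-identityʳ _) types
      go 2F = proj₂ (proj₂ k)
      go 3F = trans (one _) (sym (proj₁ k))
      go 4F = trans (one _) (sym (proj₁ (proj₂ k)))
      go 5F = trans (cong₂ _*_ types (sym (proj₁ (proj₂ k)))) (basis-5 (relation X Y))

    relation-self : ∀ X → relation X X ≡ 0F
    relation-self X with X ≈ₚ? X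
    ... | yes _  = refl
    ... | no X≉X = contradiction (P.refl {X}) X≉X

    -- A field with one element would have 0 = 1. This licenses cancelling the factor q - 1 from
    -- sums over vectors.
    q-1≢0 : q - 1# ≢ 0#
    q-1≢0 e = 1≢0 (trans (sym (enum-index 1ᴬ)) (trans (cong enum (unique size≡1 (indexᴬ 1ᴬ) (indexᴬ 0ᴬ))) (enum-index 0ᴬ)))
      where
      open Finite (OddField.finite oddField) using (size; enum; enum-index) renaming (index to indexᴬ)
      size≡1 : size ≡ 1
      size≡1 = fromℕ-injective size 1 (trans (solve 1 (λ q → q := (q :- con (pos 1)) :+ con (pos 1)) refl q) (trans (cong (_+ 1#) e) (+-identityˡ 1#)))
      unique : ∀ {n} → n ≡ 1 → (i j : Fin n) → i ≡ j
      unique refl 0F 0F = refl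

    private
      -- The arguments of χ and δ₀ change by non-zero squares, so entries are functions of points
      -- and `∑-points` applies.
      entry-• : ∀ b x c z → c ≢ 0ᴬ → entry b x (c • z) ≡ entry b x z
      entry-• b x c z c≢0 = cong₂ (λ u v → typeNumber (twisted b) (normᵛ x) * u * v) (number (twisted b)) (kern b)
        where
        number : ∀ t → typeNumber t (normᵛ (c • z)) ≡ typeNumber t (normᵛ z)
        number false = refl
        number true  = trans (cong χ (norm-• c z)) (χ-square-* c≢0 _)
        δ-case : δ₀ (D x (c • z)) ≡ δ₀ (D x z)
        δ-case = trans (cong δ₀ (D-• x c z)) (δ-scale (⊗-≢0 c≢0 c≢0) (D x z))
        χ-case : χ (D x (c • z)) ≡ χ (D x z)
        χ-case = trans (cong χ (D-• x c z)) (χ-square-* c≢0 _)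
        kern : ∀ b → kernel b (D x (c • z)) ≡ kernel b (D x z)
        kern 0F = refl
        kern 1F = refl
        kern 2F = refl
        kern 3F = δ-case
        kern 4F = χ-case
        kern 5F = χ-case

      entry-products : ∀ X Y b b′ → b ≢ 2F → b′ ≢ 2F →
        ∑ (λ t → entry b (vec X) (vec (pt t)) * entry b′ (vec Y) (vec (pt t))) ≡ eval (product b b′ (relation X Y)) ρ
      entry-products X Y b b′ b≢2 b′≢2 = cancel q-1≢0 (trans
        (∑-points (λ z → entry b (vec X) z * entry b′ (vec Y) z) λ c z c≢0 → cong₂ _*_ (entry-• b (vec X) c z c≢0) (entry-• b′ (vec Y) c z c≢0))
        (all-products (norm≢0 X) (norm≢0 Y) (correlations X Y)
          (subst (Correlations (vec Y) (vec X) (norm≢0 Y) (norm≢0 X)) (sym (relation-sym X Y)) (correlations Y X)) b b′ b≢2 b′≢2))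

      -- The indicator selects the index of X. The factor ε², which is 1, is attached to match the
      -- homogeneous table.
      identity-product : ∀ X Y b → ∑ (λ t → ⟦ X ≈ₚ? pt t ⟧ * matrix b Y (pt t)) ≡
        fromℤ (basis b (relation X Y)) * (NormDistribution.ε distribution * NormDistribution.ε distribution)
      identity-product X Y b = begin
        ∑ (λ t → ⟦ X ≈ₚ? pt t ⟧ * matrix b Y (pt t))   ≡⟨ ∑-cong (λ t → cong (_* matrix b Y (pt t)) (⟦⟧-⇔ (X ≈ₚ? pt t) (t ≟ index X)
                                                            (λ X≈ → trans (sym (index-pt t)) (index-cong (P.sym {X} {pt t} X≈)))
                                                            (λ { refl → P.sym {pt (index X)} {X} (pt-index X) }))) ⟩
        ∑ (λ t → δ t (index X) * matrix b Y (pt t))    ≡⟨ ∑-δ (λ t → matrix b Y (pt t)) (index X) ⟩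
        matrix b Y (pt (index X))                      ≡⟨ matrix-basis b Y _ ⟩
        fromℤ (basis b (relation Y (pt (index X))))    ≡⟨ cong (λ l → fromℤ (basis b l)) (trans (relation-congʳ Y (pt (index X)) X (pt-index X)) (relation-sym Y X)) ⟩
        fromℤ (basis b (relation X Y))                 ≡⟨ sym (trans (cong (fromℤ (basis b (relation X Y)) *_) ε²≡1) (*-identityʳ _)) ⟩
        fromℤ (basis b (relation X Y)) * (NormDistribution.ε distribution * NormDistribution.ε distribution) ∎

    matrix-products : ∀ X Y b b′ → ∑ (λ t → matrix b X (pt t) * matrix b′ Y (pt t)) ≡ eval (product b b′ (relation X Y)) ρ
    matrix-products X Y = λ
      { 2F b′ → identity-product X Y b′
      -- The table entry with second index 2 reduces only after the first index is known, hence one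
      -- clause for each.
      ; 0F 2F → right 0F (refl)
      ; 1F 2F → right 1F (refl)
      ; 3F 2F → right 3F (refl)
      ; 4F 2F → right 4F (refl)
      ; 5F 2F → right 5F (refl)
      ; 0F 0F → e 0F 0F (λ ()) (λ ()) ; 0F 1F → e 0F 1F (λ ()) (λ ()) ; 0F 3F → e 0F 3F (λ ()) (λ ())
      ; 0F 4F → e 0F 4F (λ ()) (λ ()) ; 0F 5F → e 0F 5F (λ ()) (λ ())
      ; 1F 0F → e 1F 0F (λ ()) (λ ()) ; 1F 1F → e 1F 1F (λ ()) (λ ()) ; 1F 3F → e 1F 3F (λ ()) (λ ())
      ; 1F 4F → e 1F 4F (λ ()) (λ ()) ; 1F 5F → e 1F 5F (λ ()) (λ ())
      ; 3F 0F → e 3F 0F (λ ()) (λ ()) ; 3F 1F → e 3F 1F (λ ()) (λ ()) ; 3F 3F → e 3F 3F (λ ()) (λ ())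
      ; 3F 4F → e 3F 4F (λ ()) (λ ()) ; 3F 5F → e 3F 5F (λ ()) (λ ())
      ; 4F 0F → e 4F 0F (λ ()) (λ ()) ; 4F 1F → e 4F 1F (λ ()) (λ ()) ; 4F 3F → e 4F 3F (λ ()) (λ ())
      ; 4F 4F → e 4F 4F (λ ()) (λ ()) ; 4F 5F → e 4F 5F (λ ()) (λ ())
      ; 5F 0F → e 5F 0F (λ ()) (λ ()) ; 5F 1F → e 5F 1F (λ ()) (λ ()) ; 5F 3F → e 5F 3F (λ ()) (λ ())
      ; 5F 4F → e 5F 4F (λ ()) (λ ()) ; 5F 5F → e 5F 5F (λ ()) (λ ())
      }
      where
      e = entry-products X Y
      right : ∀ b {p} → p ≡ fromℤ (basis b (relation X Y)) * (NormDistribution.ε distribution * NormDistribution.ε distribution) →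
              ∑ (λ t → matrix b X (pt t) * ⟦ Y ≈ₚ? pt t ⟧) ≡ p
      right b refl = trans (∑-cong λ t → *-comm _ _) (trans (identity-product Y X b)
        (cong (λ l → fromℤ (basis b l) * (NormDistribution.ε distribution * NormDistribution.ε distribution)) (relation-sym Y X)))

    adjacency : Fin 6 → Point → Point → Num
    adjacency i X Y = ⟦ relation X Y ≟ i ⟧

-- Intersection numbers and valencies

module Intersections where

  open import Algebra.Bundles using (CommutativeRing)
  open import Data.Fin.Base using (Fin; zero; suc)
  open import Data.Fin.Patterns using (0F; 1F; 2F; 3F; 4F; 5F)
  import Data.Fin.Properties as Fin
  open import Data.Integer.Base using () renaming (+_ to pos)
  open import Data.Nat.Base as ℕ using (ℕ; zero; suc)
  import Data.Nat.Properties as ℕ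
  open import Data.Product.Base using (∃-syntax; _,_; proj₁)
  open import Data.Sign.Base as Sign using (Sign)
  open import Data.Vec.Base using (Vec)
  open import Function.Base using (_∘_)
  open import Relation.Binary.PropositionalEquality
  open import Relation.Nullary using (yes; no; contradiction)
  open DiscreteRings
  open FiniteTypes
  open FiniteFields
  open QuadraticSpaces
  open Products
  open VectorModel
  open FieldModel
  open Geometry
  open PointSums
  open BasisProducts
  open PointMatrices
  open import Defs using (BinaryForm; module BinaryForm; IsField; HasSign)

  module Intersections (N : NumberRing) {a ℓ} (F : CommutativeRing a ℓ) (F-field : IsField F)
                   (model : Model F) (f : BinaryForm F) (nonDegenerate : BinaryForm.NonDegenerate f)
                   (sign : Sign) (hasSign : HasSign F sign f) (m₀ : ℕ) where

    private
      m = suc m₀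
    open NumberRing N renaming (Carrier to Num)
    open Model model using (oddField)
    open OddField oddField using (finite) renaming (Carrier to A)
    open Sums (NumberRing.discreteRing N)
    open Character N oddField using (q)
    open import Algebra.Properties.Semiring.Mult.TCOptimised semiring using (×1-homo-*; 1+×)
    open Classification N F F-field model f m using (Point; relation)
    open VectorSpace oddField (Transfer.form F F-field model f) using (space) public
    open PointSums.PointSums N F F-field model f m
    open PointMatrices.PointMatrices N F F-field model f nonDegenerate sign hasSign m₀
    open NormCount N oddField (Transfer.form F F-field model f) using (power)
    open BasisProducts.BasisProducts N oddField (space m) distribution using (ρ)
    open Tables (DiscreteRing.commutativeRing (NumberRing.discreteRing N)) hiding (q; M; ε; qM)
    open ≡-Reasoning

    private
      ε M : Num
      ε = NormDistribution.ε distribution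
      M = NormDistribution.M distribution

      eval-∑ : ∀ {n} (p : Fin n → Polynomial 3) → eval (∑ₚ p) ρ ≡ ∑ (λ i → eval (p i) ρ)
      eval-∑ p = trans (go p) (sym (∑≡sum _))
        where
        open import Algebra.Properties.Semiring.Sum semiring using (sum)
        go : ∀ {n} (p : Fin n → Polynomial 3) → eval (∑ₚ p) ρ ≡ sum (λ i → eval (p i) ρ)
        go {zero}  p = refl
        go {suc n} p = cong (eval (p zero) ρ +_) (go (p ∘ suc))

      4A-number : Fin 6 → Fin 6 → Num
      4A-number i b = fromℤ (4A i b)

    4# : Num
    4# = fromℤ (pos 4)

    4P-number : Fin 6 → Fin 6 → Num
    4P-number j i = eval (4P j i) ρ

    -- Entries of basis matrices depend only on the relation of the two points, so the inverse base
    -- change `basis-4A` applies entrywise.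
    adjacency-matrix : ∀ i X Y → 4# * adjacency i X Y ≡ ∑ (λ b → 4A-number i b * matrix b X Y)
    adjacency-matrix i X Y = sym (begin
      ∑ (λ b → 4A-number i b * matrix b X Y)                       ≡⟨ ∑-cong (λ b → cong (4A-number i b *_) (matrix-basis b X Y)) ⟩
      ∑ (λ b → 4A-number i b * fromℤ (basis b l))                  ≡⟨ sym (eval-∑ (λ b → con (4A i b) :* con (basis b l))) ⟩
      eval (∑ₚ λ b → con (4A i b) :* con (basis b l)) ρ            ≡⟨ basis-4A i l ρ ⟩
      4# * eval (δₚ i l) ρ                                         ≡⟨ cong (4# *_) (indicator i l) ⟩
      4# * adjacency i X Y                                         ∎)
      where
      l = relation X Y
      indicator : ∀ i l → eval (δₚ i l) ρ ≡ ⟦ l ≟ i ⟧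
      indicator i l with i Fin.≟ l
      ... | yes refl = sym (⟦⟧-yes (l ≟ l) refl)
      ... | no i≢l   = sym (⟦⟧-no (l ≟ i) (i≢l ∘ sym))

    -- Sixteen times the intersection numbers.
    16p : Fin 6 → Fin 6 → Fin 6 → Num
    16p i k l = ∑ λ b → ∑ λ b′ → 4A-number i b * 4A-number k b′ * eval (product b b′ l) ρ

    adjacency-products : ∀ i k X Y →
      4# * 4# * ∑ (λ t → adjacency i X (pt t) * adjacency k Y (pt t)) ≡ 16p i k (relation X Y)
    adjacency-products i k X Y = begin
      4# * 4# * ∑ (λ t → adjacency i X (pt t) * adjacency k Y (pt t))
        ≡⟨ trans (sym (∑-* _ _)) (∑-cong λ t → (solve 3 (λ f u v → f :* f :* (u :* v) := f :* u :* (f :* v)) refl (4#) (adjacency i X (pt t)) (adjacency k Y (pt t)))) ⟩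
      ∑ (λ t → 4# * adjacency i X (pt t) * (4# * adjacency k Y (pt t)))
        ≡⟨ ∑-cong (λ t → trans (cong₂ _*_ (adjacency-matrix i X (pt t)) (adjacency-matrix k Y (pt t))) (sym (∑-prod _ _))) ⟩
      ∑ (λ t → ∑ λ b → ∑ λ b′ → 4A-number i b * matrix b X (pt t) * (4A-number k b′ * matrix b′ Y (pt t)))
        ≡⟨ trans (∑-swap _) (∑-cong λ b → ∑-swap _) ⟩
      ∑ (λ b → ∑ λ b′ → ∑ λ t → 4A-number i b * matrix b X (pt t) * (4A-number k b′ * matrix b′ Y (pt t)))
        ≡⟨ ∑-cong (λ b → ∑-cong λ b′ → trans (∑-cong λ t →
             (solve 4 (λ a u c v → a :* u :* (c :* v) := a :* c :* (u :* v)) refl (4A-number i b) (matrix b X (pt t)) (4A-number k b′) (matrix b′ Y (pt t))))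
             (trans (∑-* _ _) (cong (4A-number i b * 4A-number k b′ *_) (matrix-products X Y b b′)))) ⟩
      16p i k (relation X Y) ∎

    private
      4P-basis-number : Fin 6 → Fin 6 → Num
      4P-basis-number j b = eval (4P-basis j b) ρ

      4A-4P : ∀ i j → ∑ (λ b → 4A-number i b * 4P-basis-number j b) ≡ 4# * 4P-number j i
      4A-4P i j = trans (sym (eval-∑ (λ b → con (4A i b) :* 4P-basis j b))) (4A-4P-basis i j ρ)

      character-number : ∀ b b′ j → 4# * ∑ (λ l → eval (product b b′ l) ρ * 4P-number j l) ≡ 4P-basis-number j b * 4P-basis-number j b′
      character-number b b′ j = trans (cong (4# *_) (sym (eval-∑ (λ l → product b b′ l :* 4P j l)))) (character b b′ j ρ)

      4≢0ₙ : 4# ≢ 0#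
      4≢0ₙ e = contradiction (fromℕ-injective 4 0 e) λ ()

    -- Multiplicativity on the basis matrices extends to the adjacency matrices, because both sides
    -- are bilinear in the coefficients `4A`.
    16p-character : ∀ i k j → ∑ (λ l → 16p i k l * 4P-number j l) ≡ 4# * (4P-number j i * 4P-number j k)
    16p-character i k j = cancel 4≢0ₙ (begin
      4# * ∑ (λ l → 16p i k l * 4P-number j l)
        ≡⟨ cong (4# *_) (trans (∑-cong λ l → trans (sym (∑-*ʳ _ _)) (∑-cong λ b → sym (∑-*ʳ _ _)))
             (trans (∑-swap _) (∑-cong λ b → ∑-swap _))) ⟩
      4# * ∑ (λ b → ∑ λ b′ → ∑ λ l → 4A-number i b * 4A-number k b′ * eval (product b b′ l) ρ * 4P-number j l)
        ≡⟨ trans (sym (∑-* _ _)) (∑-cong λ b → trans (sym (∑-* _ _)) (∑-cong λ b′ → begin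
             4# * ∑ (λ l → 4A-number i b * 4A-number k b′ * eval (product b b′ l) ρ * 4P-number j l)
               ≡⟨ cong (4# *_) (trans (∑-cong λ l → *-assoc _ _ _) (∑-* _ _)) ⟩
             4# * (4A-number i b * 4A-number k b′ * ∑ (λ l → eval (product b b′ l) ρ * 4P-number j l))
               ≡⟨ (solve 4 (λ f a c s → f :* (a :* c :* s) := a :* c :* (f :* s)) refl (4#) (4A-number i b) (4A-number k b′) (∑ (λ l → eval (product b b′ l) ρ * 4P-number j l))) ⟩
             4A-number i b * 4A-number k b′ * (4# * ∑ (λ l → eval (product b b′ l) ρ * 4P-number j l))
               ≡⟨ cong (4A-number i b * 4A-number k b′ *_) (character-number b b′ j) ⟩
             4A-number i b * 4A-number k b′ * (4P-basis-number j b * 4P-basis-number j b′)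
               ≡⟨ (solve 4 (λ a c u v → a :* c :* (u :* v) := a :* u :* (c :* v)) refl (4A-number i b) (4A-number k b′) (4P-basis-number j b) (4P-basis-number j b′)) ⟩
             4A-number i b * 4P-basis-number j b * (4A-number k b′ * 4P-basis-number j b′) ∎)) ⟩
      ∑ (λ b → ∑ λ b′ → 4A-number i b * 4P-basis-number j b * (4A-number k b′ * 4P-basis-number j b′))
        ≡⟨ trans (∑-prod _ _) (cong₂ _*_ (4A-4P i j) (4A-4P k j)) ⟩
      4# * 4P-number j i * (4# * 4P-number j k)
        ≡⟨ (solve 3 (λ f u v → f :* u :* (f :* v) := f :* (f :* (u :* v))) refl (4#) (4P-number j i) (4P-number j k)) ⟩
      4# * (4# * (4P-number j i * 4P-number j k)) ∎)

    -- A row sum is a diagonal entry of the product with the all-one matrix, which is basis matrix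
    -- 0.
    valencies : ∀ i X → 4# * ∑ (λ t → adjacency i X (pt t)) ≡ 4P-number 0F i
    valencies i X = begin
      4# * ∑ (λ t → adjacency i X (pt t))
        ≡⟨ trans (sym (∑-* _ _)) (∑-cong λ t → adjacency-matrix i X (pt t)) ⟩
      ∑ (λ t → ∑ λ b → 4A-number i b * matrix b X (pt t))
        ≡⟨ ∑-swap _ ⟩
      ∑ (λ b → ∑ λ t → 4A-number i b * matrix b X (pt t))
        ≡⟨ ∑-cong (λ b → trans (∑-* _ _) (cong (4A-number i b *_) (trans (∑-cong λ t → trans (sym (*-identityʳ _)) (cong (matrix b X (pt t) *_) (sym (matrix-0 (pt t)))))
             (matrix-products X X b 0F)))) ⟩
      ∑ (λ b → 4A-number i b * eval (product b 0F (relation X X)) ρ)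
        ≡⟨ ∑-cong (λ b → cong (λ l → 4A-number i b * eval (product b 0F l) ρ) (relation-self X)) ⟩
      ∑ (λ b → 4A-number i b * eval (product b 0F 0F) ρ)
        ≡⟨ sym (eval-∑ (λ b → con (4A i b) :* product b 0F 0F)) ⟩
      eval (∑ₚ λ b → con (4A i b) :* product b 0F 0F) ρ
        ≡⟨ valency i ρ ⟩
      4P-number 0F i ∎
      where
      matrix-0 : ∀ Y → matrix 0F X Y ≡ 1#
      matrix-0 Y = (solve 0 (con (pos 1) :* con (pos 1) :* con (pos 1) := con (pos 1)) refl)

    number-of-points : fromℤ (pos (proj₁ enumeration)) ≡ eval points ρ
    number-of-points = cancel q-1≢0 (trans (cong ((q - 1#) *_) (sym (trans (∑-const {Fin (proj₁ enumeration)} 1#) (*-identityʳ _))))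
      (trans (∑-points (λ _ → 1#) λ _ _ _ → refl) (trans (∑-cong λ z → *-identityʳ _)
        (trans (Products.Products.∑-χ²κ N oddField (space m) distribution)
          (solve 3 (λ q M ε → (q :- con (pos 1)) :* (q :* q :* q :* M :* M :- ε :* q :* M) := (q :- con (pos 1)) :* (q :* M :* (q :* (q :* M) :- ε))) refl q M ε)))))

    private
      number : ℕ → Num
      number n = fromℤ (pos n)

      order = Finite.size finite

      order≢1 : order ≢ 1
      order≢1 e = q-1≢0 (trans (cong (λ n → number n - 1#) e) (-‿inverseʳ 1#))

      order≢0 : order ≢ 0
      order≢0 e with subst Fin e (Finite.index finite (OddField.0ᴬ oddField))
      ... | ()

      number-power : ∀ n → power n ≡ number (order ℕ.^ n)
      number-power zero    = refl
      number-power (suc n) = trans (cong (q *_) (number-power n)) (sym (×1-homo-* order (order ℕ.^ n)))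

      number≢0 : ∀ {n} → n ≢ 0 → number n ≢ 0#
      number≢0 {n} n≢0 e = n≢0 (fromℕ-injective n 0 e)

      number+1≢0 : ∀ n → number n + 1# ≢ 0#
      number+1≢0 n e = contradiction (fromℕ-injective (suc n) 0 (trans (1+× n 1#) (trans (+-comm _ _) e))) λ ()

      difference≢0 : ∀ {n k} → n ≢ k → number n - number k ≢ 0#
      difference≢0 {n} {k} n≢k e = n≢k (fromℕ-injective n k (begin
        number n                           ≡⟨ (solve 2 (λ a b → a := (a :- b) :+ b) refl (number n) (number k)) ⟩
        (number n - number k) + number k   ≡⟨ cong (_+ number k) e ⟩
        0# + number k                      ≡⟨ +-identityˡ _ ⟩
        number k                           ∎))

      *-≢0 : ∀ {u v} → u ≢ 0# → v ≢ 0# → u * v ≢ 0#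
      *-≢0 u≢0 v≢0 e = v≢0 (integral e u≢0)

      qM≡ : q * M ≡ number (order ℕ.^ suc m₀)
      qM≡ = trans (cong (q *_) distribution-M) (number-power (suc m₀))

      power≢0 : ∀ n → order ℕ.^ n ≢ 0
      power≢0 n e = order≢0 (ℕ.m^n≡0⇒m≡0 order n e)

      power≢1 : ∀ n → order ℕ.^ suc n ≢ 1
      power≢1 n e = order≢1 (ℕ.m*n≡1⇒m≡1 order (order ℕ.^ n) e)

      -- A positive power of q is neither 1, since q ≠ 1, nor -1, since the characteristic is zero.
      +ε≢0 : ∀ {u} n → u ≡ number (order ℕ.^ suc n) → u + ε ≢ 0#
      +ε≢0 {u} n refl e = go sign distribution-ε
        where
        go : ∀ s → ε ≢ signNumber s
        go Sign.+ ε≡ = number+1≢0 (order ℕ.^ suc n) (trans (cong (λ z → u + z) (sym ε≡)) e)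
        go Sign.- ε≡ = difference≢0 (power≢1 n) (trans (cong (λ z → u + z) (sym ε≡)) e)

      -ε≢0 : ∀ {u} n → u ≡ number (order ℕ.^ suc n) → u - ε ≢ 0#
      -ε≢0 {u} n refl e = go sign distribution-ε
        where
        go : ∀ s → ε ≢ signNumber s
        go Sign.+ ε≡ = difference≢0 (power≢1 n) (trans (cong (λ z → u - z) (sym ε≡)) e)
        go Sign.- ε≡ = number+1≢0 (order ℕ.^ suc n) (trans (solve 1 (λ u → u :+ con (pos 1) := u :- :- con (pos 1)) refl u) (trans (cong (λ z → u - z) (sym ε≡)) e))

    points≢0 : eval points ρ ≢ 0#
    points≢0 = *-≢0 (subst (_≢ 0#) (sym qM≡) (number≢0 (power≢0 (suc m₀))))
      (-ε≢0 (suc m₀) (trans (cong (q *_) qM≡) (sym (×1-homo-* order (order ℕ.^ suc m₀)))))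

    -- The valencies are products of 4, q^m, q^m ± ε, q ± 1 and, for index 2 alone, q - 3. In index
    -- 1 the difference q^(2m) - ε² factors accordingly.
    valency≢0 : ∀ i → (i ≡ 2F → order ≢ 3) → 4P-number 0F i ≢ 0#
    valency≢0 = λ
      { 0F _ → *-≢0 4≢0ₙ (subst (_≢ 0#) (sym ε²≡1) (number≢0 {1} λ ()))
      ; 1F _ → *-≢0 4≢0ₙ (subst (_≢ 0#) (solve 2 (λ u ε → (u :+ ε) :* (u :- ε) := u :* u :- ε :* ε) refl (q * M) ε) (*-≢0 qM+ε qM-ε))
      ; 2F h → *-≢0 (*-≢0 qM qM+ε) (difference≢0 (h refl))
      ; 3F _ → *-≢0 (*-≢0 qM qM-ε) (difference≢0 order≢1)
      ; 4F _ → *-≢0 (*-≢0 qM qM+ε) (difference≢0 order≢1)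
      ; 5F _ → *-≢0 (*-≢0 qM qM-ε) (number+1≢0 order)
      }
      where
      qM : q * M ≢ 0#
      qM = subst (_≢ 0#) (sym qM≡) (number≢0 (power≢0 (suc m₀)))
      qM+ε : q * M + ε ≢ 0#
      qM+ε = +ε≢0 m₀ qM≡
      qM-ε : q * M - ε ≢ 0#
      qM-ε = -ε≢0 m₀ qM≡

    somePoint : Point
    somePoint = pt (first (proj₁ enumeration) refl)
      where
      first : ∀ n → proj₁ enumeration ≡ n → Fin (proj₁ enumeration)
      first zero    e = contradiction (trans (sym number-of-points) (cong number e)) points≢0
      first (suc n) e = subst Fin (sym e) zero

    -- From a fixed point, a relation without a partner would have valency zero; so the search among
    -- the points succeeds.
    relation-nonempty : ∀ i → (i ≡ 2F → order ≢ 3) → ∃[ X ] ∃[ Y ] relation X Y ≡ i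
    relation-nonempty i h with Fin.any? (λ t → relation somePoint (pt t) Fin.≟ i)
    ... | yes (t , e) = somePoint , pt t , e
    ... | no none     = contradiction (begin
      4P-number 0F i                                  ≡⟨ sym (valencies i somePoint) ⟩
      4# * ∑ (λ t → adjacency i somePoint (pt t))     ≡⟨ cong (4# *_) (trans (∑-cong λ t → ⟦⟧-no (relation somePoint (pt t) ≟ i) λ e → none (t , e)) ∑-zero) ⟩
      4# * 0#                                         ≡⟨ zeroʳ 4# ⟩
      0#                                              ∎) (valency≢0 i h)

    -- The factor q - 3 makes the valency zero, and a vanishing sum of indicators has no true
    -- instance.
    no-R₂ : order ≡ 3 → ∀ X Y → relation X Y ≢ 2F
    no-R₂ order≡3 X Y e = ∑-⟦⟧≡0 (λ t → relation X (pt t) ≟ 2F) (integral {4#} (trans (valencies 2F X) vanishing) 4≢0ₙ) (index Y)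
      (trans (relation-congʳ X (pt (index Y)) Y (pt-index Y)) e)
      where
      open Character N oddField using (∑-⟦⟧≡0)
      vanishing : 4P-number 0F 2F ≡ 0#
      vanishing = trans (cong (λ n → q * M * (q * M + ε) * (number n - number 3)) order≡3)
        (trans (cong (q * M * (q * M + ε) *_) (-‿inverseʳ (number 3))) (zeroʳ _))

-- Idempotents from multiplicative rows

module Eigenmatrices where

  open import Algebra.Bundles using (CommutativeRing)
  open import Data.Bool.Base using (if_then_else_)
  open import Data.Fin.Base using (Fin; zero; suc)
  open import Data.Fin.Patterns using (0F)
  open import Data.Fin.Properties using (_≟_)
  open import Data.Nat.Base as ℕ using (ℕ; zero; suc)
  open import Data.Product.Base using (∃₂; _,_; proj₁; proj₂)
  open import Data.Vec.Functional using (Vector)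
  open import Function.Base using (_∘_)
  open import Function.Bundles using (Inverse)
  open import Relation.Binary.Bundles using (Setoid)
  open import Relation.Binary.Core using (Rel)
  open import Relation.Binary.PropositionalEquality as ≡ using (_≡_; _≢_)
  open import Relation.Nullary using (Dec; yes; no; does; contradiction)
  open import Defs using (IsAssociationScheme; HasEigenmatrices)

  module _ {k ℓₖ} (K : CommutativeRing k ℓₖ) where

    open CommutativeRing K

    δᴷ : ∀ {n} → Fin n → Fin n → Carrier
    δᴷ i j = if does (i ≟ j) then 1# else 0#

    if-cong : ∀ {p q} {P : Set p} {Q : Set q} (P? : Dec P) (Q? : Dec Q) → (P → Q) → (Q → P) →
              (if does P? then 1# else 0#) ≈ (if does Q? then 1# else 0#)
    if-cong (yes _) (yes _) _ _ = refl
    if-cong (yes p) (no ¬q) f _ = contradiction (f p) ¬q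
    if-cong (no ¬p) (yes q) _ g = contradiction (g q) ¬p
    if-cong (no _)  (no _)  _ _ = refl

  module OpaqueSums {k ℓₖ} (K : CommutativeRing k ℓₖ) where

    open CommutativeRing K hiding (zero)
    open import Algebra.Properties.Semiring.Sum semiring as Sum using ()

    opaque
      sum : ∀ {n} → Vector Carrier n → Carrier
      sum = Sum.sum

      sum-unfold : ∀ {n} (f : Vector Carrier n) → Sum.sum f ≈ sum f
      sum-unfold f = refl

      sum-cong : ∀ {n} {f g : Vector Carrier n} → (∀ i → f i ≈ g i) → sum f ≈ sum g
      sum-cong = Sum.sum-cong-≋

      sum-zero : ∀ {n} {f : Vector Carrier n} → (∀ i → f i ≈ 0#) → sum f ≈ 0#
      sum-zero {n} h = trans (Sum.sum-cong-≋ h) (Sum.sum-replicate-zero n)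

      ∑-comm : ∀ {m n} (f : Fin m → Fin n → Carrier) → sum (λ i → sum (λ j → f i j)) ≈ sum (λ j → sum (λ i → f i j))
      ∑-comm = Sum.∑-comm

      *-distribˡ-sum : ∀ {n} x (f : Vector Carrier n) → x * sum f ≈ sum (λ i → x * f i)
      *-distribˡ-sum = Sum.*-distribˡ-sum

      *-distribʳ-sum : ∀ {n} x (f : Vector Carrier n) → sum f * x ≈ sum (λ i → f i * x)
      *-distribʳ-sum = Sum.*-distribʳ-sum

      sum-δ : ∀ {n} (i : Fin n) (f : Vector Carrier n) → sum (λ t → δᴷ K i t * f t) ≈ f i
      sum-δ {suc n} zero    f = trans (+-cong (*-identityˡ _) (sum-zero {f = λ t → 0# * f (suc t)} λ t → zeroˡ (f (suc t)))) (+-identityʳ _)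
      sum-δ {suc n} (suc i) f = trans (+-cong (zeroˡ _) (sum-δ i (f ∘ suc))) (+-identityˡ _)

  module EigenAlgebra {k ℓₖ a} (K : CommutativeRing k ℓₖ) {n size : ℕ} {Point : Set a} (pt : Fin size → Point)
                      (relation : Point → Point → Fin n) (A : Fin n → Point → Point → CommutativeRing.Carrier K) where

    open CommutativeRing K hiding (zero)
    open IntegerSolver K
    open OpaqueSums K
    open import Relation.Binary.Reasoning.Setoid setoid

    private
      δ : Fin n → Fin n → Carrier
      δ = δᴷ K

    infixl 7 _·_
    _·_ : (M N : Point → Point → Carrier) → Point → Point → Carrier
    (M · N) x y = sum λ t → M x (pt t) * N (pt t) y

    private
      δ-sym : ∀ i j → δ i j ≈ δ j i
      δ-sym i j = if-cong K (i ≟ j) (j ≟ i) ≡.sym ≡.sym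

    module _ (A-value : ∀ i x y → A i x y ≈ δᴷ K i (relation x y))
             (nonEmpty : ∀ l → ∃₂ λ x y → relation x y ≡ l)
             (P Q : Fin n → Fin n → Carrier) (p : Fin n → Fin n → Fin n → Carrier)
             (v w : Carrier) (vw≈1 : v * w ≈ 1#)
             (products : ∀ i k x y → (A i · A k) x y ≈ p i k (relation x y))
             (characters : ∀ i k j → sum (λ l → p i k l * P j l) ≈ P j i * P j k)
             (P-Q : ∀ i j → sum (λ t → P i t * Q t j) ≈ v * δᴷ K i j)
             (Q-P : ∀ i j → sum (λ t → Q i t * P t j) ≈ v * δᴷ K i j) where

      private
        combination-value : ∀ (c : Vector Carrier n) x y → sum (λ i → c i * A i x y) ≈ c (relation x y)
        combination-value c x y = trans (sum-cong λ i → trans (*-congˡ (A-value i x y))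
          (trans (*-congˡ (δ-sym i (relation x y))) (*-comm _ _))) (sum-δ (relation x y) c)

        cancel-v : ∀ {x y} → v * x ≈ v * y → x ≈ y
        cancel-v {x} {y} e = begin
          x             ≈⟨ *-identityˡ x ⟨
          1# * x        ≈⟨ *-congʳ vw≈1 ⟨
          v * w * x     ≈⟨ (solve 3 (λ v w x → v :* w :* x := w :* (v :* x)) refl v w x) ⟩
          w * (v * x)   ≈⟨ *-congˡ e ⟩
          w * (v * y)   ≈⟨ (solve 3 (λ v w y → w :* (v :* y) := v :* w :* y) refl v w y) ⟩
          v * w * y     ≈⟨ *-congʳ vw≈1 ⟩
          1# * y        ≈⟨ *-identityˡ y ⟩
          y             ∎

        swap-sums : ∀ {m n} (f : Fin m → Carrier) (g : Fin m → Fin n → Carrier) (h : Fin n → Carrier) →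
                    sum (λ i → f i * sum (λ j → g i j * h j)) ≈ sum (λ j → sum (λ i → f i * g i j) * h j)
        swap-sums f g h = begin
          sum (λ i → f i * sum (λ j → g i j * h j))     ≈⟨ sum-cong (λ i → *-distribˡ-sum (f i) _) ⟩
          sum (λ i → sum (λ j → f i * (g i j * h j)))   ≈⟨ ∑-comm _ ⟩
          sum (λ j → sum (λ i → f i * (g i j * h j)))   ≈⟨ sum-cong (λ j → trans (sum-cong λ i → sym (*-assoc (f i) (g i j) (h j))) (sym (*-distribʳ-sum (h j) _))) ⟩
          sum (λ j → sum (λ i → f i * g i j) * h j)     ∎

        -- Multiplying the character relation by Q inverts P: this is the classical formula for
        -- intersection numbers in terms of both eigenmatrices.
        intersection : ∀ i k l → v * p i k l ≈ sum (λ j → Q l j * (P j i * P j k))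
        intersection i k l = begin
          v * p i k l                                        ≈⟨ *-congˡ (sum-δ l (p i k)) ⟨
          v * sum (λ t → δ l t * p i k t)                    ≈⟨ *-distribˡ-sum v (λ t → δ l t * p i k t) ⟩
          sum (λ t → v * (δ l t * p i k t))                  ≈⟨ sum-cong (λ t → *-assoc v (δ l t) (p i k t)) ⟨
          sum (λ t → v * δ l t * p i k t)                    ≈⟨ sum-cong (λ t → *-congʳ (Q-P l t)) ⟨
          sum (λ t → sum (λ j → Q l j * P j t) * p i k t)    ≈⟨ swap-sums (Q l) P (p i k) ⟨
          sum (λ j → Q l j * sum (λ t → P j t * p i k t))    ≈⟨ sum-cong (λ j → *-congˡ (trans (sum-cong λ t → *-comm (P j t) (p i k t)) (characters i k j))) ⟩
          sum (λ j → Q l j * (P j i * P j k))                ∎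

        -- Substituting the previous formula and using P Q = v shows that column j of Q is a common
        -- eigenvector of the intersection matrices.
        eigenvector : ∀ i j l → sum (λ k → p i k l * Q k j) ≈ P j i * Q l j
        eigenvector i j l = cancel-v (begin
          v * sum (λ k → p i k l * Q k j)                            ≈⟨ *-distribˡ-sum v (λ k → p i k l * Q k j) ⟩
          sum (λ k → v * (p i k l * Q k j))                          ≈⟨ sum-cong (λ k → trans (sym (*-assoc v (p i k l) (Q k j))) (*-congʳ (intersection i k l))) ⟩
          sum (λ k → sum (λ t → Q l t * (P t i * P t k)) * Q k j)    ≈⟨ sum-cong (λ k → *-congʳ (sum-cong λ t → sym (*-assoc (Q l t) (P t i) (P t k)))) ⟩
          sum (λ k → sum (λ t → Q l t * P t i * P t k) * Q k j)      ≈⟨ swap-sums (λ t → Q l t * P t i) P (λ k → Q k j) ⟨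
          sum (λ t → Q l t * P t i * sum (λ k → P t k * Q k j))      ≈⟨ sum-cong (λ t → trans (*-congˡ (P-Q t j)) (trans (*-congˡ (*-congˡ (δ-sym t j)))
                                                                          (solve 4 (λ a b v d → a :* b :* (v :* d) := d :* (v :* (b :* a))) refl (Q l t) (P t i) v (δ j t)))) ⟩
          sum (λ t → δ j t * (v * (P t i * Q l t)))                  ≈⟨ sum-δ j (λ t → v * (P t i * Q l t)) ⟩
          v * (P j i * Q l j)                                        ∎)

      E : Fin n → Point → Point → Carrier
      E j x y = sum (λ i → w * Q i j * A i x y)

      E-value : ∀ j x y → E j x y ≈ w * Q (relation x y) j
      E-value j = combination-value (λ i → w * Q i j)

      ·-combination : ∀ (M : Point → Point → Carrier) (c : Vector Carrier n) x y →
        (M · λ x y → sum (λ k → c k * A k x y)) x y ≈ sum (λ k → c k * (M · A k) x y)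
      ·-combination M c x y = begin
        sum (λ t → M x (pt t) * sum (λ k → c k * A k (pt t) y))      ≈⟨ sum-cong (λ t → *-distribˡ-sum (M x (pt t)) (λ k → c k * A k (pt t) y)) ⟩
        sum (λ t → sum (λ k → M x (pt t) * (c k * A k (pt t) y)))    ≈⟨ ∑-comm (λ t k → M x (pt t) * (c k * A k (pt t) y)) ⟩
        sum (λ k → sum (λ t → M x (pt t) * (c k * A k (pt t) y)))    ≈⟨ sum-cong (λ k → trans (sum-cong λ t →
                                                                          (solve 3 (λ a c b → a :* (c :* b) := c :* (a :* b)) refl (M x (pt t)) (c k) (A k (pt t) y))) (sym (*-distribˡ-sum (c k) (λ t → M x (pt t) * A k (pt t) y)))) ⟩
        sum (λ k → c k * (M · A k) x y)                              ∎

      combination-· : ∀ (M : Point → Point → Carrier) (c : Vector Carrier n) x y →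
        ((λ x y → sum (λ k → c k * A k x y)) · M) x y ≈ sum (λ k → c k * (A k · M) x y)
      combination-· M c x y = begin
        sum (λ t → sum (λ k → c k * A k x (pt t)) * M (pt t) y)      ≈⟨ sum-cong (λ t → *-distribʳ-sum (M (pt t) y) (λ k → c k * A k x (pt t))) ⟩
        sum (λ t → sum (λ k → c k * A k x (pt t) * M (pt t) y))      ≈⟨ ∑-comm (λ t k → c k * A k x (pt t) * M (pt t) y) ⟩
        sum (λ k → sum (λ t → c k * A k x (pt t) * M (pt t) y))      ≈⟨ sum-cong (λ k → trans (sum-cong λ t → *-assoc (c k) (A k x (pt t)) (M (pt t) y)) (sym (*-distribˡ-sum (c k) (λ t → A k x (pt t) * M (pt t) y)))) ⟩
        sum (λ k → c k * (A k · M) x y)                              ∎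

      eigenvalue : ∀ i j x y → (A i · E j) x y ≈ P j i * E j x y
      eigenvalue i j x y = begin
        (A i · E j) x y                            ≈⟨ ·-combination (A i) (λ k → w * Q k j) x y ⟩
        sum (λ k → w * Q k j * (A i · A k) x y)    ≈⟨ sum-cong (λ k → trans (*-congˡ (products i k x y)) (solve 3 (λ w a b → w :* a :* b := w :* (b :* a)) refl w (Q k j) (p i k l))) ⟩
        sum (λ k → w * (p i k l * Q k j))          ≈⟨ *-distribˡ-sum w (λ k → p i k l * Q k j) ⟨
        w * sum (λ k → p i k l * Q k j)            ≈⟨ *-congˡ (eigenvector i j l) ⟩
        w * (P j i * Q l j)                        ≈⟨ (solve 3 (λ w a b → w :* (a :* b) := a :* (w :* b)) refl w (P j i) (Q l j)) ⟩
        P j i * (w * Q l j)                        ≈⟨ *-congˡ (E-value j x y) ⟨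
        P j i * E j x y                            ∎
        where l = relation x y

      -- Expanding the left factor in adjacency matrices and applying their eigenvalues on E j
      -- leaves row j of P times column i of Q, hence v or zero. Idempotency and orthogonality are
      -- the two cases.
      E·E : ∀ i j x y → (E i · E j) x y ≈ δ j i * E j x y
      E·E i j x y = begin
        (E i · E j) x y                                ≈⟨ combination-· (E j) (λ k → w * Q k i) x y ⟩
        sum (λ k → w * Q k i * (A k · E j) x y)        ≈⟨ sum-cong (λ k → trans (*-congˡ (eigenvalue k j x y))
                                                            (solve 4 (λ w a b e → w :* a :* (b :* e) := w :* e :* (b :* a)) refl w (Q k i) (P j k) (E j x y))) ⟩
        sum (λ k → w * E j x y * (P j k * Q k i))      ≈⟨ *-distribˡ-sum (w * E j x y) (λ k → P j k * Q k i) ⟨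
        w * E j x y * sum (λ k → P j k * Q k i)        ≈⟨ *-congˡ (P-Q j i) ⟩
        w * E j x y * (v * δ j i)                      ≈⟨ (solve 4 (λ w e v d → w :* e :* (v :* d) := v :* w :* (d :* e)) refl w (E j x y) v (δ j i)) ⟩
        v * w * (δ j i * E j x y)                      ≈⟨ *-congʳ vw≈1 ⟩
        1# * (δ j i * E j x y)                         ≈⟨ *-identityˡ _ ⟩
        δ j i * E j x y                                ∎

      spans : ∀ (c : Vector Carrier n) x y →
              sum (λ i → c i * A i x y) ≈ sum (λ j → sum (λ i → c i * P j i) * E j x y)
      spans c x y = sym (begin
        sum (λ j → sum (λ i → c i * P j i) * E j x y)        ≈⟨ sum-cong (λ j → *-cong (sum-cong λ i → *-comm (c i) (P j i)) (E-value j x y)) ⟩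
        sum (λ j → sum (λ i → P j i * c i) * (w * Q l j))    ≈⟨ sum-cong (λ j → (solve 3 (λ s w a → s :* (w :* a) := w :* (a :* s)) refl (sum (λ i → P j i * c i)) w (Q l j))) ⟩
        sum (λ j → w * (Q l j * sum (λ i → P j i * c i)))    ≈⟨ *-distribˡ-sum w (λ j → Q l j * sum (λ i → P j i * c i)) ⟨
        w * sum (λ j → Q l j * sum (λ i → P j i * c i))      ≈⟨ *-congˡ (swap-sums (Q l) P c) ⟩
        w * sum (λ i → sum (λ j → Q l j * P j i) * c i)      ≈⟨ *-congˡ (sum-cong λ i → trans (*-congʳ (Q-P l i)) (*-assoc v (δ l i) (c i))) ⟩
        w * sum (λ i → v * (δ l i * c i))                    ≈⟨ *-congˡ (trans (sym (*-distribˡ-sum v (λ i → δ l i * c i))) (*-congˡ (sum-δ l c))) ⟩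
        w * (v * c l)                                        ≈⟨ (solve 3 (λ w v c → w :* (v :* c) := v :* w :* c) refl w v (c l)) ⟩
        v * w * c l                                          ≈⟨ trans (*-congʳ vw≈1) (*-identityˡ _) ⟩
        c l                                                  ≈⟨ combination-value c x y ⟨
        sum (λ i → c i * A i x y)                            ∎)
        where l = relation x y

      -- Evaluation at one pair from each relation shows that Q c is zero; multiplying by P gives v
      -- c = 0. Here the non-emptiness of all relations enters.
      independent : ∀ c → (∀ x y → sum (λ j → c j * E j x y) ≈ 0#) → ∀ i → c i ≈ 0#
      independent c vanishes i = cancel-v (begin
        v * c i                                              ≈⟨ *-congˡ (sum-δ i c) ⟨
        v * sum (λ j → δ i j * c j)                          ≈⟨ *-distribˡ-sum v (λ j → δ i j * c j) ⟩
        sum (λ j → v * (δ i j * c j))                        ≈⟨ sum-cong (λ j → trans (sym (*-assoc v (δ i j) (c j))) (*-congʳ (sym (P-Q i j)))) ⟩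
        sum (λ j → sum (λ l → P i l * Q l j) * c j)          ≈⟨ swap-sums (P i) Q c ⟨
        sum (λ l → P i l * sum (λ j → Q l j * c j))          ≈⟨ sum-zero (λ l → trans (*-congˡ (coefficient l)) (zeroʳ _)) ⟩
        0#                                                   ≈⟨ zeroʳ v ⟨
        v * 0#                                               ∎)
        where
        coefficient : ∀ l → sum (λ j → Q l j * c j) ≈ 0#
        coefficient l with nonEmpty l
        ... | x , y , ≡.refl = begin
          sum (λ j → Q (relation x y) j * c j)   ≈⟨ trans (*-congʳ vw≈1) (*-identityˡ _) ⟨
          v * w * sum (λ j → Q (relation x y) j * c j)        ≈⟨ trans (*-assoc v w _) (*-congˡ (*-distribˡ-sum w (λ j → Q (relation x y) j * c j))) ⟩
          v * sum (λ j → w * (Q (relation x y) j * c j))      ≈⟨ *-congˡ (sum-cong λ j → trans (solve 3 (λ w a c → w :* (a :* c) := c :* (w :* a)) refl w (Q (relation x y) j) (c j)) (*-congˡ (sym (E-value j x y)))) ⟩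
          v * sum (λ j → c j * E j x y)          ≈⟨ *-congˡ (vanishes x y) ⟩
          v * 0#                                 ≈⟨ zeroʳ v ⟩
          0#                                     ∎

  module _ {k ℓₖ a ℓ r} (K : CommutativeRing k ℓₖ) {S : Setoid a ℓ} {d : ℕ}
           {R : Fin (suc d) → Rel (Setoid.Carrier S) r} (scheme : IsAssociationScheme S R) where

    open IsAssociationScheme scheme using (size; enumeration; partitions; nonEmpty; relation?)
    open CommutativeRing K hiding (zero)
    open OpaqueSums K using (sum-unfold)
    open import Algebra.Properties.Semiring.Sum semiring using (sum)
    open import Algebra.Definitions.RawMonoid +-rawMonoid using () renaming (_×_ to _×ₖ_)
    import Defs as D

    private
      relation : Setoid.Carrier S → Setoid.Carrier S → Fin (suc d)
      relation x y = proj₁ (partitions x y)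

      unique : ∀ {i x y} → R i x y → relation x y ≡ i
      unique {x = x} {y} = proj₂ (proj₂ (partitions x y))

      v : Carrier
      v = size ×ₖ 1#

      module Opaque = OpaqueSums K
      module Algebra = EigenAlgebra K (Inverse.from enumeration) relation (D.A K scheme)

    adjacency-value : ∀ i x y → D.A K scheme i x y ≈ δᴷ K i (relation x y)
    adjacency-value i x y = if-cong K (relation? i x y) (i ≟ relation x y)
      (λ Ri → ≡.sym (unique Ri)) (λ { ≡.refl → proj₁ (proj₂ (partitions x y)) })

    -- K is a commutative ring, so the inverse w of the number of points is supplied with its
    -- equation. The last hypothesis, that column 0 of Q is constantly one, identifies E 0F with the
    -- all-one matrix divided by that number.
    hasEigenmatrices :
      (P Q : Fin (suc d) → Fin (suc d) → Carrier) (p : Fin (suc d) → Fin (suc d) → Fin (suc d) → Carrier)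
      (w : Carrier) → v * w ≈ 1# →
      (∀ i k x y → D._·_ K scheme (D.A K scheme i) (D.A K scheme k) x y ≈ p i k (relation x y)) →
      (∀ i k j → sum (λ l → p i k l * P j l) ≈ P j i * P j k) →
      (∀ i j → sum (λ t → P i t * Q t j) ≈ v * δᴷ K i j) →
      (∀ i j → sum (λ t → Q i t * P t j) ≈ v * δᴷ K i j) →
      (∀ i → Q i 0F ≈ 1#) → HasEigenmatrices K scheme P Q
    hasEigenmatrices P Q p w vw≈1 products characters P-Q Q-P Q₀ = record
      { E             = E
      ; E-element     = λ j → (λ i → w * Q i j) , λ x y → sym (sum-unfold (λ i → w * Q i j * D.A K scheme i x y))
      ; E-spans       = λ M (c , M≈) → coefficients c , λ x y → trans (M≈ x y)
          (trans (sum-unfold (λ i → c i * D.A K scheme i x y)) (trans (spans c x y) (sym (sum-unfold (λ j → coefficients c j * E j x y)))))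
      ; E-independent = λ c h → independent c λ x y → trans (sym (sum-unfold (λ j → c j * E j x y))) (h x y)
      ; idempotent    = λ j x y → trans (sum-unfold (λ t → E j x (pt t) * E j (pt t) y)) (trans (E·E j j x y) (trans (*-congʳ (δ-diagonal j)) (*-identityˡ _)))
      ; orthogonal    = λ i j i≢j x y → trans (sum-unfold (λ t → E i x (pt t) * E j (pt t) y)) (trans (E·E i j x y) (trans (*-congʳ (δ-off-diagonal i≢j)) (zeroˡ _)))
      ; E₀            = λ x y → trans (*-congˡ (trans (E-value 0F x y) (trans (*-congˡ (Q₀ _)) (*-identityʳ w)))) vw≈1
      ; eigenvalue    = λ i j x y → trans (sum-unfold (λ t → D.A K scheme i x (pt t) * E j (pt t) y)) (eigenvalue i j x y)
      ; P-Q           = P-Q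
      ; Q-P           = Q-P
      }
      where
      pt = Inverse.from enumeration
      nonEmpty′ : ∀ l → ∃₂ λ x y → relation x y ≡ l
      nonEmpty′ l = let x , y , Rl = nonEmpty l in x , y , unique Rl
      products′ : ∀ i k x y → Algebra._·_ (D.A K scheme i) (D.A K scheme k) x y ≈ p i k (relation x y)
      products′ i k x y = trans (sym (sum-unfold (λ t → D.A K scheme i x (pt t) * D.A K scheme k (pt t) y))) (products i k x y)
      characters′ : ∀ i k j → Opaque.sum (λ l → p i k l * P j l) ≈ P j i * P j k
      characters′ i k j = trans (sym (sum-unfold (λ l → p i k l * P j l))) (characters i k j)
      P-Q′ : ∀ i j → Opaque.sum (λ t → P i t * Q t j) ≈ v * δᴷ K i j
      P-Q′ i j = trans (sym (sum-unfold (λ t → P i t * Q t j))) (P-Q i j)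
      Q-P′ : ∀ i j → Opaque.sum (λ t → Q i t * P t j) ≈ v * δᴷ K i j
      Q-P′ i j = trans (sym (sum-unfold (λ t → Q i t * P t j))) (Q-P i j)
      E           = Algebra.E adjacency-value nonEmpty′ P Q p v w vw≈1 products′ characters′ P-Q′ Q-P′
      E-value     = Algebra.E-value adjacency-value nonEmpty′ P Q p v w vw≈1 products′ characters′ P-Q′ Q-P′
      E·E         = Algebra.E·E adjacency-value nonEmpty′ P Q p v w vw≈1 products′ characters′ P-Q′ Q-P′
      eigenvalue  = Algebra.eigenvalue adjacency-value nonEmpty′ P Q p v w vw≈1 products′ characters′ P-Q′ Q-P′
      spans       = Algebra.spans adjacency-value nonEmpty′ P Q p v w vw≈1 products′ characters′ P-Q′ Q-P′
      coefficients : Vector Carrier (suc d) → Vector Carrier (suc d)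
      coefficients c j = Opaque.sum (λ i → c i * P j i)
      independent = Algebra.independent adjacency-value nonEmpty′ P Q p v w vw≈1 products′ characters′ P-Q′ Q-P′
      δ-diagonal : ∀ j → δᴷ K j j ≈ 1#
      δ-diagonal j with j ≟ j
      ... | yes _  = refl
      ... | no j≢j = contradiction ≡.refl j≢j
      δ-off-diagonal : ∀ {i j} → i ≢ j → δᴷ K j i ≈ 0#
      δ-off-diagonal {i} {j} i≢j with j ≟ i
      ... | yes j≡i = contradiction (≡.sym j≡i) i≢j
      ... | no _    = refl

-- The rational tables and their polynomial counterparts

module Rationals where

  open import Data.Fin.Base using (Fin; zero; suc)
  open import Data.Fin.Patterns using (0F; 1F; 2F; 3F; 4F; 5F)
  open import Data.Integer.Base as ℤ using () renaming (+_ to pos)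
  import Data.Integer.Properties as ℤ
  open import Data.Nat.Base as ℕ using (ℕ; zero; suc)
  import Data.Nat.Properties as ℕ
  open import Data.Rational.Base as ℚ using (ℚ; 0ℚ; 1ℚ; ½; _-_)
  import Data.Rational.Properties as ℚ
  import Data.Rational.Unnormalised.Base as ℚᵘ
  import Data.Rational.Unnormalised.Properties as ℚᵘ
  open import Data.Sign.Base as Sign using (Sign)
  open import Data.Vec.Base using (Vec; []; _∷_; lookup)
  open import Relation.Binary.Definitions using (tri<; tri≈; tri>)
  open import Relation.Binary.PropositionalEquality
  open import Relation.Nullary using (yes; no; contradiction)
  import Algebra.Definitions.RawSemiring as RawSemiringDefs
  open DiscreteRings
  open FiniteFields using (NumberRing; module NumberRing)
  open import Defs using (_/_; fromℕ; fromSign; 𝐏; 𝐐)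

  rationals : DiscreteRing
  rationals = record { isCommutativeRing = ℚ.+-*-isCommutativeRing }

  open DiscreteRing rationals hiding (_-_)
  open IntegerSolver commutativeRing
  open import Algebra.Properties.Semiring.Mult.TCOptimised semiring using (1+×)

  ÷-cancel : ∀ x y → y ≢ 0ℚ → y * (x / y) ≡ x
  ÷-cancel x y y≢0 with y ℚ.≟ 0ℚ
  ... | yes y≡0 = contradiction y≡0 y≢0
  ... | no ≢0   = trans (solve 3 (λ x y i → y :* (x :* i) := x :* (y :* i)) refl x y _)
    (trans (cong (x *_) (ℚ.*-inverseʳ y {{ℚ.≢-nonZero ≢0}})) (*-identityʳ x))

  fromℤ-mono : ∀ {m n} → m ℕ.< n → fromℤ (pos m) ℚ.< fromℤ (pos n)
  fromℤ-mono {m} {suc n} (ℕ.s≤s m≤n) = ℚ.≤-<-trans (monotone m≤n) (step n)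
    where
    step : ∀ n → fromℤ (pos n) ℚ.< fromℤ (pos (suc n))
    step n = subst₂ ℚ._<_ (+-identityˡ _) (sym (1+× n 1#)) (ℚ.+-monoˡ-< (fromℤ (pos n)) (ℚ.positive⁻¹ 1ℚ))
    monotone : ∀ {m n} → m ℕ.≤ n → fromℤ (pos m) ℚ.≤ fromℤ (pos n)
    monotone {m} {n} m≤n with ℕ.≤⇒≤′ m≤n
    ... | ℕ.≤′-refl      = ℚ.≤-refl
    ... | ℕ.≤′-step {n} h = ℚ.≤-trans (monotone (ℕ.≤′⇒≤ h)) (ℚ.<⇒≤ (step n))

  numberRing : NumberRing
  numberRing = record
    { discreteRing    = rationals
    ; integral        = λ {x} {y} xy≡0 x≢0 → trans (sym (÷-cancel′ x≢0 y)) (trans (cong (recip x x≢0 *_) xy≡0) (zeroʳ (recip x x≢0)))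
    ; fromℕ-injective = λ m n e → injective m n e
    }
    where
    recip : ∀ x → x ≢ 0ℚ → ℚ
    recip x x≢0 = ℚ.1/_ x {{ℚ.≢-nonZero x≢0}}
    ÷-cancel′ : ∀ {x} x≢0 y → recip x x≢0 * (x * y) ≡ y
    ÷-cancel′ {x} x≢0 y = trans (sym (*-assoc (recip x x≢0) x y)) (trans (cong (_* y) (ℚ.*-inverseˡ x {{ℚ.≢-nonZero x≢0}})) (*-identityˡ y))
    injective : ∀ m n → fromℤ (pos m) ≡ fromℤ (pos n) → m ≡ n
    injective m n e with ℕ.<-cmp m n
    ... | tri< m<n _ _ = contradiction e (ℚ.<⇒≢ (fromℤ-mono m<n))
    ... | tri≈ _ m≡n _ = m≡n
    ... | tri> _ _ n<m = contradiction (sym e) (ℚ.<⇒≢ (fromℤ-mono n<m))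

  -- `fromℕ` yields a normalised fraction, `fromℤ` an iterated sum of ones; their agreement is
  -- checked on unnormalised fractions.
  fromℕ≡ : ∀ n → fromℕ n ≡ fromℤ (pos n)
  fromℕ≡ zero    = refl
  fromℕ≡ (suc n) = trans (ℚ.toℚᵘ-injective (ℚᵘ.≃-trans (ℚ.toℚᵘ-fromℚᵘ (ℚᵘ.mkℚᵘ (pos (suc n)) 0))
      (ℚᵘ.≃-sym (ℚᵘ.≃-trans (ℚ.toℚᵘ-homo-+ 1ℚ (fromℕ n)) (ℚᵘ.≃-trans (ℚᵘ.+-congʳ (ℚ.toℚᵘ 1ℚ) (ℚ.toℚᵘ-fromℚᵘ (ℚᵘ.mkℚᵘ (pos n) 0)))
        (ℚᵘ.*≡* (cong (λ k → k ℤ.* pos 1) (trans (cong (λ k → pos 1 ℤ.+ k) (ℤ.*-identityʳ (pos n))) refl))))))))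
    (trans (cong (1ℚ +_) (fromℕ≡ n)) (sym (1+× n 1#)))

  open RawSemiringDefs ℚ.+-*-rawSemiring using (_^_)

  private
    4# : ℚ
    4# = fromℤ (pos 4)
    ¼ : ℚ
    ¼ = ½ * ½

    quarter : ∀ a b c → 4# * (¼ * a * b * c) ≡ a * b * c
    quarter a b c = trans (solve 4 (λ h a b c → con (pos 4) :* (h :* a :* b :* c) := con (pos 4) :* h :* (a :* b :* c)) refl (¼) a b c) (*-identityˡ (a * b * c))

    quarter′ : ∀ a b c d → 4# * (¼ * a * b * c * d) ≡ a * b * c * d
    quarter′ a b c d = trans (solve 5 (λ h a b c d → con (pos 4) :* (h :* a :* b :* c :* d) := con (pos 4) :* h :* (a :* b :* c :* d)) refl (¼) a b c d) (*-identityˡ (a * b * c * d))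

    negate : ∀ {x y} → 4# * x ≡ y → 4# * (- x) ≡ - y
    negate {x} e = trans (solve 1 (λ x → con (pos 4) :* :- x := :- (con (pos 4) :* x)) refl x) (cong -_ e)

    -- The tables with the powers of q as independent parameters.
    module _ (q q^[m-1] q^m q^[m+1] q^[n-1] ε : ℚ) where

      private
        2# 3# -1# : ℚ
        2# = fromℕ 2
        3# = fromℕ 3
        -1# = - 1ℚ

      P-rows : Vec (Vec ℚ 6) 6
      P-rows =
          ( 1ℚ ∷ q^[n-1] - 1ℚ ∷ ¼ * q^m * (q^m + ε) * (q - 3#) ∷ ¼ * q^m * (q^m - ε) * (q - 1ℚ)
              ∷ ¼ * q^m * (q^m + ε) * (q - 1ℚ) ∷ ¼ * q^m * (q^m - ε) * (q + 1ℚ) ∷ [] )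
        ∷ ( 1ℚ ∷ q^[n-1] - 1ℚ ∷ ¼ * q^m * (q^m + ε) * (q - 3#) ∷ ¼ * q^m * (q^m - ε) * (q - 1ℚ)
              ∷ - (¼ * q^m * (q^m + ε) * (q - 1ℚ)) ∷ - (¼ * q^m * (q^m - ε) * (q + 1ℚ)) ∷ [] )
        ∷ ( 1ℚ ∷ ε * q^[m-1] - 1ℚ ∷ ¼ * ε * q^[m-1] * (q + 1ℚ) * (q - 3#) ∷ - (¼ * ε * q^[m-1] * (q - 1ℚ) ^ 2)
              ∷ ¼ * ε * q^[m-1] * (q - 1ℚ) * (q + 1ℚ) ∷ - (¼ * ε * q^[m-1] * (q - 1ℚ) * (q + 1ℚ)) ∷ [] )
        ∷ ( 1ℚ ∷ ε * q^[m-1] - 1ℚ ∷ ¼ * ε * q^[m-1] * (q + 1ℚ) * (q - 3#) ∷ - (¼ * ε * q^[m-1] * (q - 1ℚ) ^ 2)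
              ∷ - (¼ * ε * q^[m-1] * (q - 1ℚ) * (q + 1ℚ)) ∷ ¼ * ε * q^[m-1] * (q - 1ℚ) * (q + 1ℚ) ∷ [] )
        ∷ ( 1ℚ ∷ ε * q^m - 1ℚ ∷ - (ε * q^m) ∷ 0ℚ ∷ 0ℚ ∷ 0ℚ ∷ [] )
        ∷ ( 1ℚ ∷ - (ε * q^m) - 1ℚ ∷ 0ℚ ∷ ε * q^m ∷ 0ℚ ∷ 0ℚ ∷ [] )
        ∷ []

      Q-rows : Vec (Vec ℚ 6) 6
      Q-rows =
          ( 1ℚ ∷ 1ℚ ∷ q ^ 2 * ((q^[n-1] - 1ℚ) / (q ^ 2 - 1ℚ)) ∷ q ^ 2 * ((q^[n-1] - 1ℚ) / (q ^ 2 - 1ℚ))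
              ∷ (q - 3#) / (2# * (q - 1ℚ)) * (q^m + ε) * (q^[m+1] - ε)
              ∷ (q - 1ℚ) / (2# * (q + 1ℚ)) * (q^m - ε) * (q^[m+1] - ε) ∷ [] )
        ∷ ( 1ℚ ∷ 1ℚ ∷ q ^ 2 * ((ε * q^[m-1] - 1ℚ) / (q ^ 2 - 1ℚ)) ∷ q ^ 2 * ((ε * q^[m-1] - 1ℚ) / (q ^ 2 - 1ℚ))
              ∷ ε * ((q - 3#) / (2# * (q - 1ℚ))) * (q^[m+1] - ε)
              ∷ - (ε * ((q - 1ℚ) / (2# * (q + 1ℚ))) * (q^[m+1] - ε)) ∷ [] )
        ∷ ( 1ℚ ∷ 1ℚ ∷ ε * (q / (q - 1ℚ)) * (q^m - ε) ∷ ε * (q / (q - 1ℚ)) * (q^m - ε)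
              ∷ - (ε * (2# / (q - 1ℚ)) * (q^[m+1] - ε)) ∷ 0ℚ ∷ [] )
        ∷ ( 1ℚ ∷ 1ℚ ∷ - (ε * (q / (q + 1ℚ)) * (q^m + ε)) ∷ - (ε * (q / (q + 1ℚ)) * (q^m + ε))
              ∷ 0ℚ ∷ ε * (2# / (q + 1ℚ)) * (q^[m+1] - ε) ∷ [] )
        ∷ ( 1ℚ ∷ -1# ∷ ε * (q / (q - 1ℚ)) * (q^m - ε) ∷ - (ε * (q / (q - 1ℚ)) * (q^m - ε)) ∷ 0ℚ ∷ 0ℚ ∷ [] )
        ∷ ( 1ℚ ∷ -1# ∷ - (ε * (q / (q + 1ℚ)) * (q^m + ε)) ∷ ε * (q / (q + 1ℚ)) * (q^m + ε) ∷ 0ℚ ∷ 0ℚ ∷ [] )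
        ∷ []

  open Tables commutativeRing using (4P; Q-numerator; denominator)

  module _ (q M ε : ℚ) (ε² : ε * ε ≡ 1ℚ) where

    private
      ρ : Vec ℚ 3
      ρ = q ∷ M ∷ ε ∷ []
      qM 3# : ℚ
      qM = q * M
      3# = fromℤ (pos 3)
      unit : ∀ x → 4# * (x - 1ℚ) ≡ 4# * (x - ε * ε)
      unit x = cong (λ z → 4# * (x - z)) (sym ε²)
      P : Fin 6 → Fin 6 → ℚ
      P j i = lookup (lookup (P-rows q M (q * M) (q * (q * M)) (q * M * (q * M)) ε) j) i
      Q : Fin 6 → Fin 6 → ℚ
      Q i j = lookup (lookup (Q-rows q M (q * M) (q * (q * M)) (q * M * (q * M)) ε) i) j
      square : ∀ a b → a * b * (q - 1ℚ) ^ 2 ≡ a * b * ((q - 1ℚ) * (q - 1ℚ))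
      square a b = cong (a * b *_) (cong ((q - 1ℚ) *_) (*-identityʳ (q - 1ℚ)))

    -- The factor 4 absorbs the quarters, and the hypothesis on ε accounts for the units that the
    -- polynomial table writes as ε².
    P-table : ∀ j i → 4# * P j i ≡ eval (4P j i) ρ
    P-table 0F 0F = cong (4# *_) (sym ε²)
    P-table 0F 1F = unit (q * M * (q * M))
    P-table 0F 2F = quarter qM (qM + ε) (q - 3#)
    P-table 0F 3F = quarter qM (qM - ε) (q - 1ℚ)
    P-table 0F 4F = quarter qM (qM + ε) (q - 1ℚ)
    P-table 0F 5F = quarter qM (qM - ε) (q + 1ℚ)
    P-table 1F 0F = cong (4# *_) (sym ε²)
    P-table 1F 1F = unit (q * M * (q * M))
    P-table 1F 2F = quarter qM (qM + ε) (q - 3#)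
    P-table 1F 3F = quarter qM (qM - ε) (q - 1ℚ)
    P-table 1F 4F = negate {¼ * qM * (qM + ε) * (q - 1ℚ)} (quarter qM (qM + ε) (q - 1ℚ))
    P-table 1F 5F = negate {¼ * qM * (qM - ε) * (q + 1ℚ)} (quarter qM (qM - ε) (q + 1ℚ))
    P-table 2F 0F = cong (4# *_) (sym ε²)
    P-table 2F 1F = unit (ε * M)
    P-table 2F 2F = quarter′ ε M (q + 1ℚ) (q - 3#)
    P-table 2F 3F = negate {¼ * ε * M * (q - 1ℚ) ^ 2} (trans (quarter ε M ((q - 1ℚ) ^ 2)) (square ε M))
    P-table 2F 4F = quarter′ ε M (q - 1ℚ) (q + 1ℚ)
    P-table 2F 5F = negate {¼ * ε * M * (q - 1ℚ) * (q + 1ℚ)} (quarter′ ε M (q - 1ℚ) (q + 1ℚ))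
    P-table 3F 0F = cong (4# *_) (sym ε²)
    P-table 3F 1F = unit (ε * M)
    P-table 3F 2F = quarter′ ε M (q + 1ℚ) (q - 3#)
    P-table 3F 3F = negate {¼ * ε * M * (q - 1ℚ) ^ 2} (trans (quarter ε M ((q - 1ℚ) ^ 2)) (square ε M))
    P-table 3F 4F = negate {¼ * ε * M * (q - 1ℚ) * (q + 1ℚ)} (quarter′ ε M (q - 1ℚ) (q + 1ℚ))
    P-table 3F 5F = quarter′ ε M (q - 1ℚ) (q + 1ℚ)
    P-table 4F 0F = cong (4# *_) (sym ε²)
    P-table 4F 1F = unit (ε * (q * M))
    P-table 4F 2F = negate {ε * qM} refl
    P-table 4F 3F = refl
    P-table 4F 4F = refl
    P-table 4F 5F = refl
    P-table 5F 0F = cong (4# *_) (sym ε²)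
    P-table 5F 1F = unit (- (ε * (q * M)))
    P-table 5F 2F = refl
    P-table 5F 3F = refl
    P-table 5F 4F = refl
    P-table 5F 5F = refl

    module _ (q-1≢0 : q - 1ℚ ≢ 0ℚ) (q+1≢0 : q + 1ℚ ≢ 0ℚ) where

      private
        *-≢0 : ∀ {x y} → x ≢ 0ℚ → y ≢ 0ℚ → x * y ≢ 0ℚ
        *-≢0 x≢0 y≢0 e = y≢0 (NumberRing.integral numberRing e x≢0)

        2# : ℚ
        2# = fromℤ (pos 2)

        2≢0 : 2# ≢ 0ℚ
        2≢0 ()

        q²-1 : q ^ 2 - 1ℚ ≡ (q - 1ℚ) * (q + 1ℚ)
        q²-1 = (solve 1 (λ q → q :* (q :* con (pos 1)) :- con (pos 1) := (q :- con (pos 1)) :* (q :+ con (pos 1))) refl q)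

        q²-1≢0 : q ^ 2 - 1ℚ ≢ 0ℚ
        q²-1≢0 e = *-≢0 q-1≢0 q+1≢0 (trans (sym q²-1) e)

        negative : ∀ {d x y} → d * x ≡ y → d * (- x) ≡ - y
        negative {d} {x} e = trans (solve 2 (λ d x → d :* :- x := :- (d :* x)) refl d x) (cong -_ e)

        col-2 : ∀ x y → x ≡ y → (q - 1ℚ) * (q + 1ℚ) * (q ^ 2 * (x / (q ^ 2 - 1ℚ))) ≡ q * (q * y)
        col-2 x _ refl = trans (cong (_* (q ^ 2 * r)) (sym q²-1)) (trans (solve 2 (λ q r → (q :* (q :* con (pos 1)) :- con (pos 1)) :* (q :* (q :* con (pos 1)) :* r) := q :* (q :* ((q :* (q :* con (pos 1)) :- con (pos 1)) :* r))) refl q r)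
          (cong (λ z → q * (q * z)) (÷-cancel x (q ^ 2 - 1ℚ) q²-1≢0)))
          where r = x / (q ^ 2 - 1ℚ)

        col-2⁻ : ∀ u → (q - 1ℚ) * (q + 1ℚ) * (ε * (q / (q - 1ℚ)) * u) ≡ q * (ε * (q + 1ℚ) * u)
        col-2⁻ u = trans (solve 4 (λ q ε u r → (q :- con (pos 1)) :* (q :+ con (pos 1)) :* (ε :* r :* u) := (q :- con (pos 1)) :* r :* (ε :* (q :+ con (pos 1)) :* u)) refl q ε u r)
          (cong (_* (ε * (q + 1ℚ) * u)) (÷-cancel q (q - 1ℚ) q-1≢0))
          where r = q / (q - 1ℚ)

        col-2⁺ : ∀ u → (q - 1ℚ) * (q + 1ℚ) * (ε * (q / (q + 1ℚ)) * u) ≡ q * (ε * (q - 1ℚ) * u)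
        col-2⁺ u = trans (solve 4 (λ q ε u r → (q :- con (pos 1)) :* (q :+ con (pos 1)) :* (ε :* r :* u) := (q :+ con (pos 1)) :* r :* (ε :* (q :- con (pos 1)) :* u)) refl q ε u r)
          (cong (_* (ε * (q - 1ℚ) * u)) (÷-cancel q (q + 1ℚ) q+1≢0))
          where r = q / (q + 1ℚ)

        two : ∀ {y} x u v → y ≢ 0ℚ → 2# * y * (x / (2# * y) * u * v) ≡ x * u * v
        two {y} x u v y≢0 = trans (solve 4 (λ y r u v → con (pos 2) :* y :* (r :* u :* v) := con (pos 2) :* y :* r :* u :* v) refl y r u v)
          (cong (λ z → z * u * v) (÷-cancel x (2# * y) (*-≢0 2≢0 y≢0)))
          where r = x / (2# * y)

        two′ : ∀ {y} x v → y ≢ 0ℚ → 2# * y * (ε * (x / (2# * y)) * v) ≡ ε * x * v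
        two′ {y} x v y≢0 = trans (solve 4 (λ y r ε v → con (pos 2) :* y :* (ε :* r :* v) := ε :* (con (pos 2) :* y :* r) :* v) refl y r ε v)
          (cong (λ z → ε * z * v) (÷-cancel x (2# * y) (*-≢0 2≢0 y≢0)))
          where r = x / (2# * y)

        two″ : ∀ {y} v → y ≢ 0ℚ → 2# * y * (ε * (2# / y) * v) ≡ 4# * ε * v
        two″ {y} v y≢0 = trans (solve 4 (λ y r ε v → con (pos 2) :* y :* (ε :* r :* v) := con (pos 2) :* ε :* (y :* r) :* v) refl y r ε v)
          (trans (cong (λ z → 2# * ε * z * v) (÷-cancel 2# y y≢0)) (solve 2 (λ ε v → con (pos 2) :* ε :* con (pos 2) :* v := con (pos 4) :* ε :* v) refl ε v))
          where r = 2# / y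

        minus-unit : ∀ x → x - 1ℚ ≡ x - ε * ε
        minus-unit x = cong (λ z → x - z) (sym ε²)

        one : 1ℚ * 1ℚ ≡ ε * ε
        one = sym ε²

      Q-table : ∀ i j → eval (denominator j) ρ * Q i j ≡ eval (Q-numerator i j) ρ
      Q-table 0F 0F = one
      Q-table 0F 1F = one
      Q-table 0F 2F = col-2 (qM * qM - 1ℚ) (qM * qM - ε * ε) (minus-unit (qM * qM))
      Q-table 0F 3F = col-2 (qM * qM - 1ℚ) (qM * qM - ε * ε) (minus-unit (qM * qM))
      Q-table 0F 4F = two (q - 3#) (qM + ε) (q * qM - ε) q-1≢0
      Q-table 0F 5F = two (q - 1ℚ) (qM - ε) (q * qM - ε) q+1≢0
      Q-table 1F 0F = one
      Q-table 1F 1F = one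
      Q-table 1F 2F = col-2 (ε * M - 1ℚ) (ε * M - ε * ε) (minus-unit (ε * M))
      Q-table 1F 3F = col-2 (ε * M - 1ℚ) (ε * M - ε * ε) (minus-unit (ε * M))
      Q-table 1F 4F = two′ (q - 3#) (q * qM - ε) q-1≢0
      Q-table 1F 5F = negative {2# * (q + 1ℚ)} {ε * ((q - 1ℚ) / (2# * (q + 1ℚ))) * (q * qM - ε)} (two′ (q - 1ℚ) (q * qM - ε) q+1≢0)
      Q-table 2F 0F = one
      Q-table 2F 1F = one
      Q-table 2F 2F = col-2⁻ (qM - ε)
      Q-table 2F 3F = col-2⁻ (qM - ε)
      Q-table 2F 4F = negative {2# * (q - 1ℚ)} {ε * (2# / (q - 1ℚ)) * (q * qM - ε)} (two″ (q * qM - ε) q-1≢0)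
      Q-table 2F 5F = zeroʳ (2# * (q + 1ℚ))
      Q-table 3F 0F = one
      Q-table 3F 1F = one
      Q-table 3F 2F = negative {(q - 1ℚ) * (q + 1ℚ)} {ε * (q / (q + 1ℚ)) * (qM + ε)} (col-2⁺ (qM + ε))
      Q-table 3F 3F = negative {(q - 1ℚ) * (q + 1ℚ)} {ε * (q / (q + 1ℚ)) * (qM + ε)} (col-2⁺ (qM + ε))
      Q-table 3F 4F = zeroʳ (2# * (q - 1ℚ))
      Q-table 3F 5F = two″ (q * qM - ε) q+1≢0
      Q-table 4F 0F = one
      Q-table 4F 1F = negative {1ℚ} {1ℚ} one
      Q-table 4F 2F = col-2⁻ (qM - ε)
      Q-table 4F 3F = negative {(q - 1ℚ) * (q + 1ℚ)} {ε * (q / (q - 1ℚ)) * (qM - ε)} (col-2⁻ (qM - ε))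
      Q-table 4F 4F = zeroʳ (2# * (q - 1ℚ))
      Q-table 4F 5F = zeroʳ (2# * (q + 1ℚ))
      Q-table 5F 0F = one
      Q-table 5F 1F = negative {1ℚ} {1ℚ} one
      Q-table 5F 2F = negative {(q - 1ℚ) * (q + 1ℚ)} {ε * (q / (q + 1ℚ)) * (qM + ε)} (col-2⁺ (qM + ε))
      Q-table 5F 3F = col-2⁺ (qM + ε)
      Q-table 5F 4F = zeroʳ (2# * (q - 1ℚ))
      Q-table 5F 5F = zeroʳ (2# * (q + 1ℚ))

  private
    ^-+1 : ∀ q m → q ^ (m ℕ.+ 1) ≡ q * q ^ m
    ^-+1 q zero    = refl
    ^-+1 q (suc m) = cong (q *_) (^-+1 q m)

    ^-*2 : ∀ q m → q ^ (m ℕ.* 2) ≡ q ^ m * q ^ m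
    ^-*2 q zero    = refl
    ^-*2 q (suc m) = trans (cong (λ z → q * (q * z)) (^-*2 q m)) (solve 2 (λ q p → q :* (q :* (p :* p)) := q :* p :* (q :* p)) refl q (q ^ m))

  module _ (order m : ℕ) (sign : Sign) where

    private
      q = fromℕ order
      M = q ^ m
      ε = fromSign sign
      ρ : Vec ℚ 3
      ρ = q ∷ M ∷ ε ∷ []

      ε² : ε * ε ≡ 1ℚ
      ε² = go sign
        where
        go : ∀ s → fromSign s * fromSign s ≡ 1ℚ
        go Sign.+ = refl
        go Sign.- = refl

    -- With suc m as the parameter, the truncated exponent reduces to m, so M is q^m here, and the
    -- other exponents are expressed through q and M.
    4𝐏 : ∀ j i → 4# * 𝐏 order (suc m) sign j i ≡ eval (4P j i) ρ
    4𝐏 j i = trans (cong₂ (λ u v → 4# * lookup (lookup (P-rows q M (q * M) u v ε) j) i) (cong (q *_) (^-+1 q m)) (^-*2 q (suc m)))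
      (P-table q M ε ε² j i)

    denominator-𝐐 : q - 1ℚ ≢ 0ℚ → q + 1ℚ ≢ 0ℚ → ∀ i j →
      eval (denominator j) ρ * 𝐐 order (suc m) sign i j ≡ eval (Q-numerator i j) ρ
    denominator-𝐐 q-1≢0 q+1≢0 i j =
      trans (cong₂ (λ u v → eval (denominator j) ρ * lookup (lookup (Q-rows q M (q * M) u v ε) i) j) (cong (q *_) (^-+1 q m)) (^-*2 q (suc m)))
        (Q-table q M ε ε² q-1≢0 q+1≢0 i j)

-- The association scheme and its eigenmatrices

module Schemes where

  open import Algebra.Bundles using (CommutativeRing)
  open import Algebra.Morphism.Structures using (IsRingHomomorphism)
  open import Data.Fin.Base using (Fin; zero; suc)
  open import Data.Fin.Patterns using (0F; 1F; 2F; 3F; 4F; 5F)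
  import Data.Fin.Properties as Fin
  open import Data.Integer.Base using () renaming (+_ to pos)
  open import Data.Nat.Base as ℕ using (ℕ; zero; suc)
  open import Data.Product.Base using (∃₂; ∃-syntax; _×_; _,_; proj₁; proj₂)
  open import Data.Rational.Base as ℚ using (ℚ; 1ℚ; ½)
  import Data.Rational.Properties as ℚ
  open import Data.Sign.Base as Sign using (Sign)
  open import Data.Vec.Base using (Vec; []; _∷_)
  open import Level using (_⊔_)
  open import Function.Base using (_∘_)
  open import Function.Bundles using (mk⇔)
  open import Relation.Binary.Bundles using (Setoid)
  open import Relation.Binary.PropositionalEquality
  open import Relation.Nullary using (Dec; yes; no; contradiction; _×-dec_)
  open import Relation.Nullary.Decidable using (map′)
  import Algebra.Definitions.RawSemiring as RawSemiringDefs
  open DiscreteRings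
  open FiniteTypes
  open FiniteFields using (NumberRing; module NumberRing; OddField; module OddField; module Character)
  open QuadraticSpaces using (NormDistribution; module NormDistribution)
  open VectorModel using (module NormCount)
  open FieldModel using (Model; module Model; module Transfer)
  open FiniteSetoids
  open Geometry using (module Classification)
  open PointSums using (module PointSums)
  open BasisProducts using (module BasisProducts)
  open PointMatrices using (module PointMatrices)
  open Intersections using (module Intersections)
  open Eigenmatrices
  open Rationals
  open import Defs using (BinaryForm; module BinaryForm; IsField; HasSize; Restrict; AnisotropicPoints; HasSign;
    IsAssociationScheme; HasEigenmatrices; 𝐏; 𝐐; fromℕ; fromSign)
    renaming (R to Relation)

  module _ {a ℓ} (F : CommutativeRing a ℓ) (F-field : IsField F) (model : Model F) (f : BinaryForm F)
           (nonDegenerate : BinaryForm.NonDegenerate f) (sign : Sign) (hasSign : HasSign F sign f) (m₀ : ℕ) where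

    private
      m = suc m₀
      order = Finite.size (OddField.finite (Model.oddField model))
      P = AnisotropicPoints F F-field f m
      module P = Setoid P
    open NumberRing numberRing
    open Sums (NumberRing.discreteRing numberRing)
    open Classification numberRing F F-field model f m using (Point; relation; relation-holds; relation-unique)
    open PointSums.PointSums numberRing F F-field model f m using (enumeration; pt)
    open PointMatrices.PointMatrices numberRing F F-field model f nonDegenerate sign hasSign m₀
      using (adjacency; distribution; distribution-M; distribution-ε; signNumber; ε²≡1; relation-congʳ; relation-sym; q-1≢0)
    open Intersections.Intersections numberRing F F-field model f nonDegenerate sign hasSign m₀
      using (4P-number; 16p; adjacency-products; 16p-character; number-of-points; points≢0; relation-nonempty)
    open NormCount numberRing (Model.oddField model) (Transfer.form F F-field model f) using (power)
    open Tables (DiscreteRing.commutativeRing rationals) using (4P; Q-numerator; denominator; cofactor; points; δₚ; ∑ₚ; PQ; QP)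
    open Character numberRing (Model.oddField model) using (q)
    open ≡-Reasoning

    private
      4# : ℚ
      4# = fromℤ (pos 4)

      ρ : Vec ℚ 3
      ρ = q ∷ NormDistribution.M distribution ∷ NormDistribution.ε distribution ∷ []

      ρ≡ : fromℕ order ∷ RawSemiringDefs._^_ ℚ.+-*-rawSemiring (fromℕ order) m₀ ∷ fromSign sign ∷ [] ≡ ρ
      ρ≡ = cong₂ _∷_ (fromℕ≡ order) (cong₂ (λ u v → u ∷ v ∷ []) (trans (powers m₀) (sym distribution-M)) (trans (signs sign) (sym distribution-ε)))
        where
        open RawSemiringDefs ℚ.+-*-rawSemiring using (_^_)
        powers : ∀ n → fromℕ order ^ n ≡ power n
        powers zero    = refl
        powers (suc n) = cong₂ _*_ (fromℕ≡ order) (powers n)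
        signs : ∀ s → fromSign s ≡ signNumber s
        signs Sign.+ = refl
        signs Sign.- = refl

      q-1 q+1 : ℚ
      q-1 = q - 1#
      q+1 = q + 1#

      q+1≢0 : q + 1# ≢ 0#
      q+1≢0 e = contradiction (fromℕ-injective (suc order) 0 (trans (1+×′ order) e)) λ ()
        where
        open import Algebra.Properties.Semiring.Mult.TCOptimised semiring using (1+×)
        1+×′ : ∀ n → fromℤ (pos (suc n)) ≡ fromℤ (pos n) + 1#
        1+×′ n = trans (1+× n 1#) (+-comm 1# (fromℤ (pos n)))

      *-≢0 : ∀ {x y} → x ≢ 0# → y ≢ 0# → x * y ≢ 0#
      *-≢0 x≢0 y≢0 e = y≢0 (integral e x≢0)

    -- Opaque copies keep the type checker from unfolding rational arithmetic.
    opaque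
      𝐩 𝐪 : Fin 6 → Fin 6 → ℚ
      𝐩 = 𝐏 order m sign
      𝐪 = 𝐐 order m sign

      𝐩≡𝐏 : 𝐩 ≡ 𝐏 order m sign
      𝐩≡𝐏 = refl

      𝐪≡𝐐 : 𝐪 ≡ 𝐐 order m sign
      𝐪≡𝐐 = refl

      𝐪-0 : ∀ i → 𝐪 i 0F ≡ 1ℚ
      𝐪-0 0F = refl
      𝐪-0 1F = refl
      𝐪-0 2F = refl
      𝐪-0 3F = refl
      𝐪-0 4F = refl
      𝐪-0 5F = refl

    opaque
      v : ℚ
      v = fromℤ (pos (proj₁ enumeration))

      v≡size : v ≡ fromℤ (pos (proj₁ enumeration))
      v≡size = refl

      v≢0 : v ≢ 0#
      v≢0 e = points≢0 (trans (sym number-of-points) e)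

      v≡points : v ≡ eval points ρ
      v≡points = number-of-points

    private
      descale : ∀ (c d x : ℚ) {y} → c * d ≡ 1# → d * x ≡ y → x ≡ c * y
      descale c d x cd≡1 dx≡y = trans (sym (*-identityˡ x)) (trans (cong (_* x) (sym cd≡1)) (trans (*-assoc c d x) (cong (c *_) dx≡y)))

      rescaled : ∀ (c d y : ℚ) → c * d ≡ 1# → d * (c * y) ≡ y
      rescaled c d y cd≡1 = trans (solve 3 (λ c d y → d :* (c :* y) := c :* d :* y) refl c d y) (trans (cong (_* y) cd≡1) (*-identityˡ y))

    opaque
      private
        sixteenth : ℚ
        sixteenth = ½ * ½ * (½ * ½)

        sixteenth*16 : sixteenth * (4# * 4#) ≡ 1#
        sixteenth*16 = refl

    opaque
      -- The intersection numbers. Each of the two adjacency matrices carries a factor 4 in the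
      -- integral tables, hence the sixteenth.
      p : Fin 6 → Fin 6 → Fin 6 → ℚ
      p i k l = sixteenth * 16p i k l

      p-adjacency : ∀ i k X Y → ∑ (λ t → adjacency i X (pt t) * adjacency k Y (pt t)) ≡ p i k (relation X Y)
      p-adjacency i k X Y = descale sixteenth (4# * 4#) (∑ (λ t → adjacency i X (pt t) * adjacency k Y (pt t))) sixteenth*16 (adjacency-products i k X Y)

      16*p : ∀ i k l → 4# * 4# * p i k l ≡ 16p i k l
      16*p i k l = rescaled sixteenth (4# * 4#) (16p i k l) sixteenth*16

    private
      4≢0 : 4# ≢ 0#
      4≢0 e = contradiction (fromℕ-injective 4 0 e) λ ()

      2≢0 : fromℤ (pos 2) ≢ 0#
      2≢0 e = contradiction (fromℕ-injective 2 0 e) λ ()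

      eval-∑ : ∀ {n} (g : Fin n → Polynomial 3) → eval (∑ₚ g) ρ ≡ ∑ (λ i → eval (g i) ρ)
      eval-∑ g = trans (go g) (sym (∑≡sum _))
        where
        open import Algebra.Properties.Semiring.Sum semiring using (sum)
        go : ∀ {n} (g : Fin n → Polynomial 3) → eval (∑ₚ g) ρ ≡ sum (λ i → eval (g i) ρ)
        go {zero}  g = refl
        go {suc n} g = cong (eval (g zero) ρ +_) (go (g ∘ suc))

      δ-eval : ∀ i j → eval (δₚ i j) ρ ≡ ⟦ i Fin.≟ j ⟧
      δ-eval i j with i Fin.≟ j
      ... | yes _ = refl
      ... | no  _ = refl

      reorder : ∀ (e f l u d : ℚ) → e ≡ 1# → f * e * u * l * d ≡ f * l * (u * d)
      reorder e f l u d refl = (solve 4 (λ f l u d → f :* con (pos 1) :* u :* l :* d := f :* l :* (u :* d)) refl f l u d)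

      reorder′ : ∀ (e f l u d : ℚ) → e ≡ 1# → f * e * l * u * d ≡ f * l * (u * d)
      reorder′ e f l u d refl = (solve 4 (λ f l u d → f :* con (pos 1) :* l :* u :* d := f :* l :* (u :* d)) refl f l u d)

      εε : ℚ
      εε = NormDistribution.ε distribution * NormDistribution.ε distribution

    opaque
      private
        p₄ num : Fin 6 → Fin 6 → ℚ
        p₄ = 4P-number
        num i j = eval (Q-numerator i j) ρ

        den cof : Fin 6 → ℚ
        den j = eval (denominator j) ρ
        cof j = eval (cofactor j) ρ

        L : ℚ
        L = fromℤ (pos 2) * (q-1 * q+1)

        p₄≡ : ∀ j i → p₄ j i ≡ 4P-number j i
        p₄≡ j i = refl

        den≢0 : ∀ j → den j ≢ 0#
        den≢0 0F = λ ()
        den≢0 1F = λ ()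
        den≢0 2F = *-≢0 q-1≢0 q+1≢0
        den≢0 3F = *-≢0 q-1≢0 q+1≢0
        den≢0 4F = *-≢0 2≢0 q-1≢0
        den≢0 5F = *-≢0 2≢0 q+1≢0

        L≢0 : L ≢ 0#
        L≢0 = *-≢0 2≢0 (*-≢0 q-1≢0 q+1≢0)

        cof-den : ∀ j → L ≡ cof j * den j
        cof-den 0F = sym (*-identityʳ L)
        cof-den 1F = sym (*-identityʳ L)
        cof-den 2F = refl
        cof-den 3F = refl
        cof-den 4F = (solve 1 (λ q → con (pos 2) :* ((q :- con (pos 1)) :* (q :+ con (pos 1))) := (q :+ con (pos 1)) :* (con (pos 2) :* (q :- con (pos 1)))) refl q)
        cof-den 5F = (solve 1 (λ q → con (pos 2) :* ((q :- con (pos 1)) :* (q :+ con (pos 1))) := (q :- con (pos 1)) :* (con (pos 2) :* (q :+ con (pos 1)))) refl q)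

        p₄-num : ∀ i j → ∑ (λ t → p₄ i t * num t j) ≡ 4# * den j * (v * ⟦ i Fin.≟ j ⟧)
        p₄-num i j = trans (sym (eval-∑ (λ t → 4P i t :* Q-numerator t j))) (trans (PQ i j ρ)
          (trans (cong₂ (λ x y → 4# * εε * x * den j * y) (sym v≡points) (δ-eval i j)) (reorder εε 4# (den j) v ⟦ i Fin.≟ j ⟧ ε²≡1)))

        num-p₄ : ∀ i j → ∑ (λ t → cof t * num i t * p₄ t j) ≡ 4# * L * (v * ⟦ i Fin.≟ j ⟧)
        num-p₄ i j = trans (sym (eval-∑ (λ t → cofactor t :* Q-numerator i t :* 4P t j))) (trans (QP i j ρ)
          (trans (cong₂ (λ x y → 4# * εε * L * x * y) (sym v≡points) (δ-eval i j)) (reorder′ εε 4# L v ⟦ i Fin.≟ j ⟧ ε²≡1)))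

    opaque
      unfolding 𝐩 p₄

      private
        4P≡ : ∀ j i → 4# * 𝐩 j i ≡ p₄ j i
        4P≡ j i = trans (4𝐏 order m₀ sign j i) (cong (eval (4P j i)) ρ≡)

        Q≡ : ∀ i j → den j * 𝐪 i j ≡ num i j
        Q≡ i j = subst (λ r → eval (denominator j) r * 𝐪 i j ≡ eval (Q-numerator i j) r) ρ≡
          (denominator-𝐐 order m₀ sign (subst (λ z → z - 1# ≢ 0#) (sym (fromℕ≡ order)) q-1≢0)
            (subst (λ z → z + 1# ≢ 0#) (sym (fromℕ≡ order)) q+1≢0) i j)

    private
      rescale : ∀ (f d : ℚ) (w x : Fin 6 → ℚ) {y z : Fin 6 → ℚ} → (∀ t → f * w t ≡ y t) → (∀ t → d * x t ≡ z t) →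
                f * d * ∑ (λ t → w t * x t) ≡ ∑ (λ t → y t * z t)
      rescale f d w x y≡ z≡ = trans (sym (∑-* (f * d) (λ t → w t * x t))) (∑-cong λ t →
        trans (solve 4 (λ f d a b → f :* d :* (a :* b) := f :* a :* (d :* b)) refl f d (w t) (x t)) (cong₂ _*_ (y≡ t) (z≡ t)))

      rescale′ : ∀ (l f : ℚ) (c d w x : Fin 6 → ℚ) {y z : Fin 6 → ℚ} → (∀ t → l ≡ c t * d t) →
                 (∀ t → d t * w t ≡ y t) → (∀ t → f * x t ≡ z t) →
                 f * l * ∑ (λ t → w t * x t) ≡ ∑ (λ t → c t * y t * z t)
      rescale′ l f c d w x l≡ y≡ z≡ = trans (sym (∑-* (f * l) (λ t → w t * x t))) (∑-cong λ t →
        trans (cong (λ l → f * l * (w t * x t)) (l≡ t))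
          (trans (solve 5 (λ f c d a b → f :* (c :* d) :* (a :* b) := c :* (d :* a) :* (f :* b)) refl f (c t) (d t) (w t) (x t))
            (cong₂ (λ y z → c t * y * z) (y≡ t) (z≡ t))))

      regroup : ∀ (f a b : ℚ) → f * (f * a * (f * b)) ≡ f * f * f * (a * b)
      regroup f a b = (solve 3 (λ f a b → f :* (f :* a :* (f :* b)) := f :* f :* f :* (a :* b)) refl f a b)

    -- Clearing denominators takes 4 · 4 for p and a further 4 for the row of 𝐩, which leads back to
    -- the integral identity `16p-character`.
    p-character : ∀ i k j → ∑ (λ l → p i k l * 𝐩 j l) ≡ 𝐩 j i * 𝐩 j k
    p-character i k j = cancel (*-≢0 (*-≢0 4≢0 4≢0) 4≢0) (begin
      4# * 4# * 4# * ∑ (λ l → p i k l * 𝐩 j l)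
        ≡⟨ rescale (4# * 4#) 4# (p i k) (𝐩 j) (16*p i k) (λ l → trans (4P≡ j l) (p₄≡ j l)) ⟩
      ∑ (λ l → 16p i k l * 4P-number j l)
        ≡⟨ 16p-character i k j ⟩
      4# * (4P-number j i * 4P-number j k)
        ≡⟨ cong (4# *_) (cong₂ _*_ (sym (trans (4P≡ j i) (p₄≡ j i))) (sym (trans (4P≡ j k) (p₄≡ j k)))) ⟩
      4# * (4# * 𝐩 j i * (4# * 𝐩 j k))
        ≡⟨ regroup 4# (𝐩 j i) (𝐩 j k) ⟩
      4# * 4# * 4# * (𝐩 j i * 𝐩 j k) ∎)

    𝐩-𝐪 : ∀ i j → ∑ (λ t → 𝐩 i t * 𝐪 t j) ≡ v * ⟦ i Fin.≟ j ⟧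
    𝐩-𝐪 i j = cancel (*-≢0 4≢0 (den≢0 j))
      (trans (rescale 4# (den j) (𝐩 i) (λ t → 𝐪 t j) (4P≡ i) (λ t → Q≡ t j)) (p₄-num i j))

    𝐪-𝐩 : ∀ i j → ∑ (λ t → 𝐪 i t * 𝐩 t j) ≡ v * ⟦ i Fin.≟ j ⟧
    𝐪-𝐩 i j = cancel (*-≢0 4≢0 L≢0)
      (trans (rescale′ L 4# cof den (𝐪 i) (λ t → 𝐩 t j) cof-den (Q≡ i) (λ t → 4P≡ t j)) (num-p₄ i j))

    -- e selects the non-empty relations, e′ the corresponding eigenspaces.
    record Selection (d : ℕ) : Set (a ⊔ ℓ) where
      field
        e e′         : Fin (suc d) → Fin 6
        e-0          : e 0F ≡ 0F
        e′-0         : e′ 0F ≡ 0F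
        e-injective  : ∀ {i j} → e i ≡ e j → i ≡ j
        e′-injective : ∀ {i j} → e′ i ≡ e′ j → i ≡ j
        covers       : ∀ X Y → ∃[ i ] e i ≡ relation X Y
        allowed      : ∀ i → e i ≡ 2F → order ≢ 3
        P-reduce     : ∀ j (g : Fin 6 → ℚ) → ∑ (λ t → 𝐩 (e′ j) (e t) * g (e t)) ≡ ∑ (λ t → 𝐩 (e′ j) t * g t)
        Q-reduce     : ∀ i (g : Fin 6 → ℚ) → ∑ (λ t → 𝐪 (e i) (e′ t) * g (e′ t)) ≡ ∑ (λ t → 𝐪 (e i) t * g t)

    module _ {d : ℕ} (selection : Selection d) where

      open Selection selection

      private
        R′ : Fin (suc d) → Point → Point → Set (a ⊔ ℓ)
        R′ i = Relation F F-field f m (e i)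

        toR : ∀ {i X Y} → relation X Y ≡ e i → R′ i X Y
        toR {i} {X} {Y} eq = subst (λ l → Relation F F-field f m l X Y) eq (relation-holds X Y)

        fromR : ∀ {i X Y} → R′ i X Y → relation X Y ≡ e i
        fromR {i} {X} {Y} = relation-unique (e i) X Y

        both? : ∀ i j X Y Z → Dec (R′ i X Z × R′ j Y Z)
        both? i j X Y Z = map′ (λ (h , k) → toR h , toR k) (λ (h , k) → fromR h , fromR k)
          ((relation X Z ≟ e i) ×-dec (relation Y Z ≟ e j))

        nonEmpty′ : ∀ i → ∃₂ λ X Y → R′ i X Y
        nonEmpty′ i = let X , Y , eq = relation-nonempty (e i) (allowed i) in X , Y , toR eq

        count-p : ∀ i j X Y → fromℤ (pos (count (λ t → both? i j X Y (pt t)))) ≡ p (e i) (e j) (relation X Y)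
        count-p i j X Y = trans (sym (∑-⟦⟧ (λ t → both? i j X Y (pt t)))) (trans (∑-cong λ t → product t) (p-adjacency (e i) (e j) X Y))
          where
          product : ∀ t → ⟦ both? i j X Y (pt t) ⟧ ≡ adjacency (e i) X (pt t) * adjacency (e j) Y (pt t)
          product t = sym (trans (cong (adjacency (e i) X (pt t) *_) (sym (*-identityʳ _))) (trans
            (⟦⟧-× (relation X (pt t) ≟ e i) (relation Y (pt t) ≟ e j) (both? i j X Y (pt t))
              (λ h k → toR h , toR k) (fromR ∘ proj₁) (fromR ∘ proj₂) 1#) (*-identityʳ _)))

      scheme : IsAssociationScheme P R′
      scheme = record
        { size        = proj₁ enumeration
        ; enumeration = proj₂ enumeration
        ; respects    = λ i →
              (λ {X} {Y} {Z} Y≈Z h → toR (trans (sym (relation-congʳ X Y Z Y≈Z)) (fromR h)))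
            , (λ {X} {Y} {Z} Y≈Z h → toR (trans (relation-sym Z X) (trans (sym (relation-congʳ X Y Z Y≈Z)) (trans (relation-sym X Y) (fromR h)))))
        ; partitions  = λ X Y → let i , eq = covers X Y in
              i , toR (sym eq) , λ h → e-injective (trans eq (fromR h))
        ; nonEmpty    = nonEmpty′
        ; symmetric   = λ i {X} {Y} h → toR (trans (relation-sym Y X) (fromR h))
        ; identity    = λ {X} {Y} → mk⇔ (subst (λ l → Relation F F-field f m l X Y) e-0) (subst (λ l → Relation F F-field f m l X Y) (sym e-0))
        -- The number is counted at a sample pair of the relation. At any other pair of it the count
        -- has the same rational value p, and natural numbers embed in the rationals.
        ; intersectionNumber = λ i j l → let X₀ , Y₀ , R₀ = nonEmpty′ l in
              count (λ t → both? i j X₀ Y₀ (pt t)) , λ {X} {Y} h →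
                subst (HasSize (Restrict P (λ Z → R′ i X Z × R′ j Y Z)))
                  (fromℕ-injective _ _ (trans (count-p i j X Y) (trans (cong (p (e i) (e j)) (trans (fromR h) (sym (fromR R₀)))) (sym (count-p i j X₀ Y₀)))))
                  (HasSize-restrict P (proj₂ enumeration) (both? i j X Y) λ {Z} {W} Z≈W (h , k) →
                    toR (trans (sym (relation-congʳ X Z W Z≈W)) (fromR h)) , toR (trans (sym (relation-congʳ Y Z W Z≈W)) (fromR k)))
        }

      module _ {k ℓₖ} (K : CommutativeRing k ℓₖ) (ι : ℚ → CommutativeRing.Carrier K)
               (ι-homomorphism : IsRingHomomorphism ℚ.+-*-rawRing (CommutativeRing.rawRing K) ι) where

        private
          module K = CommutativeRing K
          module ι = IsRingHomomorphism ι-homomorphism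
          open import Algebra.Properties.Semiring.Sum K.semiring using (sum; sum-cong-≋)
          open import Algebra.Definitions.RawMonoid K.+-rawMonoid using () renaming (_×_ to _×ₖ_)

          ι-≡ : ∀ {x y} → x ≡ y → ι x K.≈ ι y
          ι-≡ = ι.⟦⟧-cong

          ι-∑ : ∀ {n} (g : Fin n → ℚ) → sum (λ t → ι (g t)) K.≈ ι (∑ g)
          ι-∑ g = K.trans (go g) (ι-≡ (sym (∑≡sum g)))
            where
            open import Algebra.Properties.Semiring.Sum semiring using () renaming (sum to sumℚ)
            go : ∀ {n} (g : Fin n → ℚ) → sum (λ t → ι (g t)) K.≈ ι (sumℚ g)
            go {zero}  g = K.sym ι.0#-homo
            go {suc n} g = K.trans (K.+-congˡ (go (g ∘ suc))) (K.sym (ι.+-homo (g zero) (sumℚ (g ∘ suc))))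

          ι-∑* : ∀ {n} (g h : Fin n → ℚ) → sum (λ t → ι (g t) K.* ι (h t)) K.≈ ι (∑ (λ t → g t * h t))
          ι-∑* g h = K.trans (sum-cong-≋ {x = λ t → ι (g t) K.* ι (h t)} {y = λ t → ι (g t * h t)} λ t → K.sym (ι.*-homo (g t) (h t))) (ι-∑ (λ t → g t * h t))

          ι-number : ∀ n → n ×ₖ K.1# K.≈ ι (fromℤ (pos n))
          ι-number zero    = K.sym ι.0#-homo
          ι-number (suc n) = K.trans (K.+-cong (K.sym ι.1#-homo) (ι-number n)) (K.trans (K.sym (ι.+-homo 1# (fromℤ (pos n)))) (ι-≡ (sym (1+× n 1#))))
            where open import Algebra.Properties.Semiring.Mult.TCOptimised semiring using (1+×)

          ι-⟦⟧ : ∀ {r} {S : Set r} (S? : Dec S) (i j : Fin (suc d)) → (S → i ≡ j) → (i ≡ j → S) → ι ⟦ S? ⟧ K.≈ δᴷ K i j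
          ι-⟦⟧ S? i j f g with S? | i Fin.≟ j
          ... | yes _ | yes _   = ι.1#-homo
          ... | yes s | no i≢j  = contradiction (f s) i≢j
          ... | no ¬s | yes i≡j = contradiction (g i≡j) ¬s
          ... | no _  | no _    = ι.0#-homo

          vᴷ : K.Carrier
          vᴷ = proj₁ enumeration ×ₖ K.1#

          ι-v : vᴷ K.≈ ι v
          ι-v = K.trans (ι-number (proj₁ enumeration)) (ι-≡ (sym v≡size))

          -- The number of points is invertible over the rationals, and ι carries its inverse to K.
          w : K.Carrier
          w = ι (ℚ.1/_ v {{ℚ.≢-nonZero v≢0}})

          vw≈1 : vᴷ K.* w K.≈ K.1#
          vw≈1 = K.trans (K.*-congʳ ι-v) (K.trans (K.sym (ι.*-homo v _)) (K.trans (ι-≡ (ℚ.*-inverseʳ v {{ℚ.≢-nonZero v≢0}})) ι.1#-homo))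

          adjacency-ι : ∀ i X Y → Defs.A K scheme i X Y K.≈ ι (adjacency (e i) X Y)
          adjacency-ι i X Y = K.trans (adjacency-value K scheme i X Y)
            (K.sym (ι-⟦⟧ (relation X Y ≟ e i) i (proj₁ (covers X Y)) (λ eq → e-injective (trans (sym eq) (sym (proj₂ (covers X Y)))))
              λ { refl → sym (proj₂ (covers X Y)) }))

          products : ∀ i j X Y → Defs._·_ K scheme (Defs.A K scheme i) (Defs.A K scheme j) X Y K.≈ ι (p (e i) (e j) (e (proj₁ (covers X Y))))
          products i j X Y = K.trans
            (sum-cong-≋ {x = λ t → Defs.A K scheme i X (pt t) K.* Defs.A K scheme j (pt t) Y} {y = λ t → ι (adjacency (e i) X (pt t)) K.* ι (adjacency (e j) Y (pt t))}
              λ t → K.*-cong (adjacency-ι i X (pt t))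
                (K.trans (adjacency-ι j (pt t) Y) (ι-≡ (cong (λ l → ⟦ l ≟ e j ⟧) (relation-sym (pt t) Y)))))
            (K.trans (ι-∑* (λ t → adjacency (e i) X (pt t)) (λ t → adjacency (e j) Y (pt t)))
              (ι-≡ (trans (p-adjacency (e i) (e j) X Y) (cong (p (e i) (e j)) (sym (proj₂ (covers X Y)))))))

          -- `P-reduce` extends the sum over the selected relations to all six, where the relation
          -- for the full tables holds.
          characters : ∀ i h j → sum (λ l → ι (p (e i) (e h) (e l)) K.* ι (𝐩 (e′ j) (e l))) K.≈ ι (𝐩 (e′ j) (e i)) K.* ι (𝐩 (e′ j) (e h))
          characters i h j = K.trans (ι-∑* (λ l → p (e i) (e h) (e l)) (λ l → 𝐩 (e′ j) (e l))) (K.trans (ι-≡ reduced) (ι.*-homo (𝐩 (e′ j) (e i)) (𝐩 (e′ j) (e h))))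
            where
            reduced : ∑ (λ l → p (e i) (e h) (e l) * 𝐩 (e′ j) (e l)) ≡ 𝐩 (e′ j) (e i) * 𝐩 (e′ j) (e h)
            reduced = begin
              ∑ (λ l → p (e i) (e h) (e l) * 𝐩 (e′ j) (e l))   ≡⟨ ∑-cong (λ l → *-comm (p (e i) (e h) (e l)) (𝐩 (e′ j) (e l))) ⟩
              ∑ (λ l → 𝐩 (e′ j) (e l) * p (e i) (e h) (e l))   ≡⟨ P-reduce j (p (e i) (e h)) ⟩
              ∑ (λ l → 𝐩 (e′ j) l * p (e i) (e h) l)           ≡⟨ ∑-cong (λ l → *-comm (𝐩 (e′ j) l) (p (e i) (e h) l)) ⟩
              ∑ (λ l → p (e i) (e h) l * 𝐩 (e′ j) l)           ≡⟨ p-character (e i) (e h) (e′ j) ⟩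
              𝐩 (e′ j) (e i) * 𝐩 (e′ j) (e h)                  ∎

          P-Q : ∀ i j → sum (λ t → ι (𝐩 (e′ i) (e t)) K.* ι (𝐪 (e t) (e′ j))) K.≈ vᴷ K.* δᴷ K i j
          P-Q i j = K.trans (ι-∑* (λ t → 𝐩 (e′ i) (e t)) (λ t → 𝐪 (e t) (e′ j))) (K.trans
            (ι-≡ (trans (P-reduce i (λ t → 𝐪 t (e′ j))) (𝐩-𝐪 (e′ i) (e′ j))))
            (K.trans (ι.*-homo v ⟦ e′ i Fin.≟ e′ j ⟧) (K.*-cong (K.sym ι-v) (ι-⟦⟧ (e′ i Fin.≟ e′ j) i j e′-injective (cong e′)))))

          Q-P : ∀ i j → sum (λ t → ι (𝐪 (e i) (e′ t)) K.* ι (𝐩 (e′ t) (e j))) K.≈ vᴷ K.* δᴷ K i j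
          Q-P i j = K.trans (ι-∑* (λ t → 𝐪 (e i) (e′ t)) (λ t → 𝐩 (e′ t) (e j))) (K.trans
            (ι-≡ (trans (Q-reduce i (λ t → 𝐩 t (e j))) (𝐪-𝐩 (e i) (e j))))
            (K.trans (ι.*-homo v ⟦ e i Fin.≟ e j ⟧) (K.*-cong (K.sym ι-v) (ι-⟦⟧ (e i Fin.≟ e j) i j e-injective (cong e)))))

        -- Every identity is proved over the rationals and mapped to K by ι, so the result holds
        -- over each ring that receives the rationals, the real numbers among them.
        eigenmatrices : HasEigenmatrices K scheme (λ j i → ι (𝐏 order m sign (e′ j) (e i))) (λ i j → ι (𝐐 order m sign (e i) (e′ j)))
        eigenmatrices = subst₂ (λ P Q → HasEigenmatrices K scheme (λ j i → ι (P (e′ j) (e i))) (λ i j → ι (Q (e i) (e′ j)))) 𝐩≡𝐏 𝐪≡𝐐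
          (hasEigenmatrices K scheme (λ j i → ι (𝐩 (e′ j) (e i))) (λ i j → ι (𝐪 (e i) (e′ j))) (λ i j l → ι (p (e i) (e j) (e l))) w vw≈1 products characters P-Q Q-P
            λ i → K.trans (ι-≡ (trans (cong (𝐪 (e i)) e′-0) (𝐪-0 (e i)))) ι.1#-homo)

-- The cases q ≠ 3 and q = 3

module Conclusion where

  open import Algebra.Bundles using (CommutativeRing)
  open import Algebra.Morphism.Structures using (IsRingHomomorphism)
  open import Data.Fin.Base using (Fin; zero; suc; punchIn; punchOut)
  open import Data.Fin.Patterns using (0F; 1F; 2F; 3F; 4F)
  import Data.Fin.Properties as Fin
  open import Data.Nat.Base as ℕ using (ℕ; zero; suc)
  open import Data.Product.Base using (Σ; _,_)
  import Data.Rational.Base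
  open import Data.Rational.Base as ℚ using (ℚ; 0ℚ; ½)
  import Data.Rational.Properties as ℚ
  open import Data.Sign.Base as Sign using (Sign)
  open import Function.Base using (_∘_; id)
  open import Relation.Binary.PropositionalEquality
  open import Relation.Nullary using (¬_)
  import Algebra.Definitions.RawSemiring as RawSemiringDefs
  open DiscreteRings
  open FiniteTypes
  open FiniteFields using (NumberRing; module NumberRing; OddField; module OddField)
  open FieldModel using (Model; module Model)
  open Geometry using (module Classification)
  open Intersections using (module Intersections)
  open Rationals
  open Schemes
  open import Defs using (BinaryForm; module BinaryForm; IsField; AnisotropicPoints; HasSign;
    IsAssociationScheme; HasEigenmatrices; 𝐏; 𝐐; fromℕ; fromSign)
    renaming (R to Relation)

  private
    *-zeroˡ-zeroˡ : ∀ x y → 0ℚ ℚ.* x ℚ.* y ≡ 0ℚ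
    *-zeroˡ-zeroˡ x y = trans (cong (ℚ._* y) (ℚ.*-zeroˡ x)) (ℚ.*-zeroˡ y)

  module _ (m : ℕ) (sign : Sign) where

    open RawSemiringDefs ℚ.+-*-rawSemiring using (_^_)
    open Data.Rational.Base using (_+_; _-_; _*_)

    private
      q ε : ℚ
      q = fromℕ 3
      ε = fromSign sign

    -- For q = 3 the factor q - 3 annihilates the column of R₂ in every row but that of V₄. Sums
    -- along the remaining rows therefore lose nothing when R₂ is deleted.
    𝐏-3 : ∀ j → 𝐏 3 m sign (punchIn 4F j) 2F ≡ 0ℚ
    𝐏-3 0F = ℚ.*-zeroʳ (½ * ½ * q ^ m * (q ^ m + ε))
    𝐏-3 1F = ℚ.*-zeroʳ (½ * ½ * q ^ m * (q ^ m + ε))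
    𝐏-3 2F = ℚ.*-zeroʳ (½ * ½ * ε * q ^ (m ℕ.∸ 1) * (q + fromℕ 1))
    𝐏-3 3F = ℚ.*-zeroʳ (½ * ½ * ε * q ^ (m ℕ.∸ 1) * (q + fromℕ 1))
    𝐏-3 4F = refl

    -- The counterpart for 𝐐: outside the row of R₂ the column of V₄ vanishes, partly through q - 3
    -- and partly by definition, so V₄ may be deleted together with R₂.
    𝐐-3 : ∀ i → 𝐐 3 m sign (punchIn 2F i) 4F ≡ 0ℚ
    𝐐-3 0F = *-zeroˡ-zeroˡ (q ^ m + ε) (q ^ (m ℕ.+ 1) - ε)
    𝐐-3 1F = trans (cong (λ z → z * (q ^ (m ℕ.+ 1) - ε)) (ℚ.*-zeroʳ ε)) (ℚ.*-zeroˡ (q ^ (m ℕ.+ 1) - ε))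
    𝐐-3 2F = refl
    𝐐-3 3F = refl
    𝐐-3 4F = refl

  module _ where
    open NumberRing numberRing
    open Sums (NumberRing.discreteRing numberRing)
    open import Algebra.Properties.Semiring.Sum semiring using (sum; sum-remove)

    ∑-punchIn : ∀ {n} (i : Fin (suc n)) (c g : Fin (suc n) → ℚ) → c i ≡ 0# →
                ∑ (λ t → c (punchIn i t) * g (punchIn i t)) ≡ ∑ (λ t → c t * g t)
    ∑-punchIn {n} i c g ci≡0 = begin
      ∑ h′                 ≡⟨ ∑≡sum h′ ⟩
      sum h′               ≡⟨ sym (+-identityˡ (sum h′)) ⟩
      0# + sum h′          ≡⟨ cong (λ z → z + sum h′) (sym (trans (cong (λ z → z * g i) ci≡0) (zeroˡ (g i)))) ⟩
      c i * g i + sum h′   ≡⟨ sym (sum-remove {n} {i} h) ⟩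
      sum h                ≡⟨ sym (∑≡sum h) ⟩
      ∑ h                  ∎
      where
      open ≡-Reasoning
      h : Fin (suc n) → ℚ
      h t = c t * g t
      h′ : Fin n → ℚ
      h′ t = c (punchIn i t) * g (punchIn i t)

  module Theorem {a ℓ} (F : CommutativeRing a ℓ) (F-field : IsField F) (model : Model F) (f : BinaryForm F)
           (nonDegenerate : BinaryForm.NonDegenerate f) (sign : Sign) (hasSign : HasSign F sign f) (m₀ : ℕ)
           {k ℓₖ} (K : CommutativeRing k ℓₖ) (ι : ℚ → CommutativeRing.Carrier K)
           (ι-homomorphism : IsRingHomomorphism ℚ.+-*-rawRing (CommutativeRing.rawRing K) ι) where

    private
      m = suc m₀
      order = Finite.size (OddField.finite (Model.oddField model))
      R = Relation F F-field f m
    open Classification numberRing F F-field model f m using (relation; relation-unique)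
    open Intersections.Intersections numberRing F F-field model f nonDegenerate sign hasSign m₀ using (no-R₂)

    theorem-≢3 : order ≢ 3 → Σ (IsAssociationScheme (AnisotropicPoints F F-field f m) R) λ scheme →
      HasEigenmatrices K scheme (λ j i → ι (𝐏 order m sign j i)) (λ i j → ι (𝐐 order m sign i j))
    theorem-≢3 order≢3 =
      scheme F F-field model f nonDegenerate sign hasSign m₀ selection ,
      eigenmatrices F F-field model f nonDegenerate sign hasSign m₀ selection K ι ι-homomorphism
      where
      selection : Selection F F-field model f nonDegenerate sign hasSign m₀ 5
      selection = record
        { e = id ; e′ = id ; e-0 = refl ; e′-0 = refl ; e-injective = id ; e′-injective = id
        ; covers = λ X Y → relation X Y , refl
        ; allowed = λ _ _ → order≢3
        ; P-reduce = λ _ _ → refl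
        ; Q-reduce = λ _ _ → refl
        }

    no-R : order ≡ 3 → ∀ X Y → ¬ R 2F X Y
    no-R order≡3 X Y r = no-R₂ order≡3 X Y (relation-unique 2F X Y r)

    theorem-3 : order ≡ 3 → Σ (IsAssociationScheme (AnisotropicPoints F F-field f m) (λ i → R (punchIn 2F i))) λ scheme →
      HasEigenmatrices K scheme (λ j i → ι (𝐏 order m sign (punchIn 4F j) (punchIn 2F i)))
                                (λ i j → ι (𝐐 order m sign (punchIn 2F i) (punchIn 4F j)))
    theorem-3 order≡3 =
      scheme F F-field model f nonDegenerate sign hasSign m₀ selection ,
      eigenmatrices F F-field model f nonDegenerate sign hasSign m₀ selection K ι ι-homomorphism
      where
      P-0 : ∀ j → 𝐩 F F-field model f nonDegenerate sign hasSign m₀ (punchIn 4F j) 2F ≡ 0ℚ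
      P-0 j = trans (cong (λ P → P (punchIn 4F j) 2F)
        (trans (𝐩≡𝐏 F F-field model f nonDegenerate sign hasSign m₀) (cong (λ o → 𝐏 o m sign) order≡3))) (𝐏-3 m sign j)
      Q-0 : ∀ i → 𝐪 F F-field model f nonDegenerate sign hasSign m₀ (punchIn 2F i) 4F ≡ 0ℚ
      Q-0 i = trans (cong (λ Q → Q (punchIn 2F i) 4F)
        (trans (𝐪≡𝐐 F F-field model f nonDegenerate sign hasSign m₀) (cong (λ o → 𝐐 o m sign) order≡3))) (𝐐-3 m sign i)
      selection : Selection F F-field model f nonDegenerate sign hasSign m₀ 4
      selection = record
        { e = punchIn 2F ; e′ = punchIn 4F ; e-0 = refl ; e′-0 = refl
        ; e-injective = Fin.punchIn-injective 2F _ _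
        ; e′-injective = Fin.punchIn-injective 4F _ _
        -- No pair has index 2, so every index that occurs comes from one of the five remaining
        -- ones.
        ; covers = λ X Y → let 2≢ = no-R₂ order≡3 X Y ∘ sym in punchOut 2≢ , Fin.punchIn-punchOut 2≢
        ; allowed = λ i e≡2 _ → Fin.punchInᵢ≢i 2F i e≡2
        ; P-reduce = λ j g → ∑-punchIn 2F (𝐩 F F-field model f nonDegenerate sign hasSign m₀ (punchIn 4F j)) g (P-0 j)
        ; Q-reduce = λ i g → ∑-punchIn 4F (𝐪 F F-field model f nonDegenerate sign hasSign m₀ (punchIn 2F i)) g (Q-0 i)
        }
open import Algebra.Bundles using (CommutativeRing)
open import Algebra.Morphism.Structures using (IsRingHomomorphism)
open import Data.Fin.Base using (punchIn)
open import Data.Fin.Patterns using (2F; 4F)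
open import Data.Nat.Base using (ℕ; _+_; _*_; _≤_)
open import Data.Product using (Σ; _×_)
open import Data.Rational.Base using (ℚ; +-*-rawRing)
open import Data.Sign.Base using (Sign)
open import Relation.Binary.PropositionalEquality using (_≡_; _≢_)
open import Relation.Nullary using (¬_)
open import Defs

open import Data.Nat.Base using (zero; suc; s≤s)
open import Data.Product using (_,_; proj₂)

theorem4p18 : ∀ {a ℓ k ℓₖ}
    (q : ℕ) → IsOddPrimePower q →
    (F : CommutativeRing a ℓ) (F-field : IsField F) →
    HasSize (CommutativeRing.setoid F) q →
    (m : ℕ) → let n = 1 + m * 2 in 3 ≤ n →
    (ε : Sign) (f : BinaryForm F) → BinaryForm.NonDegenerate f → HasSign F ε f →
    (K : CommutativeRing k ℓₖ) (ι : ℚ → CommutativeRing.Carrier K) →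
    IsRingHomomorphism +-*-rawRing (CommutativeRing.rawRing K) ι →
    (q ≢ 3 →
    Σ (IsAssociationScheme (AnisotropicPoints F F-field f m) (R F F-field f m)) λ scheme →
    HasEigenmatrices K scheme
    (λ j i → ι (𝐏 q m ε j i))
    (λ i j → ι (𝐐 q m ε i j)))
    ×
    (q ≡ 3 →
    (∀ X Y → ¬ R F F-field f m 2F X Y) ×
    Σ (IsAssociationScheme (AnisotropicPoints F F-field f m)
    (λ i → R F F-field f m (punchIn 2F i))) λ scheme →
    HasEigenmatrices K scheme
    (λ j i → ι (𝐏 q m ε (punchIn 4F j) (punchIn 2F i)))
    (λ i j → ι (𝐐 q m ε (punchIn 2F i) (punchIn 4F j))))
-- For m = 0 the dimension n is 1, against 3 ≤ n.
theorem4p18 q qOdd F F-field hasSize zero (s≤s ()) ε f nonDegenerate hasSign K ι ι-homomorphism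
theorem4p18 q (_ , odd) F F-field hasSize (suc m₀) _ ε f nonDegenerate hasSign K ι ι-homomorphism =
    C.theorem-≢3 , λ q≡3 → C.no-R q≡3 , C.theorem-3 q≡3
  where
  model = FieldModel.FieldModel.model Rationals.numberRing F F-field hasSize odd
  module C = Conclusion.Theorem F F-field model f nonDegenerate ε hasSign m₀ K ι ι-homomorphism
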